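{- For all non-negative integers $n$ and $g$, there is a bijection $\Phi$ from $\{1,\dots,2^{n+1}\}\times\mathcal{E}_g(n)$ to $\mathcal{T}_g(n)$ such that, for every $(i,M)$, writing $\Phi(i,M)=(T,\sigma)$, there is a correspondence between the vertices of $M$ and the cycles of $\sigma$ under which the underlying graph of $M$ and the underlying graph of $(T,\sigma)$ are the same (isomorphic as vertex-rooted multigraphs). In particular $2^{n+1}|\mathcal{E}_g(n)|=|\mathcal{T}_g(n)|$.
   Context: A map of genus $g$ is a connected graph (loops and multiple edges allowed) embedded in a closed compact oriented surface of genus $g$ such that the complement is a union of topological disks (faces); equivalently, a connected graph with a rotation system (a cyclic ordering of half-edges around each vertex). A corner is the angular sector between two consecutive edges around a vertex; a rooted map has a distinguished corner, whose vertex is the root vertex. A unicellular map is a map with one face. $\mathcal{E}_g(n)$ denotes the set of rooted unicellular maps of genus $g$ with $n$ edges; the underlying graph of such a map is its graph, rooted at the root vertex. A plane tree is a rooted unicellular map of genus $0$; a plane tree with $n$ edges has $n+1$ vertices, canonically numbered $1,\dots,n+1$ following a left-to-right depth-first traversal from the root. A C-permutation on a finite set is a permutation all of whose cycles have odd length, each cycle carrying a sign $+$ or $-$; for a C-permutation on $m$ elements with $\ell$ cycles, its genus is $(m-\ell)/2$. A C-decorated tree with $n$ edges is a pair $(T,\sigma)$ with $T$ a plane tree with $n$ edges and $\sigma$ a C-permutation of $\{1,\dots,n+1\}$, viewed as a permutation of the vertices of $T$; its genus is that of $\sigma$. $\mathcal{T}_g(n)$ denotes the set of C-decorated trees of genus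 $g$ with $n$ edges. The underlying graph of $(T,\sigma)$ is the vertex-rooted multigraph obtained from $T$ by merging into a single vertex the vertices of each cycle of $\sigma$ (rooted at the vertex corresponding to the cycle containing the root vertex of $T$). -}

module Defs where

open import Data.Nat using (ℕ; zero; suc; _+_; _*_; _^_; _<_; _≤ᵇ_; _<?_)
open import Data.Nat.DivMod using (_%_)
open import Data.Bool using (Bool; if_then_else_)
open import Data.Fin using (Fin; zero; suc; toℕ; fromℕ<; _≟_)
open import Data.List using (List; []; _∷_; _++_; map; foldr; filter; length; upTo; allFin)
open import Data.Product using (Σ; ∃; _×_; _,_)
open import Data.Sum using (_⊎_)
open import Data.Unit using (⊤)
open import Data.Empty using (⊥)
open import Relation.Nullary using (¬_; yes; no)
open import Relation.Binary.PropositionalEquality using (_≡_)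
open import Function.Bundles using (_↔_; Inverse)
open import Data.Fin.Permutation using (Permutation′; _⟨$⟩ʳ_; _∘ₚ_)

iter : ∀ {m} → Permutation′ m → ℕ → Fin m → Fin m
iter π zero    i = i
iter π (suc k) i = π ⟨$⟩ʳ (iter π k i)

SameCycle : ∀ {m} → Permutation′ m → Fin m → Fin m → Set
SameCycle π i j = ∃ λ k → iter π k i ≡ j

-- the least element (w.r.t. toℕ) of the cycle of π containing i
-- (the orbit of i is exactly {π^k i | k < m})
cycMin : ∀ {m} → Permutation′ m → Fin m → Fin m
cycMin {m} π i =
  foldr (λ a b → if toℕ a ≤ᵇ toℕ b then a else b) i
        (map (λ k → iter π k i) (upTo m))

numCycles : ∀ {m} → Permutation′ m → ℕ
numCycles {m} π = length (filter (λ i → cycMin π i ≟ i) (allFin m))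

cycleLength : ∀ {m} → Permutation′ m → Fin m → ℕ
cycleLength {m} π i = length (filter (λ j → cycMin π j ≟ cycMin π i) (allFin m))

-- Vertex-rooted multigraphs (loops and multiple edges allowed).
-- Vertices are given as a type V together with a relation _~_ saying when
-- two elements of V denote the same vertex; edges are a type E with an
-- (unordered) pair of endpoints.

record Graph : Set₁ where
  field
    V    : Set
    _~_  : V → V → Set
    E    : Set
    ends : E → V × V
    root : V

record GraphIso (G H : Graph) : Set where
  private
    module G = Graph G
    module H = Graph H
  field
    f        : G.V → H.V
    f-resp   : ∀ {a b} → a G.~ b → f a H.~ f b
    f-inj    : ∀ {a b} → f a H.~ f b → a G.~ b
    f-surj   : ∀ v → ∃ λ u → f u H.~ v
    e        : G.E ↔ H.E
    root-ok  : f G.root H.~ H.root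
    ends-ok  : ∀ x → let (a , b) = G.ends x ; (c , d) = H.ends (Inverse.to e x) in
                 (f a H.~ c × f b H.~ d) ⊎ (f a H.~ d × f b H.~ c)

data Reach {m} (σ α : Permutation′ m) : Fin m → Fin m → Set where
  here  : ∀ {h} → Reach σ α h h
  stepσ : ∀ {h h'} → Reach σ α (σ ⟨$⟩ʳ h) h' → Reach σ α h h'
  stepα : ∀ {h h'} → Reach σ α (α ⟨$⟩ʳ h) h' → Reach σ α h h'

-- A labelled rooted unicellular map of genus g with n ≥ 1 edges:
-- half-edges Fin (2n), rotation σ (vertices = cycles of σ), fixed-point-free
-- involution α (edges = cycles of α), a root half-edge (equivalently, the
-- root corner following it), connected, with exactly one face (cycle of
-- σ∘α), and genus g by Euler's formula  v - n + 1 = 2 - 2g.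
record LMap (n g : ℕ) : Set where
  field
    σ α       : Permutation′ (2 * n)
    root      : Fin (2 * n)
    α-invol   : ∀ h → α ⟨$⟩ʳ (α ⟨$⟩ʳ h) ≡ h
    α-fpf     : ∀ h → ¬ (α ⟨$⟩ʳ h ≡ h)
    connected : ∀ h h' → Reach σ α h h'
    one-face  : numCycles (σ ∘ₚ α) ≡ 1
    genus     : numCycles σ + 2 * g ≡ n + 1

LMapIso : ∀ {n g} → LMap n g → LMap n g → Set
LMapIso {n} M M' = Σ (Permutation′ (2 * n)) λ π →
    (∀ h → π ⟨$⟩ʳ (M.σ ⟨$⟩ʳ h) ≡ M'.σ ⟨$⟩ʳ (π ⟨$⟩ʳ h))
  × (∀ h → π ⟨$⟩ʳ (M.α ⟨$⟩ʳ h) ≡ M'.α ⟨$⟩ʳ (π ⟨$⟩ʳ h))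
  × (π ⟨$⟩ʳ M.root ≡ M'.root)
  where module M = LMap M ; module M' = LMap M'

-- E_g(n): with 0 edges the only map is the vertex map (genus 0)
UMap : ℕ → ℕ → Set
UMap zero    g = g ≡ 0
UMap (suc m) g = LMap (suc m) g

_≈M_ : ∀ {n g} → UMap n g → UMap n g → Set
_≈M_ {zero}  _ _ = ⊤
_≈M_ {suc m} M M' = LMapIso M M'

lmapGraph : ∀ {n g} → LMap n g → Graph
lmapGraph {n} M = record
  { V    = Fin (2 * n)
  ; _~_  = SameCycle M.σ
  ; E    = Σ (Fin (2 * n)) (λ h → toℕ h < toℕ (M.α ⟨$⟩ʳ h))
  ; ends = λ { (h , _) → h , M.α ⟨$⟩ʳ h }
  ; root = M.root }
  where module M = LMap M

mapGraph : ∀ {n g} → UMap n g → Graph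
mapGraph {zero}  _ = record { V = ⊤ ; _~_ = _≡_ ; E = ⊥ ; ends = λ () ; root = _ }
mapGraph {suc m} M = lmapGraph M

-- Plane trees (ordered rooted trees), with vertices numbered 0..n
-- (i.e. 1..n+1 of the paper) in left-to-right depth-first (preorder) order.

data PTree : Set where
  node : List PTree → PTree

mutual
  size : PTree → ℕ
  size (node cs) = suc (sizes cs)

  sizes : List PTree → ℕ
  sizes []       = 0
  sizes (c ∷ cs) = size c + sizes cs

edges : PTree → ℕ
edges (node cs) = sizes cs

mutual
  -- parentsT i t : parents of the strict descendants of t (whose root has
  -- number i), listed in preorder
  parentsT : ℕ → PTree → List ℕ
  parentsT i (node cs) = parentsF i (suc i) cs

  -- parentsF p k cs : the trees cs are children of p, first one numbered k
  parentsF : ℕ → ℕ → List PTree → List ℕ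
  parentsF p k []       = []
  parentsF p k (c ∷ cs) = p ∷ (parentsT k c ++ parentsF p (k + size c) cs)

nth : List ℕ → ℕ → ℕ
nth []       _       = 0
nth (x ∷ xs) zero    = x
nth (x ∷ xs) (suc k) = nth xs k

-- ℕ → Fin (suc n); only ever applied to values < suc n (default never used)
toFin : ∀ n → ℕ → Fin (suc n)
toFin n x with x <? suc n
... | yes p = fromℕ< p
... | no _  = zero

-- parent (in Fin (suc n)) of the vertex numbered k+1, k = 0..n-1
parent : ∀ n → PTree → Fin n → Fin (suc n)
parent n t k = toFin n (nth (parentsT 0 t) (toℕ k))

-- a C-permutation of Fin m: a permutation with all cycles of odd length,
-- each cycle carrying a sign (Bool), encoded as a sign function constant
-- on cycles. Genus: (m - #cycles)/2.
record CDTree (n g : ℕ) : Set where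
  field
    tree       : PTree
    tree-edges : edges tree ≡ n
    perm       : Permutation′ (suc n)
    sign       : Fin (suc n) → Bool
    sign-cyc   : ∀ i → sign (perm ⟨$⟩ʳ i) ≡ sign i
    odd-cycles : ∀ i → cycleLength perm i % 2 ≡ 1
    genus      : numCycles perm + 2 * g ≡ suc n

_≈T_ : ∀ {n g} → CDTree n g → CDTree n g → Set
X ≈T Y = (X.tree ≡ Y.tree)
       × (∀ i → X.perm ⟨$⟩ʳ i ≡ Y.perm ⟨$⟩ʳ i)
       × (∀ i → X.sign i ≡ Y.sign i)
  where module X = CDTree X ; module Y = CDTree Y

treeGraph : ∀ {n g} → CDTree n g → Graph
treeGraph {n} X = record
  { V    = Fin (suc n)
  ; _~_  = SameCycle X.perm
  ; E    = Fin n
  ; ends = λ k → parent n X.tree k , suc k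
  ; root = zero }
  where module X = CDTree X

_≈D_ : ∀ {n g} → Fin (2 ^ suc n) × UMap n g → Fin (2 ^ suc n) × UMap n g → Set
(i , M) ≈D (j , M') = (i ≡ j) × (M ≈M M')

{-# OPTIONS --safe #-}
-- Glue three vertices of a rooted unicellular map, by A x B p C q D ↦ A x C q B p D in the word of half-edges read
-- along the face. Iterating this turns a map with a marked descent of the face walk into a map
-- with an odd set of vertices to be merged, and it preserves the graph obtained by merging (Chapuy's
-- trisections). A map has n + 1 descents, so the multiset 𝓔 of the graphs of all unicellular maps of any genus
-- satisfies (n + 1) · 𝓔 = D 𝓔, where D merges an odd number of vertices in all possible ways.
--
-- The multiset 𝓣 of the graphs of C-decorated trees satisfies (n + 1) · 𝓣 = D 𝓣 as well: marking an element of a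
-- C-permutation singles out a signed odd cycle on a set U, in |U| · 2 (|U| - 1)! ways, and merging an odd number of
-- cycles singles out a C-permutation of an odd set U, again in 2 |U|! ways.
--
-- D is |V| · id plus terms with fewer vertices, so such a multiset is determined by its graphs with n + 1 vertices,
-- and these are the plane trees, 2 ^ (n + 1) times in 𝓣. Hence 2 ^ (n + 1) · 𝓔 = 𝓣, and Φ matches the members of
-- these lists. Isomorphism is made rigid by numbering the half-edges along the face from the root.
module Submission where

open import Defs
open import Data.Bool using (Bool; true; false; not; if_then_else_)
open import Data.Empty using (⊥; ⊥-elim)
open import Data.Fin using (Fin; zero; suc; toℕ; fromℕ<; _≟_)
open import Data.Fin.Permutation using (Permutation′; _⟨$⟩ʳ_; _⟨$⟩ˡ_; _∘ₚ_; permutation; inverseˡ)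
import Data.Fin.Properties as Finₚ
open import Data.List using (List; []; _∷_; [_]; _++_; _∷ʳ_; map; concat; concatMap; filter; length; upTo; allFin; tabulate; replicate; foldr)
import Data.List
open import Data.List.Membership.Propositional using (_∈_; _∉_)
open import Data.List.Membership.Propositional.Properties
import Data.List.Properties as Listₚ
import Data.List.Relation.Binary.Permutation.Homogeneous as Homo
import Data.List.Relation.Binary.Permutation.Propositional as ↭
open ↭ using (_↭_; ↭-refl; ↭-sym; ↭-trans; ↭-reflexive)
import Data.List.Relation.Binary.Permutation.Propositional.Properties as ↭ₚ
open ↭ₚ using (∈-resp-↭; All-resp-↭)
import Data.List.Relation.Binary.Permutation.Setoid.Properties as PermSetoidₚ
import Data.List.Relation.Binary.Pointwise as Pointwise
open Pointwise using (Pointwise; []; _∷_)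
open import Data.List.Relation.Binary.Subset.Propositional using (_⊆_)
open import Data.List.Relation.Unary.All as All using (All; []; _∷_)
import Data.List.Relation.Unary.All.Properties as Allₚ
open import Data.List.Relation.Unary.AllPairs as AllPairs using (AllPairs; []; _∷_)
import Data.List.Relation.Unary.AllPairs.Properties as AllPairsₚ
open import Data.List.Relation.Unary.Any as Any using (Any; here; there)
import Data.List.Relation.Unary.Any.Properties as Anyₚ
open import Data.List.Relation.Unary.Unique.Propositional using (Unique)
import Data.List.Relation.Unary.Unique.Propositional.Properties as Uniqueₚ
open import Data.Nat using (ℕ; zero; suc; _!; _+_; _*_; _∸_; _^_; _≤_; _<_; z≤n; s≤s)
import Data.Nat as ℕ
open import Data.Nat.DivMod using (_%_)
import Data.Nat.Properties as ℕₚ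
open import Data.Nat.Tactic.RingSolver using (solve-∀)
open import Data.Product using (Σ; ∃; ∃₂; _×_; _,_; proj₁; proj₂)
open import Data.Sum using (_⊎_; inj₁; inj₂; [_,_]′)
open import Data.Unit using (⊤; tt)
open import Data.Vec as Vec using (Vec; lookup)
import Data.Vec.Properties as Vecₚ
open import Function using (_∘_; id)
open import Function.Bundles using (mk↔ₛ′)
open import Level using (0ℓ)
open import Relation.Binary.Bundles using (Setoid)
open import Relation.Binary.Definitions using (tri<; tri≈; tri>)
open import Relation.Binary.PropositionalEquality using (_≡_; _≢_; refl; sym; trans; cong; cong₂; subst; subst₂; module ≡-Reasoning)
open import Relation.Nullary using (¬_; Dec; yes; no; contradiction)
open import Relation.Nullary.Decidable using (¬?; _×-dec_; recompute)
import Relation.Nullary.Reflects as Reflects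
open import Relation.Unary using (Decidable)

private variable
  A B : Set
  ℓ : ℕ

∈-∷ʳ⁻ : ∀ {x y : A} xs → y ∈ xs ∷ʳ x → y ∈ xs ⊎ y ≡ x
∈-∷ʳ⁻ xs y∈ with ∈-++⁻ xs y∈
... | inj₁ y∈xs      = inj₁ y∈xs
... | inj₂ (here eq) = inj₂ eq

unique-∷⁺ : ∀ {x : A} {xs} → x ∉ xs → Unique xs → Unique (x ∷ xs)
unique-∷⁺ {xs = xs} x∉ u = All.tabulate (λ {y} y∈ eq → x∉ (subst (_∈ xs) (sym eq) y∈)) ∷ u

unique-∷⁻ : ∀ {x : A} {xs} → Unique (x ∷ xs) → x ∉ xs
unique-∷⁻ (p ∷ _) x∈ = All.lookup p x∈ refl

unique-++⁻ : ∀ (xs : List A) {ys} → Unique (xs ++ ys) →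
             Unique xs × Unique ys × (∀ {x} → x ∈ xs → x ∉ ys)
unique-++⁻ []       u       = [] , u , λ ()
unique-++⁻ (x ∷ xs) (p ∷ u) =
  let ux , uy , d = unique-++⁻ xs u in
  Allₚ.++⁻ˡ xs p ∷ ux , uy , λ
    { (here refl) y∈ → All.lookup (Allₚ.++⁻ʳ xs p) y∈ refl
    ; (there x∈)  y∈ → d x∈ y∈ }

unique-++⁺ : ∀ {xs ys : List A} → Unique xs → Unique ys → (∀ {x} → x ∈ xs → x ∉ ys) → Unique (xs ++ ys)
unique-++⁺ ux uy d = Uniqueₚ.++⁺ ux uy (λ (x∈ , y∈) → d x∈ y∈)

unique-resp-↭ : ∀ {xs ys : List A} → xs ↭ ys → Unique xs → Unique ys
unique-resp-↭ ↭.refl         u                   = u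
unique-resp-↭ (↭.prep x p)   (a ∷ u)             = All-resp-↭ p a ∷ unique-resp-↭ p u
unique-resp-↭ (↭.swap x y p) ((n ∷ a) ∷ (b ∷ u)) =
  (n ∘ sym ∷ All-resp-↭ p b) ∷ All-resp-↭ p a ∷ unique-resp-↭ p u
unique-resp-↭ (↭.trans p q)  u                   = unique-resp-↭ q (unique-resp-↭ p u)

++-∷-injective : ∀ {x : A} as {bs} cs {ds} → Unique (as ++ x ∷ bs) →
                 as ++ x ∷ bs ≡ cs ++ x ∷ ds → as ≡ cs × bs ≡ ds
++-∷-injective []       []       u eq = refl , Listₚ.∷-injectiveʳ eq
++-∷-injective []       (c ∷ cs) u eq with Listₚ.∷-injective eq
... | refl , refl = contradiction (∈-++⁺ʳ cs (here refl)) (unique-∷⁻ u)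
++-∷-injective (a ∷ as) []       u eq with Listₚ.∷-injective eq
... | refl , refl = contradiction (∈-++⁺ʳ as (here refl)) (unique-∷⁻ u)
++-∷-injective (a ∷ as) (c ∷ cs) (_ ∷ u) eq with Listₚ.∷-injective eq
... | refl , eq′ with ++-∷-injective as cs u eq′
...   | refl , refl = refl , refl

∈⇒↭ : ∀ {x : A} {xs} → x ∈ xs → ∃ λ ys → xs ↭ x ∷ ys
∈⇒↭ {x = x} x∈ with ∈-∃++ x∈
... | ys , zs , refl = ys ++ zs , ↭ₚ.shift x ys zs

unique-⊆⇒↭ : ∀ {xs ys : List A} → Unique xs → xs ⊆ ys → ∃ λ zs → ys ↭ xs ++ zs
unique-⊆⇒↭ {xs = []}     {ys} u s = ys , ↭-refl
unique-⊆⇒↭ {xs = x ∷ xs} {ys} (p ∷ u) s with ∈⇒↭ (s (here refl))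
... | ys′ , ys↭ with unique-⊆⇒↭ {xs = xs} {ys′} u s′
  where
  s′ : xs ⊆ ys′
  s′ y∈ with ∈-resp-↭ ys↭ (s (there y∈))
  ... | here refl = contradiction refl (All.lookup p y∈)
  ... | there y∈′ = y∈′
...   | zs , q = zs , ↭-trans ys↭ (↭.prep x q)

unique-⊆⇒length : ∀ {xs ys : List A} → Unique xs → xs ⊆ ys → length xs ≤ length ys
unique-⊆⇒length {xs = xs} u s with unique-⊆⇒↭ u s
... | zs , p = subst (length xs ≤_) (sym (trans (↭ₚ.↭-length p) (Listₚ.length-++ xs))) (ℕₚ.m≤m+n _ _)

unique-↭ : ∀ {xs ys : List A} → Unique xs → Unique ys → xs ⊆ ys → ys ⊆ xs → xs ↭ ys
unique-↭ {xs = xs} ux uy s s′ with unique-⊆⇒↭ ux s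
... | [] , p = ↭-trans (↭-reflexive (sym (Listₚ.++-identityʳ xs))) (↭-sym p)
... | z ∷ zs , p =
  contradiction (here refl)
    (proj₂ (proj₂ (unique-++⁻ xs (unique-resp-↭ p uy))) (s′ (∈-resp-↭ (↭-sym p) (∈-++⁺ʳ xs (here refl)))))

unique-length : ∀ {N} {xs : List (Fin N)} → Unique xs → length xs ≤ N
unique-length {N} {xs} u =
  subst (length xs ≤_) (Listₚ.length-tabulate id) (unique-⊆⇒length u (λ {x} _ → ∈-allFin x))

-- Walk f a w b: iterating f from a visits w in this order and ends in b.
data Walk {A : Set} (f : A → A) : A → List A → A → Set where
  stop : ∀ {a} → Walk f a [] a
  step : ∀ {a c w b} → f a ≡ c → Walk f c w b → Walk f a (c ∷ w) b

walk-++ : ∀ {f : A → A} {a b c u v} → Walk f a u b → Walk f b v c → Walk f a (u ++ v) c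
walk-++ stop       q = q
walk-++ (step e p) q = step e (walk-++ p q)

walk-split : ∀ {f : A → A} {a c} u {v} → Walk f a (u ++ v) c → ∃ λ b → Walk f a u b × Walk f b v c
walk-split []      p          = _ , stop , p
walk-split (x ∷ u) (step e p) = let b , q , r = walk-split u p in b , step e q , r

walk-end : ∀ {f : A → A} {a b c} u → Walk f a (u ∷ʳ b) c → b ≡ c
walk-end []      (step _ stop) = refl
walk-end (x ∷ u) (step _ p)    = walk-end u p

walk-splitAt : ∀ {f : A → A} {a b c} u {v} → Walk f a (u ++ b ∷ v) c →
               Walk f a (u ∷ʳ b) b × Walk f b v c
walk-splitAt []      (step e p) = step e stop , p
walk-splitAt (x ∷ u) (step e p) = let q , r = walk-splitAt u p in step e q , r

walk-end∈ : ∀ {f : A → A} {a b w} → Walk f a w b → b ∈ a ∷ w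
walk-end∈ stop       = here refl
walk-end∈ (step e p) = there (walk-end∈ p)

reroute : ∀ {f g : A → A} {a a′ b c} u → (∀ {y} → y ∈ u → g y ≡ f y) → g a′ ≡ f a →
          Walk f a (u ∷ʳ b) c → Walk g a′ (u ∷ʳ b) c
reroute []      agree e (step e′ stop) = step (trans e e′) stop
reroute (x ∷ u) agree e (step e′ p)    = step (trans e e′) (reroute u (agree ∘ there) (agree (here refl)) p)

walk-map : ∀ {f : A → A} {g : B → B} (π : A → B) → (∀ x → π (f x) ≡ g (π x)) →
           ∀ {a w b} → Walk f a w b → Walk g (π a) (map π w) (π b)
walk-map π comm stop       = stop
walk-map π comm (step e p) = step (trans (sym (comm _)) (cong π e)) (walk-map π comm p)

walk-cong : ∀ {f g : A → A} → (∀ x → f x ≡ g x) → ∀ {a w b} → Walk f a w b → Walk g a w b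
walk-cong eq stop       = stop
walk-cong eq (step e p) = step (trans (sym (eq _)) e) (walk-cong eq p)

first-return : ∀ {f : A → A} {a b} u v → b ∉ u → b ∉ v →
               Walk f a (u ∷ʳ b) b → Walk f a (v ∷ʳ b) b → u ≡ v
first-return []      []      _ _ _ _ = refl
first-return []      (y ∷ v) _ n (step refl stop) (step refl q) = contradiction (here refl) n
first-return (x ∷ u) []      m _ (step refl p) (step refl stop) = contradiction (here refl) m
first-return (x ∷ u) (y ∷ v) m n (step refl p) (step refl q) =
  cong (x ∷_) (first-return u v (m ∘ there) (n ∘ there) p q)

walk-preimage : ∀ {f : A → A} {a w b y} → Walk f a w b → y ∈ w → ∃ λ x → x ∈ a ∷ w × f x ≡ y
walk-preimage (step e p) (here refl) = _ , here refl , e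
walk-preimage (step e p) (there y∈)  = let x , x∈ , eq = walk-preimage p y∈ in x , there x∈ , eq

walk-image : ∀ {f : A → A} {a w b y} → Walk f a w b → y ∈ a ∷ w → y ≡ b ⊎ f y ∈ w
walk-image stop       (here refl) = inj₁ refl
walk-image (step e p) (here refl) = inj₂ (here e)
walk-image (step e p) (there y∈)  with walk-image p y∈
... | inj₁ eq = inj₁ eq
... | inj₂ m  = inj₂ (there m)

snoc-view : ∀ (w : List A) → w ≡ [] ⊎ ∃₂ λ u b → w ≡ u ∷ʳ b
snoc-view []      = inj₁ refl
snoc-view (x ∷ w) with snoc-view w
... | inj₁ refl           = inj₂ ([] , x , refl)
... | inj₂ (u , b , refl) = inj₂ (x ∷ u , b , refl)

record Cycle {A : Set} (f : A → A) (w : List A) : Set where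
  constructor cycle
  field
    {body} : List A
    {end}  : A
    shape  : w ≡ body ∷ʳ end
    walk   : Walk f end w end

cycle-∷ʳ : ∀ {f : A → A} {u b} → Walk f b (u ∷ʳ b) b → Cycle f (u ∷ʳ b)
cycle-∷ʳ p = cycle refl p

cycle-walk : ∀ {f : A → A} {u b} → Cycle f (u ∷ʳ b) → Walk f b (u ∷ʳ b) b
cycle-walk {u = u} (cycle {body} sh p) with Listₚ.∷ʳ-injective u body sh
... | refl , refl = p

rotate-walk : ∀ {f : A → A} {b x} u {v} → Walk f b (u ++ x ∷ v ∷ʳ b) b → Walk f x ((v ∷ʳ b) ++ u ∷ʳ x) x
rotate-walk u p = let q , r = walk-splitAt u p in walk-++ r q

cycle-at : ∀ {f : A → A} {w x} → Cycle f w → x ∈ w → ∃ λ u → Walk f x (u ∷ʳ x) x × u ∷ʳ x ↭ w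
cycle-at {w = w} {x} (cycle {body} {end} refl p) x∈ with ∈-∃++ x∈
... | as , bs , eq with snoc-view bs
...   | inj₁ refl with Listₚ.∷ʳ-injective body as eq
...     | refl , refl = as , p , ↭-refl
cycle-at {w = w} {x} (cycle {body} {end} refl p) x∈ | as , bs , eq | inj₂ (v , b , refl)
  with Listₚ.∷ʳ-injective body (as ++ x ∷ v) (trans eq (sym (Listₚ.++-assoc as (x ∷ v) [ b ])))
... | refl , refl =
  (v ∷ʳ b) ++ as
  , subst (λ z → Walk _ x z x) (sym (Listₚ.++-assoc (v ∷ʳ b) as [ x ]))
      (rotate-walk as (subst (λ z → Walk _ b z b) eq p))
  , ↭-trans (↭-reflexive (Listₚ.++-assoc (v ∷ʳ b) as [ x ]))
    (↭-trans (↭ₚ.++-comm (v ∷ʳ b) (as ∷ʳ x))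
      (↭-reflexive (trans (Listₚ.++-assoc as [ x ] (v ∷ʳ b)) (sym eq))))

cycle-image : ∀ {f : A → A} {w x} → Cycle f w → x ∈ w → f x ∈ w
cycle-image c x∈ with cycle-at c x∈
... | []    , step e stop , p = ∈-resp-↭ p (here e)
... | y ∷ u , step e _    , p = ∈-resp-↭ p (here e)

∷ʳ-unique : ∀ {u : List A} {x} → Unique (u ∷ʳ x) → x ∉ u
∷ʳ-unique {u = u} un x∈ = proj₂ (proj₂ (unique-++⁻ u un)) x∈ (here refl)

cycles-meet : ∀ {f : A → A} {c d x} → Cycle f c → Cycle f d → Unique c → Unique d →
              x ∈ c → x ∈ d → c ↭ d
cycles-meet cc cd uc ud xc xd with cycle-at cc xc | cycle-at cd xd
... | u , p , pu | v , q , pv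
  with first-return u v (∷ʳ-unique (unique-resp-↭ (↭-sym pu) uc)) (∷ʳ-unique (unique-resp-↭ (↭-sym pv) ud)) p q
... | refl = ↭-trans (↭-sym pu) pv

cycle-map : ∀ {f : A → A} {g : B → B} (π : A → B) → (∀ x → π (f x) ≡ g (π x)) →
            ∀ {w} → Cycle f w → Cycle g (map π w)
cycle-map π comm (cycle {body} {end} refl p) =
  cycle (Listₚ.map-++ π body [ end ]) (walk-map π comm p)

cycle-cong : ∀ {f g : A → A} → (∀ x → f x ≡ g x) → ∀ {w} → Cycle f w → Cycle g w
cycle-cong eq (cycle sh p) = cycle sh (walk-cong eq p)

cycle-local : ∀ {f g : A → A} {w} → (∀ {y} → y ∈ w → g y ≡ f y) → Cycle f w → Cycle g w
cycle-local agree (cycle {body} {end} refl p) =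
  cycle refl (reroute body (agree ∘ ∈-++⁺ˡ) (agree (∈-++⁺ʳ body (here refl))) p)

module _ {N : ℕ} where

  _∈?_ : (x : Fin N) (xs : List (Fin N)) → Dec (x ∈ xs)
  x ∈? xs = Any.any? (x ≟_) xs

  private
    grow : ∀ {f : Fin N → Fin N} → (∀ {x y} → f x ≡ f y → x ≡ y) → ∀ {a b} k u → length u + k ≡ N →
           Walk f b u a → Unique (b ∷ u) → ∃ λ v → Walk f b (v ∷ʳ b) b × Unique (v ∷ʳ b)
    grow inj zero u eq p un =
      contradiction (subst (suc (length u) ≤_) (sym (trans (sym (ℕₚ.+-identityʳ _)) eq)) (unique-length un)) ℕₚ.1+n≰n
    grow {f} inj {a} {b} (suc k) u eq p un with f a ≟ b
    ... | yes e = u , walk-++ p (step e stop) , unique-resp-↭ (↭ₚ.∷↭∷ʳ b u) un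
    ... | no ne = grow inj k (u ∷ʳ f a) (trans (cong (_+ k) (Listₚ.length-++ u)) (trans (ℕₚ.+-assoc (length u) 1 k) eq))
                    (walk-++ p (step refl stop))
                    (unique-resp-↭ (↭-sym (↭-trans (↭.prep b (↭-sym (↭ₚ.∷↭∷ʳ (f a) u))) (↭.swap b (f a) ↭-refl)))
                      (unique-∷⁺ fresh un))
      where
      fresh : f a ∉ b ∷ u
      fresh (here e)  = ne e
      fresh (there m) with ∈-∃++ m
      ... | as , bs , refl with walk-splitAt as p
      ...   | q , r with walk-split as q
      ...     | c , q₁ , step e stop with inj e
      ...       | refl = proj₂ (proj₂ (unique-++⁻ (b ∷ as) un)) (walk-end∈ q₁) (walk-end∈ r)

  orbit : ∀ {f : Fin N → Fin N} → (∀ {x y} → f x ≡ f y → x ≡ y) →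
          ∀ b → ∃ λ v → Walk f b (v ∷ʳ b) b × Unique (v ∷ʳ b)
  orbit inj b = grow inj N [] refl stop ([] ∷ [])

  injective⇒surjective : ∀ {f : Fin N → Fin N} → (∀ {x y} → f x ≡ f y → x ≡ y) → ∀ y → ∃ λ x → f x ≡ y
  injective⇒surjective inj y with orbit inj y
  ... | v , p , _ with walk-preimage p (∈-++⁺ʳ v (here refl))
  ...   | x , _ , eq = x , eq

  surjective⇒injective : ∀ {f : Fin N → Fin N} → (∀ y → ∃ λ x → f x ≡ y) → ∀ {x y} → f x ≡ f y → x ≡ y
  surjective⇒injective {f} surj {x} {y} eq =
    let x′ , ex = g-surj x ; y′ , ey = g-surj y in
    trans (sym ex) (trans (cong g (trans (sym (proj₂ (surj x′)))
      (trans (cong f ex) (trans eq (trans (sym (cong f ey)) (proj₂ (surj y′))))))) ey)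
    where
    g : Fin N → Fin N
    g y = proj₁ (surj y)
    g-surj : ∀ y → ∃ λ x → g x ≡ y
    g-surj = injective⇒surjective (λ {x} {y} e → trans (sym (proj₂ (surj x))) (trans (cong f e) (proj₂ (surj y))))

  private
    orb : (Fin N → Fin N) → Fin N → ℕ → Fin N → List (Fin N)
    orb f b zero    a = []
    orb f b (suc k) a with f a ≟ b
    ... | yes _ = []
    ... | no  _ = f a ∷ orb f b k (f a)

    orb-walk : ∀ {f b} k {a} u → length u < k → b ∉ u → Walk f a (u ∷ʳ b) b → orb f b k a ≡ u
    orb-walk {f} {b} (suc k) {a} [] _ _ (step e stop) with f a ≟ b
    ... | yes _ = refl
    ... | no ne = contradiction e ne
    orb-walk {f} {b} (suc k) {a} (x ∷ u) (s≤s lt) n (step e p) with f a ≟ b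
    ... | yes e′ = contradiction (here (trans (sym e′) e)) n
    ... | no _ with e
    ...   | refl = cong (f a ∷_) (orb-walk k u lt (n ∘ there) p)

  abstract
    -- Junk unless f is injective.
    inner : (Fin N → Fin N) → Fin N → List (Fin N)
    inner f b = orb f b (suc N) b

  cyc : (Fin N → Fin N) → Fin N → List (Fin N)
  cyc f b = inner f b ∷ʳ b

  abstract
    cyc-walk : ∀ {f b u} → Walk f b (u ∷ʳ b) b → Unique (u ∷ʳ b) → cyc f b ≡ u ∷ʳ b
    cyc-walk {f} {b} {u} p un =
      cong (_∷ʳ b) (orb-walk (suc N) u (s≤s (unique-length (proj₁ (unique-++⁻ u un)))) (∷ʳ-unique un) p)

  module _ {f : Fin N → Fin N} (inj : ∀ {x y} → f x ≡ f y → x ≡ y) where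

    cyc-cycle : ∀ b → Walk f b (cyc f b) b × Unique (cyc f b)
    cyc-cycle b with orbit inj b
    ... | v , p , u rewrite cyc-walk p u = p , u

    cyc-unique : ∀ b → Unique (cyc f b)
    cyc-unique b = proj₂ (cyc-cycle b)

    cyc-Cycle : ∀ b → Cycle f (cyc f b)
    cyc-Cycle b = cycle-∷ʳ (proj₁ (cyc-cycle b))

    end∈cyc : ∀ b → b ∈ cyc f b
    end∈cyc b = ∈-++⁺ʳ (inner f b) (here refl)

    cyc-sym : ∀ {x y} → x ∈ cyc f y → cyc f y ↭ cyc f x
    cyc-sym {x} {y} m =
      cycles-meet (cyc-Cycle y) (cyc-Cycle x) (cyc-unique y) (cyc-unique x) m (end∈cyc x)

    ∈cyc-sym : ∀ {x y} → x ∈ cyc f y → y ∈ cyc f x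
    ∈cyc-sym {x} {y} m = ∈-resp-↭ (cyc-sym m) (end∈cyc y)

++-cancelˡ-↭ : ∀ (xs : List A) {ys zs} → xs ++ ys ↭ xs ++ zs → ys ↭ zs
++-cancelˡ-↭ []       p = p
++-cancelˡ-↭ (x ∷ xs) p = ++-cancelˡ-↭ xs (↭ₚ.drop-∷ p)

infix 3 _≋_

_≋_ : List (List A) → List (List A) → Set
_≋_ = Homo.Permutation _↭_

≋-refl : ∀ {cs : List (List A)} → cs ≋ cs
≋-refl = Homo.refl (Pointwise.refl ↭-refl)

≋-reflexive : ∀ {cs ds : List (List A)} → cs ≡ ds → cs ≋ ds
≋-reflexive refl = ≋-refl

≋-sym : ∀ {cs ds : List (List A)} → cs ≋ ds → ds ≋ cs
≋-sym = Homo.sym ↭-sym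

≋-shift : ∀ {c d : List A} → c ↭ d → ∀ as bs → as ++ c ∷ bs ≋ d ∷ as ++ bs
≋-shift = PermSetoidₚ.shift ↭.↭-setoid

≋-length : ∀ {cs ds : List (List A)} → cs ≋ ds → length cs ≡ length ds
≋-length = PermSetoidₚ.xs↭ys⇒|xs|≡|ys| ↭.↭-setoid

≋-map : ∀ (f : A → B) {cs ds} → cs ≋ ds → map (map f) cs ≋ map (map f) ds
≋-map f = PermSetoidₚ.map⁺ ↭.↭-setoid ↭.↭-setoid (↭ₚ.map⁺ f)

concat-pointwise : ∀ {cs ds : List (List A)} → Pointwise _↭_ cs ds → concat cs ↭ concat ds
concat-pointwise []       = ↭-refl
concat-pointwise (p ∷ ps) = ↭ₚ.++⁺ p (concat-pointwise ps)

concat-≋ : ∀ {cs ds : List (List A)} → cs ≋ ds → concat cs ↭ concat ds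
concat-≋ (Homo.refl ps)    = concat-pointwise ps
concat-≋ (Homo.prep p q)   = ↭ₚ.++⁺ p (concat-≋ q)
concat-≋ (Homo.swap {xs = xs} {x = x} {y} p q r) =
  ↭-trans (↭ₚ.shifts x y) (↭ₚ.++⁺ q (↭ₚ.++⁺ p (concat-≋ r)))
concat-≋ (Homo.trans p q)  = ↭-trans (concat-≋ p) (concat-≋ q)

concat-↭ : ∀ {cs ds : List (List A)} → cs ↭ ds → concat cs ↭ concat ds
concat-↭ ↭.refl         = ↭-refl
concat-↭ (↭.prep c p)   = ↭ₚ.++⁺ˡ c (concat-↭ p)
concat-↭ (↭.swap c d p) = ↭-trans (↭ₚ.shifts c d) (↭ₚ.++⁺ˡ d (↭ₚ.++⁺ˡ c (concat-↭ p)))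
concat-↭ (↭.trans p q)  = ↭-trans (concat-↭ p) (concat-↭ q)

concat-shift : ∀ (as : List (List A)) d bs → concat (as ++ d ∷ bs) ↭ d ++ concat (as ++ bs)
concat-shift as d bs = concat-↭ (↭ₚ.shift d as bs)

SameBlock : List (List A) → A → A → Set
SameBlock cs a b = Any (λ c → a ∈ c × b ∈ c) cs

SameBlock-≋ : ∀ {cs ds : List (List A)} {a b} → cs ≋ ds → SameBlock cs a b → SameBlock ds a b
SameBlock-≋ = PermSetoidₚ.Any-resp-↭ ↭.↭-setoid (λ p (a∈ , b∈) → ∈-resp-↭ p a∈ , ∈-resp-↭ p b∈)

SameBlock-map : ∀ (f : A → B) {cs a b} → SameBlock cs a b → SameBlock (map (map f) cs) (f a) (f b)
SameBlock-map f (here (a∈ , b∈)) = here (∈-map⁺ f a∈ , ∈-map⁺ f b∈)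
SameBlock-map f (there s)        = there (SameBlock-map f s)

concat-unique : ∀ {cs : List (List A)} {c} → Unique (concat cs) → c ∈ cs → Unique c
concat-unique {cs = d ∷ cs} u (here refl) = proj₁ (unique-++⁻ d u)
concat-unique {cs = d ∷ cs} u (there c∈)  = concat-unique (proj₁ (proj₂ (unique-++⁻ d u))) c∈

cycles-≋ : ∀ {f : A → A} {cs ds} → All (Cycle f) cs → All (Cycle f) ds →
           Unique (concat cs) → concat cs ↭ concat ds → cs ≋ ds
cycles-≋ {cs = []} {[]} [] [] u p = ≋-refl
cycles-≋ {cs = []} {d ∷ ds} [] (cycle {body} {end} refl _ ∷ _) u p =
  contradiction (∈-resp-↭ (↭-sym p) (∈-++⁺ˡ (∈-++⁺ʳ body (here refl)))) λ ()
cycles-≋ {cs = c ∷ cs} {ds} (cc@(cycle {body} {end} refl _) ∷ ccs) cds u p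
  with ∈-concat⁻′ ds (∈-resp-↭ p (∈-++⁺ˡ (∈-++⁺ʳ body (here refl))))
... | d , x∈d , d∈ with ∈-∃++ d∈
...   | as , bs , refl =
  Homo.trans (Homo.prep c↭d (cycles-≋ ccs (Allₚ.++⁺ (Allₚ.++⁻ˡ as cds) (All.tail (Allₚ.++⁻ʳ as cds)))
    (proj₁ (proj₂ (unique-++⁻ c u)))
    (++-cancelˡ-↭ c (↭-trans p (↭-trans (concat-shift as d bs) (↭ₚ.++⁺ʳ _ (↭-sym c↭d)))))))
    (≋-sym (≋-shift ↭-refl as bs))
  where
  c↭d : c ↭ d
  c↭d = cycles-meet cc (All.lookup cds d∈) (proj₁ (unique-++⁻ c u))
          (concat-unique (unique-resp-↭ p u) d∈) (∈-++⁺ʳ body (here refl)) x∈d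

walk⇒cycle : ∀ {f : A → A} {b x w} → x ∈ w → Walk f b w b → Cycle f w
walk⇒cycle {w = w} x∈ p with snoc-view w
... | inj₁ refl = contradiction x∈ λ ()
... | inj₂ (u , b , refl) with walk-end u p
...   | refl = cycle refl p

walk-agree : ∀ {f g : A → A} {a w b c y} → Walk f a w b → Walk g a w c → y ∈ a ∷ w → y ≡ b ⊎ f y ≡ g y
walk-agree stop       stop        (here refl) = inj₁ refl
walk-agree (step e p) (step e′ q) (here refl) = inj₂ (trans e (sym e′))
walk-agree (step e p) (step e′ q) (there y∈)  = walk-agree p q y∈

walk-agree-start : ∀ {f g : A → A} {a a′ x w b c} → Walk f a (x ∷ w) b → Walk g a′ (x ∷ w) c → f a ≡ g a′
walk-agree-start (step e p) (step e′ q) = trans e (sym e′)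

cycle-agree : ∀ {f g : A → A} {w y} → Cycle f w → Cycle g w → y ∈ w → f y ≡ g y
cycle-agree {w = x ∷ w} (cycle {u} sh p) (cycle {v} sh′ q) y∈ with Listₚ.∷ʳ-injective u v (trans (sym sh) sh′)
... | refl , refl with walk-agree p q (there y∈)
...   | inj₁ refl = walk-agree-start p q
...   | inj₂ eq   = eq
cycle-agree {w = []} _ _ ()

module _ {N : ℕ} where

  private
    nextFrom : Fin N → Fin N → List (Fin N) → Fin N → Fin N
    nextFrom d x []       y with x ≟ y
    ... | yes _ = d
    ... | no  _ = y
    nextFrom d x (z ∷ xs) y with x ≟ y
    ... | yes _ = z
    ... | no  _ = nextFrom d z xs y

    nextFrom-walk : ∀ {g : Fin N → Fin N} d x xs → Unique (x ∷ xs) →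
                    (∀ {y} → y ∈ x ∷ xs → g y ≡ nextFrom d x xs y) →
                    ∃ λ l → Walk g x xs l × g l ≡ d
    nextFrom-walk d x [] u eq = x , stop , trans (eq (here refl)) last
      where
      last : nextFrom d x [] x ≡ d
      last with x ≟ x
      ... | yes _ = refl
      ... | no ne = contradiction refl ne
    nextFrom-walk {g} d x (z ∷ xs) (p ∷ u) eq =
      let l , w , e = nextFrom-walk {g} d z xs u (λ y∈ → trans (eq (there y∈)) (skip (All.lookup p y∈))) in
      l , step (trans (eq (here refl)) first) w , e
      where
      first : nextFrom d x (z ∷ xs) x ≡ z
      first with x ≟ x
      ... | yes _ = refl
      ... | no ne = contradiction refl ne
      skip : ∀ {y} → x ≢ y → nextFrom d x (z ∷ xs) y ≡ nextFrom d z xs y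
      skip {y} ne with x ≟ y
      ... | yes e = contradiction e ne
      ... | no _  = refl

  next : List (Fin N) → Fin N → Fin N
  next []       y = y
  next (x ∷ xs) y = nextFrom x x xs y

  next-cycle : ∀ {x w} → x ∈ w → Unique w → Cycle (next w) w
  next-cycle {w = y ∷ w} _ u with nextFrom-walk {next (y ∷ w)} y y w u (λ _ → refl)
  ... | l , p , e = walk⇒cycle (here refl) (step e p)

  cycle⇒next : ∀ {f w y} → Cycle f w → Unique w → y ∈ w → next w y ≡ f y
  cycle⇒next c u y∈ = cycle-agree (next-cycle y∈ u) c y∈

  rotate₃ : Fin N → Fin N → Fin N → Fin N → Fin N
  rotate₃ x p q y with y ≟ x | y ≟ p | y ≟ q
  ... | yes _ | _     | _     = p
  ... | no _  | yes _ | _     = q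
  ... | no _  | no _  | yes _ = x
  ... | no _  | no _  | no _  = y

  module _ {x p q : Fin N} where

    rotate₃-1 : rotate₃ x p q x ≡ p
    rotate₃-1 with x ≟ x
    ... | yes _ = refl
    ... | no ne = contradiction refl ne

    rotate₃-2 : p ≢ x → rotate₃ x p q p ≡ q
    rotate₃-2 n with p ≟ x | p ≟ p
    ... | yes e | _     = contradiction e n
    ... | no _  | yes _ = refl
    ... | no _  | no ne = contradiction refl ne

    rotate₃-3 : q ≢ x → q ≢ p → rotate₃ x p q q ≡ x
    rotate₃-3 n m with q ≟ x | q ≟ p | q ≟ q
    ... | yes e | _     | _     = contradiction e n
    ... | no _  | yes e | _     = contradiction e m
    ... | no _  | no _  | yes _ = refl
    ... | no _  | no _  | no ne = contradiction refl ne

    rotate₃-fix : ∀ {y} → y ≢ x → y ≢ p → y ≢ q → rotate₃ x p q y ≡ y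
    rotate₃-fix {y} n m o with y ≟ x | y ≟ p | y ≟ q
    ... | yes e | _     | _     = contradiction e n
    ... | no _  | yes e | _     = contradiction e m
    ... | no _  | no _  | yes e = contradiction e o
    ... | no _  | no _  | no _  = refl

  -- The word W = A x B p C q D and the word W′ = A x C q B p D.
  cut₁ cut₂ : (as bs cs ds : List (Fin N)) (x p q : Fin N) → List (Fin N)
  cut₁ as bs cs ds x p q = as ++ x ∷ bs ++ p ∷ cs ++ q ∷ ds
  cut₂ as bs cs ds x p q = as ++ x ∷ cs ++ q ∷ bs ++ p ∷ ds

  module Cut (as bs cs ds : List (Fin N)) (x p q : Fin N)
             (un : Unique (cut₁ as bs cs ds x p q)) where

    W W′ : List (Fin N)
    W  = cut₁ as bs cs ds x p q
    W′ = cut₂ as bs cs ds x p q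

    private
      uₐ = unique-++⁻ as un
      uᵦ = unique-++⁻ (as ∷ʳ x) (subst Unique (sym (Listₚ.++-assoc as [ x ] _)) un)
      uᵪ = unique-++⁻ bs (proj₁ (proj₂ uᵦ))
      u₁ = unique-++⁻ (bs ∷ʳ p) (subst Unique (sym (Listₚ.++-assoc bs [ p ] _)) (proj₁ (proj₂ uᵦ)))
      u₂ = unique-++⁻ cs (proj₁ (proj₂ u₁))
      u₃ = unique-++⁻ (cs ∷ʳ q) (subst Unique (sym (Listₚ.++-assoc cs [ q ] _)) (proj₁ (proj₂ u₁)))
      x∈ᵃ : x ∈ as ∷ʳ x
      x∈ᵃ = ∈-++⁺ʳ as (here refl)
      p∈ᵇ : p ∈ bs ∷ʳ p
      p∈ᵇ = ∈-++⁺ʳ bs (here refl)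
      q∈ᶜ : q ∈ cs ∷ʳ q
      q∈ᶜ = ∈-++⁺ʳ cs (here refl)

    abstract
     W↭W′ : W ↭ W′
     W↭W′ = ↭ₚ.++⁺ˡ as (↭.prep x (↭-trans (↭-reflexive (sym (Listₚ.++-assoc bs [ p ] _)))
              (↭-trans (↭-reflexive (cong ((bs ∷ʳ p) ++_) (sym (Listₚ.++-assoc cs [ q ] ds))))
                (↭-trans (↭ₚ.shifts (bs ∷ʳ p) (cs ∷ʳ q))
                  (↭-reflexive (trans (Listₚ.++-assoc cs [ q ] _) (cong (λ z → cs ++ q ∷ z) (Listₚ.++-assoc bs [ p ] ds))))))))

    abstract
     unique′ : Unique W′
     unique′ = unique-resp-↭ W↭W′ un

     p≢x : p ≢ x
     p≢x refl = proj₂ (proj₂ uᵦ) x∈ᵃ (∈-++⁺ʳ bs (here refl))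
     q≢x : q ≢ x
     q≢x refl = proj₂ (proj₂ uᵦ) x∈ᵃ (∈-++⁺ʳ bs (there (∈-++⁺ʳ cs (here refl))))
     q≢p : q ≢ p
     q≢p refl = proj₂ (proj₂ u₁) p∈ᵇ (∈-++⁺ʳ cs (here refl))

    private
      c : Fin N → Fin N
      c = rotate₃ x p q
      g : Fin N → Fin N
      g y = next W (c y)

      fixᵃ : ∀ {y} → y ∈ as → c y ≡ y
      fixᵃ m = rotate₃-fix (λ { refl → proj₂ (proj₂ uₐ) m (here refl) })
        (λ { refl → proj₂ (proj₂ uₐ) m (there (∈-++⁺ʳ bs (here refl))) })
        (λ { refl → proj₂ (proj₂ uₐ) m (there (∈-++⁺ʳ bs (there (∈-++⁺ʳ cs (here refl))))) })
      fixᵇ : ∀ {y} → y ∈ bs → c y ≡ y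
      fixᵇ m = rotate₃-fix (λ { refl → proj₂ (proj₂ uᵦ) x∈ᵃ (∈-++⁺ˡ m) })
        (λ { refl → proj₂ (proj₂ uᵪ) m (here refl) })
        (λ { refl → proj₂ (proj₂ uᵪ) m (there (∈-++⁺ʳ cs (here refl))) })
      fixᶜ : ∀ {y} → y ∈ cs → c y ≡ y
      fixᶜ m = rotate₃-fix (λ { refl → proj₂ (proj₂ uᵦ) x∈ᵃ (∈-++⁺ʳ bs (there (∈-++⁺ˡ m))) })
        (λ { refl → proj₂ (proj₂ u₁) p∈ᵇ (∈-++⁺ˡ m) })
        (λ { refl → proj₂ (proj₂ u₂) m (here refl) })
      fixᵈ : ∀ {y} → y ∈ ds → c y ≡ y
      fixᵈ m = rotate₃-fix (λ { refl → proj₂ (proj₂ uᵦ) x∈ᵃ (∈-++⁺ʳ bs (there (∈-++⁺ʳ cs (there m)))) })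
        (λ { refl → proj₂ (proj₂ u₁) p∈ᵇ (∈-++⁺ʳ cs (there m)) })
        (λ { refl → proj₂ (proj₂ u₃) q∈ᶜ m })

      cycle₁ : Cycle (next W) W
      cycle₁ = next-cycle (∈-++⁺ʳ as (here refl)) un

      cycle₂ : Cycle g W′
      cycle₂ = go cycle₁
        where
        go : Cycle (next W) W → Cycle g W′
        go (cycle sh w) with walk-splitAt as w
        ... | wa , w₁ with walk-splitAt bs w₁
        ...   | wb , w₂ with walk-splitAt cs w₂
        ...     | wc , wd
          with walk-split ds (subst (λ z → Walk g p z x) (Listₚ.++-assoc ds as [ x ])
                 (reroute {g = g} {a′ = p} (ds ++ as)
                   (λ m → cong (next W) ([ fixᵈ , fixᵃ ]′ (∈-++⁻ ds m)))
                   (cong (next W) (rotate₃-2 p≢x))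
                   (subst (λ z → Walk (next W) q z x) (sym (Listₚ.++-assoc ds as [ x ])) (walk-++ wd wa))))
        ...       | l , wd′ , wa′ =
          walk⇒cycle (∈-++⁺ʳ as (here refl))
            (subst (λ z → Walk g l z l) assoc₃
              (walk-++ wa′ (walk-++ (reroute {g = g} {a′ = x} cs (cong (next W) ∘ fixᶜ) (cong (next W) (rotate₃-1 {x} {p} {q})) wc)
                (walk-++ (reroute {g = g} {a′ = q} bs (cong (next W) ∘ fixᵇ) (cong (next W) (rotate₃-3 q≢x q≢p)) wb) wd′))))
          where
          assoc₃ : (as ∷ʳ x) ++ (cs ∷ʳ q) ++ (bs ∷ʳ p) ++ ds ≡ W′
          assoc₃ = trans (Listₚ.++-assoc as [ x ] _) (cong (λ z → as ++ x ∷ z)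
            (trans (Listₚ.++-assoc cs [ q ] _) (cong (λ z → cs ++ q ∷ z) (Listₚ.++-assoc bs [ p ] ds))))

      agree : ∀ {y} → y ∈ W → next W′ y ≡ g y
      agree m = cycle⇒next cycle₂ unique′ (∈-resp-↭ W↭W′ m)

    x∈W : x ∈ W
    x∈W = ∈-++⁺ʳ as (here refl)
    p∈W : p ∈ W
    p∈W = ∈-++⁺ʳ as (there (∈-++⁺ʳ bs (here refl)))
    q∈W : q ∈ W
    q∈W = ∈-++⁺ʳ as (there (∈-++⁺ʳ bs (there (∈-++⁺ʳ cs (here refl)))))

    abstract
     next-x : next W′ x ≡ next W p
     next-x = trans (agree x∈W) (cong (next W) (rotate₃-1 {x} {p} {q}))
     next-p : next W′ p ≡ next W q
     next-p = trans (agree p∈W) (cong (next W) (rotate₃-2 p≢x))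
     next-q : next W′ q ≡ next W x
     next-q = trans (agree q∈W) (cong (next W) (rotate₃-3 q≢x q≢p))
     next-other : ∀ {y} → y ∈ W → y ≢ x → y ≢ p → y ≢ q → next W′ y ≡ next W y
     next-other m n₁ n₂ n₃ = trans (agree m) (cong (next W) (rotate₃-fix n₁ n₂ n₃))

  idx : List (Fin N) → Fin N → ℕ
  idx []       y = 0
  idx (x ∷ xs) y with x ≟ y
  ... | yes _ = 0
  ... | no  _ = suc (idx xs y)

  idx-++-∈ : ∀ X {Y y} → y ∈ X → idx (X ++ Y) y ≡ idx X y
  idx-++-∈ (x ∷ X) {y = y} m with x ≟ y
  ... | yes _ = refl
  idx-++-∈ (x ∷ X) (here e)  | no ne = contradiction (sym e) ne
  idx-++-∈ (x ∷ X) (there m) | no ne = cong suc (idx-++-∈ X m)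

  idx-++-∉ : ∀ X {Y y} → y ∉ X → idx (X ++ Y) y ≡ length X + idx Y y
  idx-++-∉ []      n = refl
  idx-++-∉ (x ∷ X) {y = y} n with x ≟ y
  ... | yes e = contradiction (here (sym e)) n
  ... | no _  = cong suc (idx-++-∉ X (n ∘ there))

  idx-< : ∀ {X y} → y ∈ X → idx X y < length X
  idx-< {x ∷ X} {y} m with x ≟ y
  ... | yes _ = s≤s z≤n
  idx-< {x ∷ X} (here e)  | no ne = contradiction (sym e) ne
  idx-< {x ∷ X} (there m) | no ne = s≤s (idx-< m)

  idx-injective : ∀ {X y z} → y ∈ X → z ∈ X → idx X y ≡ idx X z → y ≡ z
  idx-injective {x ∷ X} {y} {z} my mz eq with x ≟ y | x ≟ z
  idx-injective my mz eq | yes refl | yes refl = refl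
  idx-injective my mz () | yes _    | no _
  idx-injective my mz () | no _     | yes _
  idx-injective (here e)   mz         eq | no ne | no _  = contradiction (sym e) ne
  idx-injective (there my) (here e)   eq | no _  | no ne = contradiction (sym e) ne
  idx-injective (there my) (there mz) eq | no _  | no _  = idx-injective my mz (ℕₚ.suc-injective eq)

  idx-before : ∀ X {Y y z} → y ∈ X → z ∉ X → idx (X ++ Y) y < idx (X ++ Y) z
  idx-before X {Y} {y} {z} my nz = subst₂ _<_ (sym (idx-++-∈ X my)) (sym (idx-++-∉ X nz))
    (ℕₚ.<-≤-trans (idx-< my) (ℕₚ.m≤m+n (length X) _))

  idx-≤⇒∈ : ∀ X {p Y y} → idx (X ++ p ∷ Y) y ≤ idx (X ++ p ∷ Y) p → y ∈ X ∷ʳ p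
  idx-≤⇒∈ X {p} {Y} {y} le with y ∈? (X ∷ʳ p)
  ... | yes m = m
  ... | no n = contradiction le (ℕₚ.<⇒≱
    (subst (λ z → idx z p < idx z y) (Listₚ.++-assoc X [ p ] Y) (idx-before (X ∷ʳ p) (∈-++⁺ʳ X (here refl)) n)))

  idx-∈⇒< : ∀ X {p Y y} → p ∉ X → y ∈ X → idx (X ++ p ∷ Y) y < idx (X ++ p ∷ Y) p
  idx-∈⇒< X n m = idx-before X m n

  idx-∈⇒≤ : ∀ X {p Y y} → p ∉ X → y ∈ X ∷ʳ p → idx (X ++ p ∷ Y) y ≤ idx (X ++ p ∷ Y) p
  idx-∈⇒≤ X n m with ∈-∷ʳ⁻ X m
  ... | inj₁ m′   = ℕₚ.<⇒≤ (idx-∈⇒< X n m′)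
  ... | inj₂ refl = ℕₚ.≤-refl

argmax : ∀ (key : A → ℕ) (P : A → Set) → Decidable P → ∀ {x} xs → x ∈ xs → P x →
         ∃ λ m → m ∈ xs × P m × (∀ {y} → y ∈ xs → P y → key y ≤ key m)
argmax key P P? (x ∷ xs) x∈ px with Any.any? P? xs
argmax key P P? (x ∷ xs) (here refl) px | no n =
  x , here refl , px , λ { (here refl) _ → ℕₚ.≤-refl ; (there y∈) py → contradiction (Any.map (λ { refl → py }) y∈) n }
argmax key P P? (x ∷ xs) (there x∈) px | no n = contradiction (Any.map (λ { refl → px }) x∈) n
argmax key P P? (x ∷ xs) _ _ | yes some with Any.satisfied (Any.map id some) | ∃-∈ some
  where
  ∃-∈ : ∀ {ys} → Any P ys → ∃ λ y → y ∈ ys × P y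
  ∃-∈ (here p)  = _ , here refl , p
  ∃-∈ (there a) = let y , m , p = ∃-∈ a in y , there m , p
... | _ | y , y∈ , py with argmax key P P? xs y∈ py
...   | m , m∈ , pm , best with P? x | ℕₚ.≤-total (key x) (key m)
...     | no nx | _       = m , there m∈ , pm , λ { (here refl) p → contradiction p nx ; (there z∈) p → best z∈ p }
...     | yes _ | inj₁ le = m , there m∈ , pm , λ { (here refl) _ → le ; (there z∈) p → best z∈ p }
...     | yes p | inj₂ ge = x , here refl , p , λ { (here refl) _ → ℕₚ.≤-refl ; (there z∈) q → ℕₚ.≤-trans (best z∈ q) ge }

-- Unicellular maps as words

unique-concatMap : ∀ (f : A → List B) {xs} → Unique xs → (∀ {x} → x ∈ xs → Unique (f x)) →
                   (∀ {x y z} → x ∈ xs → y ∈ xs → z ∈ f x → z ∈ f y → x ≡ y) → Unique (concatMap f xs)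
unique-concatMap f {[]} _ _ _ = []
unique-concatMap f {x ∷ xs} (p ∷ u) uf disj =
  unique-++⁺ (uf (here refl))
    (unique-concatMap f u (uf ∘ there) (λ m n → disj (there m) (there n)))
    (λ z∈ z∈′ → let y , y∈ , z∈y = ∈-concatMap z∈′ in
                All.lookup p y∈ (disj (here refl) (there y∈) z∈ z∈y))
  where
  ∈-concatMap : ∀ {ys z} → z ∈ concatMap f ys → ∃ λ y → y ∈ ys × z ∈ f y
  ∈-concatMap {ys} z∈ with ∈-concat⁻′ (map f ys) z∈
  ... | zs , z∈zs , zs∈ with ∈-map⁻ f zs∈
  ...   | y , y∈ , refl = y , y∈ , z∈zs

∈-concatMap⁻′ : ∀ (f : A → List B) {ys z} → z ∈ concatMap f ys → ∃ λ y → y ∈ ys × z ∈ f y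
∈-concatMap⁻′ f {ys} z∈ with ∈-concat⁻′ (map f ys) z∈
... | zs , z∈zs , zs∈ with ∈-map⁻ f zs∈
...   | y , y∈ , refl = y , y∈ , z∈zs

∈-concatMap⁺′ : ∀ (f : A → List B) {ys y z} → y ∈ ys → z ∈ f y → z ∈ concatMap f ys
∈-concatMap⁺′ f y∈ z∈ = ∈-concat⁺′ z∈ (∈-map⁺ f y∈)

inserts : A → List A → List (List A)
inserts x []       = [ x ] ∷ []
inserts x (y ∷ ys) = (x ∷ y ∷ ys) ∷ map (y ∷_) (inserts x ys)

perms : List A → List (List A)
perms []       = [] ∷ []
perms (x ∷ xs) = concatMap (inserts x) (perms xs)

∈-inserts⁺ : ∀ {x : A} as {bs} → as ++ x ∷ bs ∈ inserts x (as ++ bs)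
∈-inserts⁺ []       {[]}     = here refl
∈-inserts⁺ []       {b ∷ bs} = here refl
∈-inserts⁺ (a ∷ as)          = there (∈-map⁺ (a ∷_) (∈-inserts⁺ as))

∈-inserts⁻ : ∀ {x : A} {ys zs} → zs ∈ inserts x ys → ∃₂ λ as bs → ys ≡ as ++ bs × zs ≡ as ++ x ∷ bs
∈-inserts⁻ {ys = []}     (here refl) = [] , [] , refl , refl
∈-inserts⁻ {ys = y ∷ ys} (here refl) = [] , y ∷ ys , refl , refl
∈-inserts⁻ {ys = y ∷ ys} (there m) with ∈-map⁻ (y ∷_) m
... | zs , m′ , refl with ∈-inserts⁻ m′
...   | as , bs , refl , refl = y ∷ as , bs , refl , refl

∈-perms⁻ : ∀ {xs zs : List A} → zs ∈ perms xs → zs ↭ xs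
∈-perms⁻ {xs = []}     (here refl) = ↭-refl
∈-perms⁻ {xs = x ∷ xs} m with ∈-concatMap⁻′ (inserts x) m
... | ys , y∈ , m′ with ∈-inserts⁻ m′
...   | as , bs , refl , refl = ↭-trans (↭ₚ.shift x as bs) (↭.prep x (∈-perms⁻ y∈))

∈-perms⁺ : ∀ (xs : List A) {zs} → zs ↭ xs → zs ∈ perms xs
∈-perms⁺ []    p with ↭ₚ.↭-empty-inv p
... | refl = here refl
∈-perms⁺ (x ∷ xs) p with ∈-∃++ (∈-resp-↭ (↭-sym p) (here refl))
... | as , bs , refl = ∈-concatMap⁺′ (inserts x) (∈-perms⁺ xs (↭ₚ.drop-mid as [] p)) (∈-inserts⁺ as)

perms-unique : ∀ {xs : List A} → Unique xs → Unique (perms xs)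
perms-unique {xs = []}     u = [] ∷ []
perms-unique {A} {x ∷ xs} u@(_ ∷ u′) =
  unique-concatMap (inserts x) (perms-unique u′)
    (λ m → inserts-unique (unique-∷⁻ u ∘ ∈-resp-↭ (∈-perms⁻ m)))
    (λ {ys} {zs} m n → disj (unique-resp-↭ (↭-sym (∈-perms⁻ m)) u′) (unique-∷⁻ u ∘ ∈-resp-↭ (∈-perms⁻ m)))
  where
  inserts-unique : ∀ {ys} → x ∉ ys → Unique (inserts x ys)
  inserts-unique {[]}     n = [] ∷ []
  inserts-unique {y ∷ ys} n =
    unique-∷⁺ (λ m → let zs , _ , e = ∈-map⁻ (y ∷_) m in n (here (Listₚ.∷-injectiveˡ e)))
      (Uniqueₚ.map⁺ Listₚ.∷-injectiveʳ (inserts-unique (n ∘ there)))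
  disj : ∀ {ys zs : List A} {w} → Unique ys → x ∉ ys → w ∈ inserts x ys → w ∈ inserts x zs → ys ≡ zs
  disj uy n m m′ with ∈-inserts⁻ m | ∈-inserts⁻ m′
  ... | as , bs , refl , refl | cs , ds , refl , e
    with ++-∷-injective as cs (unique-resp-↭ (↭-sym (↭ₚ.shift x as bs)) (unique-∷⁺ n uy)) e
  ... | refl , refl = refl

module Segments {N : ℕ} (as bs cs ds : List (Fin N)) (x p q : Fin N)
                (un : Unique (cut₁ as bs cs ds x p q)) where
  private
    W : List (Fin N)
    W = cut₁ as bs cs ds x p q
    e₂ : W ≡ (as ++ x ∷ bs) ++ p ∷ cs ++ q ∷ ds
    e₂ = sym (Listₚ.++-assoc as (x ∷ bs) _)
    e₃ : W ≡ (as ++ x ∷ bs ++ p ∷ cs) ++ q ∷ ds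
    e₃ = sym (trans (Listₚ.++-assoc as _ _) (cong (λ z → as ++ x ∷ z) (Listₚ.++-assoc bs (p ∷ cs) _)))
    x∉ : x ∉ as
    x∉ m = proj₂ (proj₂ (unique-++⁻ as un)) m (here refl)
    p∉ : p ∉ as ++ x ∷ bs
    p∉ m = proj₂ (proj₂ (unique-++⁻ (as ++ x ∷ bs) (subst Unique e₂ un))) m (here refl)
    q∉ : q ∉ as ++ x ∷ bs ++ p ∷ cs
    q∉ m = proj₂ (proj₂ (unique-++⁻ (as ++ x ∷ bs ++ p ∷ cs) (subst Unique e₃ un))) m (here refl)

    split₂ : ∀ {y} → y ∈ (as ++ x ∷ bs) ∷ʳ p → y ∈ as ∷ʳ x ⊎ y ∈ bs ∷ʳ p
    split₂ {y} m = ∈-++⁻ (as ∷ʳ x) (subst (y ∈_) (trans (Listₚ.++-assoc as (x ∷ bs) [ p ]) (sym (Listₚ.++-assoc as [ x ] (bs ∷ʳ p)))) m)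
    unsplit₂ : ∀ {y} → y ∈ as ∷ʳ x ⊎ y ∈ bs ∷ʳ p → y ∈ (as ++ x ∷ bs) ∷ʳ p
    unsplit₂ {y} (inj₁ m) = subst (y ∈_) (trans (Listₚ.++-assoc as [ x ] (bs ∷ʳ p)) (sym (Listₚ.++-assoc as (x ∷ bs) [ p ]))) (∈-++⁺ˡ m)
    unsplit₂ {y} (inj₂ m) = subst (y ∈_) (trans (Listₚ.++-assoc as [ x ] (bs ∷ʳ p)) (sym (Listₚ.++-assoc as (x ∷ bs) [ p ]))) (∈-++⁺ʳ (as ∷ʳ x) m)
    pre₃ : (as ++ x ∷ bs ++ p ∷ cs) ∷ʳ q ≡ ((as ++ x ∷ bs) ∷ʳ p) ++ cs ∷ʳ q
    pre₃ = trans (Listₚ.++-assoc as _ [ q ]) (trans (cong (λ z → as ++ x ∷ z) (Listₚ.++-assoc bs _ [ q ]))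
      (sym (trans (Listₚ.++-assoc (as ++ x ∷ bs) [ p ] (cs ∷ʳ q)) (Listₚ.++-assoc as (x ∷ bs) _))))

  Seg₁ Seg₂ Seg₃ : Fin N → Set
  Seg₁ y = y ∈ as ∷ʳ x
  Seg₂ y = y ∈ bs ∷ʳ p
  Seg₃ y = y ∈ cs ∷ʳ q

  ≤x⇒ : ∀ {y} → idx W y ≤ idx W x → Seg₁ y
  ≤x⇒ = idx-≤⇒∈ as
  ⇒≤x : ∀ {y} → Seg₁ y → idx W y ≤ idx W x
  ⇒≤x = idx-∈⇒≤ as x∉
  ≤p⇒ : ∀ {y} → idx W y ≤ idx W p → Seg₁ y ⊎ Seg₂ y
  ≤p⇒ {y} le = split₂ (idx-≤⇒∈ (as ++ x ∷ bs) (subst (λ z → idx z y ≤ idx z p) e₂ le))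
  ⇒≤p : ∀ {y} → Seg₁ y ⊎ Seg₂ y → idx W y ≤ idx W p
  ⇒≤p {y} s = subst (λ z → idx z y ≤ idx z p) (sym e₂) (idx-∈⇒≤ (as ++ x ∷ bs) p∉ (unsplit₂ s))
  ≤q⇒ : ∀ {y} → idx W y ≤ idx W q → Seg₁ y ⊎ Seg₂ y ⊎ Seg₃ y
  ≤q⇒ {y} le with ∈-++⁻ ((as ++ x ∷ bs) ∷ʳ p) (subst (y ∈_) pre₃
                    (idx-≤⇒∈ (as ++ x ∷ bs ++ p ∷ cs) (subst (λ z → idx z y ≤ idx z q) e₃ le)))
  ... | inj₂ m = inj₂ (inj₂ m)
  ... | inj₁ m with split₂ m
  ...   | inj₁ s = inj₁ s
  ...   | inj₂ s = inj₂ (inj₁ s)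
  ⇒≤q : ∀ {y} → Seg₁ y ⊎ Seg₂ y ⊎ Seg₃ y → idx W y ≤ idx W q
  ⇒≤q {y} s = subst (λ z → idx z y ≤ idx z q) (sym e₃)
    (idx-∈⇒≤ (as ++ x ∷ bs ++ p ∷ cs) q∉ (subst (y ∈_) (sym pre₃) (j s)))
    where
    j : Seg₁ y ⊎ Seg₂ y ⊎ Seg₃ y → y ∈ ((as ++ x ∷ bs) ∷ʳ p) ++ cs ∷ʳ q
    j (inj₁ s)        = ∈-++⁺ˡ (unsplit₂ (inj₁ s))
    j (inj₂ (inj₁ s)) = ∈-++⁺ˡ (unsplit₂ (inj₂ s))
    j (inj₂ (inj₂ s)) = ∈-++⁺ʳ ((as ++ x ∷ bs) ∷ʳ p) s
  <p : ∀ {y} → Seg₁ y → idx W y < idx W p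
  <p {y} s = subst (λ z → idx z y < idx z p) (sym e₂) (idx-∈⇒< (as ++ x ∷ bs) p∉ (j s))
    where
    j : ∀ {y} → Seg₁ y → y ∈ as ++ x ∷ bs
    j s with ∈-∷ʳ⁻ as s
    ... | inj₁ m    = ∈-++⁺ˡ m
    ... | inj₂ refl = ∈-++⁺ʳ as (here refl)
  <p′ : ∀ {y} → y ∈ bs → idx W y < idx W p
  <p′ {y} m = subst (λ z → idx z y < idx z p) (sym e₂) (idx-∈⇒< (as ++ x ∷ bs) p∉ (∈-++⁺ʳ as (there m)))
  p<q : idx W p < idx W q
  p<q = subst (λ z → idx z p < idx z q) (sym e₃)
    (idx-∈⇒< (as ++ x ∷ bs ++ p ∷ cs) q∉ (∈-++⁺ʳ as (there (∈-++⁺ʳ bs (here refl)))))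
  x<p : idx W x < idx W p
  x<p = <p (∈-++⁺ʳ as (here refl))

  p<⇐ : ∀ {y} → Seg₃ y → idx W p < idx W y
  p<⇐ {y} m = subst (λ z → idx z p < idx z y) (sym e₂′)
    (idx-before ((as ++ x ∷ bs) ∷ʳ p) (∈-++⁺ʳ (as ++ x ∷ bs) (here refl))
      (λ n → proj₂ (proj₂ (unique-++⁻ ((as ++ x ∷ bs) ∷ʳ p) (subst Unique e₂′ un))) n
        (subst (y ∈_) (Listₚ.++-assoc cs [ q ] ds) (∈-++⁺ˡ m))))
    where
    e₂′ : W ≡ ((as ++ x ∷ bs) ∷ʳ p) ++ cs ++ q ∷ ds
    e₂′ = trans e₂ (sym (Listₚ.++-assoc (as ++ x ∷ bs) [ p ] _))

  prefix : List (Fin N)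
  prefix = (as ++ x ∷ bs ++ p ∷ cs) ∷ʳ q
  prefix-++ : prefix ++ ds ≡ W
  prefix-++ = trans (Listₚ.++-assoc (as ++ x ∷ bs ++ p ∷ cs) [ q ] ds) (sym e₃)
  tail-∉ : ∀ {y} → y ∈ ds → y ∉ prefix
  tail-∉ m n = proj₂ (proj₂ (unique-++⁻ prefix (subst Unique (sym prefix-++) un))) n m
  q<⇒ : ∀ {y} → y ∈ W → idx W q < idx W y → y ∈ ds
  q<⇒ {y} m lt with ∈-++⁻ prefix (subst (y ∈_) (sym prefix-++) m)
  ... | inj₂ d = d
  ... | inj₁ n = contradiction (subst (λ z → idx z y ≤ idx z q) (sym e₃) (idx-∈⇒≤ (as ++ x ∷ bs ++ p ∷ cs) q∉ n)) (ℕₚ.<⇒≱ lt)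
  ⇒q< : ∀ {y} → y ∈ ds → idx W q < idx W y
  ⇒q< {y} d = subst (λ z → idx z q < idx z y) prefix-++
    (idx-before prefix (∈-++⁺ʳ (as ++ x ∷ bs ++ p ∷ cs) (here refl)) (tail-∉ d))
  idx-tail : ∀ {y} → y ∈ ds → idx W y ≡ length prefix + idx ds y
  idx-tail {y} d = trans (cong (λ z → idx z y) (sym prefix-++)) (idx-++-∉ prefix (tail-∉ d))
  idx-∉tail : ∀ {y l} → y ∈ W → y ∉ ds → l ∈ ds → idx W y < idx W l
  idx-∉tail {y} {l} m n d with ∈-++⁻ prefix (subst (y ∈_) (sym prefix-++) m)
  ... | inj₂ m′ = contradiction m′ n
  ... | inj₁ m′ = subst (λ z → idx z y < idx z l) prefix-++ (idx-before prefix m′ (tail-∉ d))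

idx-tail-cut : ∀ {N} (as bs cs ds : List (Fin N)) {x p q} → Unique (cut₁ as bs cs ds x p q) →
               Unique (cut₂ as bs cs ds x p q) → ∀ {y} → y ∈ ds →
               idx (cut₁ as bs cs ds x p q) y ≡ idx (cut₂ as bs cs ds x p q) y
idx-tail-cut as bs cs ds {x} {p} {q} u u′ {y} d =
  trans (S.idx-tail d) (trans (cong (_+ idx ds y) same-length) (sym (S′.idx-tail d)))
  where
  module S  = Segments as bs cs ds x p q u
  module S′ = Segments as cs bs ds x q p u′
  same-length : length S.prefix ≡ length S′.prefix
  same-length = ℕₚ.+-cancelʳ-≡ (length ds) _ _
    (trans (sym (Listₚ.length-++ S.prefix)) (trans (cong length S.prefix-++)
    (trans (↭ₚ.↭-length (Cut.W↭W′ as bs cs ds x p q u))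
    (trans (cong length (sym S′.prefix-++)) (Listₚ.length-++ S′.prefix)))))

record Full {N : ℕ} (W : List (Fin N)) : Set where
  constructor full
  field
    unique   : Unique W
    complete : ∀ y → y ∈ W
open Full public

full-↭ : ∀ {N} {W W′ : List (Fin N)} → W ↭ W′ → Full W → Full W′
full-↭ p (full u c) = full (unique-resp-↭ p u) (∈-resp-↭ p ∘ c)

next-injective : ∀ {N} {W : List (Fin N)} → Full W → ∀ {x y} → next W x ≡ next W y → x ≡ y
next-injective {W = W} (full u c) = surjective⇒injective surj
  where
  surj : ∀ y → ∃ λ x → next W x ≡ y
  surj y with next-cycle (c y) u
  ... | cycle _ p = let x , _ , e = walk-preimage p (c y) in x , e

-- For a matching α of the half-edges, the word W read along the unique face determines the map
-- whose rotation is σ W, because the face permutation is α ∘ σ and α is an involution.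
module Maps {N : ℕ} (α : Fin N → Fin N) (α-inj : ∀ {x y} → α x ≡ α y → x ≡ y) where

  σ : List (Fin N) → Fin N → Fin N
  σ W y = α (next W y)

  C : List (Fin N) → Fin N → List (Fin N)
  C W = cyc (σ W)

  σ-injective : ∀ {W} → Full W → ∀ {x y} → σ W x ≡ σ W y → x ≡ y
  σ-injective F e = next-injective F (α-inj e)

  module OneMap {W : List (Fin N)} (F : Full W) where
    C-unique : ∀ b → Unique (C W b)
    C-unique = cyc-unique (σ-injective F)
    C-Cycle : ∀ b → Cycle (σ W) (C W b)
    C-Cycle = cyc-Cycle (σ-injective F)
    C-walk : ∀ b → Walk (σ W) b (C W b) b
    C-walk b = proj₁ (cyc-cycle (σ-injective F) b)
    ∈C : ∀ b → b ∈ C W b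
    ∈C = end∈cyc (σ-injective F)
    C-sym↭ : ∀ {x y} → x ∈ C W y → C W y ↭ C W x
    C-sym↭ = cyc-sym (σ-injective F)
    C-sym : ∀ {x y} → x ∈ C W y → y ∈ C W x
    C-sym = ∈cyc-sym (σ-injective F)
    C-trans : ∀ {x y z} → x ∈ C W y → y ∈ C W z → x ∈ C W z
    C-trans m n = ∈-resp-↭ (↭-sym (C-sym↭ n)) m

  module GlueCycles (as bs cs ds : List (Fin N)) (x p q : Fin N)
                    (F : Full (cut₁ as bs cs ds x p q)) where
    open Cut as bs cs ds x p q (unique F) public
    F′ : Full W′
    F′ = full-↭ W↭W′ F
    open OneMap F public
    open OneMap F′ public using () renaming
      (C-unique to C′-unique; C-Cycle to C′-Cycle; C-walk to C′-walk; ∈C to ∈C′; C-sym to C′-sym; C-sym↭ to C′-sym↭; C-trans to C′-trans)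

    abstract
     σ-x : σ W′ x ≡ σ W p
     σ-x = cong α next-x
     σ-p : σ W′ p ≡ σ W q
     σ-p = cong α next-p
     σ-q : σ W′ q ≡ σ W x
     σ-q = cong α next-q
     σ-other : ∀ {y} → y ≢ x → y ≢ p → y ≢ q → σ W′ y ≡ σ W y
     σ-other n₁ n₂ n₃ = cong α (next-other (complete F _) n₁ n₂ n₃)

     C-other : ∀ {l} → x ∉ C W l → p ∉ C W l → q ∉ C W l → C W′ l ≡ C W l
     C-other {l} nx np nq = cyc-walk
       (reroute _ (λ m → avoid (∈-++⁺ˡ m)) (avoid (∈C l)) (C-walk l)) (C-unique l)
       where
       avoid : ∀ {y} → y ∈ C W l → σ W′ y ≡ σ W y
       avoid m = σ-other (λ { refl → nx m }) (λ { refl → np m }) (λ { refl → nq m })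

     C′-other : ∀ {l} → x ∉ C W′ l → p ∉ C W′ l → q ∉ C W′ l → C W′ l ≡ C W l
     C′-other {l} nx np nq = sym (cyc-walk
       (reroute _ (λ m → sym (avoid (∈-++⁺ˡ m))) (sym (avoid (∈C′ l))) (C′-walk l)) (C′-unique l))
       where
       avoid : ∀ {y} → y ∈ C W′ l → σ W′ y ≡ σ W y
       avoid m = σ-other (λ { refl → nx m }) (λ { refl → np m }) (λ { refl → nq m })

     Cycle-other : ∀ {w} → x ∉ w → p ∉ w → q ∉ w → Cycle (σ W) w → Cycle (σ W′) w
     Cycle-other nx np nq = cycle-local
       (λ m → σ-other (λ { refl → nx m }) (λ { refl → np m }) (λ { refl → nq m }))

     C-merge : p ∉ C W x → q ∉ C W x → q ∉ C W p → C W′ q ≡ C W x ++ C W p ++ C W q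
     C-merge np nq nq′ = trans
       (cyc-walk (subst (λ z → Walk (σ W′) q z q) regroup whole) (subst Unique regroup disjoint)) (sym regroup)
       where
       regroup : C W x ++ C W p ++ C W q ≡ (C W x ++ C W p ++ inner (σ W) q) ∷ʳ q
       regroup = sym (trans (Listₚ.++-assoc (C W x) _ [ q ]) (cong (C W x ++_) (Listₚ.++-assoc (C W p) (inner (σ W) q) [ q ])))
       whole : Walk (σ W′) q (C W x ++ C W p ++ C W q) q
       whole = walk-++
         (reroute (inner (σ W) x) (λ m → σ-other (λ { refl → ∷ʳ-unique (C-unique x) m }) (λ { refl → np (∈-++⁺ˡ m) }) (λ { refl → nq (∈-++⁺ˡ m) }))
           σ-q (C-walk x))
         (walk-++
           (reroute (inner (σ W) p) (λ m → σ-other (λ { refl → np (C-sym (∈-++⁺ˡ m)) }) (λ { refl → ∷ʳ-unique (C-unique p) m }) (λ { refl → nq′ (∈-++⁺ˡ m) }))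
             σ-x (C-walk p))
           (reroute (inner (σ W) q) (λ m → σ-other (λ { refl → nq (C-sym (∈-++⁺ˡ m)) }) (λ { refl → nq′ (C-sym (∈-++⁺ˡ m)) }) (λ { refl → ∷ʳ-unique (C-unique q) m }))
             σ-p (C-walk q)))
       disjoint : Unique (C W x ++ C W p ++ C W q)
       disjoint = unique-++⁺ (C-unique x)
         (unique-++⁺ (C-unique p) (C-unique q) (λ m n → nq′ (C-trans (C-sym n) m)))
         (λ m n → [ (λ k → np (C-trans (C-sym k) m)) , (λ k → nq (C-trans (C-sym k) m)) ]′ (∈-++⁻ (C W p) n))

    module _ {u₁ u₂ u₃} (eq : C W′ q ≡ u₁ ++ x ∷ u₂ ++ p ∷ u₃ ∷ʳ q) where
      private
        walk′ : Walk (σ W′) q (u₁ ++ x ∷ u₂ ++ p ∷ u₃ ∷ʳ q) q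
        walk′ = subst (λ z → Walk (σ W′) q z q) eq (C′-walk q)
        un′ : Unique (u₁ ++ x ∷ u₂ ++ p ∷ u₃ ∷ʳ q)
        un′ = subst Unique eq (C′-unique q)
        w₁ = walk-splitAt u₁ walk′
        w₂ = walk-splitAt u₂ (proj₂ w₁)
        fa = unique-++⁻ u₁ un′
        fb = unique-++⁻ (u₁ ∷ʳ x) (subst Unique (sym (Listₚ.++-assoc u₁ [ x ] _)) un′)
        fc = unique-++⁻ (u₂ ∷ʳ p) (subst Unique (sym (Listₚ.++-assoc u₂ [ p ] _)) (proj₁ (proj₂ fb)))
        fd = unique-++⁻ u₂ (proj₁ (proj₂ fb))
        x∈ = ∈-++⁺ʳ u₁ {ys = [ x ]} (here refl)
        p∈ = ∈-++⁺ʳ u₂ {ys = [ p ]} (here refl)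
        p∈′ = ∈-++⁺ʳ u₂ {ys = p ∷ u₃ ∷ʳ q} (here refl)
        q∈′ = ∈-++⁺ʳ u₂ {ys = p ∷ u₃ ∷ʳ q} (there (∈-++⁺ʳ u₃ (here refl)))

      abstract
       C-split-x : C W x ≡ u₁ ∷ʳ x
       C-split-x = cyc-walk
         (reroute u₁ (λ m → sym (σ-other (λ { refl → proj₂ (proj₂ fa) m (here refl) }) (λ { refl → proj₂ (proj₂ fa) m (there p∈′) })
           (λ { refl → proj₂ (proj₂ fa) m (there q∈′) }))) (sym σ-q) (proj₁ w₁)) (proj₁ fb)
       C-split-p : C W p ≡ u₂ ∷ʳ p
       C-split-p = cyc-walk
         (reroute u₂ (λ m → sym (σ-other (λ { refl → proj₂ (proj₂ fb) x∈ (∈-++⁺ˡ m) }) (λ { refl → proj₂ (proj₂ fd) m (here refl) })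
           (λ { refl → proj₂ (proj₂ fd) m (there (∈-++⁺ʳ u₃ (here refl))) }))) (sym σ-x) (proj₁ w₂)) (proj₁ fc)
       C-split-q : C W q ≡ u₃ ∷ʳ q
       C-split-q = cyc-walk
         (reroute u₃ (λ m → sym (σ-other (λ { refl → proj₂ (proj₂ fb) x∈ (∈-++⁺ʳ u₂ (there (∈-++⁺ˡ m))) })
           (λ { refl → proj₂ (proj₂ fc) p∈ (∈-++⁺ˡ m) })
           (λ { refl → ∷ʳ-unique (proj₁ (proj₂ fc)) m }))) (sym σ-p) (proj₂ w₂)) (proj₁ (proj₂ fc))

allPairs-map : ∀ {A : Set} {P : A → Set} {R S : A → A → Set} → (∀ {a b} → P a → P b → R a b → S a b) →
               ∀ {xs} → All P xs → AllPairs R xs → AllPairs S xs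
allPairs-map f []       []       = []
allPairs-map f (p ∷ ps) (r ∷ rs) = All.zipWith (λ (pb , rb) → f p pb rb) (ps , r) ∷ allPairs-map f ps rs

decompose : ∀ {N} {W : List (Fin N)} {x q p} → Full W → idx W x < idx W q → idx W q < idx W p →
            ∃₂ λ as cs → ∃₂ λ bs ds → W ≡ cut₁ as cs bs ds x q p
decompose {W = W} {x} {q} {p} F xq qp with ∈-∃++ (complete F p)
... | X , ds , refl with ∈-∷ʳ⁻ X (idx-≤⇒∈ X (ℕₚ.<⇒≤ qp))
...   | inj₂ refl = contradiction qp (ℕₚ.<-irrefl refl)
...   | inj₁ q∈ with ∈-∃++ q∈
...     | Y , bs , refl with ∈-∷ʳ⁻ Y (idx-≤⇒∈ Y {Y = bs ++ p ∷ ds}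
                           (subst (λ z → idx z x ≤ idx z q) (Listₚ.++-assoc Y (q ∷ bs) (p ∷ ds)) (ℕₚ.<⇒≤ xq)))
...       | inj₂ refl = contradiction xq (ℕₚ.<-irrefl refl)
...       | inj₁ x∈ with ∈-∃++ x∈
...         | as , cs , refl = as , cs , bs , ds ,
  trans (Listₚ.++-assoc (as ++ x ∷ cs) (q ∷ bs) (p ∷ ds)) (Listₚ.++-assoc as (x ∷ cs) (q ∷ bs ++ p ∷ ds))

record Step {N : ℕ} (W : List (Fin N)) (x p q : Fin N) (W′ : List (Fin N)) : Set where
  constructor mkStep
  field
    {as bs cs ds} : List (Fin N)
    source : W ≡ cut₁ as bs cs ds x p q
    target : W′ ≡ cut₂ as bs cs ds x p q

step-functional : ∀ {N} {W W′ W″ : List (Fin N)} {x p q} → Unique W → Step W x p q W′ → Step W x p q W″ → W′ ≡ W″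
step-functional u (mkStep {as} {bs} {cs} refl refl) (mkStep {as′} {bs′} {cs′} e refl)
  with ++-∷-injective as as′ u e
... | refl , e₁ with ++-∷-injective bs bs′ (AllPairs.tail (proj₁ (proj₂ (unique-++⁻ as u)))) e₁
...   | refl , e₂ with ++-∷-injective cs cs′
                       (AllPairs.tail (proj₁ (proj₂ (unique-++⁻ bs (AllPairs.tail (proj₁ (proj₂ (unique-++⁻ as u)))))))) e₂
...     | refl , refl = refl

step-sym : ∀ {N} {W W′ : List (Fin N)} {x p q} → Step W x p q W′ → Step W′ x q p W
step-sym (mkStep s t) = mkStep t s

step-head : ∀ {N} {W W′ w : List (Fin N)} {x p q h} → Step W x p q W′ → W ≡ h ∷ w → ∃ λ w′ → W′ ≡ h ∷ w′
step-head (mkStep {[]}     refl refl) refl = _ , refl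
step-head (mkStep {a ∷ as} refl refl) refl = _ , refl

step-↭ : ∀ {N} {W W′ : List (Fin N)} {x p q} → Full W → Step W x p q W′ → W ↭ W′
step-↭ {x = x} {p} {q} F (mkStep {as} {bs} {cs} {ds} refl refl) = Cut.W↭W′ as bs cs ds x p q (unique F)

module Gluing {N : ℕ} (α : Fin N → Fin N) (α-inj : ∀ {x y} → α x ≡ α y → x ≡ y) where
  open Maps α α-inj public

  Down : List (Fin N) → Fin N → Set
  Down W x = idx W (σ W x) ≤ idx W x

  Top : List (Fin N) → Fin N → Set
  Top W l = All (λ y → idx W y ≤ idx W l) (C W l)

  Above : List (Fin N) → Fin N → Fin N → Set
  Above W x l = All (λ y → idx W y < idx W l) (C W x)

  Increasing : List (Fin N) → List (Fin N) → Set
  Increasing W = AllPairs (λ a b → idx W a < idx W b)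

  Valid : List (Fin N) → Fin N → List (Fin N) → Set
  Valid W x L = Down W x × All (Top W) L × All (Above W x) L × Increasing W L

  abstract
   Top? : ∀ W l → Dec (Top W l)
   Top? W l = All.all? (λ y → idx W y ℕ.≤? idx W l) (C W l)

   Valid? : ∀ W x L → Dec (Valid W x L)
   Valid? W x L = (idx W (σ W x) ℕ.≤? idx W x) ×-dec All.all? (Top? W) L
     ×-dec All.all? (λ l → All.all? (λ y → idx W y ℕ.<? idx W l) (C W x)) L
     ×-dec AllPairs.allPairs? (λ a b → idx W a ℕ.<? idx W b) L

  module Forward (as bs cs ds : List (Fin N)) (x p q : Fin N) (L : List (Fin N))
                 (F : Full (cut₁ as bs cs ds x p q)) (v : Valid (cut₁ as bs cs ds x p q) x (p ∷ q ∷ L)) where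
    open GlueCycles as bs cs ds x p q F public
    module S  = Segments as bs cs ds x p q (unique F)
    module S′ = Segments as cs bs ds x q p (unique F′)

    private
      down : Down W x
      down = proj₁ v
      top-p : Top W p
      top-p = All.head (proj₁ (proj₂ v))
      top-q : Top W q
      top-q = All.head (All.tail (proj₁ (proj₂ v)))
      tops : All (Top W) L
      tops = All.tail (All.tail (proj₁ (proj₂ v)))
      above-p : Above W x p
      above-p = All.head (proj₁ (proj₂ (proj₂ v)))
      above-q : Above W x q
      above-q = All.head (All.tail (proj₁ (proj₂ (proj₂ v))))
      aboves : All (Above W x) L
      aboves = All.tail (All.tail (proj₁ (proj₂ (proj₂ v))))
      incr : Increasing W (p ∷ q ∷ L)
      incr = proj₂ (proj₂ (proj₂ v))
      q<L : All (λ l → idx W q < idx W l) L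
      q<L = AllPairs.head (AllPairs.tail incr)
      p<q : idx W p < idx W q
      p<q = All.head (AllPairs.head incr)

    arc : List (Fin N)
    arc = C W x ++ inner (σ W) p

    abstract
     p∉Cx : p ∉ C W x
     p∉Cx m = ℕₚ.<-irrefl refl (All.lookup above-p m)
     q∉Cx : q ∉ C W x
     q∉Cx m = ℕₚ.<-irrefl refl (All.lookup above-q m)
     q∉Cp : q ∉ C W p
     q∉Cp m = ℕₚ.<⇒≱ p<q (All.lookup top-p m)

     merge : C W′ q ≡ C W x ++ C W p ++ C W q
     merge = C-merge p∉Cx q∉Cx q∉Cp

     p∈C′ : p ∈ C W′ q
     p∈C′ = subst (p ∈_) (sym merge) (∈-++⁺ʳ (C W x) (∈-++⁺ˡ (∈C p)))

     below-q : ∀ {y} → y ∈ C W′ q → idx W y ≤ idx W q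
     below-q {y} m =
       [ (λ n → ℕₚ.<⇒≤ (All.lookup above-q n))
       , (λ n → [ (λ k → ℕₚ.<⇒≤ (ℕₚ.≤-<-trans (All.lookup top-p k) p<q)) , All.lookup top-q ]′ (∈-++⁻ (C W p) n)) ]′
       (∈-++⁻ (C W x) (subst (y ∈_) merge m))

     p-max : ∀ {y} → y ∈ C W′ q → idx W′ y ≤ idx W′ p
     p-max m = [ (λ s → S′.⇒≤q (inj₁ s)) , [ (λ s → S′.⇒≤q (inj₂ (inj₂ s))) , (λ s → S′.⇒≤q (inj₂ (inj₁ s))) ]′ ]′
       (S.≤q⇒ (below-q m))

     tail-of : ∀ {l} → l ∈ L → l ∈ ds
     tail-of m = S.q<⇒ (complete F _) (All.lookup q<L m)

     avoid-x : ∀ {l} → l ∈ L → x ∉ C W l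
     avoid-x m n = ℕₚ.<-irrefl refl (All.lookup (All.lookup aboves m) (C-sym n))
     avoid-p : ∀ {l} → l ∈ L → p ∉ C W l
     avoid-p m n = ℕₚ.<⇒≱ (ℕₚ.<-trans p<q (All.lookup q<L m)) (All.lookup top-p (C-sym n))
     avoid-q : ∀ {l} → l ∈ L → q ∉ C W l
     avoid-q m n = ℕₚ.<⇒≱ (All.lookup q<L m) (All.lookup top-q (C-sym n))

     C-same : ∀ {l} → l ∈ L → C W′ l ≡ C W l
     C-same m = C-other (avoid-x m) (avoid-p m) (avoid-q m)

     same-idx : ∀ {y} → y ∈ ds → idx W y ≡ idx W′ y
     same-idx = idx-tail-cut as bs cs ds (unique F) (unique F′)

     valid′ : Valid W′ q L
     valid′ =
         subst (λ z → idx W′ z ≤ idx W′ q) (sym σ-q) (ℕₚ.<⇒≤ (S′.<p (S.≤x⇒ down)))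
       , All.tabulate (λ {l} m → All.tabulate (λ {y} k → top′ m (subst (y ∈_) (C-same m) k)))
       , All.tabulate (λ m → All.tabulate (λ k → ℕₚ.≤-<-trans (p-max k) (S′.⇒q< (tail-of m))))
       , allPairs-map (λ a b → subst₂ _<_ (same-idx a) (same-idx b)) (All.tabulate tail-of) (AllPairs.tail (AllPairs.tail incr))
       where
       top′ : ∀ {l y} → l ∈ L → y ∈ C W l → idx W′ y ≤ idx W′ l
       top′ {l} {y} m k = by-cases (y ∈? ds)
         where
         by-cases : Dec (y ∈ ds) → idx W′ y ≤ idx W′ l
         by-cases (yes d) = subst₂ _≤_ (same-idx d) (same-idx (tail-of m)) (All.lookup (All.lookup tops m) k)
         by-cases (no n)  = ℕₚ.<⇒≤ (S′.idx-∉tail (complete F′ y) n (tail-of m))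

     ¬top′ : ¬ Top W′ q
     ¬top′ t = ℕₚ.<⇒≱ S′.p<q (All.lookup t p∈C′)

     arc-eq : C W′ q ≡ arc ++ p ∷ C W q
     arc-eq = trans merge (trans (cong (C W x ++_) (Listₚ.++-assoc _ [ p ] (C W q))) (sym (Listₚ.++-assoc (C W x) _ _)))
     x∈arc : x ∈ arc
     x∈arc = ∈-++⁺ˡ (∈C x)
     x<′q : idx W′ x < idx W′ q
     x<′q = S′.x<p
     x-max : ∀ {y} → y ∈ arc → idx W′ y < idx W′ q → idx W′ y ≤ idx W′ x
     x-max {y} m lt = [ S′.⇒≤x , (λ s → contradiction (S′.p<⇐ s) (ℕₚ.<-asym lt)) ]′ (S.≤p⇒ (leq (∈-++⁻ (C W x) m)))
       where
       leq : y ∈ C W x ⊎ y ∈ inner (σ W) p → idx W y ≤ idx W p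
       leq (inj₁ n) = ℕₚ.<⇒≤ (All.lookup above-p n)
       leq (inj₂ n) = All.lookup top-p (∈-++⁺ˡ n)

  step-valid : ∀ {W W′ x p q L} → Full W → Step W x p q W′ → Valid W x (p ∷ q ∷ L) → Valid W′ q L × ¬ Top W′ q
  step-valid F (mkStep refl refl) v = let open Forward _ _ _ _ _ _ _ _ F v in valid′ , ¬top′

  step-exists : ∀ {W x p q L} → Full W → Valid W x (p ∷ q ∷ L) → ∃ λ W′ → Step W x p q W′
  step-exists {W} {x} {p} {q} F (_ , _ , (ap ∷ _) , ((pq ∷ _) ∷ _)) with decompose F (All.lookup ap (OneMap.∈C F x)) pq
  ... | as , bs , cs , ds , refl = _ , mkStep refl refl

  -- In the merged cycle p is the maximum, and x is the maximum below q of the part before p.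
  record Merged (W : List (Fin N)) (x p q : Fin N) : Set where
    field
      arc rest : List (Fin N)
      shape    : C W q ≡ arc ++ p ∷ rest
      p-max    : ∀ {y} → y ∈ C W q → idx W y ≤ idx W p
      x∈arc    : x ∈ arc
      x<q      : idx W x < idx W q
      x-max    : ∀ {y} → y ∈ arc → idx W y < idx W q → idx W y ≤ idx W x

  merged-unique : ∀ {W x x′ p p′ q} → Full W → Merged W x p q → Merged W x′ p′ q → (x , p) ≡ (x′ , p′)
  merged-unique {W} {x} {x′} {p} {p′} {q} F m m′ = conclude
    (idx-injective (complete F p) (complete F p′)
      (ℕₚ.≤-antisym (M′.p-max (subst (p ∈_) (sym M.shape) (∈-++⁺ʳ M.arc (here refl))))
                    (M.p-max (subst (p′ ∈_) (sym M′.shape) (∈-++⁺ʳ M′.arc (here refl))))))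
    where
    module M  = Merged m
    module M′ = Merged m′
    conclude : p ≡ p′ → (x , p) ≡ (x′ , p′)
    conclude refl = cong (_, p) (idx-injective (complete F x) (complete F x′)
      (ℕₚ.≤-antisym (M′.x-max (subst (x ∈_) same M.x∈arc) M.x<q) (M.x-max (subst (x′ ∈_) (sym same) M′.x∈arc) M′.x<q)))
      where
      same : M.arc ≡ M′.arc
      same = proj₁ (++-∷-injective M.arc M′.arc (subst Unique M.shape (OneMap.C-unique F q)) (trans (sym M.shape) M′.shape))

  step-merged : ∀ {W W′ x p q L} → Full W → Valid W x (p ∷ q ∷ L) → Step W x p q W′ → Merged W′ x p q
  step-merged F v (mkStep refl refl) = let open Forward _ _ _ _ _ _ _ _ F v in record
    { shape = arc-eq ; p-max = p-max ; x∈arc = x∈arc ; x<q = x<′q ; x-max = x-max }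

  step-injective : ∀ {W₁ W₂ W′ x₁ x₂ p₁ p₂ q L} → Full W₁ → Full W₂ →
    Valid W₁ x₁ (p₁ ∷ q ∷ L) → Valid W₂ x₂ (p₂ ∷ q ∷ L) →
    Step W₁ x₁ p₁ q W′ → Step W₂ x₂ p₂ q W′ → (W₁ , x₁ , p₁) ≡ (W₂ , x₂ , p₂)
  step-injective F₁ F₂ v₁ v₂ s₁ s₂
    with F′ ← full-↭ (step-↭ F₁ s₁) F₁
    with merged-unique F′ (step-merged F₁ v₁ s₁) (step-merged F₂ v₂ s₂)
  ... | refl with step-functional (unique F′) (step-sym s₁) (step-sym s₂)
  ...   | refl = refl

  module Backward (as bs cs ds : List (Fin N)) (x p q : Fin N) (F : Full (cut₁ as bs cs ds x p q)) where
    open GlueCycles as bs cs ds x p q F public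
    module S  = Segments as bs cs ds x p q (unique F)
    module S′ = Segments as cs bs ds x q p (unique F′)

    abstract
     same-idx : ∀ {y} → y ∈ ds → idx W y ≡ idx W′ y
     same-idx = idx-tail-cut as bs cs ds (unique F) (unique F′)

     module _ {L : List (Fin N)} {u₁ u₂ u₃ : List (Fin N)} (v : Valid W′ q L)
              (shape : C W′ q ≡ u₁ ++ x ∷ u₂ ++ p ∷ u₃ ∷ʳ q)
              (q-down : ∃ λ z → σ W′ q ≡ z × z ∈ u₁ ++ x ∷ u₂ × idx W′ z < idx W′ q)
              (p-max : ∀ {y} → y ∈ C W′ q → idx W′ y ≤ idx W′ p)
              (x-max : ∀ {y} → y ∈ u₁ ++ x ∷ u₂ → idx W′ y < idx W′ q → idx W′ y ≤ idx W′ x) where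

      private
       tops : All (Top W′) L
       tops = proj₁ (proj₂ v)
       aboves : All (Above W′ q) L
       aboves = proj₁ (proj₂ (proj₂ v))
       incr : Increasing W′ L
       incr = proj₂ (proj₂ (proj₂ v))
       arc : List (Fin N)
       arc = u₁ ++ x ∷ u₂
       shape′ : C W′ q ≡ arc ++ p ∷ u₃ ∷ʳ q
       shape′ = trans shape (sym (Listₚ.++-assoc u₁ (x ∷ u₂) _))
       disjoint : ∀ {y} → y ∈ arc → y ∉ p ∷ u₃ ∷ʳ q
       disjoint = proj₂ (proj₂ (unique-++⁻ arc (subst Unique shape′ (C′-unique q))))
       on-cycle : ∀ {y} → y ∈ arc → y ∈ C W′ q
       on-cycle {y} m = subst (y ∈_) (sym shape′) (∈-++⁺ˡ m)
       on-cycle′ : ∀ {y} → y ∈ p ∷ u₃ ∷ʳ q → y ∈ C W′ q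
       on-cycle′ {y} m = subst (y ∈_) (sym shape′) (∈-++⁺ʳ arc m)

       arc<p : ∀ {y} → y ∈ arc → idx W y < idx W p
       arc<p {y} m = [ S.<p , [ low , high ]′ ]′ (S′.≤q⇒ (p-max (on-cycle m)))
         where
         low : y ∈ cs ∷ʳ q → idx W y < idx W p
         low s = S.<p (S′.≤x⇒ (x-max m (ℕₚ.≤∧≢⇒< (S′.⇒≤p (inj₂ s))
           (λ e → disjoint m (subst (_∈ p ∷ u₃ ∷ʳ q) (sym (idx-injective (complete F′ y) (complete F′ q) e))
                    (there (∈-++⁺ʳ u₃ (here refl))))))))
         high : y ∈ bs ∷ʳ p → idx W y < idx W p
         high s = [ S.<p′ , (λ { refl → contradiction (here refl) (disjoint m) }) ]′ (∈-∷ʳ⁻ bs s)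

       below-q : ∀ {y} → y ∈ C W′ q → idx W y ≤ idx W q
       below-q m = S.⇒≤q ([ inj₁ , [ (λ s → inj₂ (inj₂ s)) , (λ s → inj₂ (inj₁ s)) ]′ ]′ (S′.≤q⇒ (p-max m)))

       tail-of : ∀ {l} → l ∈ L → l ∈ ds
       tail-of {l} m = S′.q<⇒ (complete F′ l) (All.lookup (All.lookup aboves m) (on-cycle′ (here refl)))

       avoid : ∀ {l y} → l ∈ L → y ∈ C W′ q → y ∉ C W′ l
       avoid m k n = ℕₚ.<-irrefl refl (All.lookup (All.lookup aboves m) (C′-trans (C′-sym n) k))

       C-same : ∀ {l} → l ∈ L → C W l ≡ C W′ l
       C-same m = sym (C′-other (avoid m (on-cycle (∈-++⁺ʳ u₁ (here refl)))) (avoid m (on-cycle′ (here refl))) (avoid m (∈C′ q)))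

       top : ∀ {l y} → l ∈ L → y ∈ C W′ l → idx W y ≤ idx W l
       top {l} {y} m k = by-cases (y ∈? ds)
         where
         by-cases : Dec (y ∈ ds) → idx W y ≤ idx W l
         by-cases (yes d) = subst₂ _≤_ (sym (same-idx d)) (sym (same-idx (tail-of m))) (All.lookup (All.lookup tops m) k)
         by-cases (no n)  = ℕₚ.<⇒≤ (S.idx-∉tail (complete F y) n (tail-of m))

       ∷ʳ⊆arc : ∀ {y} → y ∈ u₁ ∷ʳ x → y ∈ arc
       ∷ʳ⊆arc m = [ ∈-++⁺ˡ , (λ { refl → ∈-++⁺ʳ u₁ (here refl) }) ]′ (∈-∷ʳ⁻ u₁ m)

       Cx<p : ∀ {y} → y ∈ C W x → idx W y < idx W p
       Cx<p {y} m = arc<p (∷ʳ⊆arc (subst (y ∈_) (C-split-x shape) m))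

      valid : Valid W x (p ∷ q ∷ L)
      valid = down
        , (All.tabulate (λ {y} m → [ (λ k → ℕₚ.<⇒≤ (arc<p (∈-++⁺ʳ u₁ (there k)))) , (λ { refl → ℕₚ.≤-refl }) ]′
             (∈-∷ʳ⁻ u₂ (subst (y ∈_) (C-split-p shape) m)))
          ∷ All.tabulate (λ {y} m → below-q (on-cycle′ (there (subst (y ∈_) (C-split-q shape) m))))
          ∷ All.tabulate (λ {l} m → All.tabulate (λ {y} k → top m (subst (y ∈_) (C-same m) k))))
        , (All.tabulate Cx<p ∷ All.tabulate (λ m → ℕₚ.<-trans (Cx<p m) S.p<q)
          ∷ All.tabulate (λ m → All.tabulate (λ k → ℕₚ.<-trans (Cx<p k) (ℕₚ.<-trans S.p<q (S.⇒q< (tail-of m))))))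
        , ((S.p<q ∷ All.tabulate (λ m → ℕₚ.<-trans S.p<q (S.⇒q< (tail-of m))))
          ∷ All.tabulate (λ m → S.⇒q< (tail-of m))
          ∷ allPairs-map (λ a b → subst₂ _<_ (sym (same-idx a)) (sym (same-idx b))) (All.tabulate tail-of) incr)
        where
        down : idx W (σ W x) ≤ idx W x
        down = let z , e , m , lt = q-down in
          subst (λ y → idx W y ≤ idx W x) (trans (sym e) σ-q) (S.⇒≤x (S′.≤x⇒ (x-max m lt)))

  unstep : ∀ {W′ q L} → Full W′ → Valid W′ q L → ¬ Top W′ q →
           ∃₂ λ x p → ∃ λ W → Step W x p q W′ × Valid W x (p ∷ q ∷ L)
  unstep {W′} {q} {L} F v ¬top
    with argmax (idx W′) (λ _ → ⊤) (λ _ → yes tt) (C W′ q) (OneMap.∈C F q) tt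
  ... | p , p∈ , _ , p-best = found (∈-∷ʳ⁻ (inner (σ W′) q) p∈)
    where
    p-max : ∀ {y} → y ∈ C W′ q → idx W′ y ≤ idx W′ p
    p-max m = p-best m tt
    p≢q : p ≢ q
    p≢q e = ¬top (All.tabulate (λ m → subst (λ z → _ ≤ idx W′ z) e (p-max m)))
    q<p : idx W′ q < idx W′ p
    q<p = ℕₚ.≤∧≢⇒< (p-max (OneMap.∈C F q)) (λ e → p≢q (sym (idx-injective (complete F q) (complete F p) e)))
    Goal : Set
    Goal = ∃₂ λ x p → ∃ λ W → Step W x p q W′ × Valid W x (p ∷ q ∷ L)

    cut-at : ∀ x u₁ u₂ u₃ → idx W′ x < idx W′ q → C W′ q ≡ u₁ ++ x ∷ u₂ ++ p ∷ u₃ ∷ʳ q →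
             (∃ λ z → σ W′ q ≡ z × z ∈ u₁ ++ x ∷ u₂ × idx W′ z < idx W′ q) →
             (∀ {y} → y ∈ u₁ ++ x ∷ u₂ → idx W′ y < idx W′ q → idx W′ y ≤ idx W′ x) → Goal
    cut-at x u₁ u₂ u₃ x<q shape q-down x-max with decompose F x<q q<p
    ... | as , cs , bs , ds , refl =
      x , p , cut₁ as bs cs ds x p q , mkStep refl refl
      , Backward.valid as bs cs ds x p q (full-↭ (Cut.W↭W′ as cs bs ds x q p (unique F)) F) v shape q-down p-max x-max

    open-arc : ∀ arc u₃ → C W′ q ≡ arc ++ p ∷ u₃ ∷ʳ q → Walk (σ W′) q (arc ++ p ∷ u₃ ∷ʳ q) q → Goal
    open-arc [] u₃ shape (step e _) =
      contradiction (subst (λ z → idx W′ z ≤ idx W′ q) e (proj₁ v)) (ℕₚ.<⇒≱ q<p)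
    open-arc (z ∷ arc) u₃ shape (step e w)
      with argmax (idx W′) (λ y → idx W′ y < idx W′ q) (λ y → idx W′ y ℕ.<? idx W′ q) (z ∷ arc) (here refl) z<q
      where
      z≢q : z ≢ q
      z≢q refl = unique-∷⁻ (subst Unique shape (OneMap.C-unique F q)) (∈-++⁺ʳ arc (there (∈-++⁺ʳ u₃ (here refl))))
      z<q : idx W′ z < idx W′ q
      z<q = ℕₚ.≤∧≢⇒< (subst (λ z → idx W′ z ≤ idx W′ q) e (proj₁ v))
              (λ eq → z≢q (idx-injective (complete F z) (complete F q) eq))
    ... | x , x∈ , x<q , x-best with ∈-∃++ x∈
    ...   | u₁ , u₂ , eq = cut-at x u₁ u₂ u₃ x<q
      (trans shape (trans (cong (_++ p ∷ u₃ ∷ʳ q) eq) (Listₚ.++-assoc u₁ (x ∷ u₂) _)))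
      (z , e , subst (z ∈_) eq (here refl) , z<q′)
      (λ {y} m → x-best (subst (y ∈_) (sym eq) m))
      where
      z<q′ : idx W′ z < idx W′ q
      z<q′ = ℕₚ.≤∧≢⇒< (subst (λ z → idx W′ z ≤ idx W′ q) e (proj₁ v))
        (λ k → unique-∷⁻ (subst Unique shape (OneMap.C-unique F q))
          (subst (_∈ arc ++ p ∷ u₃ ∷ʳ q) (sym (idx-injective (complete F z) (complete F q) k)) (∈-++⁺ʳ arc (there (∈-++⁺ʳ u₃ (here refl))))))

    found : p ∈ inner (σ W′) q ⊎ p ≡ q → Goal
    found (inj₂ e) = contradiction e p≢q
    found (inj₁ m) with ∈-∃++ m
    ... | arc , u₃ , eq = open-arc arc u₃ shape (subst (λ z → Walk (σ W′) q z q) shape (OneMap.C-walk F q))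
      where
      shape : C W′ q ≡ arc ++ p ∷ u₃ ∷ʳ q
      shape = trans (cong (_∷ʳ q) eq) (Listₚ.++-assoc arc (p ∷ u₃) [ q ])

-- Multisets up to a setoid

splits : ℕ → List A → List (List A × List A)
splits zero    xs       = ([] , xs) ∷ []
splits (suc k) []       = []
splits (suc k) (x ∷ xs) =
  map (λ (S , R) → x ∷ S , R) (splits k xs) ++ map (λ (S , R) → S , x ∷ R) (splits (suc k) xs)

splits-map : ∀ (f : A → B) k xs → splits k (map f xs) ≡ map (λ (S , R) → map f S , map f R) (splits k xs)
splits-map f zero    xs       = refl
splits-map f (suc k) []       = refl
splits-map f (suc k) (x ∷ xs) = sym (trans (Listₚ.map-++ _ (map _ (splits k xs)) _) (cong₂ _++_
  (trans (sym (Listₚ.map-∘ (splits k xs))) (trans (Listₚ.map-∘ (splits k xs)) (cong (map _) (sym (splits-map f k xs)))))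
  (trans (sym (Listₚ.map-∘ (splits (suc k) xs))) (trans (Listₚ.map-∘ (splits (suc k) xs)) (cong (map _) (sym (splits-map f (suc k) xs)))))))

∈-splits⁻ : ∀ k (xs : List A) {S R} → (S , R) ∈ splits k xs → length S ≡ k × S ++ R ↭ xs
∈-splits⁻ zero    xs (here refl) = refl , ↭-refl
∈-splits⁻ (suc k) (x ∷ xs) m with ∈-++⁻ (map _ (splits k xs)) m
... | inj₁ m₁ with ∈-map⁻ _ m₁
...   | (S , R) , m′ , refl = let e , p = ∈-splits⁻ k xs m′ in cong suc e , ↭.prep x p
∈-splits⁻ (suc k) (x ∷ xs) m | inj₂ m₂ with ∈-map⁻ _ m₂
...   | (S , R) , m′ , refl = let e , p = ∈-splits⁻ (suc k) xs m′ in e , ↭-trans (↭ₚ.shift x S R) (↭.prep x p)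

splits-unique : ∀ k {xs : List A} → Unique xs → Unique (splits k xs)
splits-unique zero    u = [] ∷ []
splits-unique (suc k) {[]} u = []
splits-unique (suc k) {x ∷ xs} u@(_ ∷ u′) = unique-++⁺
  (Uniqueₚ.map⁺ (λ { refl → refl }) (splits-unique k u′))
  (Uniqueₚ.map⁺ (λ { refl → refl }) (splits-unique (suc k) u′))
  λ m n → disj m n
  where
  disj : ∀ {z} → z ∈ map (λ (S , R) → x ∷ S , R) (splits k xs) → z ∉ map (λ (S , R) → S , x ∷ R) (splits (suc k) xs)
  disj m n with ∈-map⁻ _ m | ∈-map⁻ _ n
  ... | (S , R) , m′ , refl | (.(x ∷ S) , R′) , n′ , refl =
    unique-∷⁻ u (∈-resp-↭ (proj₂ (∈-splits⁻ (suc k) xs n′)) (here refl))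

splits-functional : ∀ k {xs S R R′ : List A} → Unique xs → (S , R) ∈ splits k xs → (S , R′) ∈ splits k xs → R ≡ R′
splits-functional zero    u (here refl) (here refl) = refl
splits-functional (suc k) {x ∷ xs} u@(_ ∷ u′) m n
  with ∈-++⁻ (map _ (splits k xs)) m | ∈-++⁻ (map _ (splits k xs)) n
... | inj₁ m′ | inj₁ n′ with ∈-map⁻ _ m′ | ∈-map⁻ _ n′
...   | _ , m″ , refl | _ , n″ , refl = splits-functional k u′ m″ n″
splits-functional (suc k) {x ∷ xs} u@(_ ∷ u′) m n | inj₂ m′ | inj₂ n′ with ∈-map⁻ _ m′ | ∈-map⁻ _ n′
...   | _ , m″ , refl | _ , n″ , refl = cong (x ∷_) (splits-functional (suc k) u′ m″ n″)
splits-functional (suc k) {x ∷ xs} u@(_ ∷ u′) m n | inj₁ m′ | inj₂ n′ with ∈-map⁻ _ m′ | ∈-map⁻ _ n′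
...   | _ , m″ , refl | _ , n″ , refl = contradiction (∈-resp-↭ (proj₂ (∈-splits⁻ (suc k) xs n″)) (here refl)) (unique-∷⁻ u)
splits-functional (suc k) {x ∷ xs} u@(_ ∷ u′) m n | inj₂ m′ | inj₁ n′ with ∈-map⁻ _ m′ | ∈-map⁻ _ n′
...   | _ , m″ , refl | _ , n″ , refl = contradiction (∈-resp-↭ (proj₂ (∈-splits⁻ (suc k) xs m″)) (here refl)) (unique-∷⁻ u)

splits-allPairs : ∀ {Q : A → A → Set} k {xs S R : List A} → AllPairs Q xs → (S , R) ∈ splits k xs → AllPairs Q S
splits-allPairs zero    a (here refl) = []
splits-allPairs (suc k) {x ∷ xs} (p ∷ a) m with ∈-++⁻ (map _ (splits k xs)) m
... | inj₁ m′ with ∈-map⁻ _ m′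
...   | _ , m″ , refl =
  Allₚ.++⁻ˡ _ (All-resp-↭ (↭-sym (proj₂ (∈-splits⁻ k xs m″))) p) ∷ splits-allPairs k a m″
splits-allPairs (suc k) {x ∷ xs} (p ∷ a) m | inj₂ m′ with ∈-map⁻ _ m′
...   | _ , m″ , refl = splits-allPairs (suc k) a m″

∈-splits⁺ : ∀ (key : A → ℕ) {xs S : List A} → AllPairs (λ a b → key a < key b) xs →
            AllPairs (λ a b → key a < key b) S → S ⊆ xs → ∃ λ R → (S , R) ∈ splits (length S) xs
∈-splits⁺ key {xs} {[]} ax aS s = xs , here refl
∈-splits⁺ key {[]} {s₀ ∷ S} ax aS s = contradiction (s (here refl)) λ ()
∈-splits⁺ key {x ∷ xs} {s₀ ∷ S} (px ∷ ax) (ps ∷ aS) s with s (here refl)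
... | here refl =
  let R , m = ∈-splits⁺ key {xs} {S} ax aS (λ y∈ → tail-∈ (s (there y∈)) (All.lookup ps y∈)) in
  R , ∈-++⁺ˡ (∈-map⁺ _ m)
  where
  tail-∈ : ∀ {y} → y ∈ s₀ ∷ xs → key s₀ < key y → y ∈ xs
  tail-∈ (here refl) lt = contradiction lt (ℕₚ.<-irrefl refl)
  tail-∈ (there m)   lt = m
... | there s₀∈ =
  let R , m = ∈-splits⁺ key {xs} {s₀ ∷ S} ax (ps ∷ aS)
                (λ { (here refl) → s₀∈ ; (there y∈) → tail-∈ (s (there y∈)) (All.lookup ps y∈) }) in
  x ∷ R , ∈-++⁺ʳ (map _ (splits (length S) xs)) (∈-map⁺ _ m)
  where
  tail-∈ : ∀ {y} → y ∈ x ∷ xs → key s₀ < key y → y ∈ xs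
  tail-∈ (here refl) lt = contradiction lt (ℕₚ.<-asym (All.lookup px s₀∈))
  tail-∈ (there m)   lt = m

mergeFirst : List (List A) × List (List A) → List (List A)
mergeFirst (S , R) = concat S ∷ R

module Multiset (𝒮 : Setoid 0ℓ 0ℓ) where
  open Setoid 𝒮 public using () renaming (Carrier to Col; _≈_ to _≈ᶜ_; refl to ≈-refl; sym to ≈-sym; trans to ≈-trans)
  private module P = PermSetoidₚ 𝒮

  infix 3 _≅_

  _≅_ : List Col → List Col → Set _
  _≅_ = Homo.Permutation _≈ᶜ_

  ≅-refl : ∀ {xs} → xs ≅ xs
  ≅-refl = Homo.refl (Pointwise.refl ≈-refl)
  ≅-reflexive : ∀ {xs ys} → xs ≡ ys → xs ≅ ys
  ≅-reflexive refl = ≅-refl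
  ≅-sym : ∀ {xs ys} → xs ≅ ys → ys ≅ xs
  ≅-sym = Homo.sym ≈-sym
  ≅-trans : ∀ {xs ys zs} → xs ≅ ys → ys ≅ zs → xs ≅ zs
  ≅-trans = Homo.trans
  ≅-from-↭ : ∀ {xs ys} → xs ↭ ys → xs ≅ ys
  ≅-from-↭ ↭.refl         = ≅-refl
  ≅-from-↭ (↭.prep x p)   = Homo.prep ≈-refl (≅-from-↭ p)
  ≅-from-↭ (↭.swap x y p) = Homo.swap ≈-refl ≈-refl (≅-from-↭ p)
  ≅-from-↭ (↭.trans p q)  = ≅-trans (≅-from-↭ p) (≅-from-↭ q)
  ++-cong : ∀ {xs xs′ ys ys′} → xs ≅ xs′ → ys ≅ ys′ → xs ++ ys ≅ xs′ ++ ys′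
  ++-cong = P.++⁺
  ++-comm : ∀ xs ys → xs ++ ys ≅ ys ++ xs
  ++-comm = P.++-comm
  ++-swap : ∀ xs ys zs → xs ++ ys ++ zs ≅ ys ++ xs ++ zs
  ++-swap xs ys zs = P.shifts xs ys
  ++-cancelˡ : ∀ xs {ys zs} → xs ++ ys ≅ xs ++ zs → ys ≅ zs
  ++-cancelˡ xs = P.dropMiddle {xs} [] []
  ++-exchange : ∀ as bs cs ds → (as ++ bs) ++ (cs ++ ds) ≅ (as ++ cs) ++ (bs ++ ds)
  ++-exchange as bs cs ds = ≅-trans (≅-reflexive (Listₚ.++-assoc as bs _))
    (≅-trans (++-cong {as} ≅-refl (++-swap bs cs ds)) (≅-reflexive (sym (Listₚ.++-assoc as cs _))))

  map-cong-∈ : ∀ {X : Set} {f g : X → Col} xs → (∀ {x} → x ∈ xs → f x ≈ᶜ g x) → map f xs ≅ map g xs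
  map-cong-∈ []       eq = ≅-refl
  map-cong-∈ (x ∷ xs) eq = Homo.prep (eq (here refl)) (map-cong-∈ xs (eq ∘ there))

  infixr 7 _·_

  _·_ : ℕ → List Col → List Col
  zero  · xs = []
  suc k · xs = xs ++ k · xs

  ·-cong : ∀ k {xs ys} → xs ≅ ys → k · xs ≅ k · ys
  ·-cong zero    p = ≅-refl
  ·-cong (suc k) p = ++-cong p (·-cong k p)
  ·-++ : ∀ k xs ys → k · (xs ++ ys) ≅ k · xs ++ k · ys
  ·-++ zero    xs ys = ≅-refl
  ·-++ (suc k) xs ys = ≅-trans (++-cong {xs ++ ys} ≅-refl (·-++ k xs ys)) (++-exchange xs ys (k · xs) (k · ys))
  +-· : ∀ j k xs → (j + k) · xs ≡ j · xs ++ k · xs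
  +-· zero    k xs = refl
  +-· (suc j) k xs = trans (cong (xs ++_) (+-· j k xs)) (sym (Listₚ.++-assoc xs _ _))
  *-· : ∀ j k xs → (j * k) · xs ≡ j · k · xs
  *-· zero    k xs = refl
  *-· (suc j) k xs = trans (+-· k (j * k) xs) (cong (k · xs ++_) (*-· j k xs))
  ·-[] : ∀ k → k · [] ≡ []
  ·-[] zero    = refl
  ·-[] (suc k) = ·-[] k

  private
    ·-∷ : ∀ k x xs → k · (x ∷ xs) ≅ replicate k x ++ k · xs
    ·-∷ k x xs = ≅-trans (·-++ k (x ∷ []) xs) (++-cong (≅-reflexive (single k)) ≅-refl)
      where
      single : ∀ k → k · (x ∷ []) ≡ replicate k x
      single zero    = refl
      single (suc k) = cong (x ∷_) (single k)

    find : ∀ {x ys zs} k → x ∷ zs ≅ k · ys → ∃ λ ys′ → ys ≅ x ∷ ys′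
    find {x} {ys} k p = go k (P.Any-resp-↭ (λ e e′ → ≈-trans e′ e) p (here ≈-refl))
      where
      locate : ∀ {ys} → Any (x ≈ᶜ_) ys → ∃ λ ys′ → ys ≅ x ∷ ys′
      locate {y ∷ ys} (here e) = ys , Homo.prep (≈-sym e) ≅-refl
      locate {y ∷ ys} (there a) = let zs , q = locate a in y ∷ zs , ≅-trans (Homo.prep ≈-refl q) (Homo.swap ≈-refl ≈-refl ≅-refl)
      go : ∀ k → Any (x ≈ᶜ_) (k · ys) → ∃ λ ys′ → ys ≅ x ∷ ys′
      go (suc k) a with Anyₚ.++⁻ ys a
      ... | inj₁ b = locate b
      ... | inj₂ b = go k b

  ·-cancel : ∀ k {xs ys} → suc k · xs ≅ suc k · ys → xs ≅ ys
  ·-cancel k {[]} {[]} p = ≅-refl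
  ·-cancel k {[]} {y ∷ ys} p with P.¬x∷xs↭[] (≅-trans (≅-sym p) (≅-reflexive (·-[] k)))
  ... | ()
  ·-cancel k {x ∷ xs} {ys} p with find (suc k) p
  ... | ys′ , q = ≅-trans (Homo.prep ≈-refl (·-cancel k {xs} {ys′}
      (++-cancelˡ (replicate (suc k) x) (≅-trans (≅-sym (·-∷ (suc k) x xs))
        (≅-trans p (≅-trans (·-cong (suc k) q) (·-∷ (suc k) x ys′))))))) (≅-sym q)

  ∑ : ∀ {X : Set} → List X → (X → List Col) → List Col
  ∑ []       f = []
  ∑ (x ∷ xs) f = f x ++ ∑ xs f

  ∑-cong : ∀ {X : Set} (xs : List X) {f g} → (∀ {x} → x ∈ xs → f x ≅ g x) → ∑ xs f ≅ ∑ xs g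
  ∑-cong []       eq = ≅-refl
  ∑-cong (x ∷ xs) eq = ++-cong (eq (here refl)) (∑-cong xs (eq ∘ there))

  ∑-++ : ∀ {X : Set} (xs : List X) f g → ∑ xs (λ x → f x ++ g x) ≅ ∑ xs f ++ ∑ xs g
  ∑-++ []       f g = ≅-refl
  ∑-++ (x ∷ xs) f g = ≅-trans (++-cong {f x ++ g x} ≅-refl (∑-++ xs f g)) (++-exchange (f x) (g x) _ _)

  ∑-++ˡ : ∀ {X : Set} (xs : List X) {ys} f → ∑ (xs ++ ys) f ≡ ∑ xs f ++ ∑ ys f
  ∑-++ˡ []       f = refl
  ∑-++ˡ (x ∷ xs) f = trans (cong (f x ++_) (∑-++ˡ xs f)) (sym (Listₚ.++-assoc (f x) _ _))

  ∑-map : ∀ {X Y : Set} (h : X → Y) xs f → ∑ (map h xs) f ≡ ∑ xs (f ∘ h)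
  ∑-map h []       f = refl
  ∑-map h (x ∷ xs) f = cong (f (h x) ++_) (∑-map h xs f)

  ∑-∑ : ∀ {X Y : Set} (xs : List X) (h : X → List Y) f → ∑ (concatMap h xs) f ≡ ∑ xs (λ x → ∑ (h x) f)
  ∑-∑ []       h f = refl
  ∑-∑ (x ∷ xs) h f = trans (∑-++ˡ (h x) f) (cong (∑ (h x) f ++_) (∑-∑ xs h f))

  ∑-[] : ∀ {X : Set} (xs : List X) → ∑ xs (λ _ → []) ≡ []
  ∑-[] []       = refl
  ∑-[] (x ∷ xs) = ∑-[] xs

  ∑-swap : ∀ {X Y : Set} (xs : List X) (ys : List Y) (f : X → Y → List Col) → ∑ xs (λ x → ∑ ys (f x)) ≅ ∑ ys (λ y → ∑ xs (λ x → f x y))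
  ∑-swap []       ys f = ≅-reflexive (sym (∑-[] ys))
  ∑-swap (x ∷ xs) ys f = ≅-trans (++-cong {∑ ys (f x)} ≅-refl (∑-swap xs ys f)) (≅-sym (∑-++ ys (f x) _))

  ∑-const : ∀ {X : Set} (xs : List X) m → ∑ xs (λ _ → m) ≡ length xs · m
  ∑-const []       m = refl
  ∑-const (x ∷ xs) m = cong (m ++_) (∑-const xs m)

  ∑-· : ∀ {X : Set} k (xs : List X) f → ∑ xs (λ x → k · f x) ≅ k · ∑ xs f
  ∑-· k []       f = ≅-reflexive (sym (·-[] k))
  ∑-· k (x ∷ xs) f = ≅-trans (++-cong {k · f x} ≅-refl (∑-· k xs f)) (≅-sym (·-++ k (f x) _))

  ∑-over-∑ : ∀ {X : Set} (xs : List X) (f : X → List Col) h → ∑ (∑ xs f) h ≡ ∑ xs (λ x → ∑ (f x) h)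
  ∑-over-∑ []       f h = refl
  ∑-over-∑ (x ∷ xs) f h = trans (∑-++ˡ (f x) h) (cong (∑ (f x) h ++_) (∑-over-∑ xs f h))

  ∑-over-· : ∀ k xs (h : Col → List Col) → ∑ (k · xs) h ≡ k · ∑ xs h
  ∑-over-· zero    xs h = refl
  ∑-over-· (suc k) xs h = trans (∑-++ˡ xs h) (cong (∑ xs h ++_) (∑-over-· k xs h))

  ∑-singleton : ∀ {X : Set} (xs : List X) (f : X → Col) → ∑ xs (λ x → f x ∷ []) ≡ map f xs
  ∑-singleton []       f = refl
  ∑-singleton (x ∷ xs) f = cong (f x ∷_) (∑-singleton xs f)

  ∑< : ℕ → (ℕ → List Col) → List Col
  ∑< zero    f = []
  ∑< (suc k) f = f 0 ++ ∑< k (f ∘ suc)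

  ∑<-cong : ∀ k {f g} → (∀ i → f i ≅ g i) → ∑< k f ≅ ∑< k g
  ∑<-cong zero    eq = ≅-refl
  ∑<-cong (suc k) eq = ++-cong (eq 0) (∑<-cong k (eq ∘ suc))

  ∑<-++ : ∀ k f g → ∑< k (λ i → f i ++ g i) ≅ ∑< k f ++ ∑< k g
  ∑<-++ zero    f g = ≅-refl
  ∑<-++ (suc k) f g = ≅-trans (++-cong {f 0 ++ g 0} ≅-refl (∑<-++ k (f ∘ suc) (g ∘ suc))) (++-exchange (f 0) (g 0) _ _)

  ∑<-∑ : ∀ {X : Set} k (xs : List X) (f : X → ℕ → List Col) → ∑< k (λ i → ∑ xs (λ x → f x i)) ≅ ∑ xs (λ x → ∑< k (f x))
  ∑<-∑ zero    xs f = ≅-reflexive (sym (∑-[] xs))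
  ∑<-∑ (suc k) xs f = ≅-trans (++-cong {∑ xs (λ x → f x 0)} ≅-refl (∑<-∑ k xs (λ x → f x ∘ suc)))
    (≅-sym (∑-++ xs (λ x → f x 0) (λ x → ∑< k (f x ∘ suc))))

  bridge : ∀ {X Y : Set} (R : X → Y → Set) (f : X → Col) (g : Y → Col) {xs ys} → Unique xs → Unique ys →
           (∀ {x} → x ∈ xs → ∃ λ y → y ∈ ys × R x y) → (∀ {y} → y ∈ ys → ∃ λ x → x ∈ xs × R x y) →
           (∀ {x y y′} → x ∈ xs → y ∈ ys → y′ ∈ ys → R x y → R x y′ → y ≡ y′) →
           (∀ {x x′ y} → x ∈ xs → x′ ∈ xs → y ∈ ys → R x y → R x′ y → x ≡ x′) →
           (∀ {x y} → x ∈ xs → y ∈ ys → R x y → f x ≈ᶜ g y) → map f xs ≅ map g ys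
  bridge R f g {[]} {[]} _ _ _ _ _ _ _ = ≅-refl
  bridge R f g {[]} {y ∷ ys} _ _ _ surj _ _ _ with surj (here refl)
  ... | _ , () , _
  bridge {X} {Y} R f g {x ∷ xs} {ys} ux@(px ∷ ux′) uy total surj func inj colour with total (here refl)
  ... | y , y∈ , r with ∈-∃++ y∈
  ...   | as , bs , refl = ≅-trans
    (Homo.prep (colour (here refl) y∈ r)
      (bridge R f g ux′ uy′ total′ surj′ (λ m n n′ → func (there m) (weaken n) (weaken n′))
        (λ m m′ n → inj (there m) (there m′) (weaken n)) (λ m n → colour (there m) (weaken n))))
    (≅-from-↭ (↭ₚ.map⁺ g (↭-sym (↭ₚ.shift y as bs))))
    where
    uy″ : Unique (y ∷ as ++ bs)
    uy″ = unique-resp-↭ (↭ₚ.shift y as bs) uy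
    uy′ : Unique (as ++ bs)
    uy′ = AllPairs.tail uy″
    weaken : ∀ {z} → z ∈ as ++ bs → z ∈ as ++ y ∷ bs
    weaken m = ∈-resp-↭ (↭-sym (↭ₚ.shift y as bs)) (there m)
    strengthen : ∀ {z} → z ∈ as ++ y ∷ bs → z ≢ y → z ∈ as ++ bs
    strengthen m n with ∈-resp-↭ (↭ₚ.shift y as bs) m
    ... | here e   = contradiction e n
    ... | there m′ = m′
    total′ : ∀ {x′} → x′ ∈ xs → ∃ λ z → z ∈ as ++ bs × R x′ z
    total′ m with total (there m)
    ... | z , z∈ , r′ = z , strengthen z∈ (λ { refl → All.lookup px m (inj (here refl) (there m) y∈ r r′) }) , r′
    surj′ : ∀ {z} → z ∈ as ++ bs → ∃ λ x′ → x′ ∈ xs × R x′ z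
    surj′ n with surj (weaken n)
    ... | x′ , there m , r′   = x′ , m , r′
    ... | .x , here refl , r′ = contradiction (subst (_∈ as ++ bs) (func (here refl) (weaken n) y∈ r′ r) n) (unique-∷⁻ uy″)

-- Gluing and odd merging

partition-setoid : Set → Setoid 0ℓ 0ℓ
partition-setoid A = record
  { Carrier = List (List A) ; _≈_ = _≋_
  ; isEquivalence = Homo.isEquivalence ↭-refl ↭-sym }

lists : ∀ {N} → ℕ → List (List (Fin N))
lists zero    = [] ∷ []
lists {N} (suc k) = concatMap (λ x → map (x ∷_) (lists k)) (allFin N)

∈-lists⁺ : ∀ {N} (L : List (Fin N)) → L ∈ lists (length L)
∈-lists⁺ []      = here refl
∈-lists⁺ (x ∷ L) = ∈-concatMap⁺′ _ (∈-allFin x) (∈-map⁺ (x ∷_) (∈-lists⁺ L))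

∈-lists⁻ : ∀ {N} k {L : List (Fin N)} → L ∈ lists k → length L ≡ k
∈-lists⁻ zero (here refl) = refl
∈-lists⁻ {N} (suc k) m with ∈-concatMap⁻′ _ {allFin N} m
... | x , _ , m′ with ∈-map⁻ (x ∷_) m′
...   | L , m″ , refl = cong suc (∈-lists⁻ k m″)

lists-unique : ∀ {N} k → Unique (lists {N} k)
lists-unique zero = [] ∷ []
lists-unique {N} (suc k) = unique-concatMap _ (Uniqueₚ.allFin⁺ N)
  (λ _ → Uniqueₚ.map⁺ Listₚ.∷-injectiveʳ (lists-unique k))
  λ {x} {y} _ _ m n → heads (∈-map⁻ (x ∷_) m) (∈-map⁻ (y ∷_) n)
  where
  heads : ∀ {x y : Fin N} {z ls ks} → (∃ λ L → L ∈ ls × z ≡ x ∷ L) → (∃ λ L → L ∈ ks × z ≡ y ∷ L) → x ≡ y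
  heads (_ , _ , refl) (_ , _ , e) = Listₚ.∷-injectiveˡ e

full-length : ∀ {N} {W : List (Fin N)} → Full W → length W ≡ N
full-length {N} {W} (full u c) = ℕₚ.≤-antisym (unique-length u)
  (subst (_≤ length W) (Listₚ.length-tabulate id) (unique-⊆⇒length (Uniqueₚ.allFin⁺ N) (λ {x} _ → c x)))

allFin-full : ∀ {N} → Full (allFin N)
allFin-full {N} = full (Uniqueₚ.allFin⁺ N) ∈-allFin

full⇒↭ : ∀ {N} {W : List (Fin N)} → Full W → W ↭ allFin N
full⇒↭ {N} (full u c) = unique-↭ u (Uniqueₚ.allFin⁺ N) (λ {x} _ → ∈-allFin x) (λ {x} _ → c x)

idx-increasing : ∀ {N} {W : List (Fin N)} → Unique W → AllPairs (λ a b → idx W a < idx W b) W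
idx-increasing {W = W} u = go [] W u
  where
  go : ∀ X Y → Unique (X ++ Y) → AllPairs (λ a b → idx (X ++ Y) a < idx (X ++ Y) b) Y
  go X []      u = []
  go X (y ∷ Y) u =
    All.tabulate (λ {z} m → subst (λ V → idx V y < idx V z) (Listₚ.++-assoc X [ y ] Y)
      (idx-before (X ∷ʳ y) (∈-++⁺ʳ X (here refl))
        (λ n → proj₂ (proj₂ (unique-++⁻ (X ∷ʳ y) (subst Unique (sym (Listₚ.++-assoc X [ y ] Y)) u))) n m)))
    ∷ subst (λ V → AllPairs (λ a b → idx V a < idx V b) Y) (Listₚ.++-assoc X [ y ] Y)
        (go (X ∷ʳ y) Y (subst Unique (sym (Listₚ.++-assoc X [ y ] Y)) u))

words : ∀ M → List (List (Fin (suc M)))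
words M = map (zero ∷_) (perms (tabulate suc))

words-full : ∀ {M W} → W ∈ words M → Full W
words-full {M} m with ∈-map⁻ (zero ∷_) m
... | w , m′ , refl = full-↭ (↭.prep zero (↭-sym (∈-perms⁻ m′))) allFin-full

words-root : ∀ {M W} → W ∈ words M → ∃ λ w → W ≡ zero ∷ w
words-root m with ∈-map⁻ (zero ∷_) m
... | w , _ , e = w , e

∈-words : ∀ {M w} → Full (zero ∷ w) → (zero ∷ w) ∈ words M
∈-words F = ∈-map⁺ (zero ∷_) (∈-perms⁺ _ (↭ₚ.drop-∷ (full⇒↭ F)))

words-unique : ∀ M → Unique (words M)
words-unique M = Uniqueₚ.map⁺ Listₚ.∷-injectiveʳ (perms-unique (AllPairs.tail (Uniqueₚ.allFin⁺ (suc M))))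

-- The blocks of a partition other than the first block Z, all of them cycles of f.
record Rest {N : ℕ} (f : Fin N → Fin N) (Z : List (Fin N)) (rest : List (List (Fin N))) : Set where
  constructor mkRest
  field
    cycles : All (Cycle f) rest
    covers : Full (Z ++ concat rest)

rest-unique : ∀ {N} {f : Fin N → Fin N} {Z Z′ rest rest′} → Z ↭ Z′ → Rest f Z rest → Rest f Z′ rest′ →
              Z ∷ rest ≋ Z′ ∷ rest′
rest-unique {Z = Z} {Z′} {rest} p (mkRest c F) (mkRest c′ F′) =
  Homo.prep p (cycles-≋ c c′ (proj₁ (proj₂ (unique-++⁻ Z (unique F))))
    (++-cancelˡ-↭ Z′ (↭-trans (↭ₚ.++⁺ʳ (concat rest) (↭-sym p)) (↭-trans (full⇒↭ F) (↭-sym (full⇒↭ F′))))))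

concat-map-++ : ∀ {A B : Set} (f : A → List B) xs ys → concat (map f (xs ++ ys)) ≡ concat (map f xs) ++ concat (map f ys)
concat-map-++ f xs ys = trans (cong concat (Listₚ.map-++ f xs ys)) (sym (Listₚ.concat-++ (map f xs) (map f ys)))

module Vertices {N : ℕ} (α : Fin N → Fin N) (α-inj : ∀ {x y} → α x ≡ α y → x ≡ y) where
  open Gluing α α-inj public

  abstract
    tops : List (Fin N) → List (Fin N)
    tops W = filter (Top? W) W

    ∈-tops⁺ : ∀ {W r} → r ∈ W → Top W r → r ∈ tops W
    ∈-tops⁺ {W} = ∈-filter⁺ (Top? W)

    ∈-tops⁻ : ∀ {W r} → r ∈ tops W → Top W r
    ∈-tops⁻ {W} m = proj₂ (∈-filter⁻ (Top? W) {xs = W} m)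

    tops-unique′ : ∀ {W} → Unique W → Unique (tops W)
    tops-unique′ {W} = Uniqueₚ.filter⁺ (Top? W)

    tops-increasing′ : ∀ {W} → Unique W → Increasing W (tops W)
    tops-increasing′ {W} u = AllPairsₚ.filter⁺ (Top? W) (idx-increasing u)

  cycles : List (Fin N) → List (List (Fin N))
  cycles W = map (C W) (tops W)

  joined : List (Fin N) → Fin N → List (Fin N) → List (Fin N)
  joined W x L = concat (map (C W) (x ∷ L))

  others : List (Fin N) → Fin N → List (Fin N) → List (Fin N)
  others W x L = filter (λ r → ¬? (r ∈? joined W x L)) (tops W)

  colour : List (Fin N) × Fin N × List (Fin N) → List (List (Fin N))
  colour (W , x , L) = joined W x L ∷ map (C W) (others W x L)

  module _ {W : List (Fin N)} (F : Full W) where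
    open OneMap F

    top-exists : ∀ y → ∃ λ r → r ∈ C W y × r ∈ tops W × Top W r
    top-exists y with argmax (idx W) (λ _ → ⊤) (λ _ → yes tt) (C W y) (∈C y) tt
    ... | r , r∈ , _ , best = r , r∈ , ∈-tops⁺ (complete F r) t , t
      where
      t : Top W r
      t = All.tabulate (λ m → best (∈-resp-↭ (↭-sym (C-sym↭ r∈)) m) tt)

    top-unique : ∀ {r s} → Top W r → Top W s → r ∈ C W s → r ≡ s
    top-unique tr ts m = idx-injective (complete F _) (complete F _)
      (ℕₚ.≤-antisym (All.lookup ts m) (All.lookup tr (C-sym m)))

    tops-top : ∀ {r} → r ∈ tops W → Top W r
    tops-top = ∈-tops⁻

    tops-unique : Unique (tops W)
    tops-unique = tops-unique′ (unique F)

    tops-increasing : Increasing W (tops W)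
    tops-increasing = tops-increasing′ (unique F)

    cycles-unique : ∀ {S} → Unique S → (∀ {r} → r ∈ S → Top W r) → Unique (concat (map (C W) S))
    cycles-unique {S} u t = unique-concatMap (C W) u (λ {r} _ → C-unique r)
      (λ m n z∈ z∈′ → top-unique (t m) (t n) (C-trans (C-sym z∈) z∈′))

    cycles-full : Full (concat (cycles W))
    cycles-full = full (cycles-unique tops-unique tops-top)
      (λ y → let r , r∈ , r∈t , _ = top-exists y in ∈-concatMap⁺′ (C W) r∈t (C-sym r∈))

    rest-of : ∀ {Z S R} → Z ↭ concat (map (C W) S) → S ++ R ↭ tops W → Rest (σ W) Z (map (C W) R)
    rest-of {Z} {S} {R} p q = mkRest (Allₚ.map⁺ (All.tabulate (λ {r} _ → C-Cycle r)))
      (full-↭ (↭-trans (concat-↭ (↭ₚ.map⁺ (C W) (↭-sym q)))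
        (↭-trans (↭-reflexive (concat-map-++ (C W) S R)) (↭ₚ.++⁺ʳ _ (↭-sym p)))) cycles-full)

    filter-complement : ∀ {S Z} → Unique S → (∀ {r} → r ∈ S → Top W r) → Z ↭ concat (map (C W) S) →
                        S ++ filter (λ r → ¬? (r ∈? Z)) (tops W) ↭ tops W
    filter-complement {S} {Z} u t p = unique-↭
      (unique-++⁺ u (Uniqueₚ.filter⁺ _ tops-unique)
        (λ {r} m n → proj₂ (∈-filter⁻ (λ r → ¬? (r ∈? Z)) {xs = tops W} n) (∈-resp-↭ (↭-sym p) (∈-concatMap⁺′ (C W) m (∈C r)))))
      tops-unique
      (λ {r} m → [ (λ k → ∈-tops⁺ (complete F r) (t k)) , (λ k → proj₁ (∈-filter⁻ _ k)) ]′ (∈-++⁻ S m))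
      back
      where
      back : tops W ⊆ S ++ filter (λ r → ¬? (r ∈? Z)) (tops W)
      back {r} m = by-cases (r ∈? Z)
        where
        by-cases : Dec (r ∈ Z) → r ∈ S ++ filter (λ r → ¬? (r ∈? Z)) (tops W)
        by-cases (no n) = ∈-++⁺ʳ S (∈-filter⁺ (λ r → ¬? (r ∈? Z)) m n)
        by-cases (yes z) = let s , s∈ , r∈ = ∈-concatMap⁻′ (C W) {S} (∈-resp-↭ p z) in
          subst (_∈ S ++ filter (λ r → ¬? (r ∈? Z)) (tops W)) (sym (top-unique (tops-top m) (t s∈) r∈)) (∈-++⁺ˡ s∈)

    colour-rest : ∀ {x L} → Valid W x L → Rest (σ W) (joined W x L) (map (C W) (others W x L))
    colour-rest {x} {L} (_ , tL , aL , inc) = go (top-exists x)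
      where
      go : (∃ λ r → r ∈ C W x × r ∈ tops W × Top W r) → Rest (σ W) (joined W x L) (map (C W) (others W x L))
      go (r , r∈ , _ , tr) = rest-of Z↭ (filter-complement uS tS Z↭)
        where
        Z↭ : joined W x L ↭ concat (map (C W) (r ∷ L))
        Z↭ = ↭ₚ.++⁺ʳ _ (C-sym↭ r∈)
        r∉L : r ∉ L
        r∉L m = ℕₚ.<-irrefl refl (All.lookup (All.lookup aL m) r∈)
        uS : Unique (r ∷ L)
        uS = unique-∷⁺ r∉L (AllPairs.map (λ { lt refl → ℕₚ.<-irrefl refl lt }) inc)
        tS : ∀ {s} → s ∈ r ∷ L → Top W s
        tS (here refl) = tr
        tS (there m)   = All.lookup tL m

    colour-≋ : ∀ {x} → Down W x → colour (W , x , []) ≋ cycles W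
    colour-≋ {x} d = cycles-≋ (subst (Cycle (σ W)) (sym (Listₚ.++-identityʳ (C W x))) (C-Cycle x) ∷ Rest.cycles R)
      (Allₚ.map⁺ (All.tabulate (λ {r} _ → C-Cycle r))) (unique (Rest.covers R))
      (↭-trans (full⇒↭ (Rest.covers R)) (↭-sym (full⇒↭ cycles-full)))
      where
      R : Rest (σ W) (joined W x []) (map (C W) (others W x []))
      R = colour-rest {x} {[]} (d , [] , [] , [])

    colour-merge : ∀ {x L R} → Valid W x L → x ∷ L ++ R ↭ tops W →
                   colour (W , x , L) ≋ joined W x L ∷ map (C W) R
    colour-merge v p = rest-unique ↭-refl (colour-rest v) (rest-of ↭-refl p)

  step-colour : ∀ {W W′ x p q L} → Full W → Step W x p q W′ → Valid W x (p ∷ q ∷ L) →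
                colour (W , x , p ∷ q ∷ L) ≋ colour (W′ , q , L)
  step-colour {x = x} {p} {q} {L} F (mkStep {as} {bs} {cs} {ds} refl refl) v =
    rest-unique Z↭Z′ (mkRest (All.tabulate transport) (Rest.covers R)) (colour-rest F′ valid′)
    where
    open Forward as bs cs ds x p q L F v
    R : Rest (σ W) (joined W x (p ∷ q ∷ L)) (map (C W) (others W x (p ∷ q ∷ L)))
    R = colour-rest F v
    same : ∀ {K} → K ⊆ L → map (C W) K ≡ map (C W′) K
    same {[]}    s = refl
    same {l ∷ K} s = cong₂ _∷_ (sym (C-same (s (here refl)))) (same (s ∘ there))
    Z↭Z′ : joined W x (p ∷ q ∷ L) ↭ joined W′ q L
    Z↭Z′ = ↭-reflexive (sym (trans (cong₂ (λ a b → a ++ concat b) merge (sym (same id)))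
      (trans (Listₚ.++-assoc (C W x) _ _) (cong (C W x ++_) (Listₚ.++-assoc (C W p) (C W q) _)))))
    fresh : ∀ {w y} → w ∈ map (C W) (others W x (p ∷ q ∷ L)) → y ∈ joined W x (p ∷ q ∷ L) → y ∉ w
    fresh m k n = proj₂ (proj₂ (unique-++⁻ (joined W x (p ∷ q ∷ L)) (unique (Rest.covers R)))) k (∈-concat⁺′ n m)
    transport : ∀ {w} → w ∈ map (C W) (others W x (p ∷ q ∷ L)) → Cycle (σ W′) w
    transport m = Cycle-other (fresh m (∈-++⁺ˡ (∈C x))) (fresh m (∈-++⁺ʳ (C W x) (∈-++⁺ˡ (∈C p))))
      (fresh m (∈-++⁺ʳ (C W x) (∈-++⁺ʳ (C W p) (∈-++⁺ˡ (∈C q))))) (All.lookup (Rest.cycles R) m)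

twice : ℕ → ℕ
twice zero    = zero
twice (suc j) = suc (suc (twice j))

filter-split : ∀ {A : Set} {P : A → Set} (P? : Decidable P) xs → xs ↭ filter P? xs ++ filter (λ x → ¬? (P? x)) xs
filter-split P? [] = ↭-refl
filter-split P? (x ∷ xs) with P? x
... | yes _ = ↭.prep x (filter-split P? xs)
... | no _  = ↭-trans (↭.prep x (filter-split P? xs)) (↭-sym (↭ₚ.shift x (filter P? xs) _))

module _ {A B C : Set} (xs : List A) (ys : List B) (f : A → B → List C) where

  triplesAt : A → B → List (A × B × C)
  triplesAt a b = map (λ c → a , b , c) (f a b)

  triples : List (A × B × C)
  triples = concatMap (λ a → concatMap (triplesAt a) ys) xs

  ∈-triples⁺ : ∀ {a b c} → a ∈ xs → b ∈ ys → c ∈ f a b → (a , b , c) ∈ triples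
  ∈-triples⁺ {a} ma mb mc = ∈-concatMap⁺′ _ ma (∈-concatMap⁺′ (triplesAt a) mb (∈-map⁺ _ mc))

  ∈-triples⁻ : ∀ {a b c} → (a , b , c) ∈ triples → a ∈ xs × b ∈ ys × c ∈ f a b
  ∈-triples⁻ m with ∈-concatMap⁻′ (λ a → concatMap (triplesAt a) ys) {xs} m
  ... | a , ma , m₁ with ∈-concatMap⁻′ (triplesAt a) {ys} m₁
  ...   | b , mb , m₂ with ∈-map⁻ _ m₂
  ...     | c , mc , refl = ma , mb , mc

  triples-unique : Unique xs → Unique ys → (∀ {a b} → a ∈ xs → Unique (f a b)) → Unique triples
  triples-unique ux uy uf = unique-concatMap _ ux
    (λ {a} ma → unique-concatMap (triplesAt a) uy (λ _ → Uniqueₚ.map⁺ (λ { refl → refl }) (uf ma)) (λ _ _ → second a))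
    (λ {a} {a′} _ _ → first a a′)
    where
    second : ∀ a {b b′ z} → z ∈ triplesAt a b → z ∈ triplesAt a b′ → b ≡ b′
    second a m n with ∈-map⁻ _ m | ∈-map⁻ _ n
    ... | _ , _ , refl | _ , _ , refl = refl
    first : ∀ a a′ {z} → z ∈ concatMap (triplesAt a) ys → z ∈ concatMap (triplesAt a′) ys → a ≡ a′
    first a a′ m n with ∈-concatMap⁻′ (triplesAt a) {ys} m | ∈-concatMap⁻′ (triplesAt a′) {ys} n
    ... | _ , _ , m′ | _ , _ , n′ with ∈-map⁻ _ m′ | ∈-map⁻ _ n′
    ...   | _ , _ , refl | _ , _ , refl = refl

module _ {A B : Set} (xs : List A) (f : A → List B) where

  pairsAt : A → List (A × B)
  pairsAt a = map (a ,_) (f a)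

  pairs : List (A × B)
  pairs = concatMap pairsAt xs

  ∈-pairs⁺ : ∀ {a b} → a ∈ xs → b ∈ f a → (a , b) ∈ pairs
  ∈-pairs⁺ ma mb = ∈-concatMap⁺′ pairsAt ma (∈-map⁺ _ mb)

  ∈-pairs⁻ : ∀ {a b} → (a , b) ∈ pairs → a ∈ xs × b ∈ f a
  ∈-pairs⁻ m with ∈-concatMap⁻′ pairsAt {xs} m
  ... | a , ma , m₁ with ∈-map⁻ _ m₁
  ...   | b , mb , refl = ma , mb

  pairs-unique : Unique xs → (∀ {a} → a ∈ xs → Unique (f a)) → Unique pairs
  pairs-unique ux uf = unique-concatMap pairsAt ux (λ m → Uniqueₚ.map⁺ (λ { refl → refl }) (uf m)) (λ _ _ → first)
    where
    first : ∀ {a a′ z} → z ∈ pairsAt a → z ∈ pairsAt a′ → a ≡ a′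
    first m n with ∈-map⁻ _ m | ∈-map⁻ _ n
    ... | _ , _ , refl | _ , _ , refl = refl

module OddMerges {A : Set} where
  open Multiset (partition-setoid A)

  -- Odd numbers of blocks, up to 2K − 1.
  oddMerges : ℕ → List (List A) → List (List (List A))
  oddMerges K cs = ∑< K (λ j → map mergeFirst (splits (suc (twice j)) cs))

module Fibres {M : ℕ} (α : Fin (suc M) → Fin (suc M)) (α-inj : ∀ {x y} → α x ≡ α y → x ≡ y) where
  open Vertices α α-inj public
  open Multiset (partition-setoid (Fin (suc M))) public
  open OddMerges {Fin (suc M)} public
  private
    N = suc M
    State = List (Fin N) × Fin N × List (Fin N)

  statesAt : ℕ → List (Fin N) → Fin N → List (List (Fin N))
  statesAt k W x = filter (Valid? W x) (lists k)

  states : ℕ → List State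
  states k = triples (words M) (allFin N) (statesAt k)

  abstract
   ∈-states⁺ : ∀ {W x L} → W ∈ words M → Valid W x L → (W , x , L) ∈ states (length L)
   ∈-states⁺ {W} {x} {L} w v = ∈-triples⁺ (words M) (allFin N) (statesAt (length L)) w (∈-allFin x)
     (∈-filter⁺ (Valid? W x) (∈-lists⁺ L) v)

   ∈-states⁻ : ∀ k {W x L} → (W , x , L) ∈ states k → W ∈ words M × length L ≡ k × Valid W x L
   ∈-states⁻ k {W} {x} m = go (∈-triples⁻ (words M) (allFin N) (statesAt k) m)
     where
     go : ∀ {L} → W ∈ words M × x ∈ allFin N × L ∈ statesAt k W x → W ∈ words M × length L ≡ k × Valid W x L
     go (w , _ , m′) = let l , v = ∈-filter⁻ (Valid? W x) {xs = lists k} m′ in w , ∈-lists⁻ k l , v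

   states-unique : ∀ k → Unique (states k)
   states-unique k = triples-unique (words M) (allFin N) (statesAt k) (words-unique M) (Uniqueₚ.allFin⁺ N)
     (λ {W} {x} _ → Uniqueₚ.filter⁺ (Valid? W x) (lists-unique k))

  AtTop : State → Set
  AtTop (W , x , _) = Top W x
  AtTop? : Decidable AtTop
  AtTop? (W , x , _) = Top? W x

  closed open′ : ℕ → List State
  closed k = filter AtTop? (states k)
  open′  k = filter (λ s → ¬? (AtTop? s)) (states k)

  _↝_ : State → State → Set
  (W , x , L) ↝ (W′ , q , L′) = ∃ λ p → L ≡ p ∷ q ∷ L′ × Step W x p q W′

  step-words : ∀ {W W′ x p q} → Full W → Step W x p q W′ → W ∈ words M → W′ ∈ words M
  step-words {W} {W′} F s w = go (step-head s (proj₂ (words-root w)))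
    where
    go : (∃ λ w′ → W′ ≡ zero ∷ w′) → W′ ∈ words M
    go (_ , refl) = ∈-words (full-↭ (step-↭ F s) F)

  private
    ↝-total : ∀ k {s} → s ∈ states (2 + k) → ∃ λ t → t ∈ open′ k × s ↝ t
    ↝-total k {W , x , L} m = go L (∈-states⁻ (2 + k) m)
      where
      go : ∀ L → W ∈ words M × length L ≡ 2 + k × Valid W x L → ∃ λ t → t ∈ open′ k × (W , x , L) ↝ t
      go (p ∷ q ∷ L) (w , refl , v) = finish (words-full w) (step-exists (words-full w) v)
        where
        finish : Full W → (∃ λ W′ → Step W x p q W′) → ∃ λ t → t ∈ open′ k × (W , x , p ∷ q ∷ L) ↝ t
        finish F (W′ , s) = (W′ , q , L)
          , ∈-filter⁺ (λ s → ¬? (AtTop? s)) (∈-states⁺ (step-words F s w) (proj₁ (step-valid F s v))) (proj₂ (step-valid F s v))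
          , p , refl , s

    ↝-surj : ∀ k {t} → t ∈ open′ k → ∃ λ s → s ∈ states (2 + k) × s ↝ t
    ↝-surj k {W′ , q , L} m = go (∈-filter⁻ (λ s → ¬? (AtTop? s)) {xs = states k} m)
      where
      go : (W′ , q , L) ∈ states k × ¬ Top W′ q → ∃ λ s → s ∈ states (2 + k) × s ↝ (W′ , q , L)
      go (m₁ , ¬t) = go₂ (∈-states⁻ k m₁)
        where
        go₂ : W′ ∈ words M × length L ≡ k × Valid W′ q L → ∃ λ s → s ∈ states (2 + k) × s ↝ (W′ , q , L)
        go₂ (w , refl , v) = go₃ (unstep (words-full w) v ¬t)
          where
          go₃ : (∃₂ λ x p → ∃ λ W → Step W x p q W′ × Valid W x (p ∷ q ∷ L)) →
                ∃ λ s → s ∈ states (2 + k) × s ↝ (W′ , q , L)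
          go₃ (x , p , W , s , v′) = (W , x , p ∷ q ∷ L)
            , ∈-states⁺ (step-words (words-full w) (step-sym s) w) v′ , p , refl , s

    ↝-func : ∀ k {s t t′} → s ∈ states (2 + k) → s ↝ t → s ↝ t′ → t ≡ t′
    ↝-func k {W , x , _} m (p , refl , s) (_ , refl , s′) = cong (_, _)
      (step-functional (unique (words-full (proj₁ (∈-states⁻ (2 + k) m)))) s s′)

    ↝-inj : ∀ k {s s′ t} → s ∈ states (2 + k) → s′ ∈ states (2 + k) → s ↝ t → s′ ↝ t → s ≡ s′
    ↝-inj k m m′ (p , refl , s) (p′ , refl , s′) = go (∈-states⁻ (2 + k) m) (∈-states⁻ (2 + k) m′) s s′
      where
      go : ∀ {W W′ V x x′ p p′ q L} → W ∈ words M × length (p ∷ q ∷ L) ≡ 2 + k × Valid W x (p ∷ q ∷ L) →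
           W′ ∈ words M × length (p′ ∷ q ∷ L) ≡ 2 + k × Valid W′ x′ (p′ ∷ q ∷ L) →
           Step W x p q V → Step W′ x′ p′ q V → (W , x , p ∷ q ∷ L) ≡ (W′ , x′ , p′ ∷ q ∷ L)
      go (w , _ , v) (w′ , _ , v′) s s′ =
        cong (λ (W , x , p) → W , x , p ∷ _) (step-injective (words-full w) (words-full w′) v v′ s s′)

    ↝-colour : ∀ k {s t} → s ∈ states (2 + k) → s ↝ t → colour s ≋ colour t
    ↝-colour k m (p , refl , s) = let w , _ , v = ∈-states⁻ (2 + k) m in step-colour (words-full w) s v

  colours : ℕ → List (List (List (Fin N)))
  colours k = map colour (states k)

  closedColours : ℕ → List (List (List (Fin N)))
  closedColours k = map colour (closed k)

  colours-step : ∀ k → colours k ≅ closedColours k ++ colours (2 + k)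
  colours-step k = ≅-trans (≅-from-↭ (↭ₚ.map⁺ colour (filter-split AtTop? (states k))))
    (≅-trans (≅-reflexive (Listₚ.map-++ colour (closed k) (open′ k)))
      (++-cong {closedColours k} ≅-refl (≅-sym
        (bridge _↝_ colour colour (states-unique (2 + k)) (Uniqueₚ.filter⁺ _ (states-unique k))
          (↝-total k) (↝-surj k) (λ m _ _ → ↝-func k m) (λ m m′ _ → ↝-inj k m m′) (λ m _ → ↝-colour k m)))))

  colours-sum : ∀ K k → colours k ≅ ∑< K (λ j → closedColours (twice j + k)) ++ colours (twice K + k)
  colours-sum zero    k = ≅-refl
  colours-sum (suc K) k = ≅-trans (colours-step k)
    (≅-trans (++-cong {closedColours k} ≅-refl (colours-sum K (2 + k)))
      (≅-trans (≅-reflexive (sym (Listₚ.++-assoc (closedColours k) _ _)))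
        (++-cong (++-cong {closedColours k} ≅-refl (∑<-cong K (λ j → ≅-reflexive (cong closedColours (shift j)))))
                 (≅-reflexive (cong colours (shift K))))))
    where
    shift : ∀ j → twice j + (2 + k) ≡ 2 + (twice j + k)
    shift j = trans (ℕₚ.+-suc (twice j) (suc k)) (cong suc (ℕₚ.+-suc (twice j) k))

  colours-none : ∀ k → N < k → colours k ≡ []
  colours-none k lt = none (λ {s} m → let _ , e , v = ∈-states⁻ k {proj₁ s} m in
    ℕₚ.<⇒≱ lt (subst (_≤ N) e (unique-length (AllPairs.map (λ { lt refl → ℕₚ.<-irrefl refl lt }) (proj₂ (proj₂ (proj₂ v)))))))
    where
    none : ∀ {ss} → (∀ {s} → s ∈ ss → ⊥) → map colour ss ≡ []
    none {[]}     _ = refl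
    none {s ∷ ss} n = ⊥-elim (n (here refl))

  closed-merges : ∀ k → closedColours k ≅ ∑ (words M) (λ W → map mergeFirst (splits (suc k) (cycles W)))
  closed-merges k = ≅-trans
    (bridge _~_ colour merged (Uniqueₚ.filter⁺ AtTop? (states-unique k)) choices-unique total surj func inj same)
    (≅-reflexive (trans (Listₚ.map-concatMap merged _ (words M)) (unfold (words M))))
    where
    merged : List (Fin N) × (List (Fin N) × List (Fin N)) → List (List (Fin N))
    merged (W , S , R) = concat (map (C W) S) ∷ map (C W) R
    choicesAt : List (Fin N) → List (List (Fin N) × List (Fin N))
    choicesAt W = splits (suc k) (tops W)
    choices : List (List (Fin N) × (List (Fin N) × List (Fin N)))
    choices = pairs (words M) choicesAt
    unfold : ∀ Ws → concatMap (map merged ∘ pairsAt (words M) choicesAt) Ws ≡ ∑ Ws (λ W → map mergeFirst (splits (suc k) (cycles W)))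
    unfold []       = refl
    unfold (W ∷ Ws) = cong₂ _++_
      (trans (sym (Listₚ.map-∘ (splits (suc k) (tops W))))
        (trans (Listₚ.map-∘ (splits (suc k) (tops W))) (cong (map mergeFirst) (sym (splits-map (C W) (suc k) (tops W))))))
      (unfold Ws)
    choices-unique : Unique choices
    choices-unique = pairs-unique (words M) choicesAt (words-unique M) (λ m → splits-unique (suc k) (tops-unique (words-full m)))
    _~_ : State → List (Fin N) × (List (Fin N) × List (Fin N)) → Set
    (W , x , L) ~ (W′ , S , R) = W ≡ W′ × S ≡ x ∷ L
    closed⁻ : ∀ {W x L} → (W , x , L) ∈ closed k → W ∈ words M × length L ≡ k × Valid W x L × Top W x
    closed⁻ m = let m₁ , t = ∈-filter⁻ AtTop? {xs = states k} m ; w , e , v = ∈-states⁻ k m₁ in w , e , v , t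
    choices⁻ : ∀ {W S R} → (W , S , R) ∈ choices → W ∈ words M × (S , R) ∈ splits (suc k) (tops W)
    choices⁻ = ∈-pairs⁻ (words M) choicesAt
    above-top : ∀ {W x L} → Full W → Valid W x L → Top W x → Increasing W (x ∷ L)
    above-top {W} {x} F (_ , _ , ab , inc) t = All.map (λ a → All.lookup a (OneMap.∈C F x)) ab ∷ inc
    total : ∀ {s} → s ∈ closed k → ∃ λ c → c ∈ choices × s ~ c
    total {W , x , L} m = go (closed⁻ m)
      where
      go : W ∈ words M × length L ≡ k × Valid W x L × Top W x → ∃ λ c → c ∈ choices × (W , x , L) ~ c
      go (w , refl , v , t) = go₂ (∈-splits⁺ (idx W) {tops W} {x ∷ L} (tops-increasing F) (above-top F v t)
                    (λ { (here refl) → ∈-tops⁺ (complete F x) t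
                       ; (there y∈)  → ∈-tops⁺ (complete F _) (All.lookup (proj₁ (proj₂ v)) y∈) }))
        where
        F = words-full w
        go₂ : (∃ λ R → (x ∷ L , R) ∈ splits (suc k) (tops W)) → ∃ λ c → c ∈ choices × (W , x , L) ~ c
        go₂ (R , r) = (W , x ∷ L , R) , ∈-pairs⁺ (words M) choicesAt w r , refl , refl
    surj : ∀ {c} → c ∈ choices → ∃ λ s → s ∈ closed k × s ~ c
    surj {W , S , R} m = go S (proj₁ (choices⁻ m)) (proj₂ (choices⁻ m))
      where
      go : ∀ S → W ∈ words M → (S , R) ∈ splits (suc k) (tops W) → ∃ λ s → s ∈ closed k × s ~ (W , S , R)
      go []      w r = contradiction (proj₁ (∈-splits⁻ (suc k) (tops W) r)) λ ()
      go (x ∷ L) w r =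
        (W , x , L) , ∈-filter⁺ AtTop? (subst (λ i → (W , x , L) ∈ states i) (ℕₚ.suc-injective (proj₁ sp)) (∈-states⁺ w v)) t , refl , refl
        where
        F = words-full w
        sp : length (x ∷ L) ≡ suc k × (x ∷ L) ++ R ↭ tops W
        sp = ∈-splits⁻ (suc k) (tops W) r
        t : Top W x
        t = tops-top F (∈-resp-↭ (proj₂ sp) (here refl))
        inc : Increasing W (x ∷ L)
        inc = splits-allPairs (suc k) (tops-increasing F) r
        v : Valid W x L
        v = All.lookup t (cycle-image (OneMap.C-Cycle F x) (OneMap.∈C F x))
          , All.tabulate (λ m → tops-top F (∈-resp-↭ (proj₂ sp) (there (∈-++⁺ˡ m))))
          , All.map (λ lt → All.map (λ le → ℕₚ.≤-<-trans le lt) t) (AllPairs.head inc)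
          , AllPairs.tail inc
    func : ∀ {s c c′} → s ∈ closed k → c ∈ choices → c′ ∈ choices →
           s ~ c → s ~ c′ → c ≡ c′
    func {W , x , L} {_ , _ , R} {_ , _ , R′} _ m m′ (refl , refl) (refl , refl) =
      let w , r = choices⁻ m ; _ , r′ = choices⁻ m′ in
      cong (λ R → W , x ∷ L , R) (splits-functional (suc k) (tops-unique (words-full w)) r r′)
    inj : ∀ {s s′ c} → s ∈ closed k → s′ ∈ closed k → c ∈ choices → s ~ c → s′ ~ c → s ≡ s′
    inj _ _ _ (refl , refl) (refl , refl) = refl
    same : ∀ {s c} → s ∈ closed k → c ∈ choices → s ~ c → colour s ≋ merged c
    same {W , x , L} m m′ (refl , refl) =
      let w , _ , v , _ = closed⁻ m ; _ , r = choices⁻ m′ in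
      colour-merge (words-full w) v (proj₂ (∈-splits⁻ (suc k) (tops W) r))

  downs : List (Fin N) → List (Fin N)
  downs W = filter (λ x → Valid? W x []) (allFin N)

  colours-0 : colours 0 ≅ ∑ (words M) (λ W → length (downs W) · (cycles W ∷ []))
  colours-0 = ≅-trans (≅-reflexive (trans (Listₚ.map-concatMap colour _ (words M)) (unfold (words M))))
    (∑-cong (words M) (λ {W} w → ≅-trans (≅-reflexive (trans (Listₚ.map-concatMap colour (triplesAt (words M) (allFin N) (statesAt 0) W) (allFin N)) (unfold (allFin N))))
      (at W (words-full w) (allFin N))))
    where
    unfold : ∀ {X : Set} {f : X → List (List (List (Fin N)))} xs → concatMap f xs ≡ ∑ xs f
    unfold []       = refl
    unfold {f = f} (x ∷ xs) = cong (f x ++_) (unfold xs)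
    at : ∀ W → Full W → ∀ xs → ∑ xs (λ x → map colour (triplesAt (words M) (allFin N) (statesAt 0) W x)) ≅
         length (filter (λ x → Valid? W x []) xs) · (cycles W ∷ [])
    at W F []       = ≅-refl
    at W F (x ∷ xs) with Valid? W x []
    ... | yes v = Homo.prep (colour-≋ F (proj₁ v)) (at W F xs)
    ... | no _  = at W F xs

  fibres-eigen : ∀ {m} K → N < twice K → (∀ {W} → W ∈ words M → length (downs W) ≡ m) →
                 m · map cycles (words M) ≅ ∑ (map cycles (words M)) (oddMerges K)
  fibres-eigen {m} K big count = ≅-trans (≅-sym lhs) (≅-trans (colours-sum K 0) rhs)
    where
    lhs : colours 0 ≅ m · map cycles (words M)
    lhs = ≅-trans colours-0 (≅-trans
      (∑-cong (words M) (λ {W} w → ≅-reflexive (cong (_· (cycles W ∷ [])) (count w))))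
      (≅-trans (∑-· m (words M) _) (·-cong m (≅-reflexive (∑-singleton (words M) cycles)))))
    rhs : ∑< K (λ j → closedColours (twice j + 0)) ++ colours (twice K + 0) ≅ ∑ (map cycles (words M)) (oddMerges K)
    rhs = ≅-trans (≅-reflexive (trans (cong (∑< K _ ++_) (trans (cong colours (ℕₚ.+-identityʳ (twice K))) (colours-none _ big)))
                     (Listₚ.++-identityʳ _)))
      (≅-trans (∑<-cong K (λ j → ≅-trans (≅-reflexive (cong closedColours (ℕₚ.+-identityʳ (twice j)))) (closed-merges (twice j))))
        (≅-trans (∑<-∑ K (words M) (λ W j → map mergeFirst (splits (suc (twice j)) (cycles W))))
          (≅-reflexive (sym (∑-map cycles (words M) (oddMerges K))))))

length-filter-⇔ : ∀ {A B : Set} {P : A → Set} {Q : B → Set} (P? : Decidable P) (Q? : Decidable Q) (f : A → B) xs →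
                  (∀ {x} → x ∈ xs → (P x → Q (f x)) × (Q (f x) → P x)) →
                  length (filter P? xs) ≡ length (filter Q? (map f xs))
length-filter-⇔ P? Q? f []       eq = refl
length-filter-⇔ P? Q? f (x ∷ xs) eq with P? x | Q? (f x)
... | yes _ | yes _ = cong suc (length-filter-⇔ P? Q? f xs (eq ∘ there))
... | no _  | no _  = length-filter-⇔ P? Q? f xs (eq ∘ there)
... | yes p | no nq = contradiction (proj₁ (eq (here refl)) p) nq
... | no np | yes q = contradiction (proj₂ (eq (here refl)) q) np

halve : ∀ {a b} → a + a ≡ b + b → a ≡ b
halve {zero}  {zero}  e = refl
halve {suc a} {suc b} e = cong suc (halve (ℕₚ.suc-injective (ℕₚ.suc-injective
  (trans (cong suc (sym (ℕₚ.+-suc a a))) (trans e (cong suc (ℕₚ.+-suc b b)))))))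

module DownCount {N n : ℕ} (N≡2n : N ≡ n + n) (α : Fin N → Fin N) (α-invol : ∀ x → α (α x) ≡ x)
                 (α-fpf : ∀ x → α x ≢ x) where

  α-injective : ∀ {x y} → α x ≡ α y → x ≡ y
  α-injective {x} {y} e = trans (sym (α-invol x)) (trans (cong α e) (α-invol y))

  module _ {W : List (Fin N)} (F : Full W) where
    private
      Back : Fin N → Set
      Back y = idx W (α y) < idx W y
      Back? : Decidable Back
      Back? y = idx W (α y) ℕ.<? idx W y

      backs≡ : length (filter Back? (allFin N)) ≡ length (filter (λ y → ¬? (Back? y)) (allFin N))
      backs≡ = trans (length-filter-⇔ Back? (λ y → ¬? (Back? y)) α (allFin N) (λ {y} _ → to , from))
        (↭ₚ.↭-length (↭ₚ.filter-↭ (λ y → ¬? (Back? y)) α-perm))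
        where
        to : ∀ {y} → Back y → ¬ Back (α y)
        to {y} lt lt′ = ℕₚ.<-asym lt (subst (λ z → idx W z < idx W (α y)) (α-invol y) lt′)
        from : ∀ {y} → ¬ Back (α y) → Back y
        from {y} n = ℕₚ.≤∧≢⇒< (ℕₚ.≮⇒≥ (λ lt → n (subst (λ z → idx W z < idx W (α y)) (sym (α-invol y)) lt)))
          (λ e → α-fpf y (idx-injective (complete F (α y)) (complete F y) e))
        α-perm : map α (allFin N) ↭ allFin N
        α-perm = full⇒↭ (full (Uniqueₚ.map⁺ α-injective (Uniqueₚ.allFin⁺ N))
          (λ y → subst (_∈ map α (allFin N)) (α-invol y) (∈-map⁺ α (∈-allFin (α y)))))

      backs : length (filter Back? (allFin N)) ≡ n
      backs = halve (trans (cong (length (filter Back? (allFin N)) +_) backs≡) (trans (sym (Listₚ.length-++ (filter Back? (allFin N))))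
        (trans (sym (↭ₚ.↭-length (filter-split Back? (allFin N)))) (trans (Listₚ.length-tabulate id) N≡2n))))

    -- Every step of the walk around the face is a descent at exactly one of its two half-edges,
    -- except for the step that closes up the walk.
    down-count : ∀ {P : Fin N → Set} (P? : Decidable P) →
                 (∀ x → (P x → idx W (α (next W x)) ≤ idx W x) × (idx W (α (next W x)) ≤ idx W x → P x)) →
                 ∀ {z w} → W ≡ z ∷ w → length (filter P? (allFin N)) ≡ suc n
    down-count {P} P? P⇔ {z} {w} refl = trans
      (length-filter-⇔ P? Q? (next W) (allFin N) (λ {x} _ → to x ∘ proj₁ (P⇔ x) , proj₂ (P⇔ x) ∘ from x))
      (trans (↭ₚ.↭-length (↭ₚ.filter-↭ Q? (↭-trans next-perm (↭-sym (full⇒↭ F)))))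
        (trans (cong length (Listₚ.filter-accept Q? (inj₁ refl)))
          (cong suc (trans (sym rest) backs))))
      where
      Q : Fin N → Set
      Q y = y ≡ z ⊎ Back y
      Q? : Decidable Q
      Q? y with y ≟ z | Back? y
      ... | yes e | _     = yes (inj₁ e)
      ... | no _  | yes b = yes (inj₂ b)
      ... | no ne | no nb = no [ ne , nb ]′
      idx-z : idx W z ≡ 0
      idx-z with z ≟ z
      ... | yes _ = refl
      ... | no ne = contradiction refl ne
      z∉w : z ∉ w
      z∉w = unique-∷⁻ (unique F)
      rest : length (filter Back? (allFin N)) ≡ length (filter Q? w)
      rest = trans (sym (↭ₚ.↭-length (↭ₚ.filter-↭ Back? (full⇒↭ F))))
        (trans (cong length (Listₚ.filter-reject Back? (λ lt → ℕₚ.n≮0 (subst (idx W (α z) <_) idx-z lt))))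
          (trans (length-filter-⇔ Back? Q? id w (λ m → inj₂ , [ (λ { refl → contradiction m z∉w }) , id ]′))
            (cong (length ∘ filter Q?) (Listₚ.map-id w))))
      next-perm : map (next W) (allFin N) ↭ allFin N
      next-perm = full⇒↭ (full (Uniqueₚ.map⁺ (next-injective F) (Uniqueₚ.allFin⁺ N))
        (λ y → let x , e = injective⇒surjective (next-injective F) y in subst (_∈ map (next W) (allFin N)) e (∈-map⁺ _ (∈-allFin x))))
      next-idx : ∀ x → (next W x ≡ z × (∀ y → idx W y ≤ idx W x)) ⊎ (next W x ∈ w × idx W (next W x) ≡ suc (idx W x))
      next-idx x with ∈-∃++ (complete F x) | next-cycle (complete F x) (unique F)
      ... | X , [] , e | cycle {u} {l} e′ (step e₀ _) with Listₚ.∷ʳ-injective X u (trans (sym e) e′)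
      ...   | refl , refl = inj₁ (e₀ , λ y → subst (idx W y ≤_) (sym last-idx) (ℕₚ.≤-pred (subst (idx W y <_) len (idx-< (complete F y)))))
        where
        len : length W ≡ suc (length X)
        len = trans (cong length e) (trans (Listₚ.length-++ X) (ℕₚ.+-comm (length X) 1))
        last-idx : idx W x ≡ length X
        last-idx = trans (cong (λ V → idx V x) e) (trans (idx-++-∉ X (∷ʳ-unique (subst Unique e (unique F))))
          (trans (cong (length X +_) here-idx) (ℕₚ.+-identityʳ _)))
          where
          here-idx : idx [ x ] x ≡ 0
          here-idx with x ≟ x
          ... | yes _ = refl
          ... | no ne = contradiction refl ne
      next-idx x | X , y ∷ Y , e | cycle {u} {l} e′ wk
        with proj₂ (walk-splitAt X (subst (λ V → Walk (next W) l V l) e wk))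
      ... | step e₁ _ = inj₂ (subst (_∈ w) (sym e₁) (y∈w X e) , trans (cong (idx W) e₁) (trans (at y (X ∷ʳ x) (trans e (sym (Listₚ.++-assoc X [ x ] (y ∷ Y)))))
          (trans (Listₚ.length-++ X) (trans (ℕₚ.+-comm (length X) 1) (cong suc (sym (at x X e)))))))
        where
        y∈w : ∀ X → z ∷ w ≡ X ++ x ∷ y ∷ Y → y ∈ w
        y∈w []      refl = here refl
        y∈w (_ ∷ X) refl = ∈-++⁺ʳ X (there (here refl))
        at : ∀ v V {V′} → W ≡ V ++ v ∷ V′ → idx W v ≡ length V
        at v V {V′} e = trans (cong (λ U → idx U v) e) (trans (idx-++-∉ V (λ m → proj₂ (proj₂ (unique-++⁻ V (subst Unique e (unique F)))) m (here refl)))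
          (trans (cong (length V +_) (here-idx V′)) (ℕₚ.+-identityʳ _)))
          where
          here-idx : ∀ V′ → idx (v ∷ V′) v ≡ 0
          here-idx V′ with v ≟ v
          ... | yes _ = refl
          ... | no ne = contradiction refl ne
      to : ∀ x → idx W (α (next W x)) ≤ idx W x → Q (next W x)
      to x le = [ inj₁ ∘ proj₁ , (λ (_ , e) → inj₂ (subst (idx W (α (next W x)) <_) (sym e) (s≤s le))) ]′ (next-idx x)
      from : ∀ x → Q (next W x) → idx W (α (next W x)) ≤ idx W x
      from x q = [ (λ (_ , all) → all _) , (λ (m , e) → [ (λ e′ → contradiction (subst (_∈ w) e′ m) z∉w)
        , (λ lt → ℕₚ.≤-pred (subst (idx W (α (next W x)) <_) e lt)) ]′ q) ]′ (next-idx x)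

-- Sums over C-permutations

_⊻_ : Bool → Bool → Bool
true  ⊻ b = not b
false ⊻ b = b

not-not : ∀ b → not (not b) ≡ b
not-not true  = refl
not-not false = refl

not-⊻ : ∀ a b → a ⊻ not b ≡ not (a ⊻ b)
not-⊻ true  b = refl
not-⊻ false b = refl

⊻-not : ∀ a b → not a ⊻ b ≡ not (a ⊻ b)
⊻-not true  true  = refl
⊻-not true  false = refl
⊻-not false b     = refl

consˡ consʳ : ∀ {A : Set} → A → List A × List A → List A × List A
consˡ x (U , R) = x ∷ U , R
consʳ x (U , R) = U , x ∷ R

-- The ways to split a list into U and R with |U| odd (for true) or even (for false).
paritySplits : ∀ {A : Set} → Bool → List A → List (List A × List A)
paritySplits true  []       = []
paritySplits false []       = ([] , []) ∷ []
paritySplits b     (x ∷ xs) = map (consˡ x) (paritySplits (not b) xs) ++ map (consʳ x) (paritySplits b xs)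

∈-paritySplits : ∀ {A : Set} b (xs : List A) {U R} → (U , R) ∈ paritySplits b xs →
                 U ++ R ↭ xs × (b ≡ true → ∃₂ λ u U′ → U ≡ u ∷ U′)
∈-paritySplits true  []       ()
∈-paritySplits false []       (here refl) = ↭-refl , λ ()
∈-paritySplits b     (x ∷ xs) m with ∈-++⁻ (map (consˡ x) (paritySplits (not b) xs)) (subst (_ ∈_) (eq b) m)
  where
  eq : ∀ b → paritySplits b (x ∷ xs) ≡ map (consˡ x) (paritySplits (not b) xs) ++ map (consʳ x) (paritySplits b xs)
  eq true  = refl
  eq false = refl
... | inj₁ m₁ with ∈-map⁻ (consˡ x) m₁
...   | _ , m′ , refl = ↭.prep x (proj₁ (∈-paritySplits (not b) xs m′)) , λ _ → _ , _ , refl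
∈-paritySplits b     (x ∷ xs) m | inj₂ m₂ with ∈-map⁻ (consʳ x) m₂
...   | (U , R) , m′ , refl = ↭-trans (↭ₚ.shift x U R) (↭.prep x (proj₁ (∈-paritySplits b xs m′))) , proj₂ (∈-paritySplits b xs m′)

split-length : ∀ {A : Set} b (xs : List A) {U R} → (U , R) ∈ paritySplits b xs → length U + length R ≡ length xs
split-length b xs {U} m = trans (sym (Listₚ.length-++ U)) (↭ₚ.↭-length (proj₁ (∈-paritySplits b xs m)))

∑ℕ : ∀ {X : Set} → List X → (X → ℕ) → ℕ
∑ℕ []       f = 0
∑ℕ (x ∷ xs) f = f x + ∑ℕ xs f

∑ℕ-++ : ∀ {X : Set} (xs : List X) {ys} f → ∑ℕ (xs ++ ys) f ≡ ∑ℕ xs f + ∑ℕ ys f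
∑ℕ-++ []       f = refl
∑ℕ-++ (x ∷ xs) f = trans (cong (f x +_) (∑ℕ-++ xs f)) (sym (ℕₚ.+-assoc (f x) _ _))

∑ℕ-map : ∀ {X Y : Set} (h : X → Y) xs f → ∑ℕ (map h xs) f ≡ ∑ℕ xs (f ∘ h)
∑ℕ-map h []       f = refl
∑ℕ-map h (x ∷ xs) f = cong (f (h x) +_) (∑ℕ-map h xs f)

∑ℕ-cong : ∀ {X : Set} (xs : List X) {f g} → (∀ {x} → f x ≡ g x) → ∑ℕ xs f ≡ ∑ℕ xs g
∑ℕ-cong []       eq = refl
∑ℕ-cong (x ∷ xs) eq = cong₂ _+_ eq (∑ℕ-cong xs eq)

ifEven : Bool → ℕ → ℕ
ifEven true  x = 0
ifEven false x = x

-- The sum of t i j over i + j = y with i of the given parity.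
diagonal : Bool → ℕ → (ℕ → ℕ → ℕ) → ℕ
diagonal b zero    t = ifEven b (t 0 0)
diagonal b (suc y) t = ifEven b (t 0 (suc y)) + diagonal (not b) y (t ∘ suc)

diagonal-cong : ∀ b y {s t} → (∀ i j → s i j ≡ t i j) → diagonal b y s ≡ diagonal b y t
diagonal-cong b zero    eq = cong (ifEven b) (eq 0 0)
diagonal-cong b (suc y) eq = cong₂ _+_ (cong (ifEven b) (eq 0 (suc y))) (diagonal-cong (not b) y (eq ∘ suc))

ifEven-* : ∀ b c x → ifEven b (c * x) ≡ c * ifEven b x
ifEven-* true  c x = sym (ℕₚ.*-zeroʳ c)
ifEven-* false c x = refl

-- Pascal's rule: each summand t i j of a longer diagonal is hit with total weight (c + i) + j.
diagonal-pascal : ∀ b y c t →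
  diagonal (not b) y (λ i j → suc (c + i) * t (suc i) j) + diagonal b y (λ i j → suc j * t i (suc j)) + c * ifEven b (t 0 (suc y))
  ≡ (c + suc y) * diagonal b (suc y) t
diagonal-pascal b zero c t
  rewrite ifEven-* (not b) (suc (c + 0)) (t 1 0) | ifEven-* b 1 (t 0 1) = pf (ifEven (not b) (t 1 0)) (ifEven b (t 0 1)) c
  where
  pf : ∀ f e c → suc (c + 0) * f + 1 * e + c * e ≡ (c + 1) * (e + f)
  pf = solve-∀
diagonal-pascal b (suc y) c t
  rewrite ifEven-* (not b) (suc (c + 0)) (t 1 (suc y)) | ifEven-* b (suc (suc y)) (t 0 (suc (suc y))) =
  trans (pf₁ c (ifEven (not b) (t 1 (suc y))) D₁ y (ifEven b (t 0 (suc (suc y)))) D₂)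
    (trans (cong₂ _+_ ih refl) (pf₂ c y (diagonal (not b) (suc y) (t ∘ suc)) (ifEven b (t 0 (suc (suc y))))))
  where
  D₁ = diagonal (not (not b)) y (λ i j → suc (c + suc i) * t (suc (suc i)) j)
  D₂ = diagonal (not b) y (λ i j → suc j * t (suc i) (suc j))
  ih : D₁ + D₂ + suc c * ifEven (not b) (t 1 (suc y)) ≡ (suc c + suc y) * diagonal (not b) (suc y) (t ∘ suc)
  ih = trans (cong (λ z → z + D₂ + suc c * ifEven (not b) (t 1 (suc y)))
         (diagonal-cong (not (not b)) y (λ i j → cong (λ k → suc k * t (suc (suc i)) j) (ℕₚ.+-suc c i))))
       (diagonal-pascal (not b) y (suc c) (t ∘ suc))
  pf₁ : ∀ c f d y e s → suc (c + 0) * f + d + (suc (suc y) * e + s) + c * e ≡ (d + s + suc c * f) + (c + suc (suc y)) * e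
  pf₁ = solve-∀
  pf₂ : ∀ c y f e → (suc c + suc y) * f + (c + suc (suc y)) * e ≡ (c + suc (suc y)) * (e + f)
  pf₂ = solve-∀

∑-paritySplits : ∀ {A : Set} b (Y : List A) t →
  ∑ℕ (paritySplits b Y) (λ (u , U) → length u ! * length U ! * t (length u) (length U)) ≡ length Y ! * diagonal b (length Y) t
∑-paritySplits true  [] t = refl
∑-paritySplits false [] t = pf (t 0 0)
  where
  pf : ∀ a → 1 * 1 * a + 0 ≡ 1 * a
  pf = solve-∀
∑-paritySplits b (x ∷ Y) t = begin
  ∑ℕ (paritySplits b (x ∷ Y)) w
    ≡⟨ trans (unfold b) (trans (∑ℕ-++ (map (consˡ x) (paritySplits (not b) Y)) w)
         (cong₂ _+_ (∑ℕ-map (consˡ x) (paritySplits (not b) Y) w) (∑ℕ-map (consʳ x) (paritySplits b Y) w))) ⟩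
  ∑ℕ (paritySplits (not b) Y) (w ∘ consˡ x) + ∑ℕ (paritySplits b Y) (w ∘ consʳ x)
    ≡⟨ cong₂ _+_
         (trans (∑ℕ-cong (paritySplits (not b) Y) (λ {(u , U)} → pf₁ (length u) (length u !) (length U !) (t (suc (length u)) (length U))))
           (∑-paritySplits (not b) Y (λ i j → suc i * t (suc i) j)))
         (trans (∑ℕ-cong (paritySplits b Y) (λ {(u , U)} → pf₂ (length U) (length u !) (length U !) (t (length u) (suc (length U)))))
           (∑-paritySplits b Y (λ i j → suc j * t i (suc j)))) ⟩
  y ! * D₁ + y ! * D₂
    ≡⟨ sym (ℕₚ.*-distribˡ-+ (y !) D₁ D₂) ⟩
  y ! * (D₁ + D₂)
    ≡⟨ cong (y ! *_) (trans (sym (ℕₚ.+-identityʳ _)) (diagonal-pascal b y 0 t)) ⟩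
  y ! * (suc y * diagonal b (suc y) t)
    ≡⟨ pf₃ (y !) (suc y) (diagonal b (suc y) t) ⟩
  suc y ! * diagonal b (suc y) t ∎
  where
  open ≡-Reasoning
  y = length Y
  w : List _ × List _ → ℕ
  w (u , U) = length u ! * length U ! * t (length u) (length U)
  D₁ = diagonal (not b) y (λ i j → suc i * t (suc i) j)
  D₂ = diagonal b y (λ i j → suc j * t i (suc j))
  unfold : ∀ b → ∑ℕ (paritySplits b (x ∷ Y)) w ≡ ∑ℕ (map (consˡ x) (paritySplits (not b) Y) ++ map (consʳ x) (paritySplits b Y)) w
  unfold true  = refl
  unfold false = refl
  pf₁ : ∀ i p q s → (suc i * p) * q * s ≡ p * q * (suc i * s)
  pf₁ = solve-∀
  pf₂ : ∀ j p q s → p * (suc j * q) * s ≡ p * q * (suc j * s)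
  pf₂ = solve-∀
  pf₃ : ∀ f s d → f * (s * d) ≡ s * f * d
  pf₃ = solve-∀

-- The number of C-permutations of a set with k elements.
#C : ℕ → ℕ
#C zero    = 1
#C (suc k) = 2 * suc k !

private
  ratio : ℕ → ℕ
  ratio zero    = 1
  ratio (suc j) = 2

  #C-ratio : ∀ j → #C j ≡ j ! * ratio j
  #C-ratio zero    = refl
  #C-ratio (suc j) = ℕₚ.*-comm 2 (suc j !)

  diagonal-ratio : ∀ y → diagonal false y (λ _ → ratio) ≡ suc y × diagonal true y (λ _ → ratio) ≡ y
  diagonal-ratio zero    = refl , refl
  diagonal-ratio (suc y) = let e , o = diagonal-ratio y in cong (2 +_) o , e

#C-suc : ∀ {A : Set} (Y : List A) →
         ∑ℕ (paritySplits false Y) (λ (u , U) → 2 * length u ! * #C (length U)) ≡ #C (suc (length Y))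
#C-suc Y = begin
  ∑ℕ (paritySplits false Y) (λ (u , U) → 2 * length u ! * #C (length U))
    ≡⟨ ∑ℕ-cong (paritySplits false Y) (λ {(u , U)} → trans (cong (2 * length u ! *_) (#C-ratio (length U)))
         (pf (length u !) (length U !) (ratio (length U)))) ⟩
  ∑ℕ (paritySplits false Y) (λ (u , U) → length u ! * length U ! * (2 * ratio (length U)))
    ≡⟨ ∑-paritySplits false Y (λ _ j → 2 * ratio j) ⟩
  length Y ! * diagonal false (length Y) (λ _ j → 2 * ratio j)
    ≡⟨ cong (length Y ! *_) (trans (double (length Y) false (λ _ → ratio)) (cong (2 *_) (proj₁ (diagonal-ratio (length Y))))) ⟩
  length Y ! * (2 * suc (length Y))
    ≡⟨ pf′ (length Y !) (suc (length Y)) ⟩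
  2 * suc (length Y) ! ∎
  where
  open ≡-Reasoning
  pf : ∀ p q r → 2 * p * (q * r) ≡ p * q * (2 * r)
  pf = solve-∀
  pf′ : ∀ f s → f * (2 * s) ≡ 2 * (s * f)
  pf′ = solve-∀
  double : ∀ y b t → diagonal b y (λ i j → 2 * t i j) ≡ 2 * diagonal b y t
  double zero    b t = ifEven-* b 2 (t 0 0)
  double (suc y) b t = trans (cong₂ _+_ (ifEven-* b 2 (t 0 (suc y))) (double y (not b) (t ∘ suc)))
    (sym (ℕₚ.*-distribˡ-+ 2 (ifEven b (t 0 (suc y))) _))

module CSum (A : Set) (𝒮 : Setoid 0ℓ 0ℓ) where
  open Multiset 𝒮

  ∑ᵖ : Bool → List A → (List A → List A → List Col) → List Col
  ∑ᵖ b V f = ∑ (paritySplits b V) (λ (U , R) → f U R)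

  ∑ᵖ-∷ : ∀ b x V f → ∑ᵖ b (x ∷ V) f ≡ ∑ᵖ (not b) V (λ U R → f (x ∷ U) R) ++ ∑ᵖ b V (λ U R → f U (x ∷ R))
  ∑ᵖ-∷ true  x V f = trans (∑-++ˡ (map (consˡ x) (paritySplits false V)) _)
    (cong₂ _++_ (∑-map (consˡ x) (paritySplits false V) _) (∑-map (consʳ x) (paritySplits true V) _))
  ∑ᵖ-∷ false x V f = trans (∑-++ˡ (map (consˡ x) (paritySplits true V)) _)
    (cong₂ _++_ (∑-map (consˡ x) (paritySplits true V) _) (∑-map (consʳ x) (paritySplits false V) _))

  ∑ᵖ-cong : ∀ b V {f g} → (∀ U R → (U , R) ∈ paritySplits b V → f U R ≅ g U R) → ∑ᵖ b V f ≅ ∑ᵖ b V g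
  ∑ᵖ-cong b V eq = ∑-cong (paritySplits b V) (λ {(U , R)} m → eq U R m)

  ∑ᵖ-++ : ∀ b V f g → ∑ᵖ b V (λ U R → f U R ++ g U R) ≅ ∑ᵖ b V f ++ ∑ᵖ b V g
  ∑ᵖ-++ b V f g = ∑-++ (paritySplits b V) _ _

  ∑ᵖ-exchange : ∀ a b V (F : List A → List A → List A → List Col) →
    ∑ᵖ a V (λ u R → ∑ᵖ b R (λ U R′ → F u U R′)) ≅ ∑ᵖ b V (λ U R → ∑ᵖ a R (λ u R′ → F u U R′))
  ∑ᵖ-exchange true  true  [] F = ≅-refl
  ∑ᵖ-exchange true  false [] F = ≅-refl
  ∑ᵖ-exchange false true  [] F = ≅-refl
  ∑ᵖ-exchange false false [] F = ≅-refl
  ∑ᵖ-exchange a b (x ∷ V) F = ≅-trans (expand a b F)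
    (≅-trans (++-cong (∑ᵖ-exchange (not a) b V (λ u → F (x ∷ u)))
               (++-cong (∑ᵖ-exchange a (not b) V (λ u U → F u (x ∷ U))) (∑ᵖ-exchange a b V (λ u U R → F u U (x ∷ R)))))
      (≅-trans (++-swap (∑ᵖ b V (λ U R → ∑ᵖ (not a) R (λ u → F (x ∷ u) U))) (∑ᵖ (not b) V (λ U R → ∑ᵖ a R (λ u → F u (x ∷ U)))) _)
        (≅-sym (expand b a (λ U u → F u U)))))
    where
    expand : ∀ a b F → ∑ᵖ a (x ∷ V) (λ u R → ∑ᵖ b R (F u)) ≅
      ∑ᵖ (not a) V (λ u R → ∑ᵖ b R (F (x ∷ u))) ++
      (∑ᵖ a V (λ u R → ∑ᵖ (not b) R (λ U → F u (x ∷ U))) ++ ∑ᵖ a V (λ u R → ∑ᵖ b R (λ U R′ → F u U (x ∷ R′))))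
    expand a b F = ≅-trans (≅-reflexive (∑ᵖ-∷ a x V (λ u R → ∑ᵖ b R (F u))))
      (++-cong {∑ᵖ (not a) V (λ u R → ∑ᵖ b R (F (x ∷ u)))} ≅-refl
        (≅-trans (∑ᵖ-cong a V (λ u R _ → ≅-reflexive (∑ᵖ-∷ b x R (F u)))) (∑ᵖ-++ a V _ _)))

  ∑ᵖ-assoc : ∀ a b V (F : List A → List A → List A → List Col) →
    ∑ᵖ a V (λ u R → ∑ᵖ b R (λ U R′ → F u U R′)) ≅ ∑ᵖ (a ⊻ b) V (λ Y R′ → ∑ᵖ a Y (λ u U → F u U R′))
  ∑ᵖ-assoc true  true  [] F = ≅-refl
  ∑ᵖ-assoc true  false [] F = ≅-refl
  ∑ᵖ-assoc false true  [] F = ≅-refl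
  ∑ᵖ-assoc false false [] F = ≅-refl
  ∑ᵖ-assoc a b (x ∷ V) F = ≅-trans
    (≅-trans (≅-reflexive (∑ᵖ-∷ a x V (λ u R → ∑ᵖ b R (F u))))
      (++-cong (≅-trans (∑ᵖ-assoc (not a) b V (λ u → F (x ∷ u))) (≅-reflexive (cong (λ p → ∑ᵖ p V (λ Y R′ → ∑ᵖ (not a) Y (λ u U → F (x ∷ u) U R′))) (⊻-not a b))))
        (≅-trans (∑ᵖ-cong a V (λ u R _ → ≅-reflexive (∑ᵖ-∷ b x R (F u))))
          (≅-trans (∑ᵖ-++ a V _ _)
            (++-cong (≅-trans (∑ᵖ-assoc a (not b) V (λ u U → F u (x ∷ U))) (≅-reflexive (cong (λ p → ∑ᵖ p V (λ Y R′ → ∑ᵖ a Y (λ u U → F u (x ∷ U) R′))) (not-⊻ a b))))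
              (∑ᵖ-assoc a b V (λ u U R → F u U (x ∷ R))))))))
    (≅-sym (≅-trans (≅-reflexive (∑ᵖ-∷ (a ⊻ b) x V _))
      (≅-trans (++-cong (≅-trans (∑ᵖ-cong (not (a ⊻ b)) V (λ Y R′ _ → ≅-reflexive (∑ᵖ-∷ a x Y (λ u U → F u U R′)))) (∑ᵖ-++ (not (a ⊻ b)) V _ _))
                 (≅-refl {∑ᵖ (a ⊻ b) V (λ Y R′ → ∑ᵖ a Y (λ u U → F u U (x ∷ R′)))}))
        (≅-reflexive (Listₚ.++-assoc (∑ᵖ (not (a ⊻ b)) V (λ Y R′ → ∑ᵖ (not a) Y (λ u U → F (x ∷ u) U R′))) _ _)))))

  ·-comm : ∀ j k xs → j · k · xs ≡ k · j · xs
  ·-comm j k xs = trans (sym (*-· j k xs)) (trans (cong (_· xs) (ℕₚ.*-comm j k)) (*-· k j xs))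

  ∑ᵖ-· : ∀ k b V f → ∑ᵖ b V (λ U R → k · f U R) ≅ k · ∑ᵖ b V f
  ∑ᵖ-· k b V f = ∑-· k (paritySplits b V) _

  -- The sum of f over the partitions of V into odd blocks, a block of size k counting 2 (k - 1)! times.
  -- The first argument bounds the length of V.
  ∑ᶜ : ℕ → List A → (List (List A) → List Col) → List Col
  ∑ᶜ _       []      f = f []
  ∑ᶜ zero    (v ∷ V) f = []
  ∑ᶜ (suc k) (v ∷ V) f = ∑ᵖ false V (λ u R → (2 * length u !) · ∑ᶜ k R (λ P → f ((v ∷ u) ∷ P)))

  ∑ᶜ-cong : ∀ k V {f h} → (∀ P → f P ≅ h P) → ∑ᶜ k V f ≅ ∑ᶜ k V h
  ∑ᶜ-cong k       []      eq = eq []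
  ∑ᶜ-cong zero    (v ∷ V) eq = ≅-refl
  ∑ᶜ-cong (suc k) (v ∷ V) eq = ∑ᵖ-cong false V (λ u R _ → ·-cong (2 * length u !) (∑ᶜ-cong k R (λ P → eq _)))

  ∑ᶜ-++ : ∀ k V f h → ∑ᶜ k V (λ P → f P ++ h P) ≅ ∑ᶜ k V f ++ ∑ᶜ k V h
  ∑ᶜ-++ k       []      f h = ≅-refl
  ∑ᶜ-++ zero    (v ∷ V) f h = ≅-refl
  ∑ᶜ-++ (suc k) (v ∷ V) f h = ≅-trans
    (∑ᵖ-cong false V (λ u R _ → ≅-trans (·-cong (2 * length u !) (∑ᶜ-++ k R (λ P → f ((v ∷ u) ∷ P)) (λ P → h ((v ∷ u) ∷ P))))
      (·-++ (2 * length u !) _ _)))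
    (∑ᵖ-++ false V _ _)

  rest-length : ∀ b V {U R : List A} {k} → length V ≤ k → (U , R) ∈ paritySplits b V → length R ≤ k
  rest-length b V {U} {R} le m = ℕₚ.≤-trans (ℕₚ.m≤n+m (length R) (length U)) (ℕₚ.≤-trans (ℕₚ.≤-reflexive (split-length b V m)) le)

  ∑ᶜ-fuel : ∀ k V f → length V ≤ k → ∑ᶜ (suc k) V f ≅ ∑ᶜ k V f
  ∑ᶜ-fuel k       []      f le       = ≅-refl
  ∑ᶜ-fuel (suc k) (v ∷ V) f (s≤s le) =
    ∑ᵖ-cong false V (λ u R m → ·-cong (2 * length u !) (∑ᶜ-fuel k R _ (rest-length false V le m)))

  ∑-weights : ∀ {X : Set} (xs : List X) (w : X → ℕ) m → ∑ xs (λ x → w x · m) ≡ ∑ℕ xs w · m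
  ∑-weights []       w m = refl
  ∑-weights (x ∷ xs) w m = trans (cong (w x · m ++_) (∑-weights xs w m)) (sym (+-· (w x) (∑ℕ xs w) m))

  -- Merging an odd (or even) number of cycles of a C-permutation of V produces each C-permutation
  -- of a complement of U together with U as often as there are C-permutations of U.
  ∑ᶜ-merge : ∀ b k V (g : List A → List (List A) → List Col) → (∀ {U U′} P → U ↭ U′ → g U P ≅ g U′ P) → length V ≤ k →
    ∑ᶜ k V (λ P → ∑ (paritySplits b P) (λ (S , R) → g (concat S) R)) ≅ ∑ᵖ b V (λ U R → #C (length U) · ∑ᶜ k R (g U))
  ∑ᶜ-merge true  k       [] g resp le = ≅-refl
  ∑ᶜ-merge false k       [] g resp le = ≅-reflexive (cong (_++ []) (sym (Listₚ.++-identityʳ (g [] []))))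
  ∑ᶜ-merge b (suc k) (v ∷ V) g resp (s≤s le) = ≅-trans
    (≅-trans (∑ᵖ-cong false V (λ u R m → ≅-trans (·-cong (2 * length u !) (inner-split u R (rest-length false V le m))) (·-++ (2 * length u !) _ _)))
      (∑ᵖ-++ false V _ _))
    (≅-trans (++-cong joins avoids) (≅-sym (≅-reflexive (∑ᵖ-∷ b v V _))))
    where
    F₁ F₂ : List A → List A → List A → List Col
    F₁ u U R = (2 * length u !) · #C (length U) · ∑ᶜ k R (g ((v ∷ u) ++ U))
    F₂ u U R = (2 * length u !) · #C (length U) · ∑ᶜ k R (λ P → g U ((v ∷ u) ∷ P))
    parity-∷ : ∀ b c P (h : List (List A) → List (List A) → List Col) → ∑ (paritySplits b (c ∷ P)) (λ (S , R) → h S R) ≡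
      ∑ (paritySplits (not b) P) (λ (S , R) → h (c ∷ S) R) ++ ∑ (paritySplits b P) (λ (S , R) → h S (c ∷ R))
    parity-∷ true  c P h = trans (∑-++ˡ (map (consˡ c) (paritySplits false P)) _)
      (cong₂ _++_ (∑-map (consˡ c) (paritySplits false P) _) (∑-map (consʳ c) (paritySplits true P) _))
    parity-∷ false c P h = trans (∑-++ˡ (map (consˡ c) (paritySplits true P)) _)
      (cong₂ _++_ (∑-map (consˡ c) (paritySplits true P) _) (∑-map (consʳ c) (paritySplits false P) _))
    inner-split : ∀ u R → length R ≤ k →
      ∑ᶜ k R (λ P → ∑ (paritySplits b ((v ∷ u) ∷ P)) (λ (S , R) → g (concat S) R)) ≅
      ∑ᵖ (not b) R (λ U R → #C (length U) · ∑ᶜ k R (g ((v ∷ u) ++ U))) ++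
      ∑ᵖ b R (λ U R → #C (length U) · ∑ᶜ k R (λ P → g U ((v ∷ u) ∷ P)))
    inner-split u R leR = ≅-trans (∑ᶜ-cong k R (λ P → ≅-reflexive (parity-∷ b (v ∷ u) P (λ S R → g (concat S) R))))
      (≅-trans (∑ᶜ-++ k R _ _) (++-cong
        (∑ᶜ-merge (not b) k R (λ U P → g ((v ∷ u) ++ U) P) (λ P p → resp P (↭ₚ.++⁺ˡ (v ∷ u) p)) leR)
        (∑ᶜ-merge b k R (λ U P → g U ((v ∷ u) ∷ P)) (λ P p → resp _ p) leR)))
    joins : ∑ᵖ false V (λ u R → (2 * length u !) · ∑ᵖ (not b) R (λ U R → #C (length U) · ∑ᶜ k R (g ((v ∷ u) ++ U)))) ≅
            ∑ᵖ (not b) V (λ Y R → #C (suc (length Y)) · ∑ᶜ (suc k) R (g (v ∷ Y)))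
    joins = ≅-trans (∑ᵖ-cong false V (λ u R _ → ≅-sym (∑ᵖ-· (2 * length u !) (not b) R _)))
      (≅-trans (∑ᵖ-assoc false (not b) V F₁)
        (∑ᵖ-cong (not b) V (λ Y R m → ≅-trans
          (∑ᵖ-cong false Y (λ u U m′ → ≅-trans
            (≅-reflexive (sym (*-· (2 * length u !) (#C (length U)) _)))
            (·-cong (2 * length u ! * #C (length U)) (∑ᶜ-cong k R (λ P → resp P (↭.prep v (proj₁ (∈-paritySplits false Y m′))))))))
          (≅-trans (≅-reflexive (trans (∑-weights (paritySplits false Y) (λ (u , U) → 2 * length u ! * #C (length U)) (∑ᶜ k R (g (v ∷ Y))))
              (cong (_· ∑ᶜ k R (g (v ∷ Y))) (#C-suc Y))))
            (·-cong (#C (suc (length Y))) (≅-sym (∑ᶜ-fuel k R _ (rest-length (not b) V le m))))))))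
    avoids : ∑ᵖ false V (λ u R → (2 * length u !) · ∑ᵖ b R (λ U R → #C (length U) · ∑ᶜ k R (λ P → g U ((v ∷ u) ∷ P)))) ≅
             ∑ᵖ b V (λ U R → #C (length U) · ∑ᶜ (suc k) (v ∷ R) (g U))
    avoids = ≅-trans (∑ᵖ-cong false V (λ u R _ → ≅-sym (∑ᵖ-· (2 * length u !) b R _)))
      (≅-trans (∑ᵖ-exchange false b V F₂)
        (∑ᵖ-cong b V (λ U R _ → ≅-trans
          (∑ᵖ-cong false R (λ u R′ _ → ≅-reflexive (·-comm (2 * length u !) (#C (length U)) _)))
          (∑ᵖ-· (#C (length U)) false R _))))

  -- Marking an element singles out its cycle.
  ∑ᶜ-mark : ∀ k V (f : List (List A) → List Col) → (∀ {P P′} → P ↭ P′ → f P ≅ f P′) → length V ≤ k →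
    length V · ∑ᶜ k V f ≅ ∑ᵖ true V (λ U R → (2 * length U !) · ∑ᶜ k R (λ P → f (U ∷ P)))
  ∑ᶜ-mark k       []      f resp le = ≅-refl
  ∑ᶜ-mark (suc k) (v ∷ V) f resp (s≤s le) = ≅-trans
    (≅-trans (≅-sym (∑ᵖ-· (suc (length V)) false V _))
      (≅-trans (∑ᵖ-cong false V (λ u R m → distribute u R m)) (∑ᵖ-++ false V _ _)))
    (≅-trans (++-cong own apart) (≅-sym (≅-reflexive (∑ᵖ-∷ true v V _))))
    where
    distribute : ∀ u R → (u , R) ∈ paritySplits false V →
      suc (length V) · (2 * length u !) · ∑ᶜ k R (λ P → f ((v ∷ u) ∷ P)) ≅
      (2 * suc (length u) !) · ∑ᶜ k R (λ P → f ((v ∷ u) ∷ P)) ++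
      (2 * length u !) · ∑ᵖ true R (λ U R → (2 * length U !) · ∑ᶜ k R (λ P → f ((v ∷ u) ∷ U ∷ P)))
    distribute u R m = ≅-trans
      (≅-reflexive (trans (cong (λ i → i · (2 * length u !) · X) (cong suc (sym (split-length false V m))))
        (trans (+-· (suc (length u)) (length R) _) (cong₂ _++_
          (trans (sym (*-· (suc (length u)) (2 * length u !) X)) (cong (_· X) (pf (suc (length u)) (length u !))))
          (·-comm (length R) (2 * length u !) X)))))
      (++-cong {(2 * suc (length u) !) · X} ≅-refl (·-cong (2 * length u !)
        (∑ᶜ-mark k R (λ P → f ((v ∷ u) ∷ P)) (λ p → resp (↭.prep (v ∷ u) p)) (rest-length false V le m))))
      where
      X = ∑ᶜ k R (λ P → f ((v ∷ u) ∷ P))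
      pf : ∀ s q → s * (2 * q) ≡ 2 * (s * q)
      pf = solve-∀
    own : ∑ᵖ false V (λ u R → (2 * suc (length u) !) · ∑ᶜ k R (λ P → f ((v ∷ u) ∷ P))) ≅
          ∑ᵖ false V (λ u R → (2 * suc (length u) !) · ∑ᶜ (suc k) R (λ P → f ((v ∷ u) ∷ P)))
    own = ∑ᵖ-cong false V (λ u R m → ·-cong (2 * suc (length u) !) (≅-sym (∑ᶜ-fuel k R _ (rest-length false V le m))))
    F : List A → List A → List A → List Col
    F u U R = (2 * length u !) · (2 * length U !) · ∑ᶜ k R (λ P → f ((v ∷ u) ∷ U ∷ P))
    apart : ∑ᵖ false V (λ u R → (2 * length u !) · ∑ᵖ true R (λ U R → (2 * length U !) · ∑ᶜ k R (λ P → f ((v ∷ u) ∷ U ∷ P)))) ≅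
            ∑ᵖ true V (λ U R → (2 * length U !) · ∑ᶜ (suc k) (v ∷ R) (λ P → f (U ∷ P)))
    apart = ≅-trans (∑ᵖ-cong false V (λ u R _ → ≅-sym (∑ᵖ-· (2 * length u !) true R _)))
      (≅-trans (∑ᵖ-exchange false true V F)
        (∑ᵖ-cong true V (λ U R _ → ≅-trans
          (∑ᵖ-cong false R (λ u R′ _ → ≅-trans (≅-reflexive (·-comm (2 * length u !) (2 * length U !) _))
            (·-cong (2 * length U !) (·-cong (2 * length u !) (∑ᶜ-cong k R′ (λ P → resp (↭.swap (v ∷ u) U ↭-refl)))))))
          (∑ᵖ-· (2 * length U !) false R _))))

  ∑ᶜ-eigen : ∀ k V (f : List (List A) → List Col) → (∀ {P P′} → P ↭ P′ → f P ≅ f P′) →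
    (∀ {U U′} P → U ↭ U′ → f (U ∷ P) ≅ f (U′ ∷ P)) → length V ≤ k →
    length V · ∑ᶜ k V f ≅ ∑ᶜ k V (λ P → ∑ (paritySplits true P) (f ∘ mergeFirst))
  ∑ᶜ-eigen k V f resp resp′ le = ≅-trans (∑ᶜ-mark k V f resp le)
    (≅-trans (∑ᵖ-cong true V (λ U R m → ≅-reflexive (cong (_· ∑ᶜ k R (λ P → f (U ∷ P))) (odd U (proj₂ (∈-paritySplits true V m) refl)))))
      (≅-sym (∑ᶜ-merge true k V (λ U P → f (U ∷ P)) resp′ le)))
    where
    odd : ∀ U → (∃₂ λ u U′ → U ≡ u ∷ U′) → 2 * length U ! ≡ #C (length U)
    odd U (_ , _ , refl) = refl

  ∑-over-∑ᶜ : ∀ k V f (h : Col → List Col) → ∑ (∑ᶜ k V f) h ≅ ∑ᶜ k V (λ P → ∑ (f P) h)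
  ∑-over-∑ᶜ k       []      f h = ≅-refl
  ∑-over-∑ᶜ zero    (v ∷ V) f h = ≅-refl
  ∑-over-∑ᶜ (suc k) (v ∷ V) f h = ≅-trans (≅-reflexive (∑-over-∑ (paritySplits false V) _ h))
    (∑ᵖ-cong false V (λ u R _ → ≅-trans (≅-reflexive (∑-over-· (2 * length u !) _ h))
      (·-cong (2 * length u !) (∑-over-∑ᶜ k R (λ P → f ((v ∷ u) ∷ P)) h))))

-- Uniqueness of solutions of the merging equation

module Labelled (N : ℕ) (root : Fin N) where

  -- A matching of the half-edges, as the vector of its values, with a partition into vertices.
  LGraph : Set
  LGraph = Vec (Fin N) N × List (List (Fin N))

  infix 3 _≃_

  record _≃_ (G H : LGraph) : Set where
    constructor iso
    field
      to from   : Fin N → Fin N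
      to∘from   : ∀ x → to (from x) ≡ x
      from∘to   : ∀ x → from (to x) ≡ x
      root-fix  : to root ≡ root
      commutes  : ∀ x → to (lookup (proj₁ G) x) ≡ lookup (proj₁ H) (to x)
      blocks    : map (map to) (proj₂ G) ≋ proj₂ H

  ≃-of-≋ : ∀ {v cs ds} → cs ≋ ds → (v , cs) ≃ (v , ds)
  ≃-of-≋ {cs = cs} p = iso id id (λ _ → refl) (λ _ → refl) refl (λ _ → refl)
    (Homo.trans (≋-reflexive (trans (Listₚ.map-cong Listₚ.map-id cs) (Listₚ.map-id cs))) p)

  ≃-sym : ∀ {G H} → G ≃ H → H ≃ G
  ≃-sym {v , cs} {w , ds} (iso t f tf ft r c b) = iso f t ft tf
    (trans (cong f (sym r)) (ft root))
    (λ x → trans (cong f (trans (cong (lookup w) (sym (tf x))) (sym (c (f x))))) (ft _))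
    (≋-sym (Homo.trans (≋-reflexive (sym (trans (sym (Listₚ.map-∘ cs))
      (trans (Listₚ.map-cong (λ c → trans (sym (Listₚ.map-∘ c)) (trans (Listₚ.map-cong ft c) (Listₚ.map-id c))) cs) (Listₚ.map-id cs)))))
      (≋-map f b)))

  ≃-trans : ∀ {G H I} → G ≃ H → H ≃ I → G ≃ I
  ≃-trans {_ , cs} (iso t f tf ft r c b) (iso t′ f′ tf′ ft′ r′ c′ b′) = iso (t′ ∘ t) (f ∘ f′)
    (λ x → trans (cong t′ (tf (f′ x))) (tf′ x)) (λ x → trans (cong f (ft′ (t x))) (ft x))
    (trans (cong t′ r) r′) (λ x → trans (cong t′ (c x)) (c′ (t x)))
    (Homo.trans (≋-reflexive (trans (Listₚ.map-cong Listₚ.map-∘ cs) (Listₚ.map-∘ cs))) (Homo.trans (≋-map t′ b) b′))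

  labelled : Setoid 0ℓ 0ℓ
  labelled = record { Carrier = LGraph ; _≈_ = _≃_
    ; isEquivalence = record { refl = ≃-of-≋ ≋-refl ; sym = ≃-sym ; trans = ≃-trans } }

  open Multiset labelled public

  ∑-≅ : ∀ {xs ys} (f : LGraph → List LGraph) → (∀ {x y} → x ≃ y → f x ≅ f y) → xs ≅ ys → ∑ xs f ≅ ∑ ys f
  ∑-≅ f resp (Homo.refl ps) = pointwise ps
    where
    pointwise : ∀ {xs ys} → Pointwise _≃_ xs ys → ∑ xs f ≅ ∑ ys f
    pointwise []       = ≅-refl
    pointwise (p ∷ ps) = ++-cong (resp p) (pointwise ps)
  ∑-≅ f resp (Homo.prep p q)   = ++-cong (resp p) (∑-≅ f resp q)
  ∑-≅ f resp (Homo.swap {x = x} {y} p q r) =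
    ≅-trans (++-swap (f x) (f y) _) (++-cong (resp q) (++-cong (resp p) (∑-≅ f resp r)))
  ∑-≅ f resp (Homo.trans p q)  = ≅-trans (∑-≅ f resp p) (∑-≅ f resp q)

  private
    Blocks : Set
    Blocks = List (List (Fin N))

    Resp : (Blocks × Blocks → List LGraph) → Set
    Resp h = ∀ {S S′ R R′} → S ≋ S′ → R ≋ R′ → h (S , R) ≅ h (S′ , R′)

    resp-l : ∀ (c : List (Fin N)) {h} → Resp h → Resp (h ∘ consˡ c)
    resp-l c r p q = r (Homo.prep ↭-refl p) q
    resp-r : ∀ (c : List (Fin N)) {h} → Resp h → Resp (h ∘ consʳ c)
    resp-r c r p q = r p (Homo.prep ↭-refl q)

    ∑-splits-∷ : ∀ k (c : List (Fin N)) cs (h : Blocks × Blocks → List LGraph) → ∑ (splits (suc k) (c ∷ cs)) h ≡ ∑ (splits k cs) (h ∘ consˡ c) ++ ∑ (splits (suc k) cs) (h ∘ consʳ c)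
    ∑-splits-∷ k c cs h = trans (∑-++ˡ (map (consˡ c) (splits k cs)) h)
      (cong₂ _++_ (∑-map (consˡ c) (splits k cs) h) (∑-map (consʳ c) (splits (suc k) cs) h))

  ∑-splits-≋ : ∀ k {cs ds : Blocks} (h : Blocks × Blocks → List LGraph) → Resp h → cs ≋ ds → ∑ (splits k cs) h ≅ ∑ (splits k ds) h
  ∑-splits-≋ zero    h r p = ++-cong (r ≋-refl p) ≅-refl
  ∑-splits-≋ (suc k) h r (Homo.refl []) = ≅-refl
  ∑-splits-≋ (suc k) {c ∷ cs} {d ∷ ds} h r (Homo.refl (p ∷ ps)) = ≅-trans (≅-reflexive (∑-splits-∷ k c cs h))
    (≅-trans (++-cong
      (≅-trans (∑-splits-≋ k (h ∘ consˡ c) (resp-l c r) (Homo.refl ps)) (∑-cong (splits k ds) (λ _ → r (Homo.prep p ≋-refl) ≋-refl)))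
      (≅-trans (∑-splits-≋ (suc k) (h ∘ consʳ c) (resp-r c r) (Homo.refl ps)) (∑-cong (splits (suc k) ds) (λ _ → r ≋-refl (Homo.prep p ≋-refl)))))
    (≅-reflexive (sym (∑-splits-∷ k d ds h))))
  ∑-splits-≋ (suc k) {c ∷ cs} {d ∷ ds} h r (Homo.prep p q) = ≅-trans (≅-reflexive (∑-splits-∷ k c cs h))
    (≅-trans (++-cong
      (≅-trans (∑-splits-≋ k (h ∘ consˡ c) (resp-l c r) q) (∑-cong (splits k ds) (λ _ → r (Homo.prep p ≋-refl) ≋-refl)))
      (≅-trans (∑-splits-≋ (suc k) (h ∘ consʳ c) (resp-r c r) q) (∑-cong (splits (suc k) ds) (λ _ → r ≋-refl (Homo.prep p ≋-refl)))))
    (≅-reflexive (sym (∑-splits-∷ k d ds h))))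
  ∑-splits-≋ (suc k) h r (Homo.trans p q) = ≅-trans (∑-splits-≋ (suc k) h r p) (∑-splits-≋ (suc k) h r q)
  ∑-splits-≋ (suc k) {x ∷ y ∷ cs} {y′ ∷ x′ ∷ ds} h r (Homo.swap p q s) =
    ≅-trans (≅-trans (≅-reflexive (∑-splits-∷ k x (y ∷ cs) h)) (++-cong {∑ (splits k (y ∷ cs)) (h ∘ consˡ x)} ≅-refl (≅-reflexive (∑-splits-∷ k y cs (h ∘ consʳ x)))))
    (≅-trans (middle k)
    (≅-sym (≅-trans (≅-reflexive (∑-splits-∷ k y′ (x′ ∷ ds) h)) (++-cong {∑ (splits k (x′ ∷ ds)) (h ∘ consˡ y′)} ≅-refl (≅-reflexive (∑-splits-∷ k x′ ds (h ∘ consʳ y′)))))))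
    where
    lr : ∀ k → ∑ (splits k cs) (h ∘ consʳ x ∘ consˡ y) ≅ ∑ (splits k ds) (h ∘ consˡ y′ ∘ consʳ x′)
    lr k = ≅-trans (∑-splits-≋ k _ (resp-l y (resp-r x r)) s) (∑-cong (splits k ds) (λ _ → r (Homo.prep q ≋-refl) (Homo.prep p ≋-refl)))
    rl : ∀ k → ∑ (splits k cs) (h ∘ consˡ x ∘ consʳ y) ≅ ∑ (splits k ds) (h ∘ consʳ y′ ∘ consˡ x′)
    rl k = ≅-trans (∑-splits-≋ k _ (resp-r y (resp-l x r)) s) (∑-cong (splits k ds) (λ _ → r (Homo.prep p ≋-refl) (Homo.prep q ≋-refl)))
    rr : ∀ k → ∑ (splits k cs) (h ∘ consʳ x ∘ consʳ y) ≅ ∑ (splits k ds) (h ∘ consʳ y′ ∘ consʳ x′)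
    rr k = ≅-trans (∑-splits-≋ k _ (resp-r y (resp-r x r)) s) (∑-cong (splits k ds) (λ _ → r ≋-refl (Homo.swap p q ≋-refl)))
    ll : ∀ k → ∑ (splits k cs) (h ∘ consˡ x ∘ consˡ y) ≅ ∑ (splits k ds) (h ∘ consˡ y′ ∘ consˡ x′)
    ll k = ≅-trans (∑-splits-≋ k _ (resp-l y (resp-l x r)) s) (∑-cong (splits k ds) (λ _ → r (Homo.swap p q ≋-refl) ≋-refl))
    middle : ∀ k → ∑ (splits k (y ∷ cs)) (h ∘ consˡ x) ++ (∑ (splits k cs) (h ∘ consʳ x ∘ consˡ y) ++ ∑ (splits (suc k) cs) (h ∘ consʳ x ∘ consʳ y)) ≅
                   ∑ (splits k (x′ ∷ ds)) (h ∘ consˡ y′) ++ (∑ (splits k ds) (h ∘ consʳ y′ ∘ consˡ x′) ++ ∑ (splits (suc k) ds) (h ∘ consʳ y′ ∘ consʳ x′))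
    middle zero = ≅-trans (++-swap (∑ (splits 0 (y ∷ cs)) (h ∘ consˡ x)) (∑ (splits 0 cs) (h ∘ consʳ x ∘ consˡ y)) _)
      (++-cong (lr 0) (++-cong (rl 0) (rr 1)))
    middle (suc k) = ≅-trans (++-cong (≅-reflexive (∑-splits-∷ k y cs (h ∘ consˡ x))) ≅-refl)
      (≅-trans (≅-trans (++-exchange (∑ (splits k cs) (h ∘ consˡ x ∘ consˡ y)) (∑ (splits (suc k) cs) (h ∘ consˡ x ∘ consʳ y)) _ _)
        (++-cong (++-cong (ll k) (lr (suc k))) (++-cong (rl (suc k)) (rr (suc (suc k))))))
      (++-cong (≅-reflexive (sym (∑-splits-∷ k x′ ds (h ∘ consˡ y′)))) ≅-refl))

  mergesOf : ℕ → LGraph → List LGraph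
  mergesOf k (v , cs) = map (λ s → v , mergeFirst s) (splits k cs)

  mergeFirst-≋ : ∀ {A : Set} {S S′ R R′ : List (List A)} → S ≋ S′ → R ≋ R′ → mergeFirst (S , R) ≋ mergeFirst (S′ , R′)
  mergeFirst-≋ p q = Homo.prep (concat-≋ p) q

  mergesOf-≃ : ∀ k {G H} → G ≃ H → mergesOf k G ≅ mergesOf k H
  mergesOf-≃ k {v , cs} {w , ds} (iso t f tf ft r c b) = ≅-trans
    (map-cong-∈ (splits k cs) (λ {(S , R)} _ → iso t f tf ft r c (≋-reflexive (cong (_∷ map (map t) R) (sym (Listₚ.concat-map S))))))
    (≅-trans (≅-reflexive (trans (Listₚ.map-∘ (splits k cs)) (trans (cong (map (λ s → w , mergeFirst s)) (sym (splits-map (map t) k cs)))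
        (sym (∑-singleton (splits k (map (map t) cs)) (λ s → w , mergeFirst s))))))
      (≅-trans (∑-splits-≋ k (λ s → (w , mergeFirst s) ∷ []) (λ p q → Homo.prep (≃-of-≋ (mergeFirst-≋ p q)) ≅-refl) b)
        (≅-reflexive (∑-singleton (splits k ds) (λ s → w , mergeFirst s)))))

  oddMergesOf : ℕ → LGraph → List LGraph
  oddMergesOf K G = ∑< K (λ j → mergesOf (suc (twice j)) G)

  oddMergesOf-≃ : ∀ K {G H} → G ≃ H → oddMergesOf K G ≅ oddMergesOf K H
  oddMergesOf-≃ K p = ∑<-cong K (λ j → mergesOf-≃ (suc (twice j)) p)

  size# : LGraph → ℕ
  size# (_ , cs) = length cs

  size#-≃ : ∀ {G H} → G ≃ H → size# G ≡ size# H
  size#-≃ {_ , cs} (iso _ _ _ _ _ _ b) = trans (sym (Listₚ.length-map _ cs)) (≋-length b)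

  abstract
    _≤ᵈ_ : ∀ i j → Dec (i ≤ j)
    _≤ᵈ_ = ℕ._≤?_
    _≡ᵈ_ : ∀ (i j : ℕ) → Dec (i ≡ j)
    _≡ᵈ_ = ℕ._≟_

  atLeast exactly : ℕ → List LGraph → List LGraph
  atLeast j = filter (λ G → j ≤ᵈ size# G)
  exactly j = filter (λ G → size# G ≡ᵈ j)

  exactly-≅ : ∀ j {xs ys} → xs ≅ ys → exactly j xs ≅ exactly j ys
  exactly-≅ j = PermSetoidₚ.filter⁺ labelled _ (λ p e → trans (sym (size#-≃ p)) e)

  filter-· : ∀ {P : LGraph → Set} (P? : Decidable P) k xs → filter P? (k · xs) ≡ k · filter P? xs
  filter-· P? zero    xs = refl
  filter-· P? (suc k) xs = trans (Listₚ.filter-++ P? xs (k · xs)) (cong (filter P? xs ++_) (filter-· P? k xs))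

  filter-∑ : ∀ {X : Set} {P : LGraph → Set} (P? : Decidable P) (xs : List X) f → filter P? (∑ xs f) ≡ ∑ xs (filter P? ∘ f)
  filter-∑ P? []       f = refl
  filter-∑ P? (x ∷ xs) f = trans (Listₚ.filter-++ P? (f x) (∑ xs f)) (cong (filter P? (f x) ++_) (filter-∑ P? xs f))

  private
    atLeast-suc : ∀ j xs → atLeast j xs ≅ exactly j xs ++ atLeast (suc j) xs
    atLeast-suc j [] = ≅-refl
    atLeast-suc j (G ∷ xs) with j ≤ᵈ size# G | size# G ≡ᵈ j | suc j ≤ᵈ size# G
    ... | yes _  | yes _ | no _   = Homo.prep ≈-refl (atLeast-suc j xs)
    ... | yes _  | no _  | yes _  = ≅-trans (Homo.prep ≈-refl (atLeast-suc j xs))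
                                      (≅-from-↭ (↭-sym (↭ₚ.shift G (exactly j xs) _)))
    ... | no _   | no _  | no _   = atLeast-suc j xs
    ... | yes _  | yes e | yes lt = contradiction lt (ℕₚ.<-irrefl (sym e))
    ... | yes le | no ne | no nl  = contradiction (ℕₚ.≤∧≢⇒< le (ne ∘ sym)) nl
    ... | no nl  | yes e | _      = contradiction (ℕₚ.≤-reflexive (sym e)) nl
    ... | no nl  | no _  | yes lt = contradiction (ℕₚ.<⇒≤ lt) nl

    singles : ∀ G → mergesOf 1 G ≅ size# G · (G ∷ [])
    singles (v , cs) = ≅-trans (map-cong-∈ (splits 1 cs) (λ {(S , R)} m → ≃-of-≋ (single S (∈-splits⁻ 1 cs m))))
      (≅-reflexive (count cs))
      where
      single : ∀ S {R} → length S ≡ 1 × S ++ R ↭ cs → mergeFirst (S , R) ≋ cs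
      single (s ∷ []) (_ , p) = Homo.trans (Homo.prep (↭-reflexive (Listₚ.++-identityʳ s)) ≋-refl) (↭⇒≋ p)
        where
        ↭⇒≋ : ∀ {as bs : Blocks} → as ↭ bs → as ≋ bs
        ↭⇒≋ ↭.refl         = ≋-refl
        ↭⇒≋ (↭.prep x p)   = Homo.prep ↭-refl (↭⇒≋ p)
        ↭⇒≋ (↭.swap x y p) = Homo.swap ↭-refl ↭-refl (↭⇒≋ p)
        ↭⇒≋ (↭.trans p q)  = Homo.trans (↭⇒≋ p) (↭⇒≋ q)
      single []          (() , _)
      single (_ ∷ _ ∷ _) (() , _)
      count : ∀ ds → map (λ _ → v , cs) (splits 1 ds) ≡ length ds · ((v , cs) ∷ [])
      count []       = refl
      count (d ∷ ds) = cong (_ ∷_) (trans (sym (Listₚ.map-∘ (splits 1 ds))) (count ds))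

    threes : ℕ → LGraph → List LGraph
    threes K G = ∑< K (λ j → mergesOf (suc (twice (suc j))) G)

    threes-≃ : ∀ K {G H} → G ≃ H → threes K G ≅ threes K H
    threes-≃ K p = ∑<-cong K (λ j → mergesOf-≃ (suc (twice (suc j))) p)

    threes-smaller : ∀ K G → All (λ H → size# H < size# G) (threes K G)
    threes-smaller K (v , cs) = over K (twice ∘ suc) (λ j → s≤s z≤n)
      where
      at : ∀ k → All (λ H → size# H < length cs) (mergesOf (suc (suc k)) (v , cs))
      at k = Allₚ.map⁺ (All.tabulate (λ {(S , R)} m → smaller S (∈-splits⁻ (suc (suc k)) cs m)))
        where
        smaller : ∀ S {R} → length S ≡ suc (suc k) × S ++ R ↭ cs → suc (length R) < length cs
        smaller S {R} (e , p) = subst (suc (length R) <_) (trans (sym (Listₚ.length-++ S)) (↭ₚ.↭-length p))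
          (subst (λ i → suc (length R) < i + length R) (sym e) (s≤s (s≤s (ℕₚ.m≤n+m (length R) k))))
      over : ∀ K (g : ℕ → ℕ) → (∀ j → 0 < g j) → All (λ H → size# H < length cs) (∑< K (λ j → mergesOf (suc (g j)) (v , cs)))
      over zero    g pos = []
      over (suc K) g pos = Allₚ.++⁺ (positive (g 0) (pos 0)) (over K (g ∘ suc) (pos ∘ suc))
        where
        positive : ∀ i → 0 < i → All (λ H → size# H < length cs) (mergesOf (suc i) (v , cs))
        positive (suc i) _ = at i

    exactly-singles : ∀ j xs → exactly j (∑ xs (λ G → size# G · (G ∷ []))) ≅ j · exactly j xs
    exactly-singles j [] = ≅-reflexive (sym (·-[] j))
    exactly-singles j (G ∷ xs) = ≅-trans (≅-reflexive (Listₚ.filter-++ _ (size# G · (G ∷ [])) _))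
      (≅-trans (++-cong (≅-reflexive (trans (filter-· _ (size# G) (G ∷ [])) (one (size# G ≡ᵈ j)))) (exactly-singles j xs))
        (≅-trans (≅-sym (·-++ j (exactly j (G ∷ [])) _)) (·-cong j (≅-reflexive (sym (Listₚ.filter-++ _ (G ∷ []) xs))))))
      where
      one : Dec (size# G ≡ j) → size# G · exactly j (G ∷ []) ≡ j · exactly j (G ∷ [])
      one (yes refl) = refl
      one (no ne) = trans (cong (size# G ·_) none) (trans (·-[] (size# G)) (trans (sym (·-[] j)) (cong (j ·_) (sym none))))
        where
        none : exactly j (G ∷ []) ≡ []
        none = Listₚ.filter-reject (λ G → size# G ≡ᵈ j) ne

    exactly-threes : ∀ K j xs → exactly j (∑ xs (threes K)) ≅ ∑ (atLeast (suc j) xs) (exactly j ∘ threes K)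
    exactly-threes K j xs = ≅-trans (≅-reflexive (filter-∑ _ xs (threes K))) (go xs)
      where
      go : ∀ xs → ∑ xs (exactly j ∘ threes K) ≅ ∑ (atLeast (suc j) xs) (exactly j ∘ threes K)
      go [] = ≅-refl
      go (G ∷ xs) with suc j ≤ᵈ size# G
      ... | yes _ = ++-cong {exactly j (threes K G)} ≅-refl (go xs)
      ... | no nl = ≅-trans (++-cong (≅-reflexive (Listₚ.filter-none _ (All.map
        (λ lt e → nl (ℕₚ.≤-trans (s≤s (ℕₚ.≤-reflexive (sym e))) lt)) (threes-smaller K G)))) ≅-refl) (go xs)

  eigen-unique : ∀ K m {𝓐 𝓑} → m · 𝓐 ≅ ∑ 𝓐 (oddMergesOf (suc K)) → m · 𝓑 ≅ ∑ 𝓑 (oddMergesOf (suc K)) →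
                 atLeast m 𝓐 ≅ atLeast m 𝓑 → 𝓐 ≅ 𝓑
  eigen-unique K m {𝓐} {𝓑} eA eB top = ≅-trans (≅-reflexive (sym (all 𝓐))) (≅-trans (descend m 0 (ℕₚ.+-identityʳ m)) (≅-reflexive (all 𝓑)))
    where
    all : ∀ xs → atLeast 0 xs ≡ xs
    all xs = Listₚ.filter-all _ (All.tabulate (λ _ → z≤n))
    layer : ∀ {𝓒} j → m · 𝓒 ≅ ∑ 𝓒 (oddMergesOf (suc K)) →
            m · exactly j 𝓒 ≅ j · exactly j 𝓒 ++ ∑ (atLeast (suc j) 𝓒) (exactly j ∘ threes K)
    layer {𝓒} j e = ≅-trans (≅-reflexive (sym (filter-· _ m 𝓒))) (≅-trans (exactly-≅ j e)
      (≅-trans (exactly-≅ j (≅-trans (∑-++ 𝓒 (mergesOf 1) (threes K)) (++-cong (∑-cong 𝓒 (λ {G} _ → singles G)) ≅-refl)))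
        (≅-trans (≅-reflexive (Listₚ.filter-++ _ (∑ 𝓒 (λ G → size# G · (G ∷ []))) _)) (++-cong (exactly-singles j 𝓒) (exactly-threes K j 𝓒)))))
    descend : ∀ d j → d + j ≡ m → atLeast j 𝓐 ≅ atLeast j 𝓑
    descend zero    j refl = top
    descend (suc d) j e = ≅-trans (atLeast-suc j 𝓐) (≅-trans (++-cong same above) (≅-sym (atLeast-suc j 𝓑)))
      where
      above : atLeast (suc j) 𝓐 ≅ atLeast (suc j) 𝓑
      above = descend d (suc j) (trans (ℕₚ.+-suc d j) e)
      peel : ∀ xs → m · xs ≡ j · xs ++ suc d · xs
      peel xs = trans (cong (_· xs) (trans (sym e) (ℕₚ.+-comm (suc d) j))) (+-· j (suc d) xs)
      remainder : ∀ {𝓒} → m · 𝓒 ≅ ∑ 𝓒 (oddMergesOf (suc K)) → suc d · exactly j 𝓒 ≅ ∑ (atLeast (suc j) 𝓒) (exactly j ∘ threes K)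
      remainder {𝓒} eC = ++-cancelˡ (j · exactly j 𝓒) (≅-trans (≅-reflexive (sym (peel (exactly j 𝓒)))) (layer j eC))
      same : exactly j 𝓐 ≅ exactly j 𝓑
      same = ·-cancel d (≅-trans (remainder eA) (≅-trans (∑-≅ (exactly j ∘ threes K) (λ p → exactly-≅ j (threes-≃ K p)) above)
        (≅-sym (remainder eB))))

vecs : ∀ {N} k → List (Vec (Fin N) k)
vecs zero        = Vec.[] ∷ []
vecs {N} (suc k) = concatMap (λ x → map (x Vec.∷_) (vecs k)) (allFin N)

∈-vecs : ∀ {N k} (v : Vec (Fin N) k) → v ∈ vecs k
∈-vecs Vec.[]      = here refl
∈-vecs (x Vec.∷ v) = ∈-concatMap⁺′ _ (∈-allFin x) (∈-map⁺ (x Vec.∷_) (∈-vecs v))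

vecs-unique : ∀ {N} k → Unique (vecs {N} k)
vecs-unique zero = [] ∷ []
vecs-unique {N} (suc k) = unique-concatMap _ (Uniqueₚ.allFin⁺ N)
  (λ _ → Uniqueₚ.map⁺ Vecₚ.∷-injectiveʳ (vecs-unique k)) (λ _ _ → heads)
  where
  heads : ∀ {x y : Fin N} {z} → z ∈ map (x Vec.∷_) (vecs k) → z ∈ map (y Vec.∷_) (vecs k) → x ≡ y
  heads m n with ∈-map⁻ _ m | ∈-map⁻ _ n
  ... | _ , _ , refl | _ , _ , refl = refl

IsMatching : ∀ {N} → Vec (Fin N) N → Set
IsMatching v = (∀ i → lookup v (lookup v i) ≡ i) × (∀ i → lookup v i ≢ i)

isMatching? : ∀ {N} (v : Vec (Fin N) N) → Dec (IsMatching v)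
isMatching? v = Finₚ.all? (λ i → lookup v (lookup v i) ≟ i) ×-dec Finₚ.all? (λ i → ¬? (lookup v i ≟ i))

record Matching (N : ℕ) : Set where
  constructor matching
  field
    vec    : Vec (Fin N) N
    .valid : IsMatching vec

  mate : Fin N → Fin N
  mate = lookup vec
open Matching public

matching-valid : ∀ {N} (m : Matching N) → IsMatching (vec m)
matching-valid (matching v p) = recompute (isMatching? v) p

mate-invol : ∀ {N} (m : Matching N) i → mate m (mate m i) ≡ i
mate-invol m = proj₁ (matching-valid m)

mate-fpf : ∀ {N} (m : Matching N) i → mate m i ≢ i
mate-fpf m = proj₂ (matching-valid m)

mate-injective : ∀ {N} (m : Matching N) {i j} → mate m i ≡ mate m j → i ≡ j
mate-injective m {i} {j} e = trans (sym (mate-invol m i)) (trans (cong (mate m) e) (mate-invol m j))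

fromFunction : ∀ {N} (α : Fin N → Fin N) → (∀ i → α (α i) ≡ i) → (∀ i → α i ≢ i) → Matching N
fromFunction α invol fpf = matching (Vec.tabulate α)
  ( (λ i → trans (Vecₚ.lookup∘tabulate α _) (trans (cong α (Vecₚ.lookup∘tabulate α i)) (invol i)))
  , (λ i e → fpf i (trans (sym (Vecₚ.lookup∘tabulate α i)) e)) )

mate-fromFunction : ∀ {N} (α : Fin N → Fin N) invol fpf i → mate (fromFunction α invol fpf) i ≡ α i
mate-fromFunction α _ _ = Vecₚ.lookup∘tabulate α

vec-ext : ∀ {A : Set} {k} {v w : Vec A k} → (∀ i → lookup v i ≡ lookup w i) → v ≡ w
vec-ext {v = v} {w} eq = trans (sym (Vecₚ.tabulate∘lookup v)) (trans (Vecₚ.tabulate-cong eq) (Vecₚ.tabulate∘lookup w))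

matching-ext : ∀ {N} {m m′ : Matching N} → (∀ i → mate m i ≡ mate m′ i) → m ≡ m′
matching-ext {m = matching v p} {matching w q} eq with vec-ext {v = v} {w} eq
... | refl = refl

keepMatching : ∀ {N} (v : Vec (Fin N) N) → Dec (IsMatching v) → List (Matching N)
keepMatching v (yes p) = matching v p ∷ []
keepMatching v (no _)  = []

matchings : ∀ N → List (Matching N)
matchings N = concatMap (λ v → keepMatching v (isMatching? v)) (vecs N)

∈-matchings : ∀ {N} (m : Matching N) → m ∈ matchings N
∈-matchings {N} m = ∈-concatMap⁺′ (λ v → keepMatching v (isMatching? v)) (∈-vecs (vec m)) (kept m (isMatching? (vec m)))
  where
  kept : ∀ (m : Matching N) (d : Dec (IsMatching (vec m))) → m ∈ keepMatching (vec m) d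
  kept m (yes _) = here refl
  kept m (no np) = contradiction (matching-valid m) np

matchings-unique : ∀ N → Unique (matchings N)
matchings-unique N = unique-concatMap (λ v → keepMatching v (isMatching? v)) (vecs-unique N)
  (λ {v} _ → single v (isMatching? v)) (λ {v} {w} _ _ m n → trans (sym (vec-of v (isMatching? v) m)) (vec-of w (isMatching? w) n))
  where
  single : ∀ v (d : Dec (IsMatching v)) → Unique (keepMatching {N} v d)
  single v (yes p) = [] ∷ []
  single v (no _)  = []
  vec-of : ∀ v (d : Dec (IsMatching v)) {m} → m ∈ keepMatching {N} v d → vec m ≡ v
  vec-of v (yes p) (here refl) = refl

tabulate-word : ∀ {A : Set} {N} (W : List A) → length W ≡ N → ∃ λ (g : Fin N → A) → tabulate g ≡ W
tabulate-word W refl = Data.List.lookup W , Listₚ.tabulate-lookup W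

next-map : ∀ {N} {W : List (Fin N)} (f g : Fin N → Fin N) → Full W → (∀ x → f (g x) ≡ x) → (∀ x → g (f x) ≡ x) →
           Full (map f W) → ∀ x → f (next W x) ≡ next (map f W) (f x)
next-map {W = W} f g F fg gf F′ x = sym (trans
  (cycle⇒next {f = λ y → f (next W (g y))}
    (cycle-map f (λ y → cong (f ∘ next W) (sym (gf y))) (next-cycle (complete F x) (unique F))) (unique F′) (complete F′ (f x)))
  (cong (f ∘ next W) (gf x)))

module _ (M : ℕ) where
  private N = suc M
  open Labelled N zero

  cyclesᵐ : Matching N → List (Fin N) → List (List (Fin N))
  cyclesᵐ m = Vertices.cycles (mate m) (mate-injective m)

  σᵐ : Matching N → List (Fin N) → Fin N → Fin N
  σᵐ m = Maps.σ (mate m) (mate-injective m)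

  cyclesᵐ-cycles : ∀ m {W} → Full W → All (Cycle (σᵐ m W)) (cyclesᵐ m W)
  cyclesᵐ-cycles m F = Allₚ.map⁺ (All.tabulate (λ {r} _ → Maps.OneMap.C-Cycle (mate m) (mate-injective m) F r))

  cyclesᵐ-full : ∀ m {W} → Full W → Full (concat (cyclesᵐ m W))
  cyclesᵐ-full m = Vertices.cycles-full (mate m) (mate-injective m)

  graphᵐ : Matching N → List (Fin N) → LGraph
  graphᵐ m W = vec m , cyclesᵐ m W

  canonical : Matching N → LGraph
  canonical m = graphᵐ m (allFin N)

  relabel-blocks : ∀ {m m′ W} (f g : Fin N → Fin N) → Full W → (∀ x → f (g x) ≡ x) → (∀ x → g (f x) ≡ x) →
                   (∀ x → f (mate m x) ≡ mate m′ (f x)) → map f W ≡ allFin N →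
                   map (map f) (cyclesᵐ m W) ≋ cyclesᵐ m′ (allFin N)
  relabel-blocks {m} {m′} {W} f g F fg gf comm eq = cycles-≋
    (Allₚ.map⁺ (All.map (cycle-map f step-comm) (cyclesᵐ-cycles m F)))
    (cyclesᵐ-cycles m′ allFin-full) (unique fullˡ)
    (↭-trans (full⇒↭ fullˡ) (↭-sym (full⇒↭ (cyclesᵐ-full m′ allFin-full))))
    where
    step-comm : ∀ x → f (σᵐ m W x) ≡ σᵐ m′ (allFin N) (f x)
    step-comm x = trans (comm (next W x)) (cong (mate m′) (trans
      (next-map f g F fg gf (subst Full (sym eq) allFin-full) x) (cong (λ V → next V (f x)) eq)))
    fullˡ : Full (concat (map (map f) (cyclesᵐ m W)))
    fullˡ = subst Full (sym (Listₚ.concat-map (cyclesᵐ m W)))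
      (full-↭ (↭ₚ.map⁺ f (↭-trans (full⇒↭ F) (↭-sym (full⇒↭ (cyclesᵐ-full m F)))))
        (subst Full (sym eq) allFin-full))

  record Renaming (W : List (Fin N)) : Set where
    field
      f g    : Fin N → Fin N
      f∘g    : ∀ x → f (g x) ≡ x
      g∘f    : ∀ x → g (f x) ≡ x
      f-zero : f zero ≡ zero
      f-word : map f W ≡ allFin N

  renaming′ : ∀ {W} → W ∈ words M → Renaming W
  renaming′ {W} w = go (tabulate-word W (full-length (words-full w))) (words-root w)
    where
    go : (∃ λ (g : Fin N → Fin N) → tabulate g ≡ W) → (∃ λ w → W ≡ zero ∷ w) → Renaming W
    go (g , e) (_ , e₀) = record
      { f = f ; g = g ; f∘g = f∘g ; g∘f = λ y → proj₂ (surj y)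
      ; f-zero = trans (cong f (sym (Listₚ.∷-injectiveˡ (trans e e₀)))) (f∘g zero)
      ; f-word = trans (cong (map f) (sym e)) (trans (Listₚ.map-tabulate g f) (Listₚ.tabulate-cong f∘g)) }
      where
      surj : ∀ y → ∃ λ x → g x ≡ y
      surj y with ∈-tabulate⁻ (subst (y ∈_) (sym e) (complete (words-full w) y))
      ... | x , eq = x , sym eq
      f : Fin N → Fin N
      f y = proj₁ (surj y)
      f∘g : ∀ x → f (g x) ≡ x
      f∘g x = surjective⇒injective surj (proj₂ (surj (g x)))

  𝓔 : List LGraph
  𝓔 = map canonical (matchings N)

  relabel : ∀ {W} → W ∈ words M → map (λ m → graphᵐ m W) (matchings N) ≅ 𝓔
  relabel {W} w = bridge (λ m m′ → ∀ x → f (mate m x) ≡ mate m′ (f x)) (λ m → graphᵐ m W) canonical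
    (matchings-unique N) (matchings-unique N)
    (λ {m} _ → conj m , ∈-matchings _ , λ x → sym (trans (mate-fromFunction _ (inv m) (fp m) (f x)) (cong (f ∘ mate m) (g∘f x))))
    (λ {m} _ → unconj m , ∈-matchings _ , λ x → trans (cong f (mate-fromFunction _ (inv′ m) (fp′ m) x)) (f∘g _))
    (λ {m} {m′} {m″} _ _ _ r r′ → matching-ext (λ i → trans (cong (mate m′) (sym (f∘g i)))
      (trans (sym (r (g i))) (trans (r′ (g i)) (cong (mate m″) (f∘g i))))))
    (λ {m} {m′} {m″} _ _ _ r r′ → matching-ext (λ i → trans (sym (g∘f _)) (trans (cong g (trans (r i) (sym (r′ i)))) (g∘f _))))
    (λ {m} {m′} _ _ r → iso f g f∘g g∘f f-zero r (relabel-blocks {m} {m′} f g (words-full w) f∘g g∘f r f-word))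
    where
    open Renaming (renaming′ w)
    inv : ∀ m i → f (mate m (g (f (mate m (g i))))) ≡ i
    inv m i = trans (cong (f ∘ mate m) (g∘f _)) (trans (cong f (mate-invol m (g i))) (f∘g i))
    fp : ∀ m i → f (mate m (g i)) ≢ i
    fp m i e = mate-fpf m (g i) (trans (sym (g∘f _)) (cong g e))
    inv′ : ∀ m i → g (mate m (f (g (mate m (f i))))) ≡ i
    inv′ m i = trans (cong (g ∘ mate m) (f∘g _)) (trans (cong g (mate-invol m (f i))) (g∘f i))
    fp′ : ∀ m i → g (mate m (f i)) ≢ i
    fp′ m i e = mate-fpf m (f i) (trans (sym (f∘g _)) (cong f e))
    conj unconj : Matching N → Matching N
    conj m = fromFunction (λ i → f (mate m (g i))) (inv m) (fp m)
    unconj m = fromFunction (λ i → g (mate m (f i))) (inv′ m) (fp′ m)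

  module _ {n : ℕ} (N≡2n : N ≡ n + n) (K : ℕ) (big : N < twice (suc K)) where
    private
      module PM = Multiset (partition-setoid (Fin N))
      module OM = OddMerges {Fin N}

      push : Vec (Fin N) N → List (List (List (Fin N))) → List LGraph
      push v = map (v ,_)

      push-≅ : ∀ v {xs ys} → xs PM.≅ ys → push v xs ≅ push v ys
      push-≅ v = PermSetoidₚ.map⁺ (partition-setoid (Fin N)) labelled ≃-of-≋

      push-· : ∀ v k xs → push v (k PM.· xs) ≡ k · push v xs
      push-· v zero    xs = refl
      push-· v (suc k) xs = trans (Listₚ.map-++ (v ,_) xs _) (cong (push v xs ++_) (push-· v k xs))

      push-∑< : ∀ v k f → push v (PM.∑< k f) ≡ ∑< k (push v ∘ f)
      push-∑< v zero    f = refl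
      push-∑< v (suc k) f = trans (Listₚ.map-++ (v ,_) (f 0) _) (cong (push v (f 0) ++_) (push-∑< v k (f ∘ suc)))

      ∑<-≡ : ∀ k {f g : ℕ → List LGraph} → (∀ i → f i ≡ g i) → ∑< k f ≡ ∑< k g
      ∑<-≡ zero    eq = refl
      ∑<-≡ (suc k) eq = cong₂ _++_ (eq 0) (∑<-≡ k (eq ∘ suc))

      push-odd : ∀ v cs → push v (OM.oddMerges (suc K) cs) ≡ oddMergesOf (suc K) (v , cs)
      push-odd v cs = trans (push-∑< v (suc K) (λ j → map mergeFirst (splits (suc (twice j)) cs))) (∑<-≡ (suc K) (λ j → sym (Listₚ.map-∘ {g = v ,_} {f = mergeFirst} (splits (suc (twice j)) cs))))

      push-∑ : ∀ v xs → push v (PM.∑ xs (OM.oddMerges (suc K))) ≡ ∑ (push v xs) (oddMergesOf (suc K))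
      push-∑ v []        = refl
      push-∑ v (cs ∷ xs) = trans (Listₚ.map-++ (v ,_) (OM.oddMerges (suc K) cs) _) (cong₂ _++_ (push-odd v cs) (push-∑ v xs))

      fibre : ∀ m → suc n · map (graphᵐ m) (words M) ≅ ∑ (map (graphᵐ m) (words M)) (oddMergesOf (suc K))
      fibre m = ≅-trans (≅-reflexive (sym (trans (push-· v (suc n) (map (cyclesᵐ m) (words M))) (cong (suc n ·_) (sym (Listₚ.map-∘ (words M)))))))
        (≅-trans (push-≅ v (Fibres.fibres-eigen (mate m) (mate-injective m) (suc K) big (λ {W} w → count w)))
          (≅-reflexive (trans (push-∑ v (map (cyclesᵐ m) (words M))) (cong (λ xs → ∑ xs (oddMergesOf (suc K))) (sym (Listₚ.map-∘ (words M)))))))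
        where
        v = vec m
        module G = Gluing (mate m) (mate-injective m)
        count : ∀ {W} → W ∈ words M → length (Fibres.downs (mate m) (mate-injective m) W) ≡ suc n
        count {W} w = DownCount.down-count N≡2n (mate m) (mate-invol m) (mate-fpf m) (words-full w)
          (λ x → G.Valid? W x []) (λ x → proj₁ , λ d → d , [] , [] , []) (proj₂ (words-root w))

      𝓛 : List LGraph
      𝓛 = ∑ (matchings N) (λ m → map (graphᵐ m) (words M))

      𝓛-eigen : suc n · 𝓛 ≅ ∑ 𝓛 (oddMergesOf (suc K))
      𝓛-eigen = ≅-trans (≅-sym (∑-· (suc n) (matchings N) _))
        (≅-trans (∑-cong (matchings N) (λ {m} _ → fibre m)) (≅-reflexive (sym (∑-over-∑ (matchings N) _ (oddMergesOf (suc K))))))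

      𝓛≅ : 𝓛 ≅ length (words M) · 𝓔
      𝓛≅ = ≅-trans (∑-cong (matchings N) (λ {m} _ → ≅-reflexive (sym (∑-singleton (words M) (graphᵐ m)))))
        (≅-trans (∑-swap (matchings N) (words M) (λ m W → graphᵐ m W ∷ []))
          (≅-trans (∑-cong (words M) (λ {W} w → ≅-trans (≅-reflexive (∑-singleton (matchings N) (λ m → graphᵐ m W))) (relabel w)))
            (≅-reflexive (∑-const (words M) 𝓔))))

    𝓔-eigen : suc n · 𝓔 ≅ ∑ 𝓔 (oddMergesOf (suc K))
    𝓔-eigen = cancel (words M) (∈-words allFin-full) refl
      where
      scaled : length (words M) · suc n · 𝓔 ≅ length (words M) · ∑ 𝓔 (oddMergesOf (suc K))
      scaled = ≅-trans (≅-reflexive (trans (sym (*-· (length (words M)) (suc n) 𝓔)) (trans (cong (_· 𝓔) (ℕₚ.*-comm (length (words M)) (suc n))) (*-· (suc n) (length (words M)) 𝓔))))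
        (≅-trans (·-cong (suc n) (≅-sym 𝓛≅)) (≅-trans 𝓛-eigen
          (≅-trans (∑-≅ (oddMergesOf (suc K)) (oddMergesOf-≃ (suc K)) 𝓛≅) (≅-reflexive (∑-over-· (length (words M)) 𝓔 (oddMergesOf (suc K)))))))
      cancel : ∀ Ws → allFin N ∈ Ws → words M ≡ Ws → suc n · 𝓔 ≅ ∑ 𝓔 (oddMergesOf (suc K))
      cancel (W ∷ Ws) _ e = ·-cancel (length Ws) (subst (λ k → k · suc n · 𝓔 ≅ k · ∑ 𝓔 (oddMergesOf (suc K))) (cong length e) scaled)

↭⇒≋ : ∀ {A : Set} {as bs : List (List A)} → as ↭ bs → as ≋ bs
↭⇒≋ ↭.refl         = ≋-refl
↭⇒≋ (↭.prep x p)   = Homo.prep ↭-refl (↭⇒≋ p)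
↭⇒≋ (↭.swap x y p) = Homo.swap ↭-refl ↭-refl (↭⇒≋ p)
↭⇒≋ (↭.trans p q)  = Homo.trans (↭⇒≋ p) (↭⇒≋ q)

inserts-length : ∀ {A : Set} (x : A) ys → length (inserts x ys) ≡ suc (length ys)
inserts-length x []       = refl
inserts-length x (y ∷ ys) = cong suc (trans (Listₚ.length-map (y ∷_) (inserts x ys)) (inserts-length x ys))

perms-length : ∀ {A : Set} (xs : List A) → length (perms xs) ≡ length xs !
perms-length []       = refl
perms-length (x ∷ xs) = trans (go (perms xs) (λ m → ↭ₚ.↭-length (∈-perms⁻ {xs = xs} m)))
  (trans (cong (_* suc (length xs)) (perms-length xs)) (ℕₚ.*-comm (length xs !) (suc (length xs))))
  where
  go : ∀ yss → (∀ {ys} → ys ∈ yss → length ys ≡ length xs) → length (concatMap (inserts x) yss) ≡ length yss * suc (length xs)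
  go []         eq = refl
  go (ys ∷ yss) eq = trans (Listₚ.length-++ (inserts x ys)) (cong₂ _+_ (trans (inserts-length x ys) (cong suc (eq (here refl)))) (go yss (eq ∘ there)))

-- The C-permutations of a list, as lists of signed cycles; each cycle starts with its first letter
-- in the list, and the cycles are ordered by these letters. The first argument bounds the length of the list.
cPerms : ∀ {A : Set} → ℕ → List A → List (List (Bool × List A))
cPerms _       []      = [] ∷ []
cPerms zero    (v ∷ V) = []
cPerms (suc k) (v ∷ V) = concatMap (λ (u , R) → concatMap (λ s →
  concatMap (λ w → map ((s , v ∷ w) ∷_) (cPerms k R)) (perms u)) (true ∷ false ∷ [])) (paritySplits false V)

module CSumList (A : Set) (𝒮 : Setoid 0ℓ 0ℓ) where
  open Multiset 𝒮
  open CSum A 𝒮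

  ∑-cPerms : ∀ k V (f : List (List A) → List Col) → (∀ {P P′} → P ≋ P′ → f P ≅ f P′) →
             ∑ (cPerms k V) (f ∘ map proj₂) ≅ ∑ᶜ k V f
  ∑-cPerms k       []      f resp = ≅-reflexive (Listₚ.++-identityʳ (f []))
  ∑-cPerms zero    (v ∷ V) f resp = ≅-refl
  ∑-cPerms (suc k) (v ∷ V) f resp = ≅-trans (≅-reflexive (∑-∑ (paritySplits false V) _ (f ∘ map proj₂)))
    (∑-cong (paritySplits false V) (λ {(u , R)} _ → at u R))
    where
    at : ∀ u R → ∑ (concatMap (λ s → concatMap (λ w → map ((s , v ∷ w) ∷_) (cPerms k R)) (perms u)) (true ∷ false ∷ [])) (f ∘ map proj₂) ≅
                 (2 * length u !) · ∑ᶜ k R (λ P → f ((v ∷ u) ∷ P))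
    at u R = ≅-trans (≅-reflexive (∑-∑ (true ∷ false ∷ []) (λ s → concatMap (λ w → map ((s , v ∷ w) ∷_) (cPerms k R)) (perms u)) (f ∘ map proj₂)))
      (≅-trans (∑-cong (true ∷ false ∷ []) (λ {s} _ → signed s))
        (≅-trans (≅-reflexive (∑-const (true ∷ false ∷ []) (length u ! · X))) (≅-reflexive (sym (*-· 2 (length u !) X)))))
      where
      X = ∑ᶜ k R (λ P → f ((v ∷ u) ∷ P))
      signed : ∀ s → ∑ (concatMap (λ w → map ((s , v ∷ w) ∷_) (cPerms k R)) (perms u)) (f ∘ map proj₂) ≅ length u ! · X
      signed s = ≅-trans (≅-reflexive (∑-∑ (perms u) _ (f ∘ map proj₂)))
        (≅-trans (∑-cong (perms u) (λ {w} m → ≅-trans (≅-reflexive (∑-map ((s , v ∷ w) ∷_) (cPerms k R) (f ∘ map proj₂)))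
            (≅-trans (∑-cPerms k R (λ P → f ((v ∷ w) ∷ P)) (λ p → resp (Homo.prep ↭-refl p)))
              (∑ᶜ-cong k R (λ P → resp (Homo.prep (↭.prep v (∈-perms⁻ m)) ≋-refl))))))
          (≅-reflexive (trans (∑-const (perms u) X) (cong (_· X) (perms-length u)))))

  ∑ᶜ-cong-≤ : ∀ k V {f h} → (∀ P → length P ≤ length V → f P ≅ h P) → ∑ᶜ k V f ≅ ∑ᶜ k V h
  ∑ᶜ-cong-≤ k       []      eq = eq [] z≤n
  ∑ᶜ-cong-≤ zero    (v ∷ V) eq = ≅-refl
  ∑ᶜ-cong-≤ (suc k) (v ∷ V) eq = ∑ᵖ-cong false V (λ u R m → ·-cong (2 * length u !)
    (∑ᶜ-cong-≤ k R (λ P le → eq _ (s≤s (ℕₚ.≤-trans le (rest-length false V ℕₚ.≤-refl m))))))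

  ∑ᶜ-[] : ∀ k V {f} → (∀ P → length P ≤ length V → f P ≡ []) → ∑ᶜ k V f ≡ []
  ∑ᶜ-[] k       []      eq = eq [] z≤n
  ∑ᶜ-[] zero    (v ∷ V) eq = refl
  ∑ᶜ-[] (suc k) (v ∷ V) eq = go (paritySplits false V) (λ m → rest-length false V ℕₚ.≤-refl m)
    where
    go : ∀ xs → (∀ {u R} → (u , R) ∈ xs → length R ≤ length V) →
         ∑ xs (λ (u , R) → (2 * length u !) · ∑ᶜ k R (λ P → _)) ≡ []
    go []             le = refl
    go ((u , R) ∷ xs) le = cong₂ _++_
      (trans (cong ((2 * length u !) ·_) (∑ᶜ-[] k R (λ P l → eq _ (s≤s (ℕₚ.≤-trans l (le (here refl))))))) (·-[] (2 * length u !)))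
      (go xs (le ∘ there))

  -- Only the identity permutation has as many cycles as elements.
  ∑ᶜ-discrete : ∀ k V (h : List (List A) → List Col) → length V ≤ k → (∀ P → length P < length V → h P ≡ []) →
                ∑ᶜ k V h ≅ 2 ^ length V · h (map [_] V)
  ∑ᶜ-discrete k       []      h le vanish = ≅-reflexive (sym (Listₚ.++-identityʳ (h [])))
  ∑ᶜ-discrete (suc k) (v ∷ V) h (s≤s le) vanish = ≅-trans (only false V nonempty-vanishes)
    (≅-trans (·-cong 2 (∑ᶜ-discrete k V (λ P → h ([ v ] ∷ P)) le (λ P lt → vanish _ (s≤s lt))))
      (≅-reflexive (sym (*-· 2 (2 ^ length V) _))))
    where
    F : List A → List A → List Col
    F u R = (2 * length u !) · ∑ᶜ k R (λ P → h ((v ∷ u) ∷ P))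
    nonempty-vanishes : ∀ x u R → length (x ∷ u) + length R ≡ length V → F (x ∷ u) R ≡ []
    nonempty-vanishes x u R e = trans (cong ((2 * length (x ∷ u) !) ·_) (∑ᶜ-[] k R (λ P l → vanish _ (s≤s (ℕₚ.≤-<-trans l
      (subst (length R <_) e (s≤s (ℕₚ.m≤n+m (length R) (length u)))))))))
      (·-[] (2 * length (x ∷ u) !))
    only : ∀ b W {G} → (∀ x u R → length (x ∷ u) + length R ≡ length W → G (x ∷ u) R ≡ []) →
           ∑ᵖ b W G ≅ (if b then [] else G [] W)
    only true  []      {G} van = ≅-refl
    only false []      {G} van = ≅-reflexive (Listₚ.++-identityʳ (G [] []))
    only b     (w ∷ W) {G} van = ≅-trans (≅-reflexive (∑ᵖ-∷ b w W G)) (≅-trans (++-cong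
      (≅-trans (∑ᵖ-cong (not b) W (λ U R m → ≅-reflexive (van w U R (cong suc (split-length (not b) W m))))) (≅-reflexive (∑-[] (paritySplits (not b) W))))
      (only b W (λ x u R e → van x u (w ∷ R) (trans (ℕₚ.+-suc (length (x ∷ u)) (length R)) (cong suc e))))) ≅-refl)

  odd-splits : ∀ K {B : Set} (P : List B) (h : List B × List B → List Col) → length P ≤ twice K →
               ∑< K (λ j → ∑ (splits (suc (twice j)) P) h) ≅ ∑ (paritySplits true P) h
  even-splits : ∀ K {B : Set} (P : List B) (h : List B × List B → List Col) → length P ≤ suc (twice K) →
                ∑< (suc K) (λ j → ∑ (splits (twice j) P) h) ≅ ∑ (paritySplits false P) h

  private
    ∑-splits-∷ : ∀ {B : Set} k (x : B) P (h : List B × List B → List Col) → ∑ (splits (suc k) (x ∷ P)) h ≡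
                 ∑ (splits k P) (h ∘ consˡ x) ++ ∑ (splits (suc k) P) (h ∘ consʳ x)
    ∑-splits-∷ k x P h = trans (∑-++ˡ (map (consˡ x) (splits k P)) h)
      (cong₂ _++_ (∑-map (consˡ x) (splits k P) h) (∑-map (consʳ x) (splits (suc k) P) h))

    ∑<-[] : ∀ K → ∑< K (λ _ → []) ≡ []
    ∑<-[] zero    = refl
    ∑<-[] (suc K) = ∑<-[] K

  odd-splits K       []      h le = ≅-reflexive (∑<-[] K)
  odd-splits (suc K) (x ∷ P) h (s≤s le) = ≅-trans (∑<-cong (suc K) (λ j → ≅-reflexive (∑-splits-∷ (twice j) x P h)))
    (≅-trans (∑<-++ (suc K) (λ j → ∑ (splits (twice j) P) (h ∘ consˡ x)) (λ j → ∑ (splits (suc (twice j)) P) (h ∘ consʳ x)))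
      (≅-trans (++-cong (even-splits K P (h ∘ consˡ x) le) (odd-splits (suc K) P (h ∘ consʳ x) (ℕₚ.≤-trans le (ℕₚ.n≤1+n _))))
        (≅-reflexive (sym (trans (∑-++ˡ (map (consˡ x) (paritySplits false P)) h)
          (cong₂ _++_ (∑-map (consˡ x) (paritySplits false P) h) (∑-map (consʳ x) (paritySplits true P) h)))))))
  even-splits K []      h le = ≅-trans (++-cong {h ([] , []) ++ []} ≅-refl (≅-reflexive (∑<-[] K))) (≅-reflexive (Listₚ.++-identityʳ _))
  even-splits K (x ∷ P) h (s≤s le) = ≅-trans
    (++-cong {h ([] , x ∷ P) ++ []} ≅-refl (≅-trans (∑<-cong K (λ j → ≅-reflexive (∑-splits-∷ (suc (twice j)) x P h)))
      (∑<-++ K (λ j → ∑ (splits (suc (twice j)) P) (h ∘ consˡ x)) (λ j → ∑ (splits (twice (suc j)) P) (h ∘ consʳ x)))))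
    (≅-trans (++-swap (h ([] , x ∷ P) ++ []) (∑< K (λ j → ∑ (splits (suc (twice j)) P) (h ∘ consˡ x))) _)
      (≅-trans (++-cong (odd-splits K P (h ∘ consˡ x) le) (even-splits K P (h ∘ consʳ x) (ℕₚ.≤-trans le (ℕₚ.n≤1+n _))))
        (≅-reflexive (sym (trans (∑-++ˡ (map (consˡ x) (paritySplits true P)) h)
          (cong₂ _++_ (∑-map (consˡ x) (paritySplits true P) h) (∑-map (consʳ x) (paritySplits false P) h)))))))

module Decorations (N : ℕ) (root : Fin N) where
  open Labelled N root
  module _ {A : Set} (v : Vec (Fin N) N) (β : A → List (Fin N)) where
    open CSum A labelled
    open CSumList A labelled

    mergeBlocks : List (List A) → LGraph
    mergeBlocks P = v , map (concatMap β) P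

    mergeBlocks-≋ : ∀ {P P′} → P ≋ P′ → mergeBlocks P ≃ mergeBlocks P′
    mergeBlocks-≋ p = ≃-of-≋ (PermSetoidₚ.map⁺ ↭.↭-setoid ↭.↭-setoid (λ q → concat-↭ (↭ₚ.map⁺ β q)) p)

    decorations : List A → List LGraph
    decorations V = map (λ P → mergeBlocks (map proj₂ P)) (cPerms (length V) V)

    private
      f : List (List A) → List LGraph
      f P = mergeBlocks P ∷ []

      f-≋ : ∀ {P P′} → P ≋ P′ → f P ≅ f P′
      f-≋ p = Homo.prep (mergeBlocks-≋ p) ≅-refl

    decorations≅ : ∀ V → decorations V ≅ ∑ᶜ (length V) V f
    decorations≅ V = ≅-trans (≅-reflexive (sym (∑-singleton (cPerms (length V) V) (λ P → mergeBlocks (map proj₂ P)))))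
      (∑-cPerms (length V) V f f-≋)

    decorations-eigen : ∀ K V → length V ≤ twice K → length V · decorations V ≅ ∑ (decorations V) (oddMergesOf K)
    decorations-eigen K V le = ≅-trans (·-cong (length V) (decorations≅ V))
      (≅-trans (∑ᶜ-eigen (length V) V f (λ p → f-≋ (↭⇒≋ p)) (λ P p → f-≋ (Homo.prep p ≋-refl)) ℕₚ.≤-refl)
        (≅-trans (∑ᶜ-cong-≤ (length V) V (λ P l → ≅-sym (same P (ℕₚ.≤-trans l le))))
          (≅-trans (≅-sym (∑-over-∑ᶜ (length V) V f (oddMergesOf K)))
            (∑-≅ (oddMergesOf K) (oddMergesOf-≃ K) (≅-sym (decorations≅ V))))))
      where
      γ : List A → List (Fin N)
      γ = concatMap β
      γ-concat : ∀ S → concat (map γ S) ≡ γ (concat S)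
      γ-concat S = trans (cong concat (Listₚ.map-∘ S)) (trans (Listₚ.concat-concat (map (map β) S)) (cong concat (Listₚ.concat-map S)))
      same : ∀ P → length P ≤ twice K → ∑ (f P) (oddMergesOf K) ≅ ∑ (paritySplits true P) (f ∘ mergeFirst)
      same P l = ≅-trans (≅-reflexive (Listₚ.++-identityʳ (oddMergesOf K (mergeBlocks P))))
        (≅-trans (∑<-cong K (λ j → ≅-reflexive (at (suc (twice j))))) (odd-splits K P (f ∘ mergeFirst) l))
        where
        at : ∀ k → mergesOf k (mergeBlocks P) ≡ ∑ (splits k P) (f ∘ mergeFirst)
        at k = trans (cong (map (λ s → v , mergeFirst s)) (splits-map γ k P))
          (trans (sym (Listₚ.map-∘ (splits k P)))
            (trans (Listₚ.map-cong (λ (S , R) → cong (λ c → v , c ∷ map γ R) (γ-concat S)) (splits k P))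
              (sym (∑-singleton (splits k P) (mergeBlocks ∘ mergeFirst)))))

    decorations-top : ∀ V → atLeast (length V) (decorations V) ≅ 2 ^ length V · ((v , map β V) ∷ [])
    decorations-top V = ≅-trans (PermSetoidₚ.filter⁺ labelled _ (λ p l → subst (length V ≤_) (size#-≃ p) l) (decorations≅ V))
      (≅-trans (≅-reflexive (filter-∑ᶜ (length V) V f))
        (≅-trans (∑ᶜ-discrete (length V) V (atLeast (length V) ∘ f) ℕₚ.≤-refl
            (λ P lt → Listₚ.filter-reject top? {mergeBlocks P} {[]} (λ le → ℕₚ.<⇒≱ lt (subst (length V ≤_) (Listₚ.length-map (concatMap β) P) le))))
          (·-cong (2 ^ length V) (≅-trans (≅-reflexive (Listₚ.filter-accept top? {mergeBlocks (map [_] V)} {[]}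
              (ℕₚ.≤-reflexive (sym (trans (Listₚ.length-map (concatMap β) (map [_] V)) (Listₚ.length-map [_] V))))))
            (≅-reflexive (cong (λ c → (v , c) ∷ []) (trans (sym (Listₚ.map-∘ {g = concatMap β} {f = [_]} V)) (Listₚ.map-cong (λ a → Listₚ.++-identityʳ (β a)) V))))))))
      where
      top? : Decidable (λ G → length V ≤ size# G)
      top? G = length V ≤ᵈ size# G
      filter-∑ᶜ : ∀ k W h → atLeast (length V) (∑ᶜ k W h) ≡ ∑ᶜ k W (atLeast (length V) ∘ h)
      filter-∑ᶜ k       []      h = refl
      filter-∑ᶜ zero    (w ∷ W) h = refl
      filter-∑ᶜ (suc k) (w ∷ W) h = trans (filter-∑ _ (paritySplits false W) _) (go (paritySplits false W))
        where
        go : ∀ xs → ∑ xs (λ (u , R) → atLeast (length V) ((2 * length u !) · ∑ᶜ k R (λ P → h ((w ∷ u) ∷ P)))) ≡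
                    ∑ xs (λ (u , R) → (2 * length u !) · ∑ᶜ k R (λ P → atLeast (length V) (h ((w ∷ u) ∷ P))))
        go []             = refl
        go ((u , R) ∷ xs) = cong₂ _++_ (trans (filter-· _ (2 * length u !) _) (cong ((2 * length u !) ·_) (filter-∑ᶜ k R _))) (go xs)

-- Genus 0 and plane trees

-- Letters paired by α in W are nested like the contour of the plane forest ts.
data NC (α : Fin ℓ → Fin ℓ) : List (Fin ℓ) → List PTree → Set where
  []  : NC α [] []
  arc : ∀ {a b U V cs ts} → α a ≡ b → NC α U cs → NC α V ts → NC α (a ∷ U ++ b ∷ V) (node cs ∷ ts)

nc-length : ∀ {α : Fin ℓ → Fin ℓ} {W ts} → NC α W ts → length W ≡ sizes ts + sizes ts
nc-length [] = refl
nc-length (arc {U = U} {cs = cs} {ts} _ p q) = cong suc (trans (Listₚ.length-++ U)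
  (trans (cong₂ (λ x y → x + suc y) (nc-length p) (nc-length q)) (pf (sizes cs) (sizes ts))))
  where
  pf : ∀ c t → c + c + suc (t + t) ≡ c + t + suc (c + t)
  pf = solve-∀

nc-functional : ∀ {α : Fin ℓ → Fin ℓ} {W ts ts′} → Unique W → NC α W ts → NC α W ts′ → ts ≡ ts′
nc-functional u p q = go u p q refl
  where
  go : ∀ {α : Fin ℓ → Fin ℓ} {W W′ ts ts′} → Unique W → NC α W ts → NC α W′ ts′ → W ≡ W′ → ts ≡ ts′
  go u [] [] e = refl
  go (_ ∷ u) (arc {U = U} refl p q) (arc {U = U′} refl p′ q′) e with Listₚ.∷-injective e
  ... | refl , e′ with ++-∷-injective U U′ u e′
  ...   | refl , refl = cong₂ (λ c t → node c ∷ t) (go (proj₁ (unique-++⁻ U u)) p p′ refl)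
                          (go (AllPairs.tail (proj₁ (proj₂ (unique-++⁻ U u)))) q q′ refl)

++-length-injective : ∀ {A : Set} (xs : List A) {ys zs ws} → length xs ≡ length ys → xs ++ zs ≡ ys ++ ws → xs ≡ ys × zs ≡ ws
++-length-injective []       {[]}     _ e = refl , e
++-length-injective (x ∷ xs) {y ∷ ys} l e with Listₚ.∷-injective e
... | refl , e′ with ++-length-injective xs {ys} (ℕₚ.suc-injective l) e′
...   | refl , refl = refl , refl

nc-injective : ∀ {α β : Fin ℓ → Fin ℓ} {W ts} → (∀ x → α (α x) ≡ x) → (∀ x → β (β x) ≡ x) →
               NC α W ts → NC β W ts → ∀ {y} → y ∈ W → α y ≡ β y
nc-injective {α = α} {β} αα ββ p q = go p q refl
  where
  go : ∀ {W W′ ts} → NC α W ts → NC β W′ ts → W ≡ W′ → ∀ {y} → y ∈ W → α y ≡ β y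
  go (arc {U = U} refl p q) (arc {U = U′} refl p′ q′) e m with Listₚ.∷-injective e
  ... | refl , e′ with ++-length-injective U {U′} (trans (nc-length p) (sym (nc-length p′))) e′
  ...   | refl , e″ with Listₚ.∷-injective e″
  ...     | eb , refl with m
  ...       | here refl = eb
  ...       | there m′ with ∈-++⁻ U m′
  ...         | inj₁ k           = go p p′ refl k
  ...         | inj₂ (there k)   = go q q′ refl k
  ...         | inj₂ (here refl) = trans (αα _) (trans (sym (ββ _)) (cong β (sym eb)))

nc-cong : ∀ {α β : Fin ℓ → Fin ℓ} {W ts} → (∀ {y} → y ∈ W → α y ≡ β y) → NC α W ts → NC β W ts
nc-cong eq [] = []
nc-cong eq (arc {U = U} e p q) = arc (trans (sym (eq (here refl))) e) (nc-cong (eq ∘ there ∘ ∈-++⁺ˡ) p)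
  (nc-cong (eq ∘ there ∘ ∈-++⁺ʳ U ∘ there) q)

split-at : ∀ {A : Set} i {j} (W : List A) → length W ≡ i + j → ∃₂ λ U V → W ≡ U ++ V × length U ≡ i × length V ≡ j
split-at zero    W       e = [] , W , refl , refl , e
split-at (suc i) (w ∷ W) e with split-at i W (ℕₚ.suc-injective e)
... | U , V , refl , eU , eV = w ∷ U , V , refl , cong suc eU , eV

record Pairing (W : List (Fin ℓ)) (α : Fin ℓ → Fin ℓ) : Set where
  field
    closed : ∀ {y} → y ∈ W → α y ∈ W
    invol  : ∀ {y} → y ∈ W → α (α y) ≡ y
    fpf    : ∀ {y} → y ∈ W → α y ≢ y
open Pairing

nc-exists : ∀ (ts : List PTree) {W : List (Fin ℓ)} → Unique W → length W ≡ sizes ts + sizes ts →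
            ∃ λ α → Pairing W α × NC α W ts
nc-exists [] {[]} u e = id , record { closed = λ () ; invol = λ () ; fpf = λ () } , []
nc-exists {ℓ} (node cs ∷ ts) {a ∷ W} u₀@(_ ∷ u) e
  with split-at (sizes cs + sizes cs) {suc (sizes ts + sizes ts)} W
         (trans (ℕₚ.suc-injective e) (pf (sizes cs) (sizes ts)))
  where
  pf : ∀ c t → c + t + suc (c + t) ≡ c + c + suc (t + t)
  pf = solve-∀
... | U , b ∷ V , refl , eU , eV
  with nc-exists cs (proj₁ (unique-++⁻ U u)) eU
     | nc-exists ts (AllPairs.tail (proj₁ (proj₂ (unique-++⁻ U u)))) (ℕₚ.suc-injective eV)
...   | αᵘ , Pᵘ , ncᵘ | αᵛ , Pᵛ , ncᵛ = α , record { closed = closed′ ; invol = invol′ ; fpf = fpf′ }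
  , arc α-a (nc-cong (sym ∘ α-U) ncᵘ) (nc-cong (sym ∘ α-V) ncᵛ)
  where
  a≢b : a ≢ b
  a≢b refl = unique-∷⁻ u₀ (∈-++⁺ʳ U (here refl))
  a∉U : a ∉ U
  a∉U m = unique-∷⁻ u₀ (∈-++⁺ˡ m)
  a∉V : a ∉ V
  a∉V m = unique-∷⁻ u₀ (∈-++⁺ʳ U (there m))
  b∉U : b ∉ U
  b∉U m = proj₂ (proj₂ (unique-++⁻ U u)) m (here refl)
  b∉V : b ∉ V
  b∉V = unique-∷⁻ (proj₁ (proj₂ (unique-++⁻ U u)))
  α : Fin ℓ → Fin ℓ
  α y with y ≟ a | y ≟ b | y ∈? U
  ... | yes _ | _     | _     = b
  ... | no _  | yes _ | _     = a
  ... | no _  | no _  | yes _ = αᵘ y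
  ... | no _  | no _  | no _  = αᵛ y
  α-a : α a ≡ b
  α-a with a ≟ a
  ... | yes _ = refl
  ... | no ne = contradiction refl ne
  α-b : α b ≡ a
  α-b with b ≟ a | b ≟ b
  ... | yes e | _     = contradiction (sym e) a≢b
  ... | no _  | yes _ = refl
  ... | no _  | no ne = contradiction refl ne
  α-U : ∀ {y} → y ∈ U → α y ≡ αᵘ y
  α-U {y} m with y ≟ a | y ≟ b | y ∈? U
  ... | yes refl | _        | _     = contradiction m a∉U
  ... | no _     | yes refl | _     = contradiction m b∉U
  ... | no _     | no _     | yes _ = refl
  ... | no _     | no _     | no n  = contradiction m n
  α-V : ∀ {y} → y ∈ V → α y ≡ αᵛ y
  α-V {y} m with y ≟ a | y ≟ b | y ∈? U
  ... | yes refl | _        | _     = contradiction m a∉V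
  ... | no _     | yes refl | _     = contradiction m b∉V
  ... | no _     | no _     | yes n = contradiction (there m) (proj₂ (proj₂ (unique-++⁻ U u)) n)
  ... | no _     | no _     | no _  = refl
  classify : ∀ {y} → y ∈ a ∷ U ++ b ∷ V → y ≡ a ⊎ y ≡ b ⊎ y ∈ U ⊎ y ∈ V
  classify (here e) = inj₁ e
  classify (there m) with ∈-++⁻ U m
  ... | inj₁ k         = inj₂ (inj₂ (inj₁ k))
  ... | inj₂ (here e)  = inj₂ (inj₁ e)
  ... | inj₂ (there k) = inj₂ (inj₂ (inj₂ k))
  closed′ : ∀ {y} → y ∈ a ∷ U ++ b ∷ V → α y ∈ a ∷ U ++ b ∷ V
  closed′ m with classify m
  ... | inj₁ refl               = subst (_∈ a ∷ U ++ b ∷ V) (sym α-a) (there (∈-++⁺ʳ U (here refl)))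
  ... | inj₂ (inj₁ refl)        = subst (_∈ a ∷ U ++ b ∷ V) (sym α-b) (here refl)
  ... | inj₂ (inj₂ (inj₁ k))    = subst (_∈ a ∷ U ++ b ∷ V) (sym (α-U k)) (there (∈-++⁺ˡ (closed Pᵘ k)))
  ... | inj₂ (inj₂ (inj₂ k))    = subst (_∈ a ∷ U ++ b ∷ V) (sym (α-V k)) (there (∈-++⁺ʳ U (there (closed Pᵛ k))))
  invol′ : ∀ {y} → y ∈ a ∷ U ++ b ∷ V → α (α y) ≡ y
  invol′ m with classify m
  ... | inj₁ refl               = trans (cong α α-a) α-b
  ... | inj₂ (inj₁ refl)        = trans (cong α α-b) α-a
  ... | inj₂ (inj₂ (inj₁ k))    = trans (cong α (α-U k)) (trans (α-U (closed Pᵘ k)) (invol Pᵘ k))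
  ... | inj₂ (inj₂ (inj₂ k))    = trans (cong α (α-V k)) (trans (α-V (closed Pᵛ k)) (invol Pᵛ k))
  fpf′ : ∀ {y} → y ∈ a ∷ U ++ b ∷ V → α y ≢ y
  fpf′ m e with classify m
  ... | inj₁ refl               = a≢b (trans (sym e) α-a)
  ... | inj₂ (inj₁ refl)        = a≢b (trans (sym α-b) e)
  ... | inj₂ (inj₂ (inj₁ k))    = fpf Pᵘ k (trans (sym (α-U k)) e)
  ... | inj₂ (inj₂ (inj₂ k))    = fpf Pᵛ k (trans (sym (α-V k)) e)

++-compare : ∀ {A : Set} (as cs : List A) {bs ds} → as ++ bs ≡ cs ++ ds →
             (∃ λ z → as ≡ cs ++ z × ds ≡ z ++ bs) ⊎ (∃ λ z → cs ≡ as ++ z × bs ≡ z ++ ds)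
++-compare []       cs       e = inj₂ (cs , refl , e)
++-compare (a ∷ as) []       e = inj₁ (a ∷ as , refl , sym e)
++-compare (a ∷ as) (c ∷ cs) e with Listₚ.∷-injective e
... | refl , e′ with ++-compare as cs e′
...   | inj₁ (z , refl , d) = inj₁ (z , refl , d)
...   | inj₂ (z , refl , d) = inj₂ (z , refl , d)

nc-insert : ∀ {α : Fin ℓ → Fin ℓ} {h k W ts} X {Y} → α h ≡ k → NC α W ts → W ≡ X ++ Y → ∃ λ ts′ → NC α (X ++ h ∷ k ∷ Y) ts′
nc-insert []      αh p refl = _ , arc αh [] p
nc-insert (x ∷ X) αh [] ()
nc-insert {α = α} (x ∷ X) αh (arc {U = U} {V} {cs} {ts} e p q) eq with Listₚ.∷-injective eq
... | refl , eq′ with ++-compare U X eq′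
...   | inj₁ (z , refl , refl) = let cs′ , p′ = nc-insert X αh p refl in
  node cs′ ∷ ts , subst (λ w → NC α (x ∷ w) (node cs′ ∷ ts)) (Listₚ.++-assoc X (_ ∷ _ ∷ z) _) (arc e p′ q)
...   | inj₂ ([] , refl , refl) = let cs′ , p′ = nc-insert U {[]} αh p (sym (Listₚ.++-identityʳ U)) in
  node cs′ ∷ ts , subst (λ w → NC α (x ∷ w) (node cs′ ∷ ts))
    (trans (Listₚ.++-assoc U (_ ∷ _ ∷ []) _) (cong (_++ _ ∷ _ ∷ _ ∷ V) (sym (Listₚ.++-identityʳ U)))) (arc e p′ q)
...   | inj₂ (y ∷ z , refl , eq″) with Listₚ.∷-injective eq″
...     | refl , refl = let ts′ , q′ = nc-insert z αh q refl in
  node cs ∷ ts′ , subst (λ w → NC α (x ∷ w) (node cs ∷ ts′)) (sym (Listₚ.++-assoc U (y ∷ z) _)) (arc e p q′)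

-- vn numbers the vertices: the k-th vertex in preorder is entered by the letter a (a descent in the tree)
-- and its parent p is entered again by the letter b = α a.
data Contour {N} (α : Fin N → Fin N) (vn : Fin N → ℕ) : ℕ → ℕ → List (Fin N) → List PTree → Set where
  []  : ∀ {p k} → Contour α vn p k [] []
  arc : ∀ {p k a b U V cs ts} → α a ≡ b → vn a ≡ k → vn b ≡ p → Contour α vn k (suc k) U cs →
        Contour α vn p (k + size (node cs)) V ts → Contour α vn p k (a ∷ U ++ b ∷ V) (node cs ∷ ts)

contour-cong : ∀ {N} {α : Fin N → Fin N} {vn vn′ p k W ts} → (∀ {y} → y ∈ W → vn y ≡ vn′ y) →
               Contour α vn p k W ts → Contour α vn′ p k W ts
contour-cong eq [] = []
contour-cong eq (arc {U = U} e ea eb c d) = arc e (trans (sym (eq (here refl))) ea)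
  (trans (sym (eq (there (∈-++⁺ʳ U (here refl))))) eb)
  (contour-cong (eq ∘ there ∘ ∈-++⁺ˡ) c) (contour-cong (eq ∘ there ∘ ∈-++⁺ʳ U ∘ there) d)

contour-exists : ∀ {N} {α : Fin N → Fin N} {W ts} → Unique W → NC α W ts → ∀ p k → ∃ λ vn → Contour α vn p k W ts
contour-exists u [] p k = (λ _ → 0) , []
contour-exists {N} {α} u₀@(_ ∷ u) (arc {a} {b} {U} {V} {cs} e ncᵘ ncᵛ) p k
  with contour-exists (proj₁ (unique-++⁻ U u)) ncᵘ k (suc k)
     | contour-exists (AllPairs.tail (proj₁ (proj₂ (unique-++⁻ U u)))) ncᵛ p (k + size (node cs))
... | vnᵘ , cᵘ | vnᵛ , cᵛ = vn , arc e vn-a vn-b (contour-cong (sym ∘ vn-U) cᵘ) (contour-cong (sym ∘ vn-V) cᵛ)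
  where
  vn : Fin N → ℕ
  vn y with y ≟ a | y ≟ b | y ∈? U
  ... | yes _ | _     | _     = k
  ... | no _  | yes _ | _     = p
  ... | no _  | no _  | yes _ = vnᵘ y
  ... | no _  | no _  | no _  = vnᵛ y
  vn-a : vn a ≡ k
  vn-a with a ≟ a
  ... | yes _ = refl
  ... | no ne = contradiction refl ne
  vn-b : vn b ≡ p
  vn-b with b ≟ a | b ≟ b
  ... | yes e | _     = contradiction (subst (_∈ U ++ b ∷ V) e (∈-++⁺ʳ U (here refl))) (unique-∷⁻ u₀)
  ... | no _  | yes _ = refl
  ... | no _  | no ne = contradiction refl ne
  vn-U : ∀ {y} → y ∈ U → vn y ≡ vnᵘ y
  vn-U {y} m with y ≟ a | y ≟ b | y ∈? U
  ... | yes refl | _        | _     = contradiction (∈-++⁺ˡ m) (unique-∷⁻ u₀)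
  ... | no _     | yes refl | _     = contradiction (here refl) (proj₂ (proj₂ (unique-++⁻ U u)) m)
  ... | no _     | no _     | yes _ = refl
  ... | no _     | no _     | no n  = contradiction m n
  vn-V : ∀ {y} → y ∈ V → vn y ≡ vnᵛ y
  vn-V {y} m with y ≟ a | y ≟ b | y ∈? U
  ... | yes refl | _        | _     = contradiction (∈-++⁺ʳ U (there m)) (unique-∷⁻ u₀)
  ... | no _     | yes refl | _     = contradiction m (unique-∷⁻ (proj₁ (proj₂ (unique-++⁻ U u))))
  ... | no _     | no _     | yes n = contradiction (there m) (proj₂ (proj₂ (unique-++⁻ U u)) n)
  ... | no _     | no _     | no _  = refl

count : ℕ → ℕ → List ℕ
count k zero    = []
count k (suc m) = k ∷ count (suc k) m

count-++ : ∀ k i j → count k (i + j) ≡ count k i ++ count (k + i) j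
count-++ k zero    j = cong (λ z → count z j) (sym (ℕₚ.+-identityʳ k))
count-++ k (suc i) j = cong (k ∷_) (trans (count-++ (suc k) i j) (cong (λ z → count (suc k) i ++ count z j) (sym (ℕₚ.+-suc k i))))

module _ {N} (α : Fin N → Fin N) (α-invol : ∀ x → α (α x) ≡ x) {vn : Fin N → ℕ} where

  data Steps : ℕ → List (Fin N) → ℕ → Set where
    stop : ∀ {p} → Steps p [] p
    step : ∀ {p y W q} → vn (α y) ≡ p → Steps (vn y) W q → Steps p (y ∷ W) q

  steps-++ : ∀ {p q r U V} → Steps p U q → Steps q V r → Steps p (U ++ V) r
  steps-++ stop       t = t
  steps-++ (step e s) t = step e (steps-++ s t)

  steps-end : ∀ {p q l} u → Steps p (u ∷ʳ l) q → vn l ≡ q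
  steps-end []      (step _ stop) = refl
  steps-end (x ∷ u) (step _ s)    = steps-end u s

  contour-steps : ∀ {p k W ts} → Contour α vn p k W ts → Steps p W p
  contour-steps [] = stop
  contour-steps {p} {k} (arc {a = a} {b} {U} e ea eb c d) =
    step (trans (cong vn e) eb) (subst (λ i → Steps i (U ++ b ∷ _) p) (sym ea)
      (steps-++ (contour-steps c) (step (trans (cong vn (trans (cong α (sym e)) (α-invol a))) ea)
        (subst (λ i → Steps i _ p) (sym eb) (contour-steps d)))))

  walk-steps : ∀ {f a W b q y} → Walk f a W b → Steps (vn a) W q → y ∈ a ∷ W → y ≡ b ⊎ vn (α (f y)) ≡ vn y
  walk-steps stop       stop        (here refl) = inj₁ refl
  walk-steps (step e w) (step e′ s) (here refl) = inj₂ (trans (cong (vn ∘ α) e) e′)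
  walk-steps (step e w) (step e′ s) (there m)   = walk-steps w s m

  contour-range : ∀ {p k W ts y} → Contour α vn p k W ts → y ∈ W → vn y ≡ p ⊎ (k ≤ vn y × vn y < k + sizes ts)
  contour-range {p} {k} (arc {U = U} {cs = cs} {ts} e refl eb c d) (here refl) =
    inj₂ (ℕₚ.≤-refl , ℕₚ.m<m+n k (s≤s z≤n))
  contour-range {p} {k} (arc {U = U} {cs = cs} {ts} e ea eb c d) (there m) with ∈-++⁻ U m
  ... | inj₂ (here refl) = inj₁ eb
  ... | inj₁ m′ with contour-range c m′
  ...   | inj₁ e′        = inj₂ (ℕₚ.≤-reflexive (sym e′) , subst (_< k + (suc (sizes cs) + sizes ts)) (sym e′) (ℕₚ.m<m+n k (s≤s z≤n)))
  ...   | inj₂ (lo , hi) = inj₂ (ℕₚ.<⇒≤ lo , ℕₚ.<-≤-trans hi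
          (ℕₚ.≤-trans (ℕₚ.≤-reflexive (sym (ℕₚ.+-suc k (sizes cs)))) (ℕₚ.+-monoʳ-≤ k (ℕₚ.m≤m+n (suc (sizes cs)) (sizes ts)))))
  contour-range {p} {k} (arc {U = U} {cs = cs} {ts} e ea eb c d) (there m) | inj₂ (there m′) with contour-range d m′
  ...   | inj₁ e′        = inj₁ e′
  ...   | inj₂ (lo , hi) = inj₂ (ℕₚ.≤-trans (ℕₚ.m≤m+n k _) lo , ℕₚ.<-≤-trans hi (ℕₚ.≤-reflexive (ℕₚ.+-assoc k (suc (sizes cs)) (sizes ts))))

  record Entries (p k : ℕ) (W : List (Fin N)) (ts : List PTree) : Set where
    field
      entries : List (Fin N)
      numbers : map vn entries ≡ count k (sizes ts)
      parents : map (vn ∘ α) entries ≡ parentsF p k ts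
      cover   : ∀ {y} → y ∈ W → y ∈ entries ⊎ α y ∈ entries

  contour-entries : ∀ {p k W ts} → Contour α vn p k W ts → Entries p k W ts
  contour-entries [] = record { entries = [] ; numbers = refl ; parents = refl ; cover = λ () }
  contour-entries {p} {k} (arc {a = a} {b} {U} {V} {cs} {ts} e ea eb c d) = record
    { entries = a ∷ C.entries ++ D.entries
    ; numbers = cong₂ _∷_ ea (trans (Listₚ.map-++ vn C.entries D.entries) (trans (cong₂ _++_ C.numbers D.numbers)
        (trans (cong (λ z → count (suc k) (sizes cs) ++ count z (sizes ts)) (ℕₚ.+-suc k (sizes cs))) (sym (count-++ (suc k) (sizes cs) (sizes ts))))))
    ; parents = cong₂ _∷_ (trans (cong vn e) eb) (trans (Listₚ.map-++ (vn ∘ α) C.entries D.entries) (cong₂ _++_ C.parents D.parents))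
    ; cover = λ { (here refl) → inj₁ (here refl) ; (there m) → cover′ (∈-++⁻ U m) } }
    where
    module C = Entries (contour-entries c)
    module D = Entries (contour-entries d)
    cover′ : ∀ {y} → y ∈ U ⊎ y ∈ b ∷ V → y ∈ a ∷ C.entries ++ D.entries ⊎ α y ∈ a ∷ C.entries ++ D.entries
    cover′ (inj₁ m) with C.cover m
    ... | inj₁ n = inj₁ (there (∈-++⁺ˡ n))
    ... | inj₂ n = inj₂ (there (∈-++⁺ˡ n))
    cover′ (inj₂ (here refl)) = inj₂ (here (trans (cong α (sym e)) (α-invol a)))
    cover′ (inj₂ (there m)) with D.cover m
    ... | inj₁ n = inj₁ (there (∈-++⁺ʳ C.entries n))
    ... | inj₂ n = inj₂ (there (∈-++⁺ʳ C.entries n))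

∈-count : ∀ {k m j} → k ≤ j → j < k + m → j ∈ count k m
∈-count {k} {zero}  {j} lo hi = contradiction (subst (j <_) (ℕₚ.+-identityʳ k) hi) (ℕₚ.≤⇒≯ lo)
∈-count {k} {suc m} {j} lo hi with k ℕ.≟ j
... | yes refl = here refl
... | no ne    = there (∈-count (ℕₚ.≤∧≢⇒< lo ne) (subst (j <_) (ℕₚ.+-suc k m) hi))

walk-const : ∀ {A B : Set} {f : A → A} (g : A → B) → (∀ y → g (f y) ≡ g y) → ∀ {a w b y} → Walk f a w b → y ∈ w → g y ≡ g a
walk-const g inv (step e w) (here refl) = trans (cong g (sym e)) (inv _)
walk-const g inv (step e w) (there m)   = trans (walk-const g inv w m) (trans (cong g (sym e)) (inv _))

unique-map⁻ : ∀ {A B : Set} (f : A → B) {xs x y} → Unique (map f xs) → x ∈ xs → y ∈ xs → f x ≡ f y → x ≡ y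
unique-map⁻ f (p ∷ u) (here refl) (here refl) e = refl
unique-map⁻ f (p ∷ u) (here refl) (there m)   e = contradiction e (All.lookup p (∈-map⁺ f m))
unique-map⁻ f (p ∷ u) (there m)   (here refl) e = contradiction (sym e) (All.lookup p (∈-map⁺ f m))
unique-map⁻ f (p ∷ u) (there m)   (there n)   e = unique-map⁻ f u m n e

module _ (M : ℕ) where
  private N = suc M

  -- The root comes last, after the complete contour of the tree.
  contourWord : List (Fin N)
  contourWord = tabulate suc ∷ʳ zero

  contourWord-full : Full contourWord
  contourWord-full = full-↭ (↭ₚ.∷↭∷ʳ zero (tabulate suc)) allFin-full

  contourWord-walk : Walk (next (allFin N)) zero contourWord zero
  contourWord-walk = go (next-cycle (∈-allFin zero) (Uniqueₚ.allFin⁺ N))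
    where
    go : Cycle (next (allFin N)) (allFin N) → Walk (next (allFin N)) zero contourWord zero
    go (cycle _ (step e p)) = walk-++ p (step e stop)

  module _ {n : ℕ} (N≡2n : N ≡ n + n) (m : Matching N) where

    private
      W = allFin N
      module V = Vertices (mate m) (mate-injective m)

    cycles-≤ : length (cyclesᵐ M m W) ≤ suc n
    cycles-≤ = subst₂ _≤_ (sym (Listₚ.length-map (V.C W) (V.tops W)))
      (DownCount.down-count N≡2n (mate m) (mate-invol m) (mate-fpf m) {W} allFin-full down? (λ x → id , id) refl)
      (unique-⊆⇒length (V.tops-unique allFin-full) (λ {r} r∈ → ∈-filter⁺ down? (∈-allFin r)
        (All.lookup (V.tops-top allFin-full r∈) (cycle-image (V.OneMap.C-Cycle allFin-full r) (V.OneMap.∈C allFin-full r)))))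
      where
      down? : Decidable (V.Down W)
      down? x = idx W (mate m (next W x)) ℕ.≤? idx W x

    record Numbering (ts : List PTree) : Set where
      field
        vn       : Fin N → Fin (suc n)
        vn-root  : vn zero ≡ zero
        blocks   : cyclesᵐ M m W ≋ map (λ i → filter (λ h → vn h ≟ i) W) (allFin (suc n))
        entries  : List (Fin N)
        numbers  : map (toℕ ∘ vn) entries ≡ count 1 n
        parents  : map (toℕ ∘ vn ∘ mate m) entries ≡ parentsF 0 1 ts
        cover    : ∀ y → y ∈ entries ⊎ mate m y ∈ entries

    numbering : ∀ {ts} → sizes ts ≡ n → NC (mate m) contourWord ts → Numbering ts
    numbering {ts} refl nc = go (contour-exists (unique contourWord-full) nc 0 1)
      where
      go : (∃ λ vn → Contour (mate m) vn 0 1 contourWord ts) → Numbering ts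
      go (vn , c) = record
        { vn = vnF ; vn-root = Finₚ.toℕ-injective (trans (vnF-vn zero) root0)
        ; blocks = Homo.trans (pointwise (V.tops W) id) (Homo.trans (≋-reflexive (Listₚ.map-∘ (V.tops W))) (↭⇒≋ (↭ₚ.map⁺ vb labels-↭)))
        ; entries = E.entries
        ; numbers = trans (Listₚ.map-cong vnF-vn E.entries) E.numbers
        ; parents = trans (Listₚ.map-cong (vnF-vn ∘ mate m) E.entries) E.parents
        ; cover = λ y → E.cover (complete contourWord-full y) }
        where
        module E = Entries (contour-entries (mate m) (mate-invol m) c)
        steps : Steps (mate m) (mate-invol m) {vn} 0 contourWord 0
        steps = contour-steps (mate m) (mate-invol m) c
        root0 : vn zero ≡ 0
        root0 = steps-end (mate m) (mate-invol m) (tabulate suc) steps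
        bound : ∀ y → vn y < suc n
        bound y = [ (λ e → subst (_< suc n) (sym e) (s≤s z≤n)) , proj₂ ]′ (contour-range (mate m) (mate-invol m) c (complete contourWord-full y))
        vnF : Fin N → Fin (suc n)
        vnF y = fromℕ< (bound y)
        vnF-vn : ∀ y → toℕ (vnF y) ≡ vn y
        vnF-vn y = Finₚ.toℕ-fromℕ< (bound y)
        vn-first : vn (mate m (next W zero)) ≡ vn zero
        vn-first = first contourWord-walk steps (complete contourWord-full zero)
          where
          first : ∀ {w b q} → Walk (next W) zero w b → Steps (mate m) (mate-invol m) {vn} 0 w q → zero ∈ w → vn (mate m (next W zero)) ≡ vn zero
          first (step e _) (step e′ _) _ = trans (cong (vn ∘ mate m) e) (trans e′ (sym root0))
        vn-σ : ∀ y → vn (mate m (next W y)) ≡ vn y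
        vn-σ y = [ (λ { refl → vn-first }) , id ]′ (walk-steps (mate m) (mate-invol m) {vn} contourWord-walk
          (subst (λ i → Steps (mate m) (mate-invol m) {vn} i contourWord 0) (sym root0) steps) (there (complete contourWord-full y)))
        vnF-σ : ∀ y → vnF (V.σ W y) ≡ vnF y
        vnF-σ y = Finₚ.toℕ-injective (trans (vnF-vn _) (trans (vn-σ y) (sym (vnF-vn y))))
        vnF-C : ∀ {x y} → y ∈ V.C W x → vnF y ≡ vnF x
        vnF-C {x} = walk-const vnF vnF-σ (V.OneMap.C-walk allFin-full x)
        hit : ∀ i → ∃ λ y → vnF y ≡ i
        hit zero = zero , Finₚ.toℕ-injective (trans (vnF-vn zero) root0)
        hit (suc i) = found (∈-map⁻ vn (subst (suc (toℕ i) ∈_) (sym E.numbers) (∈-count (s≤s z≤n) (s≤s (Finₚ.toℕ<n i)))))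
          where
          found : (∃ λ y → y ∈ E.entries × suc (toℕ i) ≡ vn y) → ∃ λ y → vnF y ≡ suc i
          found (y , _ , e) = y , Finₚ.toℕ-injective (trans (vnF-vn y) (sym e))
        labels : List (Fin (suc n))
        labels = map vnF (V.tops W)
        labels-all : allFin (suc n) ⊆ labels
        labels-all {i} _ = at (hit i)
          where
          at : (∃ λ y → vnF y ≡ i) → i ∈ labels
          at (y , refl) = let r , r∈ , rt , _ = V.top-exists allFin-full y in subst (_∈ labels) (vnF-C r∈) (∈-map⁺ vnF rt)
        labels-↭ : labels ↭ allFin (suc n)
        labels-↭ = exact (unique-⊆⇒↭ (Uniqueₚ.allFin⁺ (suc n)) labels-all)
          where
          exact : (∃ λ zs → labels ↭ allFin (suc n) ++ zs) → labels ↭ allFin (suc n)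
          exact ([] , p) = ↭-trans p (↭-reflexive (Listₚ.++-identityʳ _))
          exact (z ∷ zs , p) = contradiction (subst (_≤ suc n) too-long cycles-≤) (ℕₚ.m+1+n≰m (suc n))
            where
            too-long : length (cyclesᵐ M m W) ≡ suc n + suc (length zs)
            too-long = trans (Listₚ.length-map (V.C W) (V.tops W)) (trans (sym (Listₚ.length-map vnF (V.tops W))) (trans (↭ₚ.↭-length p)
              (trans (Listₚ.length-++ (allFin (suc n))) (cong (_+ suc (length zs)) (Listₚ.length-tabulate {n = suc n} id)))))
        labels-unique : Unique labels
        labels-unique = unique-resp-↭ (↭-sym labels-↭) (Uniqueₚ.allFin⁺ (suc n))
        vb : Fin (suc n) → List (Fin N)
        vb i = filter (λ h → vnF h ≟ i) W
        block : ∀ {r} → r ∈ V.tops W → V.C W r ↭ vb (vnF r)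
        block {r} rt = unique-↭ (V.OneMap.C-unique allFin-full r) (Uniqueₚ.filter⁺ (λ h → vnF h ≟ vnF r) (Uniqueₚ.allFin⁺ N))
          (λ {y} y∈ → ∈-filter⁺ (λ h → vnF h ≟ vnF r) (∈-allFin y) (vnF-C y∈))
          (λ {y} y∈ → back y (proj₂ (∈-filter⁻ (λ h → vnF h ≟ vnF r) {xs = W} y∈)))
          where
          back : ∀ y → vnF y ≡ vnF r → y ∈ V.C W r
          back y e = at (V.top-exists allFin-full y)
            where
            at : (∃ λ s → s ∈ V.C W y × s ∈ V.tops W × V.Top W s) → y ∈ V.C W r
            at (s , s∈ , st , _) = subst (λ z → y ∈ V.C W z) (unique-map⁻ vnF labels-unique st rt (trans (vnF-C s∈) e))
              (V.OneMap.C-sym allFin-full s∈)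
        pointwise : ∀ rs → rs ⊆ V.tops W → map (V.C W) rs ≋ map (vb ∘ vnF) rs
        pointwise []       s = ≋-refl
        pointwise (r ∷ rs) s = Homo.prep (block (s (here refl))) (pointwise rs (s ∘ there))

cycle-injective : ∀ {A : Set} {f : A → A} {w x y} → Cycle f w → Unique w → x ∈ w → y ∈ w → f x ≡ f y → x ≡ y
cycle-injective {f = f} {w} {x} {y} c u x∈ y∈ e with cycle-at c x∈
... | v , p , q = go (v ∷ʳ _) p (unique-resp-↭ (↭-sym q) u) (∈-resp-↭ (↭-sym q) y∈)
  where
  go : ∀ w → Walk f x w x → Unique w → y ∈ w → x ≡ y
  go (z ∷ w) (step e′ p) u m with walk-image p m
  ... | inj₁ refl = refl
  ... | inj₂ n    = contradiction (subst (_∈ w) (trans (sym e) e′) n) (unique-∷⁻ u)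

short-block : ∀ {A : Set} {f : A → A} {cs : List (List A)} → All (Cycle f) cs → length (concat cs) < length cs + length cs →
              ∃ λ h → [ h ] ∈ cs
short-block {cs = []} [] ()
short-block {cs = [] ∷ cs} (cycle {[]} () _ ∷ _) lt
short-block {cs = [] ∷ cs} (cycle {_ ∷ _} () _ ∷ _) lt
short-block {cs = (h ∷ []) ∷ cs} _ lt = h , here refl
short-block {cs = (a ∷ b ∷ c) ∷ cs} (_ ∷ all) lt with short-block all (smaller lt)
  where
  smaller : suc (suc (length (c ++ concat cs))) < suc (length cs + suc (length cs)) → length (concat cs) < length cs + length cs
  smaller lt = ℕₚ.≤-<-trans (subst (length (concat cs) ≤_) (sym (Listₚ.length-++ c)) (ℕₚ.m≤n+m _ (length c)))
    (ℕₚ.≤-pred (ℕₚ.≤-pred (subst (suc (suc (length (c ++ concat cs))) <_) (cong suc (ℕₚ.+-suc (length cs) (length cs))) lt)))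
... | h , m = h , there m

module LeafRemoval {N : ℕ} (α : Fin N → Fin N) (α-invol : ∀ x → α (α x) ≡ x) (α-fpf : ∀ x → α x ≢ x) where

  -- The word W, a leaf h of the map whose edge is traversed as h, α h, and the word V without this edge;
  -- R is V read from α h on.
  record Leaf (W V : List (Fin N)) (h : Fin N) : Set where
    field
      R       : List (Fin N)
      around  : Walk (next W) (α h) (R ∷ʳ h) h
      perm    : W ↭ h ∷ α h ∷ V
      same    : R ↭ V
      rotate  : ∀ {f : Fin N → Fin N} {x} → x ∈ V → Cycle f R → Cycle f V
      restore : ∀ {ts} → NC α V ts → ∃ λ ts′ → NC α W ts′

  find-leaf : ∀ {W h} → Unique W → h ∈ W → next W h ≡ α h → 2 < length W → ∃ λ V → Leaf W V h
  find-leaf {W} {h} u h∈ e big with next-cycle h∈ u | ∈-∃++ h∈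
  ... | cycle {body} {l} sh w | X , [] , refl with Listₚ.∷ʳ-injective X body sh
  find-leaf u h∈ e (s≤s ()) | cycle sh w | [] , [] , refl | refl , refl
  ...   | refl , refl = wrap X e w
    where
    wrap : ∀ X → next (X ∷ʳ h) h ≡ α h → Walk (next (X ∷ʳ h)) h (X ∷ʳ h) h → ∃ λ V → Leaf (X ∷ʳ h) V h
    wrap []      e (step e′ _) = contradiction (trans (sym e) e′) (α-fpf h)
    wrap (x ∷ X) e (step e′ p) with trans (sym e′) e
    ... | refl = X , record
      { R = X ; around = p
      ; perm = ↭-trans (↭.prep (α h) (↭-sym (↭ₚ.∷↭∷ʳ h X))) (↭.swap (α h) h ↭-refl)
      ; same = ↭-refl ; rotate = λ _ c → c
      ; restore = λ nc → _ , arc (α-invol h) nc [] }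
  find-leaf {W} {h} u h∈ e big | cycle {body} {l} sh w | X , y ∷ Y , refl with walk-splitAt X w
  ... | p , step e′ q with trans (sym e′) e
  ...   | refl = X ++ Y , record
    { R = Y ++ X
    ; around = subst (λ z → Walk (next W) (α h) z h) (sym (Listₚ.++-assoc Y X [ h ])) (walk-++ q p)
    ; perm = ↭-trans (↭ₚ.shift h X (α h ∷ Y)) (↭.prep h (↭ₚ.shift (α h) X Y))
    ; same = ↭ₚ.++-comm Y X
    ; rotate = rot
    ; restore = λ nc → nc-insert X refl nc refl }
    where
    rot : ∀ {f : Fin N → Fin N} {x} → x ∈ X ++ Y → Cycle f (Y ++ X) → Cycle f (X ++ Y)
    rot x∈ (cycle _ w′) with walk-split Y w′
    ... | m , a , b = walk⇒cycle x∈ (walk-++ b a)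

  private
    removed-cycles : ∀ {W V h cs} → Unique W → Leaf W V h → 0 < length V →
      All (Cycle (λ y → α (next W y))) cs → concat cs ↭ W → [ h ] ∈ cs →
      ∃ λ ds → All (Cycle (λ y → α (next V y))) ds × concat ds ↭ V × suc (length ds) ≡ length cs
    removed-cycles {W} {V} {h} {cs} u L pos all cov h∈ with ∈⇒↭ h∈
    ... | cs₁ , p₁ with ∈-concat⁻′ cs₁ h′∈
      where
      h′∈ : α h ∈ concat cs₁
      h′∈ with ∈-resp-↭ (↭-trans (↭-trans (↭-sym (Leaf.perm L)) (↭-sym cov)) (concat-↭ p₁)) (there (here refl))
      ... | here e  = contradiction e (α-fpf h)
      ... | there m = m
    ...   | d , h′∈d , d∈ with ∈⇒↭ d∈
    ...     | others , p₂ with All-resp-↭ (↭-trans p₁ (↭.prep [ h ] p₂)) all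
    ...       | c-h ∷ c-d ∷ c-others with cycle-at c-d h′∈d
    ...         | t , wt , t↭ with snoc-view (Leaf.R L)
    ...           | inj₁ e = contradiction pos (subst (λ i → ¬ 0 < i) (↭ₚ.↭-length (Leaf.same L)) (λ lt → ℕₚ.<-irrefl (cong length (sym e)) lt))
    ...           | inj₂ (R′ , g , refl′) = finish t wt t↭
      where
      module L = Leaf L
      f σ : Fin N → Fin N
      f = next W
      σ y = α (f y)
      around′ : Walk f (α h) ((R′ ∷ʳ g) ∷ʳ h) h
      around′ = subst (λ R → Walk f (α h) (R ∷ʳ h) h) refl′ L.around
      u₁ : Unique (h ∷ α h ∷ V)
      u₁ = unique-resp-↭ L.perm u
      R↭V : R′ ∷ʳ g ↭ V
      R↭V = ↭-trans (↭-reflexive (sym refl′)) L.same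
      g∈V : g ∈ V
      g∈V = ∈-resp-↭ R↭V (∈-++⁺ʳ R′ (here refl))
      V⊆W : V ⊆ W
      V⊆W m = ∈-resp-↭ (↭-sym L.perm) (there (there m))
      uV : Unique V
      uV = AllPairs.tail (AllPairs.tail u₁)
      h∉V : h ∉ V
      h∉V m = unique-∷⁻ u₁ (there m)
      split-g : Walk f (α h) (R′ ∷ʳ g) g × Walk f g [ h ] h
      split-g = walk-splitAt R′ (subst (λ z → Walk f (α h) z h) (Listₚ.++-assoc R′ [ g ] [ h ]) around′)
      f-g : f g ≡ h
      f-g with proj₂ split-g
      ... | step e stop = e
      f₁ : Fin N → Fin N
      f₁ y with y ≟ g
      ... | yes _ = f (α h)
      ... | no _  = f y
      f₁-g : f₁ g ≡ f (α h)
      f₁-g with g ≟ g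
      ... | yes _ = refl
      ... | no ne = contradiction refl ne
      f₁-other : ∀ {y} → y ≢ g → f₁ y ≡ f y
      f₁-other {y} ne with y ≟ g
      ... | yes e = contradiction e ne
      ... | no _  = refl
      uR : Unique (R′ ∷ʳ g)
      uR = unique-resp-↭ (↭-sym R↭V) uV
      f₁-cycle : Cycle f₁ (R′ ∷ʳ g)
      f₁-cycle = cycle refl (reroute R′ (λ m → f₁-other (λ { refl → ∷ʳ-unique uR m })) f₁-g (proj₁ split-g))
      next-V : ∀ {y} → y ∈ V → next V y ≡ f₁ y
      next-V m = cycle⇒next (L.rotate g∈V (subst (Cycle f₁) (sym refl′) f₁-cycle)) uV m
      σ-other : ∀ {y} → y ∈ V → y ≢ g → α (next V y) ≡ σ y
      σ-other m ne = cong α (trans (next-V m) (f₁-other ne))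
      σ-g : α (next V g) ≡ σ (α h)
      σ-g = cong α (trans (next-V g∈V) f₁-g)
      whole : W ↭ h ∷ d ++ concat others
      whole = ↭-trans (↭-sym cov) (↭-trans (concat-↭ p₁) (↭.prep h (concat-↭ p₂)))
      finish : ∀ t → Walk σ (α h) (t ∷ʳ α h) (α h) → t ∷ʳ α h ↭ d →
               ∃ λ ds → All (Cycle (λ y → α (next V y))) ds × concat ds ↭ V × suc (length ds) ≡ length cs
      finish t wt t↭ with snoc-view t
      ... | inj₁ refl = contradiction (f-h′ wt) not-h
        where
        f-h′ : Walk σ (α h) (α h ∷ []) (α h) → f (α h) ≡ h
        f-h′ (step e stop) = trans (sym (α-invol _)) (trans (cong α e) (α-invol h))
        not-h : f (α h) ≢ h
        not-h e = go R′ (proj₁ split-g) (∈-resp-↭ R↭V)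
          where
          go : ∀ R → Walk f (α h) (R ∷ʳ g) g → (∀ {y} → y ∈ R ∷ʳ g → y ∈ V) → ⊥
          go []      (step e′ _) s = h∉V (subst (_∈ V) (trans (sym e′) e) (s (here refl)))
          go (_ ∷ _) (step e′ _) s = h∉V (subst (_∈ V) (trans (sym e′) e) (s (here refl)))
      ... | inj₂ (t′ , g′ , refl) with walk-splitAt t′ (subst (λ z → Walk σ (α h) z (α h)) (Listₚ.++-assoc t′ [ g′ ] [ α h ]) wt)
      ...   | w₁ , step e stop = (t′ ∷ʳ g) ∷ others , cyc-d ∷ cyc-others , cover , lengths
        where
        d-shape : d ↭ α h ∷ t′ ∷ʳ g′
        d-shape = ↭-trans (↭-sym t↭) (↭-sym (↭ₚ.∷↭∷ʳ (α h) (t′ ∷ʳ g′)))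
        whole′ : W ↭ h ∷ α h ∷ (t′ ∷ʳ g′) ++ concat others
        whole′ = ↭-trans whole (↭.prep h (↭ₚ.++⁺ʳ (concat others) d-shape))
        cover′ : (t′ ∷ʳ g′) ++ concat others ↭ V
        cover′ = ↭ₚ.drop-∷ (↭ₚ.drop-∷ (↭-trans (↭-sym whole′) L.perm))
        g′∈V : g′ ∈ V
        g′∈V = ∈-resp-↭ cover′ (∈-++⁺ˡ (∈-++⁺ʳ t′ (here refl)))
        g′≡g : g′ ≡ g
        g′≡g = cycle-injective (next-cycle (V⊆W g∈V) u) u (V⊆W g′∈V) (V⊆W g∈V)
          (trans (trans (sym (α-invol _)) (trans (cong α e) (α-invol h))) (sym f-g))
        cover : (t′ ∷ʳ g) ++ concat others ↭ V
        cover = subst (λ z → (t′ ∷ʳ z) ++ concat others ↭ V) g′≡g cover′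
        uc : Unique ((t′ ∷ʳ g) ++ concat others)
        uc = unique-resp-↭ (↭-sym cover) uV
        cyc-d : Cycle (λ y → α (next V y)) (t′ ∷ʳ g)
        cyc-d = cycle refl (reroute t′
          (λ m → σ-other (∈-resp-↭ cover (∈-++⁺ˡ (∈-++⁺ˡ m))) (λ { refl → ∷ʳ-unique (proj₁ (unique-++⁻ (t′ ∷ʳ g) uc)) m }))
          σ-g (subst (λ z → Walk σ (α h) (t′ ∷ʳ z) z) g′≡g w₁))
        cyc-others : All (Cycle (λ y → α (next V y))) others
        cyc-others = All.tabulate (λ {c} c∈ → cycle-local
          (λ m → σ-other (∈-resp-↭ cover (∈-++⁺ʳ (t′ ∷ʳ g) (∈-concat⁺′ m c∈)))
            (λ { refl → proj₂ (proj₂ (unique-++⁻ (t′ ∷ʳ g) uc)) (∈-++⁺ʳ t′ (here refl)) (∈-concat⁺′ m c∈) }))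
          (All.lookup c-others c∈))
        lengths : suc (length ((t′ ∷ʳ g) ∷ others)) ≡ length cs
        lengths = sym (trans (↭ₚ.↭-length p₁) (cong suc (↭ₚ.↭-length p₂)))

  planar⇒nc : ∀ k {W cs} → Unique W → length W ≡ suc k + suc k → (∀ {y} → y ∈ W → α y ∈ W) →
              All (Cycle (λ y → α (next W y))) cs → concat cs ↭ W → length cs ≡ suc (suc k) → ∃ λ ts → NC α W ts
  planar⇒nc zero {a ∷ b ∷ []} u e closed all cov len with closed (here refl)
  ... | here e′          = contradiction e′ (α-fpf a)
  ... | there (here e′)  = _ , arc e′ [] []
  planar⇒nc (suc k) {W} {cs} u e closed all cov len
    with short-block all (subst₂ _<_ (sym (trans (↭ₚ.↭-length cov) e)) (sym (cong₂ _+_ len len))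
           (s≤s (s≤s (s≤s (ℕₚ.+-monoʳ-≤ k (ℕₚ.n≤1+n _))))))
  ... | h , h∈ with find-leaf u (∈-resp-↭ cov (∈-concat⁺′ (here refl) h∈)) next-h big
    where
    next-h : next W h ≡ α h
    next-h with cycle-walk {u = []} (All.lookup all h∈)
    ... | step e′ stop = trans (sym (α-invol _)) (cong α e′)
    big : 2 < length W
    big = subst (2 <_) (sym e) (s≤s (s≤s (subst (0 <_) (sym (ℕₚ.+-suc k (suc k))) (s≤s z≤n))))
  ...   | V , L with removed-cycles u L positive all cov h∈
    where
    length-V : suc (suc (length V)) ≡ suc (suc k) + suc (suc k)
    length-V = trans (sym (↭ₚ.↭-length (Leaf.perm L))) e
    positive : 0 < length V
    positive = ℕₚ.≤-pred (ℕₚ.≤-pred (subst (2 <_) (sym length-V) (s≤s (s≤s (subst (0 <_) (sym (ℕₚ.+-suc k (suc k))) (s≤s z≤n))))))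
  ...     | ds , all′ , cov′ , len′ = Leaf.restore L (proj₂ (planar⇒nc k {V} {ds} uV length-V closed′ all′ cov′ (ℕₚ.suc-injective (trans len′ len))))
    where
    u₁ : Unique (h ∷ α h ∷ V)
    u₁ = unique-resp-↭ (Leaf.perm L) u
    uV : Unique V
    uV = AllPairs.tail (AllPairs.tail u₁)
    length-V : length V ≡ suc k + suc k
    length-V = ℕₚ.suc-injective (ℕₚ.suc-injective (trans (sym (↭ₚ.↭-length (Leaf.perm L))) (trans e (cong suc (ℕₚ.+-suc (suc k) (suc k))))))
    closed′ : ∀ {y} → y ∈ V → α y ∈ V
    closed′ {y} m with ∈-resp-↭ (Leaf.perm L) (closed (∈-resp-↭ (↭-sym (Leaf.perm L)) (there (there m))))
    ... | here e′          = contradiction (subst (_∈ V) (trans (sym (α-invol y)) (cong α e′)) m) (unique-∷⁻ (AllPairs.tail u₁))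
    ... | there (here e′)  = contradiction (there (subst (_∈ V) (trans (sym (α-invol y)) (trans (cong α e′) (α-invol h))) m)) (unique-∷⁻ u₁)
    ... | there (there m′) = m′

push-pointwise : ∀ {A : Set} {R : A → A → Set} {as bs cs : List A} → as ↭ bs → Pointwise R bs cs →
                 ∃ λ ds → Pointwise R as ds × ds ↭ cs
push-pointwise ↭.refl         r = _ , r , ↭-refl
push-pointwise (↭.prep x p)   (r ∷ rs) = let ds , s , q = push-pointwise p rs in _ ∷ ds , r ∷ s , ↭.prep _ q
push-pointwise (↭.swap x y p) (r ∷ r′ ∷ rs) = let ds , s , q = push-pointwise p rs in _ ∷ _ ∷ ds , r′ ∷ r ∷ s , ↭.swap _ _ q
push-pointwise (↭.trans p q)  r =
  let ds , s , q′ = push-pointwise q r ; es , s′ , p′ = push-pointwise p s in es , s′ , ↭-trans p′ q′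

record Matched {X Y : Set} (R : X → Y → Set) (xs : List X) (ys : List Y) : Set where
  field
    {zs}  : List Y
    perm  : zs ↭ ys
    paired : Pointwise R xs zs

module _ (𝒮 : Setoid 0ℓ 0ℓ) where
  open Multiset 𝒮

  ≅-decompose : ∀ {xs ys} → xs ≅ ys → ∃ λ zs → Pointwise _≈ᶜ_ xs zs × zs ↭ ys
  ≅-decompose (Homo.refl ps)    = _ , ps , ↭-refl
  ≅-decompose (Homo.prep e p)   = let zs , r , q = ≅-decompose p in _ ∷ zs , e ∷ r , ↭.prep _ q
  ≅-decompose (Homo.swap e f p) = let zs , r , q = ≅-decompose p in _ ∷ _ ∷ zs , e ∷ f ∷ r , ↭.swap _ _ q
  ≅-decompose (Homo.trans p q)  =
    let zs , r , s = ≅-decompose p ; ws , r′ , s′ = ≅-decompose q ; vs , r″ , s″ = push-pointwise s r′ in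
    vs , Pointwise.transitive ≈-trans r r″ , ↭-trans s″ s′

  ≅⇒matched : ∀ {X Y : Set} {f : X → Col} {g : Y → Col} {xs ys} → map f xs ≅ map g ys → Matched (λ x y → f x ≈ᶜ g y) xs ys
  ≅⇒matched {f = f} {g} {xs} {ys} p with ≅-decompose p
  ... | cs , r , q with ↭ₚ.↭-map-inv g (↭-sym q)
  ...   | zs , refl , q′ = record { perm = ↭-sym q′ ; paired = unmap xs zs r }
    where
    unmap : ∀ xs zs → Pointwise _≈ᶜ_ (map f xs) (map g zs) → Pointwise (λ x y → f x ≈ᶜ g y) xs zs
    unmap []       []       []       = []
    unmap (x ∷ xs) (z ∷ zs) (r ∷ rs) = r ∷ unmap xs zs rs

module Lookup {X Y : Set} {R : X → Y → Set} {xs : List X} {ys : List Y} (M : Matched R xs ys) where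
  private
    find : ∀ {xs zs x} → Pointwise R xs zs → x ∈ xs → ∃ λ y → y ∈ zs × R x y
    find (r ∷ rs) (here refl) = _ , here refl , r
    find (r ∷ rs) (there m)   = let y , n , s = find rs m in y , there n , s

    find-func : ∀ {xs zs x} (rs : Pointwise R xs zs) → Unique xs → (m m′ : x ∈ xs) → proj₁ (find rs m) ≡ proj₁ (find rs m′)
    find-func (r ∷ rs) u       (here refl) (here refl) = refl
    find-func (r ∷ rs) u       (here refl) (there m)   = contradiction m (unique-∷⁻ u)
    find-func (r ∷ rs) u       (there m)   (here refl) = contradiction m (unique-∷⁻ u)
    find-func (r ∷ rs) (_ ∷ u) (there m)   (there m′)  = find-func rs u m m′

    find-inj : ∀ {xs zs x x′} (rs : Pointwise R xs zs) → Unique zs → (m : x ∈ xs) (m′ : x′ ∈ xs) →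
               proj₁ (find rs m) ≡ proj₁ (find rs m′) → x ≡ x′
    find-inj (r ∷ rs) u       (here refl) (here refl) e = refl
    find-inj (r ∷ rs) u       (here refl) (there m)   e = contradiction (subst (_∈ _) (sym e) (proj₁ (proj₂ (find rs m)))) (unique-∷⁻ u)
    find-inj (r ∷ rs) u       (there m)   (here refl) e = contradiction (subst (_∈ _) e (proj₁ (proj₂ (find rs m)))) (unique-∷⁻ u)
    find-inj (r ∷ rs) (_ ∷ u) (there m)   (there m′)  e = find-inj rs u m m′ e

    find-surj : ∀ {xs zs y} (rs : Pointwise R xs zs) → y ∈ zs → ∃ λ x → Σ (x ∈ xs) λ m → proj₁ (find rs m) ≡ y
    find-surj (r ∷ rs) (here refl) = _ , here refl , refl
    find-surj (r ∷ rs) (there m)   = let x , n , e = find-surj rs m in x , there n , e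

  open Matched M
  image : ∀ {x} → x ∈ xs → Y
  image m = proj₁ (find paired m)
  image∈ : ∀ {x} (m : x ∈ xs) → image m ∈ ys
  image∈ m = ∈-resp-↭ perm (proj₁ (proj₂ (find paired m)))
  image-rel : ∀ {x} (m : x ∈ xs) → R x (image m)
  image-rel m = proj₂ (proj₂ (find paired m))
  image-func : ∀ {x} → Unique xs → (m m′ : x ∈ xs) → image m ≡ image m′
  image-func = find-func paired
  image-inj : ∀ {x x′} → Unique ys → (m : x ∈ xs) (m′ : x′ ∈ xs) → image m ≡ image m′ → x ≡ x′
  image-inj u = find-inj paired (unique-resp-↭ (↭-sym perm) u)
  image-surj : ∀ {y} → y ∈ ys → ∃ λ x → Σ (x ∈ xs) λ m → image m ≡ y
  image-surj n = find-surj paired (∈-resp-↭ (↭-sym perm) n)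

module Main (M n′ : ℕ) (N≡2n : suc M ≡ suc n′ + suc n′) where
  private
    N = suc M
    n = suc n′
  open Labelled N zero public
  open Decorations N zero

  record Plane : Set where
    constructor plane
    field
      pairing : Matching N
      forest  : List PTree
      sized   : sizes forest ≡ n
      nested  : NC (mate pairing) (contourWord M) forest

    open Numbering (numbering M N≡2n pairing sized nested) public

    vertexBlock : Fin (suc n) → List (Fin N)
    vertexBlock i = filter (λ h → vn h ≟ i) (allFin N)
  open Plane public

  vertices# : Matching N → ℕ
  vertices# m = length (cyclesᵐ M m (allFin N))

  planar : ∀ m → vertices# m ≡ suc n → ∃ λ ts → NC (mate m) (contourWord M) ts
  planar m e = LeafRemoval.planar⇒nc (mate m) (mate-invol m) (mate-fpf m) n′ (unique (contourWord-full M))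
    (trans (full-length (contourWord-full M)) N≡2n) (λ _ → complete (contourWord-full M) _)
    (All.map (cycle-cong (λ y → cong (mate m) (sym (cycle⇒next
      (walk⇒cycle (complete (contourWord-full M) zero) (contourWord-walk M)) (unique (contourWord-full M)) (complete (contourWord-full M) y)))))
      (cyclesᵐ-cycles M m allFin-full))
    (↭-trans (full⇒↭ (cyclesᵐ-full M m allFin-full)) (↭-sym (full⇒↭ (contourWord-full M)))) e

  nc-sized : ∀ {m ts} → NC (mate m) (contourWord M) ts → sizes ts ≡ n
  nc-sized nc = halve (trans (sym (nc-length nc)) (trans (full-length (contourWord-full M)) N≡2n))

  toPlane : ∀ m → vertices# m ≡ suc n → Plane
  toPlane m e = plane m (proj₁ (planar m e)) (nc-sized {m} (proj₂ (planar m e))) (proj₂ (planar m e))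

  planesAt : ∀ m → Dec (suc n ≤ vertices# m) → List Plane
  planesAt m (yes le) = toPlane m (ℕₚ.≤-antisym (cycles-≤ M N≡2n m) le) ∷ []
  planesAt m (no _)   = []

  planes : List Plane
  planes = concatMap (λ m → planesAt m (suc n ≤ᵈ vertices# m)) (matchings N)

  plane-vertices : ∀ (p : Plane) → vertices# (pairing p) ≡ suc n
  plane-vertices p = trans (≋-length (blocks p)) (trans (Listₚ.length-map (vertexBlock p) (allFin (suc n))) (Listₚ.length-tabulate {n = suc n} id))

  ∈-planes : ∀ p → ∃ λ p′ → p′ ∈ planes × pairing p′ ≡ pairing p
  ∈-planes p =
    let p′ , m , e = member (pairing p) (suc n ≤ᵈ vertices# (pairing p)) (ℕₚ.≤-reflexive (sym (plane-vertices p))) in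
    p′ , ∈-concatMap⁺′ (λ m → planesAt m (suc n ≤ᵈ vertices# m)) (∈-matchings (pairing p)) m , e
    where
    member : ∀ m d → suc n ≤ vertices# m → ∃ λ p′ → p′ ∈ planesAt m d × pairing p′ ≡ m
    member m (yes _)  _  = _ , here refl , refl
    member m (no nle) le = contradiction le nle

  planes-pairing : Unique (map pairing planes)
  planes-pairing = subst Unique (sym (Listₚ.map-concatMap pairing _ (matchings N)))
    (unique-concatMap (λ m → map pairing (planesAt m (suc n ≤ᵈ vertices# m))) (matchings-unique N)
      (λ {m} _ → single m (suc n ≤ᵈ vertices# m))
      (λ {m} {m′} _ _ k k′ → trans (sym (from m (suc n ≤ᵈ vertices# m) k)) (from m′ (suc n ≤ᵈ vertices# m′) k′)))
    where
    single : ∀ m d → Unique (map pairing (planesAt m d))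
    single m (yes _) = [] ∷ []
    single m (no _)  = []
    from : ∀ m d {z} → z ∈ map pairing (planesAt m d) → z ≡ m
    from m (yes _) (here e) = e

  decorated : List (Plane × List (Bool × List (Fin (suc n))))
  decorated = pairs planes (λ _ → cPerms (suc n) (allFin (suc n)))

  decoratedGraph : Plane × List (Bool × List (Fin (suc n))) → LGraph
  decoratedGraph (p , P) = mergeBlocks (vec (pairing p)) (vertexBlock p) (map proj₂ P)

  𝓣 : List LGraph
  𝓣 = ∑ planes (λ p → decorations (vec (pairing p)) (vertexBlock p) (allFin (suc n)))

  private
    V : List (Fin (suc n))
    V = allFin (suc n)
    V-length : length V ≡ suc n
    V-length = Listₚ.length-tabulate {n = suc n} id

  𝓣-decorated : 𝓣 ≡ map decoratedGraph decorated
  𝓣-decorated = sym (trans (Listₚ.map-concatMap decoratedGraph _ planes) (go planes))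
    where
    go : ∀ ps → concatMap (λ p → map decoratedGraph (map (p ,_) (cPerms (suc n) V))) ps ≡
                ∑ ps (λ p → decorations (vec (pairing p)) (vertexBlock p) V)
    go []       = refl
    go (p ∷ ps) = cong₂ _++_ (trans (sym (Listₚ.map-∘ (cPerms (suc n) V)))
      (cong (λ k → map (λ P → mergeBlocks (vec (pairing p)) (vertexBlock p) (map proj₂ P)) (cPerms k V)) (sym V-length))) (go ps)

  private
    K : ℕ
    K = N
    big : N < twice (suc K)
    big = s≤s (ℕₚ.m≤n⇒m≤1+n (grow N))
      where
      grow : ∀ i → i ≤ twice i
      grow zero    = z≤n
      grow (suc i) = s≤s (ℕₚ.m≤n⇒m≤1+n (grow i))
    small : length V ≤ twice (suc K)
    small = ℕₚ.≤-trans (ℕₚ.≤-reflexive V-length) (ℕₚ.≤-trans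
      (subst (suc n ≤_) (sym N≡2n) (ℕₚ.≤-trans (ℕₚ.≤-reflexive (sym (ℕₚ.+-comm n 1))) (ℕₚ.+-monoʳ-≤ n (s≤s z≤n)))) (ℕₚ.<⇒≤ big))

  𝓣-eigen : suc n · 𝓣 ≅ ∑ 𝓣 (oddMergesOf (suc K))
  𝓣-eigen = ≅-trans (≅-sym (∑-· (suc n) planes _))
    (≅-trans (∑-cong planes (λ {p} _ → ≅-trans
        (≅-reflexive (cong (_· decorations (vec (pairing p)) (vertexBlock p) V) (sym V-length)))
        (decorations-eigen (vec (pairing p)) (vertexBlock p) (suc K) V small)))
      (≅-reflexive (sym (∑-over-∑ planes _ (oddMergesOf (suc K))))))

  trees-top : atLeast (suc n) 𝓣 ≅ atLeast (suc n) (2 ^ suc n · 𝓔 M)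
  trees-top = ≅-trans (≅-reflexive (filter-∑ _ planes _))
    (≅-trans (∑-cong planes (λ {p} _ → top p))
      (≅-trans (∑-· (2 ^ suc n) planes _)
        (≅-trans (·-cong (2 ^ suc n) (≅-trans (≅-reflexive (∑-singleton planes (canonical M ∘ pairing))) (≅-reflexive (sym (filtered (matchings N))))))
          (≅-reflexive (sym (filter-· _ (2 ^ suc n) (𝓔 M)))))))
    where
    top : ∀ p → atLeast (suc n) (decorations (vec (pairing p)) (vertexBlock p) V) ≅ 2 ^ suc n · (canonical M (pairing p) ∷ [])
    top p = ≅-trans (≅-reflexive (cong (λ i → atLeast i (decorations (vec (pairing p)) (vertexBlock p) V)) (sym V-length)))
      (≅-trans (decorations-top (vec (pairing p)) (vertexBlock p) V)
        (≅-trans (≅-reflexive (cong (λ i → 2 ^ i · ((vec (pairing p) , map (vertexBlock p) V) ∷ [])) V-length))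
          (·-cong (2 ^ suc n) (Homo.prep (≃-of-≋ (≋-sym (blocks p))) ≅-refl))))
    filtered : ∀ ms → atLeast (suc n) (map (canonical M) ms) ≡ map (canonical M ∘ pairing) (concatMap (λ m → planesAt m (suc n ≤ᵈ vertices# m)) ms)
    filtered [] = refl
    filtered (m ∷ ms) with suc n ≤ᵈ vertices# m
    ... | yes _ = cong (canonical M m ∷_) (filtered ms)
    ... | no _  = filtered ms

  maps≅trees : 2 ^ suc n · 𝓔 M ≅ 𝓣
  maps≅trees = eigen-unique K (suc n) maps-eigen 𝓣-eigen (≅-sym trees-top)
    where
    c = 2 ^ suc n
    maps-eigen : suc n · c · 𝓔 M ≅ ∑ (c · 𝓔 M) (oddMergesOf (suc K))
    maps-eigen = ≅-trans (≅-reflexive (trans (sym (*-· (suc n) c (𝓔 M))) (trans (cong (_· 𝓔 M) (ℕₚ.*-comm (suc n) c)) (*-· c (suc n) (𝓔 M)))))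
      (≅-trans (·-cong c (𝓔-eigen M N≡2n K big)) (≅-reflexive (sym (∑-over-· c (𝓔 M) (oddMergesOf (suc K))))))

-- Cycles of permutations

toPermutation : ∀ {m} (f : Fin m → Fin m) → (∀ {x y} → f x ≡ f y → x ≡ y) → Permutation′ m
toPermutation f inj = permutation f (λ y → proj₁ (surj y)) (λ y → proj₂ (surj y)) (λ x → inj (proj₂ (surj (f x))))
  where
  surj : ∀ y → ∃ λ x → f x ≡ y
  surj = injective⇒surjective inj

perm-injective : ∀ {m} (π : Permutation′ m) {x y} → π ⟨$⟩ʳ x ≡ π ⟨$⟩ʳ y → x ≡ y
perm-injective π {x} {y} e = trans (sym (inverseˡ π)) (trans (cong (π ⟨$⟩ˡ_) e) (inverseˡ π))

cycles-surjective : ∀ {m} {f : Fin m → Fin m} {cs} → All (Cycle f) cs → Full (concat cs) → ∀ y → ∃ λ x → f x ≡ y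
cycles-surjective {cs = cs} all F y with ∈-concat⁻′ cs (complete F y)
... | c , y∈ , c∈ with All.lookup all c∈
...   | cycle _ p = let x , _ , e = walk-preimage p y∈ in x , e

nextIn : ∀ {m} → List (List (Fin m)) → Fin m → Fin m
nextIn []       i = i
nextIn (c ∷ cs) i with i ∈? c
... | yes _ = next c i
... | no _  = nextIn cs i

nextIn-cycles : ∀ {m} {cs : List (List (Fin m))} → Unique (concat cs) → All (λ c → ∃ λ x → x ∈ c) cs → All (Cycle (nextIn cs)) cs
nextIn-cycles {cs = []}     u [] = []
nextIn-cycles {cs = c ∷ cs} u ((x , x∈) ∷ ne) =
  cycle-local first (next-cycle x∈ (proj₁ (unique-++⁻ c u))) ∷
  All.tabulate (λ {d} d∈ → cycle-local (λ m → later (∈-concat⁺′ m d∈))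
    (All.lookup (nextIn-cycles (proj₁ (proj₂ (unique-++⁻ c u))) ne) d∈))
  where
  first : ∀ {y} → y ∈ c → nextIn (c ∷ cs) y ≡ next c y
  first {y} m with y ∈? c
  ... | yes _ = refl
  ... | no n  = contradiction m n
  later : ∀ {y} → y ∈ concat cs → nextIn (c ∷ cs) y ≡ nextIn cs y
  later {y} m with y ∈? c
  ... | yes n = contradiction m (proj₂ (proj₂ (unique-++⁻ c u)) n)
  ... | no _  = refl

cycles-agree : ∀ {m} {f g : Fin m → Fin m} {cs} → All (Cycle f) cs → All (Cycle g) cs → Full (concat cs) → ∀ y → f y ≡ g y
cycles-agree {cs = cs} af ag F y with ∈-concat⁻′ cs (complete F y)
... | c , y∈ , c∈ = cycle-agree (All.lookup af c∈) (All.lookup ag c∈) y∈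

block-unique : ∀ {A : Set} {cs : List (List A)} {c d x} → Unique (concat cs) → c ∈ cs → d ∈ cs → x ∈ c → x ∈ d → c ≡ d
block-unique u (here refl) (here refl) _ _ = refl
block-unique {cs = e ∷ cs} u (here refl) (there d∈) xc xd = contradiction (∈-concat⁺′ xd d∈) (proj₂ (proj₂ (unique-++⁻ e u)) xc)
block-unique {cs = e ∷ cs} u (there c∈) (here refl) xc xd = contradiction (∈-concat⁺′ xc c∈) (proj₂ (proj₂ (unique-++⁻ e u)) xd)
block-unique {cs = e ∷ cs} u (there c∈) (there d∈) xc xd = block-unique (proj₁ (proj₂ (unique-++⁻ e u))) c∈ d∈ xc xd

module Frozen {m : ℕ} (π : Permutation′ m) where

  f : Fin m → Fin m
  f = π ⟨$⟩ʳ_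

  iter-shift : ∀ k i → iter π k (f i) ≡ f (iter π k i)
  iter-shift zero    i = refl
  iter-shift (suc k) i = cong f (iter-shift k i)

  walk-iter : ∀ {a w b y} → Walk f a w b → y ∈ w → ∃ λ k → k < length w × iter π (suc k) a ≡ y
  walk-iter (step e p) (here refl) = 0 , s≤s z≤n , e
  walk-iter {a} (step refl p) (there m) = let k , lt , e = walk-iter p m in
    suc k , s≤s lt , trans (cong f (sym (iter-shift k a))) e

  iter-∈ : ∀ {c i} → Cycle f c → i ∈ c → ∀ k → iter π k i ∈ c
  iter-∈ c i∈ zero    = i∈
  iter-∈ c i∈ (suc k) = cycle-image c (iter-∈ c i∈ k)

  reach : ∀ {c i j} → Cycle f c → Unique c → i ∈ c → j ∈ c → ∃ λ k → k < m × iter π k i ≡ j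
  reach {c} {i} {j} cc u i∈ j∈ with i ≟ j
  ... | yes e = 0 , ℕₚ.≤-<-trans z≤n (Finₚ.toℕ<n i) , e
  ... | no ne with cycle-at cc i∈
  ...   | t , p , q with ∈-∷ʳ⁻ t (∈-resp-↭ (↭-sym q) j∈)
  ...     | inj₂ e  = contradiction (sym e) ne
  ...     | inj₁ jt = go t p (unique-resp-↭ (↭-sym q) u) jt
    where
    go : ∀ t → Walk f i (t ∷ʳ i) i → Unique (t ∷ʳ i) → j ∈ t → ∃ λ k → k < m × iter π k i ≡ j
    go t p u jt with ∈-∃++ jt
    ... | as , bs , refl with walk-splitAt as (subst (λ z → Walk f i z i) (Listₚ.++-assoc as (j ∷ bs) [ i ]) p)
    ...   | q , _ with walk-iter q (∈-++⁺ʳ as (here refl))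
    ...     | k , lt , e = suc k , ℕₚ.≤-trans (s≤s (s≤s (ℕₚ.≤-pred (subst (k <_) (trans (Listₚ.length-++ as) (ℕₚ.+-comm (length as) 1)) lt))))
      (ℕₚ.≤-trans (subst (suc (suc (length as)) ≤_) len (s≤s (ℕₚ.≤-trans (ℕₚ.≤-reflexive (ℕₚ.+-comm 1 (length as))) (ℕₚ.+-monoʳ-≤ (length as) (s≤s z≤n)))))
        (unique-length u)) , e
      where
      len : suc (length as + suc (length bs)) ≡ length ((as ++ j ∷ bs) ∷ʳ i)
      len = sym (trans (Listₚ.length-++ (as ++ j ∷ bs)) (trans (ℕₚ.+-comm _ 1) (cong suc (Listₚ.length-++ as))))

  private
    pick : Fin m → Fin m → Fin m
    pick a b = if toℕ a ℕ.≤ᵇ toℕ b then a else b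

    pick-∈ : ∀ a b → pick a b ≡ a ⊎ pick a b ≡ b
    pick-∈ a b with toℕ a ℕ.≤ᵇ toℕ b
    ... | true  = inj₁ refl
    ... | false = inj₂ refl

    pick-≤ : ∀ a b → toℕ (pick a b) ≤ toℕ a × toℕ (pick a b) ≤ toℕ b
    pick-≤ a b with toℕ a ℕ.≤ᵇ toℕ b | ℕₚ.≤ᵇ-reflects-≤ (toℕ a) (toℕ b)
    ... | true  | r = ℕₚ.≤-refl , Reflects.invert r
    ... | false | r = ℕₚ.<⇒≤ (ℕₚ.≰⇒> (Reflects.invert r)) , ℕₚ.≤-refl

    fold-∈ : ∀ i xs → foldr pick i xs ∈ i ∷ xs
    fold-∈ i []       = here refl
    fold-∈ i (x ∷ xs) with pick-∈ x (foldr pick i xs)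
    ... | inj₁ e = there (here e)
    ... | inj₂ e with fold-∈ i xs
    ...   | here e′ = here (trans e e′)
    ...   | there n = there (there (subst (_∈ xs) (sym e) n))

    fold-≤ : ∀ i xs {x} → x ∈ i ∷ xs → toℕ (foldr pick i xs) ≤ toℕ x
    fold-≤ i []       (here refl)         = ℕₚ.≤-refl
    fold-≤ i (y ∷ xs) (here refl)         = ℕₚ.≤-trans (proj₂ (pick-≤ y (foldr pick i xs))) (fold-≤ i xs (here refl))
    fold-≤ i (y ∷ xs) (there (here refl)) = proj₁ (pick-≤ y (foldr pick i xs))
    fold-≤ i (y ∷ xs) (there (there n))   = ℕₚ.≤-trans (proj₂ (pick-≤ y (foldr pick i xs))) (fold-≤ i xs (there n))

  module _ {cs : List (List (Fin m))} (all : All (Cycle f) cs) (F : Full (concat cs)) where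

    block-of : ∀ i → ∃ λ c → i ∈ c × c ∈ cs
    block-of i = ∈-concat⁻′ cs (complete F i)

    block-Unique : ∀ {c} → c ∈ cs → Unique c
    block-Unique = concat-unique (unique F)

    cycMin-∈ : ∀ {c i} → c ∈ cs → i ∈ c → cycMin π i ∈ c
    cycMin-∈ {c} {i} c∈ i∈ with fold-∈ i (map (λ k → iter π k i) (upTo m))
    ... | here e  = subst (_∈ c) (sym e) i∈
    ... | there n with ∈-map⁻ (λ k → iter π k i) n
    ...   | k , _ , e = subst (_∈ c) (sym e) (iter-∈ (All.lookup all c∈) i∈ k)

    cycMin-≤ : ∀ {c i j} → c ∈ cs → i ∈ c → j ∈ c → toℕ (cycMin π i) ≤ toℕ j
    cycMin-≤ {c} {i} {j} c∈ i∈ j∈ with reach (All.lookup all c∈) (block-Unique c∈) i∈ j∈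
    ... | k , lt , e = fold-≤ i (map (λ k → iter π k i) (upTo m))
      (there (subst (_∈ map (λ k → iter π k i) (upTo m)) e (∈-map⁺ (λ k → iter π k i) (∈-upTo⁺ lt))))

    cycMin-const : ∀ {c i j} → c ∈ cs → i ∈ c → j ∈ c → cycMin π i ≡ cycMin π j
    cycMin-const c∈ i∈ j∈ = Finₚ.toℕ-injective (ℕₚ.≤-antisym
      (cycMin-≤ c∈ i∈ (cycMin-∈ c∈ j∈)) (cycMin-≤ c∈ j∈ (cycMin-∈ c∈ i∈)))

    SameCycle⇒SameBlock : ∀ {i j} → SameCycle π i j → SameBlock cs i j
    SameCycle⇒SameBlock {i} (k , refl) with block-of i
    ... | c , i∈ , c∈ = Any.map (λ { refl → i∈ , iter-∈ (All.lookup all c∈) i∈ k }) c∈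

    SameBlock⇒SameCycle : ∀ {i j} → SameBlock cs i j → SameCycle π i j
    SameBlock⇒SameCycle s with find-block s
      where
      find-block : ∀ {ds i j} → SameBlock ds i j → ∃ λ c → c ∈ ds × i ∈ c × j ∈ c
      find-block (here (a , b)) = _ , here refl , a , b
      find-block (there s)      = let c , n , a , b = find-block s in c , there n , a , b
    ... | c , c∈ , i∈ , j∈ = let k , _ , e = reach (All.lookup all c∈) (block-Unique c∈) i∈ j∈ in k , e

    numCycles-length : numCycles π ≡ length cs
    numCycles-length = trans (sym (↭ₚ.↭-length (↭ₚ.filter-↭ P? (full⇒↭ F)))) (go cs id)
      where
      P? : Decidable (λ i → cycMin π i ≡ i)
      P? i = cycMin π i ≟ i
      one : ∀ {c} → c ∈ cs → length (filter P? c) ≡ 1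
      one {c} c∈ with All.lookup all c∈
      ... | cycle {body} {x} refl _ = ↭ₚ.↭-length (unique-↭ {ys = [ cycMin π x ]} (Uniqueₚ.filter⁺ P? (block-Unique c∈)) ([] ∷ [])
        (λ {i} n → let i∈ , e = ∈-filter⁻ P? n in here (trans (sym e) (cycMin-const c∈ i∈ x∈)))
        (λ { (here refl) → ∈-filter⁺ P? (cycMin-∈ c∈ x∈) (cycMin-const c∈ (cycMin-∈ c∈ x∈) x∈) }))
        where
        x∈ : x ∈ body ∷ʳ x
        x∈ = ∈-++⁺ʳ body (here refl)
      go : ∀ ds → ds ⊆ cs → length (filter P? (concat ds)) ≡ length ds
      go []       s = refl
      go (d ∷ ds) s = trans (cong length (Listₚ.filter-++ P? d (concat ds))) (trans (Listₚ.length-++ (filter P? d))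
        (cong₂ _+_ (one (s (here refl))) (go ds (s ∘ there))))

    cycleLength-length : ∀ {c i} → c ∈ cs → i ∈ c → cycleLength π i ≡ length c
    cycleLength-length {c} {i} c∈ i∈ = ↭ₚ.↭-length (unique-↭ (Uniqueₚ.filter⁺ P? (Uniqueₚ.allFin⁺ m)) (block-Unique c∈)
      (λ {j} n → back j (proj₂ (∈-filter⁻ P? {xs = allFin m} n)))
      (λ {j} j∈ → ∈-filter⁺ P? (∈-allFin j) (cycMin-const c∈ j∈ i∈)))
      where
      P? : Decidable (λ j → cycMin π j ≡ cycMin π i)
      P? j = cycMin π j ≟ cycMin π i
      back : ∀ j → cycMin π j ≡ cycMin π i → j ∈ c
      back j e with block-of j
      ... | d , j∈ , d∈ with block-unique (unique F) d∈ c∈ (subst (_∈ d) e (cycMin-∈ d∈ j∈)) (cycMin-∈ c∈ i∈)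
      ...   | refl = j∈

isOdd : ℕ → Bool
isOdd zero    = false
isOdd (suc k) = not (isOdd k)

odd⇒%2 : ∀ k → isOdd k ≡ true → k % 2 ≡ 1
odd⇒%2 (suc zero)    e = refl
odd⇒%2 (suc (suc k)) e = odd⇒%2 k (trans (sym (not-not (isOdd k))) e)

%2⇒odd : ∀ k → k % 2 ≡ 1 → isOdd k ≡ true
%2⇒odd (suc zero)    e = refl
%2⇒odd (suc (suc k)) e = trans (not-not (isOdd k)) (%2⇒odd k e)

module _ {A : Set} where

  parity-consˡ : ∀ b {x : A} {V U R} → (U , R) ∈ paritySplits (not b) V → (x ∷ U , R) ∈ paritySplits b (x ∷ V)
  parity-consˡ true  {x} m = ∈-++⁺ˡ (∈-map⁺ (consˡ x) m)
  parity-consˡ false {x} m = ∈-++⁺ˡ (∈-map⁺ (consˡ x) m)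

  parity-consʳ : ∀ b {x : A} {V U R} → (U , R) ∈ paritySplits b V → (U , x ∷ R) ∈ paritySplits b (x ∷ V)
  parity-consʳ true  {x} {V} m = ∈-++⁺ʳ (map (consˡ x) (paritySplits false V)) (∈-map⁺ (consʳ x) m)
  parity-consʳ false {x} {V} m = ∈-++⁺ʳ (map (consˡ x) (paritySplits true V)) (∈-map⁺ (consʳ x) m)

  parity-uncons : ∀ b {x : A} {V U R} → (U , R) ∈ paritySplits b (x ∷ V) →
    (∃ λ U′ → U ≡ x ∷ U′ × (U′ , R) ∈ paritySplits (not b) V) ⊎ (∃ λ R′ → R ≡ x ∷ R′ × (U , R′) ∈ paritySplits b V)
  parity-uncons b {x} {V} {U} {R} m = go (∈-++⁻ (map (consˡ x) (paritySplits (not b) V)) (unfold b m))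
    where
    unfold : ∀ b → (U , R) ∈ paritySplits b (x ∷ V) → (U , R) ∈ map (consˡ x) (paritySplits (not b) V) ++ map (consʳ x) (paritySplits b V)
    unfold true  m = m
    unfold false m = m
    go : (U , R) ∈ map (consˡ x) (paritySplits (not b) V) ⊎ (U , R) ∈ map (consʳ x) (paritySplits b V) → _
    go (inj₁ k) with ∈-map⁻ (consˡ x) k
    ... | _ , k′ , refl = inj₁ (_ , refl , k′)
    go (inj₂ k) with ∈-map⁻ (consʳ x) k
    ... | _ , k′ , refl = inj₂ (_ , refl , k′)

  parity-odd : ∀ b {V : List A} {U R} → (U , R) ∈ paritySplits b V → isOdd (length U) ≡ b
  parity-odd false {[]}    (here refl) = refl
  parity-odd b     {x ∷ V} m with parity-uncons b m
  ... | inj₁ (_ , refl , m′) = trans (cong not (parity-odd (not b) m′)) (not-not b)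
  ... | inj₂ (_ , refl , m′) = parity-odd b m′

  parity-functional : ∀ b b′ {V : List A} {U R U′ R′} → Unique V → (U , R) ∈ paritySplits b V → (U′ , R′) ∈ paritySplits b′ V →
                      U ↭ U′ → U ≡ U′ × R ≡ R′
  parity-functional false false {[]} u (here refl) (here refl) p = refl , refl
  parity-functional b b′ {x ∷ V} u@(_ ∷ u′) m n p with parity-uncons b m | parity-uncons b′ n
  ... | inj₁ (_ , refl , m′) | inj₁ (_ , refl , n′) with parity-functional (not b) (not b′) u′ m′ n′ (↭ₚ.drop-∷ p)
  ...   | refl , refl = refl , refl
  parity-functional b b′ {x ∷ V} u@(_ ∷ u′) m n p | inj₂ (_ , refl , m′) | inj₂ (_ , refl , n′)
    with parity-functional b b′ u′ m′ n′ p
  ...   | refl , refl = refl , refl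
  parity-functional b b′ {x ∷ V} u@(_ ∷ u′) m n p | inj₁ (_ , refl , m′) | inj₂ (_ , refl , n′) =
    contradiction (∈-resp-↭ (proj₁ (∈-paritySplits b′ V n′)) (∈-++⁺ˡ (∈-resp-↭ p (here refl)))) (unique-∷⁻ u)
  parity-functional b b′ {x ∷ V} u@(_ ∷ u′) m n p | inj₂ (_ , refl , m′) | inj₁ (_ , refl , n′) =
    contradiction (∈-resp-↭ (proj₁ (∈-paritySplits b V m′)) (∈-++⁺ˡ (∈-resp-↭ (↭-sym p) (here refl)))) (unique-∷⁻ u)

  parity-unique : ∀ b {V : List A} → Unique V → Unique (paritySplits b V)
  parity-unique true  {[]} u = []
  parity-unique false {[]} u = [] ∷ []
  parity-unique b {x ∷ V} u@(_ ∷ u′) = fold b (unique-++⁺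
    (Uniqueₚ.map⁺ (λ { refl → refl }) (parity-unique (not b) u′))
    (Uniqueₚ.map⁺ (λ { refl → refl }) (parity-unique b u′)) disj)
    where
    disj : ∀ {z} → z ∈ map (consˡ x) (paritySplits (not b) V) → z ∉ map (consʳ x) (paritySplits b V)
    disj m n with ∈-map⁻ (consˡ x) m | ∈-map⁻ (consʳ x) n
    ... | _ , _ , refl | _ , n′ , refl = unique-∷⁻ u (∈-resp-↭ (proj₁ (∈-paritySplits b V n′)) (here refl))
    fold : ∀ b → Unique (map (consˡ x) (paritySplits (not b) V) ++ map (consʳ x) (paritySplits b V)) → Unique (paritySplits b (x ∷ V))
    fold true  u = u
    fold false u = u

  record InCPerms (k : ℕ) (v : A) (V : List A) (P : List (Bool × List A)) : Set where
    constructor inCPerms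
    field
      {s}      : Bool
      {w U R}  : List A
      {P′}     : List (Bool × List A)
      shape    : P ≡ (s , v ∷ w) ∷ P′
      chosen   : (U , R) ∈ paritySplits false V
      word     : w ∈ perms U
      others   : P′ ∈ cPerms k R

  private
    withWord : ℕ → A → List A → Bool → List A → List (List (Bool × List A))
    withWord k v R s w = map ((s , v ∷ w) ∷_) (cPerms k R)
    withSign : ℕ → A → List A → List A → Bool → List (List (Bool × List A))
    withSign k v U R s = concatMap (withWord k v R s) (perms U)
    withSplit : ℕ → A → List A × List A → List (List (Bool × List A))
    withSplit k v (U , R) = concatMap (withSign k v U R) (true ∷ false ∷ [])

  ∈-cPerms⁻ : ∀ k {v V P} → P ∈ cPerms (suc k) (v ∷ V) → InCPerms k v V P
  ∈-cPerms⁻ k {v} {V} m with ∈-concatMap⁻′ (withSplit k v) {paritySplits false V} m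
  ... | (U , R) , c , m₁ with ∈-concatMap⁻′ (withSign k v U R) {true ∷ false ∷ []} m₁
  ...   | s , _ , m₂ with ∈-concatMap⁻′ (withWord k v R s) {perms U} m₂
  ...     | w , wU , m₃ with ∈-map⁻ _ m₃
  ...       | P′ , o , e = inCPerms e c wU o

  ∈-cPerms⁺ : ∀ k {v V s w U R P′} → (U , R) ∈ paritySplits false V → w ∈ perms U → P′ ∈ cPerms k R →
              (s , v ∷ w) ∷ P′ ∈ cPerms (suc k) (v ∷ V)
  ∈-cPerms⁺ k {v} {V} {s} {w} {U} {R} c wU o = ∈-concatMap⁺′ (withSplit k v) c
    (∈-concatMap⁺′ (withSign k v U R) (sign∈ s) (∈-concatMap⁺′ (withWord k v R s) wU (∈-map⁺ _ o)))
    where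
    sign∈ : ∀ s → s ∈ true ∷ false ∷ []
    sign∈ true  = here refl
    sign∈ false = there (here refl)

  cPerms-unique : ∀ k {V : List A} → Unique V → Unique (cPerms k V)
  cPerms-unique k       {[]}    u = [] ∷ []
  cPerms-unique zero    {v ∷ V} u = []
  cPerms-unique (suc k) {v ∷ V} (_ ∷ u) = unique-concatMap (withSplit k v) (parity-unique false u)
    (λ {(U , R)} c → unique-concatMap (withSign k v U R) (((λ ()) ∷ []) ∷ [] ∷ [])
      (λ {s} _ → unique-concatMap (withWord k v R s) (perms-unique (proj₁ (uUR c)))
        (λ _ → Uniqueₚ.map⁺ Listₚ.∷-injectiveʳ (cPerms-unique k (proj₁ (proj₂ (uUR c))))) (λ _ _ → same-word R s))
      (λ _ _ → same-sign U R))
    (λ {c} {c′} m m′ → same-split c c′ m m′)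
    where
    uUR : ∀ {U R} → (U , R) ∈ paritySplits false V → Unique U × Unique R × (∀ {x} → x ∈ U → x ∉ R)
    uUR {U} c = unique-++⁻ U (unique-resp-↭ (↭-sym (proj₁ (∈-paritySplits false V c))) u)
    same-word : ∀ R s {w w′ z} → z ∈ withWord k v R s w → z ∈ withWord k v R s w′ → w ≡ w′
    same-word R s m n with ∈-map⁻ _ m | ∈-map⁻ _ n
    ... | _ , _ , refl | _ , _ , refl = refl
    same-sign : ∀ U R {s s′ z} → z ∈ withSign k v U R s → z ∈ withSign k v U R s′ → s ≡ s′
    same-sign U R {s} {s′} m n with ∈-concatMap⁻′ (withWord k v R s) {perms U} m | ∈-concatMap⁻′ (withWord k v R s′) {perms U} n
    ... | _ , _ , m′ | _ , _ , n′ with ∈-map⁻ _ m′ | ∈-map⁻ _ n′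
    ...   | _ , _ , refl | _ , _ , refl = refl
    same-split : ∀ c c′ {z} → c ∈ paritySplits false V → c′ ∈ paritySplits false V → z ∈ withSplit k v c → z ∈ withSplit k v c′ → c ≡ c′
    same-split (U , R) (U′ , R′) c c′ m n
      with ∈-concatMap⁻′ (withSign k v U R) {true ∷ false ∷ []} m | ∈-concatMap⁻′ (withSign k v U′ R′) {true ∷ false ∷ []} n
    ... | s , _ , m₁ | s′ , _ , n₁
      with ∈-concatMap⁻′ (withWord k v R s) {perms U} m₁ | ∈-concatMap⁻′ (withWord k v R′ s′) {perms U′} n₁
    ...   | w , wU , m₂ | w′ , wU′ , n₂ with ∈-map⁻ _ m₂ | ∈-map⁻ _ n₂
    ...     | _ , _ , refl | _ , _ , refl =
      let e , e′ = parity-functional false false u c c′ (↭-trans (↭-sym (∈-perms⁻ {xs = U} wU)) (∈-perms⁻ {xs = U′} wU′)) in cong₂ _,_ e e′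

  cPerms-cover : ∀ k (V : List A) {P} → P ∈ cPerms k V → concat (map proj₂ P) ↭ V
  cPerms-cover k       []      (here refl) = ↭-refl
  cPerms-cover zero    (v ∷ V) ()
  cPerms-cover (suc k) (v ∷ V) m = go (∈-cPerms⁻ k m)
    where
    go : ∀ {P} → InCPerms k v V P → concat (map proj₂ P) ↭ v ∷ V
    go (inCPerms {w = w} {U} {R} refl c wU o) =
      ↭.prep v (↭-trans (↭ₚ.++⁺ (∈-perms⁻ {xs = U} {w} wU) (cPerms-cover k R o)) (proj₁ (∈-paritySplits false V {U} {R} c)))

  cPerms-odd : ∀ k (V : List A) {P} → P ∈ cPerms k V → All (λ (_ , c) → isOdd (length c) ≡ true × ∃ λ x → x ∈ c) P
  cPerms-odd k       []      (here refl) = []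
  cPerms-odd zero    (v ∷ V) ()
  cPerms-odd (suc k) (v ∷ V) m = go (∈-cPerms⁻ k m)
    where
    go : ∀ {P} → InCPerms k v V P → All (λ (_ , c) → isOdd (length c) ≡ true × ∃ λ x → x ∈ c) P
    go (inCPerms {w = w} {U} {R} refl c wU o) =
      (cong not (trans (cong isOdd (↭ₚ.↭-length (∈-perms⁻ {xs = U} {w} wU))) (parity-odd false {V} {U} {R} c)) , v , here refl)
      ∷ cPerms-odd k R o

walk-last : ∀ {A : Set} {f : A → A} {v} u → Walk f v (u ∷ʳ v) v → Cycle f (v ∷ u)
walk-last {v = v} u p with walk-split u p
... | g , q , step e stop = walk⇒cycle (here refl) (step e q)

last-walk : ∀ {A : Set} {f : A → A} {v} u → Cycle f (v ∷ u) → Walk f v (u ∷ʳ v) v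
last-walk u (cycle _ (step e p)) = walk-++ p (step e stop)

module Sorting {m : ℕ} {f : Fin m → Fin m} (inj : ∀ {x y} → f x ≡ f y → x ≡ y) where

  walk-closed : ∀ {V : List (Fin m)} → (∀ {y} → y ∈ V → f y ∈ V) → ∀ {a w b} → a ∈ V → Walk f a w b → w ⊆ V
  walk-closed cl a∈ (step refl p) (here refl) = cl a∈
  walk-closed cl a∈ (step refl p) (there n)   = walk-closed cl (cl a∈) p n

  remaining-closed : ∀ {V u v R} → Unique V → (∀ {y} → y ∈ V → f y ∈ V) → V ↭ (u ∷ʳ v) ++ R → Walk f v (u ∷ʳ v) v →
                     ∀ {y} → y ∈ R → f y ∈ R
  remaining-closed {V} {u} {v} {R} un cl p w {y} y∈ with ∈-++⁻ (u ∷ʳ v) (∈-resp-↭ p (cl (∈-resp-↭ (↭-sym p) (∈-++⁺ʳ (u ∷ʳ v) y∈))))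
  ... | inj₂ r = r
  ... | inj₁ r with walk-preimage w r
  ...   | z , z∈ , e with inj e
  ...     | refl = contradiction y∈ (proj₂ (proj₂ (unique-++⁻ (u ∷ʳ v) (unique-resp-↭ p un))) (in-word z∈))
    where
    in-word : ∀ {z} → z ∈ v ∷ u ∷ʳ v → z ∈ u ∷ʳ v
    in-word (here refl) = ∈-++⁺ʳ u (here refl)
    in-word (there n)   = n

  cyclesOn : ∀ k V → length V ≤ k → Unique V → (∀ {y} → y ∈ V → f y ∈ V) → ∃ λ cs → All (Cycle f) cs × concat cs ↭ V
  cyclesOn k       []      le un cl = [] , [] , ↭-refl
  cyclesOn (suc k) (v ∷ V) le un cl with orbit inj v
  ... | u , w , uu with unique-⊆⇒↭ uu (walk-closed cl (here refl) w)
  ...   | R , p with cyclesOn k R (ℕₚ.≤-pred (ℕₚ.≤-trans (shorter u p) le))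
                      (proj₁ (proj₂ (unique-++⁻ (u ∷ʳ v) (unique-resp-↭ p un)))) (remaining-closed un cl p w)
    where
    shorter : ∀ u {R} → v ∷ V ↭ (u ∷ʳ v) ++ R → suc (length R) ≤ length (v ∷ V)
    shorter u {R} p = subst (suc (length R) ≤_) (sym (trans (↭ₚ.↭-length p) (trans (Listₚ.length-++ (u ∷ʳ v))
      (cong (_+ length R) (trans (Listₚ.length-++ u) (ℕₚ.+-comm (length u) 1)))))) (s≤s (ℕₚ.m≤n+m (length R) (length u)))
  ...     | cs , all , q = (u ∷ʳ v) ∷ cs , cycle-∷ʳ w ∷ all , ↭-trans (↭ₚ.++⁺ˡ (u ∷ʳ v) q) (↭-sym p)

  cycleList : ∃ λ cs → All (Cycle f) cs × Full (concat cs)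
  cycleList = let cs , all , p = cyclesOn m (allFin m) (ℕₚ.≤-reflexive (Listₚ.length-tabulate id)) (Uniqueₚ.allFin⁺ m) (λ _ → ∈-allFin _) in
    cs , all , full-↭ (↭-sym p) allFin-full

  module _ (sgn : Fin m → Bool) where

    Decorates : List (Bool × List (Fin m)) → Set
    Decorates = All (λ (s , c) → Cycle f c × (∀ {i} → i ∈ c → sgn i ≡ s))

    cPerms-functional : ∀ k V {P P′} → Unique V → P ∈ cPerms k V → P′ ∈ cPerms k V → Decorates P → Decorates P′ → P ≡ P′
    cPerms-functional k       []      u (here refl) (here refl) _ _ = refl
    cPerms-functional zero    (v ∷ V) u () _ _ _
    cPerms-functional (suc k) (v ∷ V) (nv ∷ u) p p′ d d′ = go (∈-cPerms⁻ k p) (∈-cPerms⁻ k p′) d d′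
      where
      v∉ : ∀ {w U R} → (U , R) ∈ paritySplits false V → w ∈ perms U → v ∉ w
      v∉ {w} {U} {R} ch wU m = All.lookup nv (∈-resp-↭ (proj₁ (∈-paritySplits false V {U} {R} ch)) (∈-++⁺ˡ (∈-resp-↭ (∈-perms⁻ {xs = U} wU) m))) refl
      go : ∀ {P P′} → InCPerms k v V P → InCPerms k v V P′ → Decorates P → Decorates P′ → P ≡ P′
      go (inCPerms {w = w} {U} {R} refl ch wU o) (inCPerms {w = w′} {U′} {R′} refl ch′ wU′ o′) ((c , s) ∷ d) ((c′ , s′) ∷ d′)
        with first-return w w′ (v∉ {w} {U} {R} ch wU) (v∉ {w′} {U′} {R′} ch′ wU′) (last-walk w c) (last-walk w′ c′)
      ... | refl with parity-functional false false u ch ch′ (↭-trans (↭-sym (∈-perms⁻ {xs = U} wU)) (∈-perms⁻ {xs = U′} wU′))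
      ...   | refl , refl with trans (sym (s (here refl))) (s′ (here refl))
      ...     | refl = cong (_ ∷_) (cPerms-functional k R
        (proj₁ (proj₂ (unique-++⁻ U (unique-resp-↭ (↭-sym (proj₁ (∈-paritySplits false V {U} {R} ch))) u)))) o o′ d d′)

    choose : ∀ {V u : List (Fin m)} → Unique V → Unique u → u ⊆ V → ∃₂ λ U R → (U , R) ∈ paritySplits (isOdd (length u)) V × u ↭ U
    choose {[]} {[]}    uV uu s = [] , [] , here refl , ↭-refl
    choose {[]} {x ∷ u} uV uu s = contradiction (s (here refl)) λ ()
    choose {x ∷ V} {u} uV@(_ ∷ uV′) uu s with x ∈? u
    ... | yes x∈ with ∈⇒↭ x∈
    ...   | u′ , p with choose {V} {u′} uV′ (AllPairs.tail (unique-resp-↭ p uu)) sub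
      where
      sub : u′ ⊆ V
      sub {y} m with s (∈-resp-↭ (↭-sym p) (there m))
      ... | here refl = contradiction m (unique-∷⁻ (unique-resp-↭ p uu))
      ... | there n   = n
    ...     | U , R , c , q = x ∷ U , R
      , parity-consˡ (isOdd (length u)) (subst (λ b → (U , R) ∈ paritySplits b V)
          (sym (trans (cong (not ∘ isOdd) (↭ₚ.↭-length p)) (not-not (isOdd (length u′))))) c)
      , ↭-trans p (↭.prep x q)
    choose {x ∷ V} {u} uV@(_ ∷ uV′) uu s | no x∉ with choose {V} {u} uV′ uu sub
      where
      sub : u ⊆ V
      sub {y} m with s m
      ... | here refl = contradiction m x∉
      ... | there n   = n
    ... | U , R , c , q = U , x ∷ R , parity-consʳ (isOdd (length u)) c , q

    cPerms-complete : ∀ k V → length V ≤ k → Unique V → (∀ {y} → y ∈ V → f y ∈ V) → (∀ i → sgn (f i) ≡ sgn i) →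
      (∀ v u → Walk f v (u ∷ʳ v) v → Unique (u ∷ʳ v) → isOdd (length u) ≡ false) →
      ∃ λ P → P ∈ cPerms k V × Decorates P
    cPerms-complete k       []      le un cl sc odd = [] , here refl , []
    cPerms-complete (suc k) (v ∷ V) (s≤s le) un@(_ ∷ unV) cl sc odd with orbit inj v
    ... | u , w , uu with choose unV (proj₁ (unique-++⁻ u uu)) sub
      where
      sub : u ⊆ V
      sub {y} m with walk-closed cl (here refl) w (∈-++⁺ˡ m)
      ... | here refl = contradiction m (∷ʳ-unique uu)
      ... | there n   = n
    ...   | U , R , c , q with cPerms-complete k R
              (ℕₚ.≤-trans (ℕₚ.≤-trans (ℕₚ.m≤n+m (length R) (length U)) (ℕₚ.≤-reflexive (split-length (isOdd (length u)) V c))) le)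
              (proj₁ (proj₂ (unique-++⁻ (u ∷ʳ v) (unique-resp-↭ whole un)))) (remaining-closed un cl whole w) sc odd
      where
      whole : v ∷ V ↭ (u ∷ʳ v) ++ R
      whole = ↭-trans (↭.prep v (↭-trans (↭-sym (proj₁ (∈-paritySplits (isOdd (length u)) V c))) (↭ₚ.++⁺ʳ R (↭-sym q))))
        (↭ₚ.++⁺ʳ R (↭ₚ.∷↭∷ʳ v u))
    ...     | P′ , o , d = (sgn v , v ∷ u) ∷ P′
      , ∈-cPerms⁺ k {v} {V} {sgn v} {u} {U} {R} {P′} (subst (λ b → (U , R) ∈ paritySplits b V) (odd v u w uu) c) (∈-perms⁺ U q) o
      , (walk-last u w , λ m → signs (into m)) ∷ d
      where
      into : ∀ {i} → i ∈ v ∷ u → i ∈ u ∷ʳ v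
      into (here refl) = ∈-++⁺ʳ u (here refl)
      into (there n)   = ∈-++⁺ˡ n
      signs : ∀ {i} → i ∈ u ∷ʳ v → sgn i ≡ sgn v
      signs = walk-const sgn sc w

-- Canonical labellings

walk-induction : ∀ {A : Set} {f : A → A} (P : A → Set) → (∀ y → P y → P (f y)) → ∀ {a w b y} → Walk f a w b → P a → y ∈ w → P y
walk-induction P s (step refl p) pa (here refl) = s _ pa
walk-induction P s (step refl p) pa (there n)   = walk-induction P s p (s _ pa) n

SameBlock-unmap : ∀ {A B : Set} (f : A → B) → (∀ {x y} → f x ≡ f y → x ≡ y) → ∀ {cs a b} →
                  SameBlock (map (map f) cs) (f a) (f b) → SameBlock cs a b
SameBlock-unmap f inj {c ∷ cs} {a} {b} (here (a∈ , b∈)) = here (back a∈ , back b∈)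
  where
  back : ∀ {x} → f x ∈ map f c → x ∈ c
  back m with ∈-map⁻ f m
  ... | y , y∈ , e = subst (_∈ c) (sym (inj e)) y∈
SameBlock-unmap f inj {c ∷ cs} (there s) = there (SameBlock-unmap f inj s)

module Canonical (n′ g : ℕ) where
  M N : ℕ
  M = n′ + suc (n′ + 0)
  N = suc M

  N≡2n : N ≡ suc n′ + suc n′
  N≡2n = cong (λ i → suc (n′ + suc i)) (ℕₚ.+-identityʳ n′)

  private
    W : List (Fin N)
    W = allFin N

  next-induction : ∀ (P : Fin N → Set) → P zero → (∀ i → P i → P (next W i)) → ∀ i → P i
  next-induction P p0 ps i = walk-induction P ps (contourWord-walk M) p0 (complete (contourWord-full M) i)

  module OfMap (m : LMap (suc n′) g) where
    open LMap m using (σ; α; root; α-invol; α-fpf; one-face) public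
    s a φ : Fin N → Fin N
    s = σ ⟨$⟩ʳ_
    a = α ⟨$⟩ʳ_
    φ h = a (s h)

    record Position : Set where
      field
        pos at   : Fin N → Fin N
        pos∘at   : ∀ i → pos (at i) ≡ i
        at∘pos   : ∀ h → at (pos h) ≡ h
        at-zero  : at zero ≡ root
        at-next  : ∀ i → at (next W i) ≡ φ (at i)

    abstract
     -- The half-edges are numbered along the face, starting with the root.
     position : Position
     position = single (Sorting.cycleList φ-injective)
       where
       φ-injective : ∀ {x y} → φ x ≡ φ y → x ≡ y
       φ-injective e = perm-injective σ (perm-injective α e)
       fromWord : ∀ u → Walk φ root (u ∷ʳ root) root → Full (root ∷ u) → Position
       fromWord u w F with tabulate-word (root ∷ u) (full-length F)
       ... | at , e = record
         { pos = pos ; at = at ; pos∘at = pos∘at ; at∘pos = λ h → proj₂ (surj h)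
         ; at-zero = Listₚ.∷-injectiveˡ e
         ; at-next = λ i → trans (cong (at ∘ next W) (sym (pos∘at i))) (trans (cong at (sym (follow (at i)))) (proj₂ (surj _))) }
         where
         surj : ∀ h → ∃ λ i → at i ≡ h
         surj h with ∈-tabulate⁻ (subst (h ∈_) (sym e) (complete F h))
         ... | i , eq = i , sym eq
         pos : Fin N → Fin N
         pos h = proj₁ (surj h)
         pos∘at : ∀ i → pos (at i) ≡ i
         pos∘at i = surjective⇒injective surj (proj₂ (surj (at i)))
         pos-word : map pos (root ∷ u) ≡ W
         pos-word = trans (cong (map pos) (sym e)) (trans (Listₚ.map-tabulate at pos) (Listₚ.tabulate-cong pos∘at))
         follow : ∀ h → pos (φ h) ≡ next W (pos h)
         follow h = trans (cong pos (sym (cycle⇒next (walk-last u w) (unique F) (complete F h))))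
           (trans (next-map pos at F pos∘at (λ h → proj₂ (surj h)) (subst Full (sym pos-word) allFin-full) h)
             (cong (λ V → next V (pos h)) pos-word))
       single : (∃ λ cs → All (Cycle φ) cs × Full (concat cs)) → Position
       single (cs , all , F) = go cs all F (trans (sym (Frozen.numCycles-length (σ ∘ₚ α) all F)) one-face)
         where
         go : ∀ cs → All (Cycle φ) cs → Full (concat cs) → length cs ≡ 1 → Position
         go (c ∷ []) (cc ∷ []) F _ with cycle-at cc (subst (root ∈_) (Listₚ.++-identityʳ c) (complete F root))
         ... | u , w , p = fromWord u w (full-↭ (↭-trans (↭-reflexive (Listₚ.++-identityʳ c)) (↭-trans (↭-sym p) (↭-sym (↭ₚ.∷↭∷ʳ root u)))) F)

    open Position position public

    abstract
     matched : Matching N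
     matched = fromFunction (λ i → pos (a (at i)))
       (λ i → trans (cong (pos ∘ a) (at∘pos _)) (trans (cong pos (α-invol (at i))) (pos∘at i)))
       (λ i e → α-fpf (at i) (trans (sym (at∘pos _)) (cong at e)))

     matched-mate : ∀ i → mate matched i ≡ pos (a (at i))
     matched-mate = Vecₚ.lookup∘tabulate (λ i → pos (a (at i)))

    at-mate : ∀ i → at (mate matched i) ≡ a (at i)
    at-mate i = trans (cong at (matched-mate i)) (at∘pos _)

    at-σ : ∀ i → at (σᵐ M matched W i) ≡ s (at i)
    at-σ i = trans (at-mate _) (trans (cong a (at-next i)) (α-invol _))

    at-injective : ∀ {i j} → at i ≡ at j → i ≡ j
    at-injective {i} {j} e = trans (sym (pos∘at i)) (trans (cong pos e) (pos∘at j))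

    blocks : List (List (Fin N))
    blocks = map (map at) (cyclesᵐ M matched W)

    blocks-cycles : All (Cycle s) blocks
    blocks-cycles = Allₚ.map⁺ (All.map (λ {c} → cycle-map {f = σᵐ M matched W} {g = s} at at-σ {c}) (cyclesᵐ-cycles M matched {W} allFin-full))

    blocks-full : Full (concat blocks)
    blocks-full = subst Full (sym (Listₚ.concat-map (cyclesᵐ M matched W)))
      (full (Uniqueₚ.map⁺ at-injective (unique F)) (λ h → subst (_∈ map at (concat (cyclesᵐ M matched W))) (at∘pos h) (∈-map⁺ at (complete F (pos h)))))
      where
      F = cyclesᵐ-full M matched allFin-full

    numCycles-matched : numCycles σ ≡ length (cyclesᵐ M matched W)
    numCycles-matched = trans (Frozen.numCycles-length σ blocks-cycles blocks-full) (Listₚ.length-map (map at) (cyclesᵐ M matched W))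

    SameCycle⇒ : ∀ {h h′} → SameCycle σ h h′ → SameBlock (cyclesᵐ M matched W) (pos h) (pos h′)
    SameCycle⇒ {h} {h′} sc = SameBlock-unmap at at-injective (subst₂ (SameBlock blocks) (sym (at∘pos h)) (sym (at∘pos h′))
      (Frozen.SameCycle⇒SameBlock σ blocks-cycles blocks-full sc))

    ⇒SameCycle : ∀ {h h′} → SameBlock (cyclesᵐ M matched W) (pos h) (pos h′) → SameCycle σ h h′
    ⇒SameCycle {h} {h′} sb = Frozen.SameBlock⇒SameCycle σ blocks-cycles blocks-full
      (subst₂ (SameBlock blocks) (at∘pos h) (at∘pos h′) (SameBlock-map at sb))

  iso⇒matched : ∀ {m m′ : LMap (suc n′) g} → LMapIso m m′ → OfMap.matched m ≡ OfMap.matched m′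
  iso⇒matched {m} {m′} (π , πσ , πα , πr) = matching-ext (λ i → sym (trans (A′.matched-mate i)
    (trans (cong (A′.pos ∘ A′.a) (sym (same-at i))) (trans (cong A′.pos (trans (sym (πα (A.at i))) (trans (cong (π ⟨$⟩ʳ_) (sym (A.at-mate i))) (same-at _))))
      (A′.pos∘at _)))))
    where
    module A  = OfMap m
    module A′ = OfMap m′
    same-at : ∀ i → π ⟨$⟩ʳ A.at i ≡ A′.at i
    same-at = next-induction (λ i → π ⟨$⟩ʳ A.at i ≡ A′.at i) (trans (cong (π ⟨$⟩ʳ_) A.at-zero) (trans πr (sym A′.at-zero)))
      (λ i e → trans (cong (π ⟨$⟩ʳ_) (A.at-next i)) (trans (πα _) (trans (cong A′.a (trans (πσ (A.at i)) (cong A′.s e))) (sym (A′.at-next i)))))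

  matched⇒iso : ∀ {m m′ : LMap (suc n′) g} → OfMap.matched m ≡ OfMap.matched m′ → LMapIso m m′
  matched⇒iso {m} {m′} eq = permutation (A′.at ∘ A.pos) (A.at ∘ A′.pos)
      (λ h → trans (cong A′.at (A.pos∘at _)) (A′.at∘pos h)) (λ h → trans (cong A.at (A′.pos∘at _)) (A.at∘pos h))
    , (λ h → trans (cong (A′.at ∘ A.pos) (trans (cong A.s (sym (A.at∘pos h))) (sym (A.at-σ (A.pos h)))))
        (trans (cong A′.at (trans (A.pos∘at _) (cong (λ μ → σᵐ M μ W (A.pos h)) eq))) (A′.at-σ (A.pos h))))
    , (λ h → trans (cong (A′.at ∘ A.pos) (trans (cong A.a (sym (A.at∘pos h))) (sym (A.at-mate (A.pos h)))))
        (trans (cong A′.at (trans (A.pos∘at _) (cong (λ μ → mate μ (A.pos h)) eq))) (A′.at-mate (A.pos h))))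
    , trans (cong A′.at (trans (cong A.pos (sym A.at-zero)) (A.pos∘at zero))) A′.at-zero
    where
    module A  = OfMap m
    module A′ = OfMap m′

  module OfMatching (μ : Matching N) (euler : length (cyclesᵐ M μ W) + 2 * g ≡ suc n′ + 1) where
    σₚ αₚ : Permutation′ N
    σₚ = toPermutation (σᵐ M μ W) (Maps.σ-injective (mate μ) (mate-injective μ) allFin-full)
    αₚ = toPermutation (mate μ) (mate-injective μ)

    face-cycle : Cycle ((σₚ ∘ₚ αₚ) ⟨$⟩ʳ_) W
    face-cycle = cycle-cong (λ i → sym (mate-invol μ (next W i))) (next-cycle (∈-allFin zero) (Uniqueₚ.allFin⁺ N))

    reaches : ∀ k h → Reach σₚ αₚ h (iter (σₚ ∘ₚ αₚ) k h)
    reaches zero    h = here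
    reaches (suc k) h = stepσ (stepα (subst (Reach σₚ αₚ _) (Frozen.iter-shift (σₚ ∘ₚ αₚ) k h) (reaches k _)))

    toMap : LMap (suc n′) g
    toMap = record
      { σ = σₚ ; α = αₚ ; root = zero
      ; α-invol = mate-invol μ ; α-fpf = mate-fpf μ
      ; connected = λ h h′ → let k , _ , e = Frozen.reach (σₚ ∘ₚ αₚ) face-cycle (Uniqueₚ.allFin⁺ N) (∈-allFin h) (∈-allFin h′) in
          subst (Reach σₚ αₚ h) e (reaches k h)
      ; one-face = Frozen.numCycles-length (σₚ ∘ₚ αₚ) (face-cycle ∷ []) (subst Full (sym (Listₚ.++-identityʳ W)) allFin-full)
      ; genus = trans (cong (_+ 2 * g) (Frozen.numCycles-length σₚ (cyclesᵐ-cycles M μ allFin-full) (cyclesᵐ-full M μ allFin-full))) euler }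

    matched-toMap : OfMap.matched toMap ≡ μ
    matched-toMap = matching-ext (λ i → trans (A.matched-mate i) (trans (cong A.pos (cong (mate μ) (at-id i)))
      (trans (cong A.pos (sym (at-id _))) (A.pos∘at _))))
      where
      module A = OfMap toMap
      at-id : ∀ i → A.at i ≡ i
      at-id = next-induction (λ i → A.at i ≡ i) A.at-zero
        (λ i e → trans (A.at-next i) (trans (mate-invol μ _) (cong (next W) e)))

signIn : ∀ {m} → List (Bool × List (Fin m)) → Fin m → Bool
signIn []            i = false
signIn ((s , c) ∷ P) i with i ∈? c
... | yes _ = s
... | no _  = signIn P i

signIn-block : ∀ {m} {P : List (Bool × List (Fin m))} → Unique (concat (map proj₂ P)) →
               All (λ (s , c) → ∀ {i} → i ∈ c → signIn P i ≡ s) P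
signIn-block {P = []} u = []
signIn-block {P = (s , c) ∷ P} u = first ∷ All.tabulate (λ {(t , d)} m i∈ → trans
  (later (∈-concat⁺′ i∈ (∈-map⁺ proj₂ m))) (All.lookup (signIn-block {P = P} (proj₁ (proj₂ (unique-++⁻ c u)))) m i∈))
  where
  first : ∀ {i} → i ∈ c → signIn ((s , c) ∷ P) i ≡ s
  first {i} m with i ∈? c
  ... | yes _ = refl
  ... | no n  = contradiction m n
  later : ∀ {i} → i ∈ concat (map proj₂ P) → signIn ((s , c) ∷ P) i ≡ signIn P i
  later {i} m with i ∈? c
  ... | yes n = contradiction m (proj₂ (proj₂ (unique-++⁻ c u)) n)
  ... | no _  = refl

module OfCPerm {m k : ℕ} {P : List (Bool × List (Fin m))} (P∈ : P ∈ cPerms k (allFin m)) where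

  cs : List (List (Fin m))
  cs = map proj₂ P

  f : Fin m → Fin m
  f = nextIn cs

  abstract
    covers : Full (concat cs)
    covers = full-↭ (↭-sym (cPerms-cover k (allFin m) P∈)) allFin-full

    cycles : All (Cycle f) cs
    cycles = nextIn-cycles (unique covers) (Allₚ.map⁺ (All.map proj₂ (cPerms-odd k (allFin m) P∈)))

    f-injective : ∀ {x y} → f x ≡ f y → x ≡ y
    f-injective = surjective⇒injective (cycles-surjective cycles covers)

    block-odd : ∀ {c} → c ∈ cs → isOdd (length c) ≡ true
    block-odd c∈ = All.lookup odds c∈
      where
      odds : All (λ c → isOdd (length c) ≡ true) cs
      odds = Allₚ.map⁺ (All.map proj₁ (cPerms-odd k (allFin m) P∈))

    decorates : Sorting.Decorates f-injective (signIn P) P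
    decorates = All.zipWith id (Allₚ.map⁻ cycles , signIn-block {P = P} (unique covers))

  π : Permutation′ m
  π = toPermutation f f-injective

  abstract
    sign-invariant : ∀ i → signIn P (f i) ≡ signIn P i
    sign-invariant i = go (∈-concat⁻′ cs (complete covers i))
      where
      go : (∃ λ c → i ∈ c × c ∈ cs) → signIn P (f i) ≡ signIn P i
      go (c , i∈ , c∈) = at (∈-map⁻ proj₂ c∈)
        where
        at : (∃ λ sc → sc ∈ P × c ≡ proj₂ sc) → signIn P (f i) ≡ signIn P i
        at ((s , _) , sc∈ , refl) = let cc , sg = All.lookup decorates sc∈ in trans (sg (cycle-image cc i∈)) (sym (sg i∈))

    odd-length : ∀ i → cycleLength π i % 2 ≡ 1
    odd-length i = go (∈-concat⁻′ cs (complete covers i))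
      where
      go : (∃ λ c → i ∈ c × c ∈ cs) → cycleLength π i % 2 ≡ 1
      go (c , i∈ , c∈) = trans (cong (_% 2) (Frozen.cycleLength-length π cycles covers c∈ i∈)) (odd⇒%2 (length c) (block-odd c∈))

    numCycles-π : numCycles π ≡ length P
    numCycles-π = trans (Frozen.numCycles-length π cycles covers) (Listₚ.length-map proj₂ P)

∈-count⁻ : ∀ k m {j} → j ∈ count k m → k ≤ j × j < k + m
∈-count⁻ k (suc m) (here refl) = ℕₚ.≤-refl , ℕₚ.m<m+n k (s≤s z≤n)
∈-count⁻ k (suc m) {j} (there n) = let lo , hi = ∈-count⁻ (suc k) m n in ℕₚ.<⇒≤ lo , subst (j <_) (sym (ℕₚ.+-suc k m)) hi

count-unique : ∀ k m → Unique (count k m)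
count-unique k zero    = []
count-unique k (suc m) = unique-∷⁺ (λ n → ℕₚ.<-irrefl refl (proj₁ (∈-count⁻ (suc k) m n))) (count-unique (suc k) m)

count-length : ∀ k m → length (count k m) ≡ m
count-length k zero    = refl
count-length k (suc m) = cong suc (count-length (suc k) m)

nth-entry : ∀ {A : Set} {a b : A → ℕ} E s len ps → map a E ≡ count s len → map b E ≡ ps →
            ∀ {x} → x ∈ E → nth ps (a x ∸ s) ≡ b x
nth-entry {a = a} {b} (e ∷ E) s (suc len) .(b e ∷ map b E) na refl (here refl) =
  cong (nth (b e ∷ map b E)) (trans (cong (_∸ s) (Listₚ.∷-injectiveˡ na)) (ℕₚ.n∸n≡0 s))
nth-entry {a = a} {b} (e ∷ E) s (suc len) .(b e ∷ map b E) na refl {x} (there m) =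
  trans (cong (nth (b e ∷ map b E)) (shift (proj₁ (∈-count⁻ (suc s) len (subst (a x ∈_) (Listₚ.∷-injectiveʳ na) (∈-map⁺ a m))))))
    (nth-entry E (suc s) len (map b E) (Listₚ.∷-injectiveʳ na) refl m)
  where
  shift : suc s ≤ a x → a x ∸ s ≡ suc (a x ∸ suc s)
  shift le = trans (cong (_∸ s) (sym (ℕₚ.m+[n∸m]≡n le))) (trans (cong (_∸ s) (sym (ℕₚ.+-suc s (a x ∸ suc s)))) (ℕₚ.m+n∸m≡n s _))

toFin-toℕ : ∀ n (i : Fin (suc n)) → toFin n (toℕ i) ≡ i
toFin-toℕ n i with toℕ i ℕ.<? suc n
... | yes lt = Finₚ.fromℕ<-toℕ i lt
... | no nlt = contradiction (Finₚ.toℕ<n i) nlt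

full-by-length : ∀ {N} (xs : List (Fin N)) → (∀ y → y ∈ xs) → length xs ≡ N → Unique xs
full-by-length {N} xs all len with unique-⊆⇒↭ (Uniqueₚ.allFin⁺ N) (λ {y} _ → all y)
... | [] , p = unique-resp-↭ (↭-sym (↭-trans p (↭-reflexive (Listₚ.++-identityʳ _)))) (Uniqueₚ.allFin⁺ N)
... | z ∷ zs , p = contradiction (ℕₚ.≤-reflexive (trans (sym len′) len)) (ℕₚ.m+1+n≰m N)
  where
  len′ : length xs ≡ N + suc (length zs)
  len′ = trans (↭ₚ.↭-length p) (trans (Listₚ.length-++ (allFin N)) (cong (_+ suc (length zs)) (Listₚ.length-tabulate id)))

module Trees (n′ g : ℕ) where
  open Canonical n′ g public
  open Main M n′ N≡2n public
  n : ℕ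
  n = suc n′

  Decoration : Set
  Decoration = List (Bool × List (Fin (suc n)))

  module PlaneEdges (p : Plane) where
    private
      μ = mate (pairing p)
      E = entries p
      num : Fin N → ℕ
      num x = toℕ (vn p x)

    number : ∀ {x} → x ∈ E → ∃ λ (k : Fin n) → num x ≡ suc (toℕ k)
    number {x} m with num x | ∈-count⁻ 1 n (subst (num x ∈_) (numbers p) (∈-map⁺ num m))
    ... | suc j | _ , s≤s hi = fromℕ< hi , cong suc (sym (Finₚ.toℕ-fromℕ< hi))

    abstract
      entry : ∀ (k : Fin n) → ∃ λ x → x ∈ E × num x ≡ suc (toℕ k)
      entry k with ∈-map⁻ num (subst (suc (toℕ k) ∈_) (sym (numbers p)) (∈-count (s≤s z≤n) (s≤s (Finₚ.toℕ<n k))))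
      ... | x , m , e = x , m , sym e

    entry-unique : ∀ {x y} → x ∈ E → y ∈ E → num x ≡ num y → x ≡ y
    entry-unique = unique-map⁻ num (subst Unique (sym (numbers p)) (count-unique 1 n))

    E-length : length E ≡ n
    E-length = trans (sym (Listₚ.length-map num E)) (trans (cong length (numbers p)) (count-length 1 n))

    disjoint : ∀ {x} → x ∈ E → μ x ∉ E
    disjoint {x} m m′ = proj₂ (proj₂ (unique-++⁻ E (full-by-length (E ++ map μ E) both both-length))) m′ (∈-map⁺ μ m)
      where
      both : ∀ y → y ∈ E ++ map μ E
      both y = [ ∈-++⁺ˡ , (λ k → ∈-++⁺ʳ E (subst (_∈ map μ E) (mate-invol (pairing p) y) (∈-map⁺ μ k))) ]′ (cover p y)
      both-length : length (E ++ map μ E) ≡ N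
      both-length = trans (Listₚ.length-++ E) (trans (cong₂ _+_ E-length (trans (Listₚ.length-map μ E) E-length)) (sym N≡2n))

    parent-entry : ∀ {x k} → x ∈ E → num x ≡ suc (toℕ k) → parent n (node (forest p)) k ≡ vn p (μ x)
    parent-entry {x} {k} m e = trans (cong (toFin n) (trans (cong (λ i → nth (parentsF 0 1 (forest p)) (i ∸ 1)) (sym e))
      (nth-entry E 1 n (parentsF 0 1 (forest p)) (numbers p) (parents p) m))) (toFin-toℕ n (vn p (μ x)))

    vn-surjective : ∀ i → ∃ λ x → vn p x ≡ i
    vn-surjective zero    = zero , vn-root p
    vn-surjective (suc k) = let x , _ , e = entry k in x , Finₚ.toℕ-injective e

    private
      edgeOf : ∀ {x} → x ∈ E ⊎ μ x ∈ E → Fin n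
      edgeOf (inj₁ m) = proj₁ (number m)
      edgeOf (inj₂ m) = proj₁ (number m)

    edge# : Fin N → Fin n
    edge# x = edgeOf (cover p x)

    edge#-entry : ∀ {x} → x ∈ E → num x ≡ suc (toℕ (edge# x))
    edge#-entry {x} m = go (cover p x)
      where
      go : ∀ c → num x ≡ suc (toℕ (edgeOf c))
      go (inj₁ m′) = proj₂ (number m′)
      go (inj₂ m′) = contradiction m′ (disjoint m)

    edge#-exit : ∀ {x} → μ x ∈ E → num (μ x) ≡ suc (toℕ (edge# x))
    edge#-exit {x} m = go (cover p x)
      where
      go : ∀ c → num (μ x) ≡ suc (toℕ (edgeOf c))
      go (inj₁ m′) = contradiction m (disjoint m′)
      go (inj₂ m′) = proj₂ (number m′)

  toTree : ∀ (t : Plane × Decoration) → proj₂ t ∈ cPerms (suc n) (allFin (suc n)) → length (proj₂ t) + 2 * g ≡ suc n → CDTree n g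
  toTree (p , P) P∈ euler = record
    { tree = node (forest p) ; tree-edges = sized p
    ; perm = π ; sign = signIn P ; sign-cyc = sign-invariant ; odd-cycles = odd-length
    ; genus = trans (cong (_+ 2 * g) numCycles-π) euler }
    where open OfCPerm {k = suc n} P∈

  module Comparison (m : LMap n g) (p : Plane) (P : Decoration) (P∈ : P ∈ cPerms (suc n) (allFin (suc n)))
                    (euler : length P + 2 * g ≡ suc n)
                    (same : canonical M (OfMap.matched m) ≃ decoratedGraph (p , P)) where
    open OfMap m
    open OfCPerm {k = suc n} P∈ using (cs; cycles; covers; π)
    open PlaneEdges p
    open _≃_ same renaming (to to toᵢ; from to fromᵢ; blocks to blocksᵢ)

    private
      μ = mate (pairing p)
      E = entries p
      hx : Fin N → Fin N
      hx h = toᵢ (pos h)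
      hy : Fin N → Fin N
      hy y = at (fromᵢ y)
      hx∘hy : ∀ y → hx (hy y) ≡ y
      hx∘hy y = trans (cong toᵢ (pos∘at _)) (to∘from y)
      hy∘hx : ∀ h → hy (hx h) ≡ h
      hy∘hx h = trans (cong at (from∘to _)) (at∘pos h)
      hx-a : ∀ h → hx (a h) ≡ μ (hx h)
      hx-a h = trans (cong toᵢ (trans (cong (pos ∘ a) (sym (at∘pos h))) (sym (matched-mate (pos h))))) (commutes (pos h))
      toᵢ-injective : ∀ {x y} → toᵢ x ≡ toᵢ y → x ≡ y
      toᵢ-injective {x} {y} e = trans (sym (from∘to x)) (trans (cong fromᵢ e) (from∘to y))
      γ : List (Fin (suc n)) → List (Fin N)
      γ = concatMap (vertexBlock p)
      ∈γ⁻ : ∀ c {x} → x ∈ γ c → vn p x ∈ c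
      ∈γ⁻ c {x} m with ∈-concatMap⁻′ (vertexBlock p) {c} m
      ... | i , i∈ , x∈ = subst (_∈ c) (sym (proj₂ (∈-filter⁻ (λ h → vn p h ≟ i) {xs = allFin N} x∈))) i∈
      ∈γ⁺ : ∀ c {x} → vn p x ∈ c → x ∈ γ c
      ∈γ⁺ c {x} m = ∈-concatMap⁺′ (vertexBlock p) m (∈-filter⁺ (λ h → vn p h ≟ vn p x) (∈-allFin x) refl)
      unblock : ∀ ds {x y} → SameBlock (map γ ds) x y → SameBlock ds (vn p x) (vn p y)
      unblock (d ∷ ds) (here (x∈ , y∈)) = here (∈γ⁻ d x∈ , ∈γ⁻ d y∈)
      unblock (d ∷ ds) (there s)        = there (unblock ds s)
      block : ∀ ds {x y} → SameBlock ds (vn p x) (vn p y) → SameBlock (map γ ds) x y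
      block (d ∷ ds) (here (x∈ , y∈)) = here (∈γ⁺ d x∈ , ∈γ⁺ d y∈)
      block (d ∷ ds) (there s)        = there (block ds s)

    vertex : Fin N → Fin (suc n)
    vertex h = vn p (hx h)

    vertex-resp : ∀ {h h′} → SameCycle σ h h′ → SameCycle π (vertex h) (vertex h′)
    vertex-resp sc = Frozen.SameBlock⇒SameCycle π cycles covers
      (unblock cs (SameBlock-≋ blocksᵢ (SameBlock-map toᵢ (SameCycle⇒ sc))))

    vertex-inj : ∀ {h h′} → SameCycle π (vertex h) (vertex h′) → SameCycle σ h h′
    vertex-inj sc = ⇒SameCycle (SameBlock-unmap toᵢ toᵢ-injective (SameBlock-≋ (≋-sym blocksᵢ)
      (block cs (Frozen.SameCycle⇒SameBlock π cycles covers sc))))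

    vertex-surj : ∀ v → ∃ λ h → SameCycle π (vertex h) v
    vertex-surj v = let x , e = vn-surjective v in hy x , 0 , trans (cong (vn p) (hx∘hy x)) e

    vertex-root : vertex root ≡ zero
    vertex-root = trans (cong (vn p) (trans (cong toᵢ (trans (cong pos (sym at-zero)) (pos∘at zero))) root-fix)) (vn-root p)

    private
      Edge : Set
      Edge = Σ (Fin N) (λ h → toℕ h < toℕ (a h))

      edge-≡ : ∀ {e e′ : Edge} → proj₁ e ≡ proj₁ e′ → e ≡ e′
      edge-≡ {h , lt} {.h , lt′} refl = cong (h ,_) (ℕₚ.<-irrelevant lt lt′)

      toEdge : Edge → Fin n
      toEdge (h , _) = edge# (hx h)

      orient : Fin N → Edge
      orient h with ℕₚ.<-cmp (toℕ h) (toℕ (a h))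
      ... | tri< lt _ _ = h , lt
      ... | tri≈ _ e _  = contradiction (sym (Finₚ.toℕ-injective e)) (α-fpf h)
      ... | tri> _ _ gt = a h , subst (λ z → toℕ (a h) < toℕ z) (sym (α-invol h)) gt

      orient-cases : ∀ h → proj₁ (orient h) ≡ h ⊎ proj₁ (orient h) ≡ a h
      orient-cases h with ℕₚ.<-cmp (toℕ h) (toℕ (a h))
      ... | tri< _ _ _ = inj₁ refl
      ... | tri≈ _ e _ = contradiction (sym (Finₚ.toℕ-injective e)) (α-fpf h)
      ... | tri> _ _ _ = inj₂ refl

      orient-self : ∀ h → toℕ h < toℕ (a h) → proj₁ (orient h) ≡ h
      orient-self h lt with ℕₚ.<-cmp (toℕ h) (toℕ (a h))
      ... | tri< _ _ _  = refl
      ... | tri≈ _ e _  = contradiction (sym (Finₚ.toℕ-injective e)) (α-fpf h)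
      ... | tri> nlt _ _ = contradiction lt nlt

      orient-mate : ∀ h → toℕ h < toℕ (a h) → proj₁ (orient (a h)) ≡ h
      orient-mate h lt with ℕₚ.<-cmp (toℕ (a h)) (toℕ (a (a h)))
      ... | tri< lt′ _ _ = contradiction (subst (λ z → toℕ (a h) < toℕ z) (α-invol h) lt′) (ℕₚ.<-asym lt)
      ... | tri≈ _ e _   = contradiction (sym (Finₚ.toℕ-injective e)) (α-fpf (a h))
      ... | tri> _ _ _   = α-invol h

      fromEdge : Fin n → Edge
      fromEdge k = orient (hy (proj₁ (entry k)))

      to-from : ∀ k → toEdge (fromEdge k) ≡ k
      to-from k = go (entry k)
        where
        go : (en : ∃ λ x → x ∈ E × toℕ (vn p x) ≡ suc (toℕ k)) → edge# (hx (proj₁ (orient (hy (proj₁ en))))) ≡ k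
        go (x , x∈ , e) = [ (λ o → trans (cong (edge# ∘ hx) o) direct) , (λ o → trans (cong (edge# ∘ hx) o) flipped) ]′ (orient-cases (hy x))
          where
          direct : edge# (hx (hy x)) ≡ k
          direct = trans (cong edge# (hx∘hy x)) (Finₚ.toℕ-injective (ℕₚ.suc-injective (trans (sym (edge#-entry x∈)) e)))
          flipped : edge# (hx (a (hy x))) ≡ k
          flipped = trans (cong edge# (trans (hx-a (hy x)) (cong μ (hx∘hy x))))
            (Finₚ.toℕ-injective (ℕₚ.suc-injective (trans (sym (edge#-exit {μ x} (subst (_∈ E) (sym (mate-invol (pairing p) x)) x∈)))
              (trans (cong (toℕ ∘ vn p) (mate-invol (pairing p) x)) e))))

      from-to : ∀ e → fromEdge (toEdge e) ≡ e
      from-to (h , lt) = edge-≡ (go (entry (edge# (hx h))) (cover p (hx h)))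
        where
        go : (en : ∃ λ x → x ∈ E × toℕ (vn p x) ≡ suc (toℕ (edge# (hx h)))) → hx h ∈ E ⊎ μ (hx h) ∈ E →
             proj₁ (orient (hy (proj₁ en))) ≡ h
        go (x , x∈ , e) (inj₁ m) = trans (cong (proj₁ ∘ orient) (trans (cong hy (entry-unique x∈ m (trans e (sym (edge#-entry m))))) (hy∘hx h)))
          (orient-self h lt)
        go (x , x∈ , e) (inj₂ m) = trans (cong (proj₁ ∘ orient) (trans (cong hy (trans (entry-unique x∈ m (trans e (sym (edge#-exit m)))) (sym (hx-a h)))) (hy∘hx (a h))))
          (orient-mate h lt)

    comparison : GraphIso (lmapGraph m) (treeGraph (toTree (p , P) P∈ euler))
    comparison = record
      { f = vertex ; f-resp = vertex-resp ; f-inj = vertex-inj ; f-surj = vertex-surj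
      ; e = mk↔ₛ′ toEdge fromEdge to-from from-to
      ; root-ok = 0 , vertex-root
      ; ends-ok = λ (h , lt) → ends h (cover p (hx h)) }
      where
      ends : ∀ h → hx h ∈ E ⊎ μ (hx h) ∈ E →
        (SameCycle π (vertex h) (parent n (node (forest p)) (edge# (hx h))) × SameCycle π (vertex (a h)) (suc (edge# (hx h)))) ⊎
        (SameCycle π (vertex h) (suc (edge# (hx h))) × SameCycle π (vertex (a h)) (parent n (node (forest p)) (edge# (hx h))))
      ends h (inj₁ m) = inj₂ ((0 , Finₚ.toℕ-injective (edge#-entry m))
        , (0 , trans (cong (vn p) (hx-a h)) (sym (parent-entry m (edge#-entry m)))))
      ends h (inj₂ m) = inj₁ ((0 , trans (cong (vn p) (sym (mate-invol (pairing p) (hx h)))) (sym (parent-entry m (edge#-exit m))))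
        , (0 , trans (cong (vn p) (hx-a h)) (Finₚ.toℕ-injective (edge#-exit m))))

-- The bijection

filter-map : ∀ {A B : Set} {P : B → Set} (P? : Decidable P) (f : A → B) xs →
             filter P? (map f xs) ≡ map f (filter (P? ∘ f) xs)
filter-map P? f [] = refl
filter-map P? f (x ∷ xs) with P? (f x)
... | yes _ = cong (f x ∷_) (filter-map P? f xs)
... | no _  = filter-map P? f xs

module Bijection (n′ g : ℕ) where
  open Trees n′ g

  Euler : LGraph → Set
  Euler G = size# G + 2 * g ≡ suc n
  abstract
    Euler? : Decidable Euler
    Euler? G = (size# G + 2 * g) ℕ.≟ suc n

  c : ℕ
  c = 2 ^ suc n

  signedMap : Fin c × Matching N → LGraph
  signedMap (i , μ) = canonical M μ

  signedMaps : List (Fin c × Matching N)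
  signedMaps = filter (Euler? ∘ signedMap) (pairs (allFin c) (λ _ → matchings N))

  trees : List (Plane × Decoration)
  trees = filter (Euler? ∘ decoratedGraph) decorated

  abstract
    matching-up : Matched (λ x y → signedMap x ≃ decoratedGraph y) signedMaps trees
    matching-up = ≅⇒matched labelled (≅-trans (≅-reflexive (sym (filter-map Euler? signedMap (pairs (allFin c) (λ _ → matchings N)))))
      (≅-trans (PermSetoidₚ.filter⁺ labelled Euler? (λ p e → trans (cong (_+ 2 * g) (sym (size#-≃ p))) e) whole)
        (≅-reflexive (filter-map Euler? decoratedGraph decorated))))
      where
      copies : ∀ (is : List (Fin c)) → concatMap (λ i → map signedMap (map (i ,_) (matchings N))) is ≡ length is · 𝓔 M
      copies []       = refl
      copies (i ∷ is) = cong₂ _++_ (sym (Listₚ.map-∘ (matchings N))) (copies is)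
      whole : map signedMap (pairs (allFin c) (λ _ → matchings N)) ≅ map decoratedGraph decorated
      whole = ≅-trans (≅-reflexive (trans (Listₚ.map-concatMap signedMap _ (allFin c)) (trans (copies (allFin c)) (cong (_· 𝓔 M) (Listₚ.length-tabulate {n = c} id)))))
        (≅-trans maps≅trees (≅-reflexive 𝓣-decorated))

    signedMaps-unique : Unique signedMaps
    signedMaps-unique = Uniqueₚ.filter⁺ (Euler? ∘ signedMap) (pairs-unique (allFin c) (λ _ → matchings N) (Uniqueₚ.allFin⁺ c) (λ _ → matchings-unique N))

    planes-unique : Unique planes
    planes-unique = AllPairs.map (λ ne e → ne (cong pairing e)) (AllPairsₚ.map⁻ planes-pairing)

    trees-unique : Unique trees
    trees-unique = Uniqueₚ.filter⁺ (Euler? ∘ decoratedGraph) (pairs-unique planes (λ _ → cPerms (suc n) (allFin (suc n))) planes-unique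
      (λ _ → cPerms-unique (suc n) (Uniqueₚ.allFin⁺ (suc n))))

    ∈-signedMaps⁺ : ∀ i {μ} → Euler (canonical M μ) → (i , μ) ∈ signedMaps
    ∈-signedMaps⁺ i {μ} e = ∈-filter⁺ (Euler? ∘ signedMap) (∈-pairs⁺ (allFin c) (λ _ → matchings N) (∈-allFin i) (∈-matchings μ)) e

    ∈-signedMaps⁻ : ∀ {x} → x ∈ signedMaps → Euler (signedMap x)
    ∈-signedMaps⁻ m = proj₂ (∈-filter⁻ (Euler? ∘ signedMap) {xs = pairs (allFin c) (λ _ → matchings N)} m)

    ∈-trees⁺ : ∀ {p P} → p ∈ planes → P ∈ cPerms (suc n) (allFin (suc n)) → length P + 2 * g ≡ suc n → (p , P) ∈ trees
    ∈-trees⁺ {p} {P} p∈ P∈ e = ∈-filter⁺ (Euler? ∘ decoratedGraph) (∈-pairs⁺ planes (λ _ → cPerms (suc n) (allFin (suc n))) p∈ P∈)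
      (trans (cong (_+ 2 * g) (trans (Listₚ.length-map (concatMap (vertexBlock p)) (map proj₂ P)) (Listₚ.length-map proj₂ P))) e)

    ∈-trees⁻ : ∀ {p P} → (p , P) ∈ trees → p ∈ planes × P ∈ cPerms (suc n) (allFin (suc n)) × length P + 2 * g ≡ suc n
    ∈-trees⁻ {p} {P} m = go (∈-filter⁻ (Euler? ∘ decoratedGraph) {xs = decorated} m)
      where
      go : (p , P) ∈ decorated × Euler (decoratedGraph (p , P)) → p ∈ planes × P ∈ cPerms (suc n) (allFin (suc n)) × length P + 2 * g ≡ suc n
      go (d , e) = let p∈ , P∈ = ∈-pairs⁻ planes (λ _ → cPerms (suc n) (allFin (suc n))) d in
        p∈ , P∈ , trans (cong (_+ 2 * g) (sym (trans (Listₚ.length-map (concatMap (vertexBlock p)) (map proj₂ P)) (Listₚ.length-map proj₂ P)))) e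

    map-euler : ∀ (m : LMap n g) → Euler (canonical M (OfMap.matched m))
    map-euler m = trans (cong (_+ 2 * g) (sym (OfMap.numCycles-matched m))) (trans (LMap.genus m) (ℕₚ.+-comm n 1))

  open Lookup matching-up

  asTree : ∀ (t : Plane × Decoration) → t ∈ trees → CDTree n g
  asTree (p , P) t∈ = toTree (p , P) (proj₁ (proj₂ (∈-trees⁻ t∈))) (proj₂ (proj₂ (∈-trees⁻ t∈)))

  member : ∀ i (m : LMap n g) → (i , OfMap.matched m) ∈ signedMaps
  member i m = ∈-signedMaps⁺ i (map-euler m)

  Φ : Fin c × LMap n g → CDTree n g
  Φ (i , m) = asTree (image (member i m)) (image∈ (member i m))

  asTree-cong : ∀ {t t′} (m : t ∈ trees) (m′ : t′ ∈ trees) → t ≡ t′ → asTree t m ≈T asTree t′ m′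
  asTree-cong m m′ refl = refl , (λ _ → refl) , (λ _ → refl)

  asTree-injective : ∀ {t t′} (m : t ∈ trees) (m′ : t′ ∈ trees) → asTree t m ≈T asTree t′ m′ → t ≡ t′
  asTree-injective {p , P} {p′ , P′} m m′ (same-tree , same-perm , same-sign) =
    go (∈-trees⁻ m) (∈-trees⁻ m′) same-perm
    where
    node-injective : ∀ {ts ts′} → node ts ≡ node ts′ → ts ≡ ts′
    node-injective refl = refl
    same-plane : p ∈ planes → p′ ∈ planes → p ≡ p′
    same-plane p∈ p′∈ = unique-map⁻ pairing planes-pairing p∈ p′∈ (matching-ext (λ i →
      nc-injective (mate-invol (pairing p)) (mate-invol (pairing p′)) (nested p)
        (subst (NC (mate (pairing p′)) (contourWord M)) (sym (node-injective same-tree)) (nested p′)) (complete (contourWord-full M) i)))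
    go : p ∈ planes × P ∈ cPerms (suc n) (allFin (suc n)) × length P + 2 * g ≡ suc n →
         p′ ∈ planes × P′ ∈ cPerms (suc n) (allFin (suc n)) × length P′ + 2 * g ≡ suc n →
         (∀ i → nextIn (map proj₂ P) i ≡ nextIn (map proj₂ P′) i) → (p , P) ≡ (p′ , P′)
    go (p∈ , P∈ , _) (p′∈ , P′∈ , _) perm≡ = cong₂ _,_ (same-plane p∈ p′∈)
      (Sorting.cPerms-functional A.f-injective (signIn P) (suc n) (allFin (suc n)) (Uniqueₚ.allFin⁺ (suc n)) P∈ P′∈ A.decorates
        (All.map (λ (cc , sg) → cycle-cong (λ i → sym (perm≡ i)) cc , λ {i} i∈ → trans (same-sign i) (sg {i} i∈)) B.decorates))
      where
      module A = OfCPerm {k = suc n} P∈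
      module B = OfCPerm {k = suc n} P′∈

  Φ-resp : ∀ i m j m′ → i ≡ j → LMapIso m m′ → Φ (i , m) ≈T Φ (j , m′)
  Φ-resp i m .i m′ refl m≅ = asTree-cong (image∈ (member i m)) (image∈ (member i m′)) (same (cong (i ,_) (iso⇒matched {m} {m′} m≅)))
    where
    same : (i , OfMap.matched m) ≡ (i , OfMap.matched m′) → image (member i m) ≡ image (member i m′)
    same e = go e (member i m) (member i m′)
      where
      go : ∀ {x y} → x ≡ y → (k : x ∈ signedMaps) (k′ : y ∈ signedMaps) → image k ≡ image k′
      go refl = image-func signedMaps-unique

  Φ-inj : ∀ i m j m′ → Φ (i , m) ≈T Φ (j , m′) → i ≡ j × LMapIso m m′
  Φ-inj i m j m′ eq = cong proj₁ e , matched⇒iso {m} {m′} (cong proj₂ e)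
    where
    e : (i , OfMap.matched m) ≡ (j , OfMap.matched m′)
    e = image-inj trees-unique (member i m) (member j m′) (asTree-injective (image∈ (member i m)) (image∈ (member j m′)) eq)

  Φ-surj : ∀ t → ∃ λ x → Φ x ≈T t
  Φ-surj t = withForest (CDTree.tree t) refl
    where
    module t = CDTree t
    π : Permutation′ (suc n)
    π = t.perm
    all-cycles : ∃ λ cs → All (Cycle (π ⟨$⟩ʳ_)) cs × Full (concat cs)
    all-cycles = Sorting.cycleList (perm-injective π)
    odd-orbits : ∀ v u → Walk (π ⟨$⟩ʳ_) v (u ∷ʳ v) v → Unique (u ∷ʳ v) → isOdd (length u) ≡ false
    odd-orbits v u w un = go all-cycles
      where
      go : (∃ λ cs → All (Cycle (π ⟨$⟩ʳ_)) cs × Full (concat cs)) → isOdd (length u) ≡ false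
      go (cs , all , F) = at (∈-concat⁻′ cs (complete F v))
        where
        at : (∃ λ d → v ∈ d × d ∈ cs) → isOdd (length u) ≡ false
        at (d , v∈ , d∈) = trans (sym (not-not (isOdd (length u)))) (cong not
          (trans (cong isOdd (sym (trans (Listₚ.length-++ u) (ℕₚ.+-comm (length u) 1)))) (%2⇒odd (length (u ∷ʳ v))
            (trans (cong (_% 2) (trans (↭ₚ.↭-length (cycles-meet (cycle-∷ʳ w) (All.lookup all d∈) un (concat-unique (unique F) d∈)
              (∈-++⁺ʳ u (here refl)) v∈)) (sym (Frozen.cycleLength-length π all F d∈ v∈)))) (t.odd-cycles v)))))
    Coded : Set
    Coded = ∃ λ P → P ∈ cPerms (suc n) (allFin (suc n)) × Sorting.Decorates (perm-injective π) t.sign P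
    coded : Coded
    coded = Sorting.cPerms-complete (perm-injective π) t.sign (suc n) (allFin (suc n))
      (ℕₚ.≤-reflexive (Listₚ.length-tabulate {n = suc n} id)) (Uniqueₚ.allFin⁺ (suc n)) (λ _ → ∈-allFin _) t.sign-cyc odd-orbits
    withForest : ∀ T → T ≡ t.tree → ∃ λ x → Φ x ≈T t
    withForest (node ts) eT = withMatching (nc-exists ts (unique (contourWord-full M))
        (trans (full-length (contourWord-full M)) (trans N≡2n (cong₂ _+_ (sym sized′) (sym sized′)))))
      where
      sized′ : sizes ts ≡ n
      sized′ = trans (cong edges eT) t.tree-edges
      withMatching : (∃ λ α → Pairing (contourWord M) α × NC α (contourWord M) ts) → ∃ λ x → Φ x ≈T t
      withMatching (α , pr , nc) = withPlane (∈-planes (plane μ ts sized′ (nc-cong (λ {y} _ → sym (mate-μ y)) nc)))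
        where
        in-word : ∀ y → y ∈ contourWord M
        in-word = complete (contourWord-full M)
        μ : Matching N
        μ = fromFunction α (λ i → Pairing.invol pr (in-word i)) (λ i → Pairing.fpf pr (in-word i))
        mate-μ : ∀ y → mate μ y ≡ α y
        mate-μ = mate-fromFunction α (λ i → Pairing.invol pr (in-word i)) (λ i → Pairing.fpf pr (in-word i))
        withPlane : (∃ λ p → p ∈ planes × pairing p ≡ μ) → ∃ λ x → Φ x ≈T t
        withPlane (p , p∈ , pe) = withCode coded
          where
          forest≡ : forest p ≡ ts
          forest≡ = nc-functional (unique (contourWord-full M)) (nested p)
            (nc-cong (λ {y} _ → trans (sym (mate-μ y)) (cong (λ μ → mate μ y) (sym pe))) nc)
          withCode : Coded → ∃ λ x → Φ x ≈T t
          withCode (P , P∈ , dec) = withSource (image-surj t∈)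
            where
            module A = OfCPerm {k = suc n} P∈
            π-cycles : All (Cycle (π ⟨$⟩ʳ_)) (map proj₂ P)
            π-cycles = Allₚ.map⁺ (All.map proj₁ dec)
            t∈ : (p , P) ∈ trees
            t∈ = ∈-trees⁺ p∈ P∈ (trans (cong (_+ 2 * g) (sym (trans (Frozen.numCycles-length π π-cycles A.covers) (Listₚ.length-map proj₂ P)))) t.genus)
            represents : asTree (p , P) t∈ ≈T t
            represents = trans (cong node forest≡) eT
              , (λ i → cycles-agree A.cycles π-cycles A.covers i)
              , (λ i → same-sign i (∈-concat⁻′ (map proj₂ P) (complete A.covers i)))
              where
              same-sign : ∀ i → (∃ λ d → i ∈ d × d ∈ map proj₂ P) → signIn P i ≡ t.sign i
              same-sign i (d , i∈ , d∈) = at (∈-map⁻ proj₂ d∈)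
                where
                at : (∃ λ sc → sc ∈ P × d ≡ proj₂ sc) → signIn P i ≡ t.sign i
                at (sc , sc∈ , refl) = trans (proj₂ (All.lookup A.decorates sc∈) i∈) (sym (proj₂ (All.lookup dec sc∈) i∈))
            withSource : (∃ λ x → Σ (x ∈ signedMaps) λ k → image k ≡ (p , P)) → ∃ λ x → Φ x ≈T t
            withSource ((i , μ′) , k , e) = (i , m) , compose (same (member i m) k (cong (i ,_) m-matched))
              where
              euler : length (cyclesᵐ M μ′ (allFin N)) + 2 * g ≡ suc n′ + 1
              euler = trans (∈-signedMaps⁻ k) (ℕₚ.+-comm 1 n)
              m : LMap n g
              m = OfMatching.toMap μ′ euler
              m-matched : OfMap.matched m ≡ μ′
              m-matched = OfMatching.matched-toMap μ′ euler
              same : ∀ {x y} (k : x ∈ signedMaps) (k′ : y ∈ signedMaps) → x ≡ y → image k ≡ image k′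
              same k k′ refl = image-func signedMaps-unique k k′
              compose : image (member i m) ≡ image k → Φ (i , m) ≈T t
              compose e′ =
                let t₁ , p₁ , s₁ = asTree-cong (image∈ (member i m)) t∈ (trans e′ e) ; t₂ , p₂ , s₂ = represents in
                trans t₁ t₂ , (λ v → trans (p₁ v) (p₂ v)) , (λ v → trans (s₁ v) (s₂ v))

  Φ-graph : ∀ i m → GraphIso (lmapGraph m) (treeGraph (Φ (i , m)))
  Φ-graph i m = Comparison.comparison m (proj₁ t) (proj₂ t)
    (proj₁ (proj₂ (∈-trees⁻ (image∈ (member i m))))) (proj₂ (proj₂ (∈-trees⁻ (image∈ (member i m))))) (image-rel (member i m))
    where
    t : Plane × Decoration
    t = image (member i m)

module NoEdges (g : ℕ) where

  Φ₀ : Fin 2 × (g ≡ 0) → CDTree 0 g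
  Φ₀ (i , e) = record
    { tree = node [] ; tree-edges = refl ; perm = identity ; sign = λ _ → isZero i
    ; sign-cyc = λ _ → refl ; odd-cycles = λ { zero → refl } ; genus = cong (λ k → 1 + 2 * k) e }
    where
    identity : Permutation′ 1
    identity = permutation id id (λ _ → refl) (λ _ → refl)
    isZero : Fin 2 → Bool
    isZero zero    = true
    isZero (suc _) = false

  Fin1-≡ : ∀ (i j : Fin 1) → i ≡ j
  Fin1-≡ zero zero = refl

  Φ₀-inj : ∀ x y → Φ₀ x ≈T Φ₀ y → x ≈D y
  Φ₀-inj (zero     , _) (zero     , _) _           = refl , tt
  Φ₀-inj (suc zero , _) (suc zero , _) _           = refl , tt
  Φ₀-inj (zero     , _) (suc zero , _) (_ , _ , s) = contradiction (s zero) λ ()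
  Φ₀-inj (suc zero , _) (zero     , _) (_ , _ , s) = contradiction (s zero) λ ()

  Φ₀-surj : ∀ t → ∃ λ x → Φ₀ x ≈T t
  Φ₀-surj t = withSign (CDTree.sign t zero) refl
    where
    module t = CDTree t
    one-cycle : numCycles t.perm ≡ 1
    one-cycle = Frozen.numCycles-length t.perm
      (cycle {body = []} {end = zero} refl (step (Fin1-≡ _ _) stop) ∷ []) (full ([] ∷ []) (λ { zero → here refl }))
    g≡0 : g ≡ 0
    g≡0 = ℕₚ.m+n≡0⇒m≡0 g (ℕₚ.suc-injective (trans (sym (cong (_+ 2 * g) one-cycle)) t.genus))
    tree≡ : ∀ T → edges T ≡ 0 → node [] ≡ T
    tree≡ (node [])             e = refl
    tree≡ (node (node _ ∷ _)) ()
    withSign : ∀ b → t.sign zero ≡ b → ∃ λ x → Φ₀ x ≈T t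
    withSign true  e = (zero , g≡0) , tree≡ t.tree t.tree-edges , (λ _ → Fin1-≡ _ _) , λ { zero → sym e }
    withSign false e = (suc zero , g≡0) , tree≡ t.tree t.tree-edges , (λ _ → Fin1-≡ _ _) , λ { zero → sym e }

  Φ₀-graph : ∀ i M → GraphIso (mapGraph {zero} {g} M) (treeGraph (Φ₀ (i , M)))
  Φ₀-graph i M = record
    { f = λ _ → zero ; f-resp = λ _ → 0 , refl ; f-inj = λ _ → refl ; f-surj = λ v → tt , 0 , Fin1-≡ _ _
    ; e = mk↔ₛ′ (λ ()) (λ ()) (λ ()) (λ ()) ; root-ok = 0 , refl ; ends-ok = λ () }

theorem2p6 : (n g : ℕ) →
    Σ (Fin (2 ^ suc n) × UMap n g → CDTree n g) λ Φ →
    (∀ x y → x ≈D y → Φ x ≈T Φ y)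
    × (∀ x y → Φ x ≈T Φ y → x ≈D y)
    × (∀ t → ∃ λ x → Φ x ≈T t)
    × (∀ i M → GraphIso (mapGraph {n} {g} M) (treeGraph (Φ (i , M))))
theorem2p6 zero    g = Φ₀ , (λ { _ _ (refl , _) → refl , (λ _ → refl) , (λ _ → refl) }) , Φ₀-inj , Φ₀-surj , Φ₀-graph
  where open NoEdges g
theorem2p6 (suc n′) g = Φ
  , (λ (i , m) (j , m′) (e , m≅) → Φ-resp i m j m′ e m≅)
  , (λ (i , m) (j , m′) → Φ-inj i m j m′) , Φ-surj , Φ-graph
  where open Bijection n′ g
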